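{- For all integers $k\ge1$ and $n\ge0$, $$e_4(7^kn+\delta_{7,k})\equiv0\pmod{7^k}.$$
   Context: $q=e^{2\pi i\tau}$, $(q;q)_\infty=\prod_{n\ge1}(1-q^n)$, $E_4(\tau)=1+240\sum_{n\ge1}\sigma_3(n)q^n$ with $\sigma_3(n)=\sum_{d\mid n}d^3$. The numbers $e_4(n)$ are defined by $\sum_{n\ge0}e_4(n)q^n=E_4(\tau)/(q;q)_\infty$. For a prime $\ell\ge5$ and $k\ge1$, $\delta_{\ell,k}$ is the integer with $0<\delta_{\ell,k}<\ell^k$ and $24\delta_{\ell,k}\equiv1\pmod{\ell^k}$. -}

module Defs where

open import Data.Nat as ℕ using (ℕ; zero; suc; _∸_)
open import Data.Bool using (if_then_else_)
open import Data.Nat.Divisibility as ℕD using (_∣?_)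
open import Data.Integer as ℤ using (ℤ; +_; 0ℤ; 1ℤ; _+_; _*_; -_; _-_)
open import Data.List using (List; []; _∷_; foldr; map; filter; zipWith; upTo; reverse)

Series : Set
Series = ℕ → ℤ

Σℤ : List ℤ → ℤ
Σℤ = foldr _+_ 0ℤ

_⊛_ : Series → Series → Series
(f ⊛ g) n = Σℤ (map (λ i → f i * g (n ∸ i)) (upTo (suc n)))

oneMinusQ^ : ℕ → Series
oneMinusQ^ m j = (if j ℕ.≡ᵇ 0 then 1ℤ else 0ℤ) - (if j ℕ.≡ᵇ m then 1ℤ else 0ℤ)

eulerTrunc : ℕ → Series
eulerTrunc zero = λ { zero → 1ℤ ; (suc _) → 0ℤ }
eulerTrunc (suc N) = eulerTrunc N ⊛ oneMinusQ^ (suc N)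

-- (q;q)_∞ = ∏_{m≥1}(1 - q^m): its q^n coefficient equals that of the
-- truncated product ∏_{m=1}^{n}(1 - q^m) (factors with m > n do not contribute).
qPochInf : Series
qPochInf n = eulerTrunc n n

-- Multiplicative inverse of a power series with constant term 1:
-- b_0 = 1, b_n = - Σ_{i=1}^{n} a_i b_{n-i}.
-- invRev a n = [b_n, b_{n-1}, ..., b_0]
invRev : Series → ℕ → List ℤ
invRev a zero = 1ℤ ∷ []
invRev a (suc n) = (- Σℤ (zipWith (λ i b → a (suc i) * b) (upTo (suc n)) bs)) ∷ bs
  where bs = invRev a n

headℤ : List ℤ → ℤ
headℤ [] = 0ℤ
headℤ (x ∷ _) = x

-- 1 / a  (meaningful when a_0 = 1, as for (q;q)_∞)
inv : Series → Series
inv a n = headℤ (invRev a n)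

σ₃ : ℕ → ℕ
σ₃ n = sumℕ (map (λ d → d ℕ.* d ℕ.* d) (filter (λ d → d ∣? n) (map suc (upTo n))))
  where open import Data.Nat.ListAction renaming (sum to sumℕ)

E₄ : Series
E₄ zero = 1ℤ
E₄ (suc n) = + (240 ℕ.* σ₃ (suc n))

e₄ : ℕ → ℤ
e₄ = E₄ ⊛ inv qPochInf

{-# OPTIONS --safe #-}
-- Write E for (q;q)_∞, φ for q ↦ q⁷, U for the operator Σ a(n) qⁿ ↦ Σ a(7n) qⁿ, and put
-- ζ = q² E(q⁴⁹) / E(q) and t = q E(q⁷)⁴ / E(q)⁴. The generating functions of e₄(7^k n + δ_k), multiplied
-- by E or E(q⁷), arise from E₄ by applying F ↦ U (ζ F) and F ↦ U F alternately. There is a form ω of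
-- weight 4 with E₄ = ω (1 + 245 t + 2401 t²), and with x = 7 t both maps send the lattice ω x ℤ[x] into
-- 7 times itself; since U (ζ E₄) lies in this lattice and x is divisible by 7, the theorem follows.
-- The invariance comes from the values of U (ω ζ^m) for 1 ≤ m ≤ 7 and from Watson's modular equation,
-- which expresses ζ⁷ by lower powers of ζ over ℤ[t(q⁷)].
--
-- The pentagonal number theorem and Jacobi's formula for E³ parametrise the 7-dissection of E by series
-- y and r = φ r₀ with y⁷ = r (1 - r)⁴, where y has its exponents ≡ 1 modulo 7. This turns every identity
-- between these functions into one in ℤ[r][y] / (y⁷ - r (1 - r)⁴), decided by computation, and U into
-- taking the coefficient of y⁰. Modularity is replaced by uniqueness: t is determined by its logarithmic
-- derivative, and E₄, through Ramanujan's differential equation for E₂, by functional equations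
-- under φ with only one solution.
module Submission where

-- U turns a factor φ E into E. As ζ E = q² E(q⁴⁹), inserting ζ trades the factor E for E(q⁴⁹),
-- which leaves U as E(q⁷); hence the alternation. Finite dimensionality of spaces of modular forms
-- is replaced by computation in an explicit ring. The functions met here are rational in y and r,
-- and a form of weight 2 k is such a function times ε^k, where ε = D r / (7 r (1 - r)) is never
-- evaluated. E₂ is only quasimodular and lies outside; it may occur only where it cancels: in W = D
-- log t, in ψ = D log ζ, and in W₇ X - 7 W φ X with W₇ = φ W and X = E₄ - 49 φ E₄. The powers of 7
-- are tight. U (ω ζ) = ω (-8 x - 7 x²) has no factor 7, so the lattice must start at x, and E₄,
-- whose expansion starts with ω, earns its first 7 only from the one hidden in x. From t φ t = ζ⁴
-- follows x^j U (ω ζ^i x^j) = 7^(2j) U (ω ζ^(i+4j)), so the 7-adic estimates run in blocks of four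
-- exponents, each block gaining one power of x at the price of two powers of 7.

open import Defs

-- The commutative ring of formal power series over ℤ.

module SeriesRing where
  open import Data.Nat as ℕ using (ℕ; zero; suc)
  open import Data.Integer as ℤ using (ℤ; +_; 0ℤ; 1ℤ)
  import Data.Integer.Properties as ℤP
  open import Data.Integer.Solver using (module +-*-Solver)
  open import Algebra using (CommutativeRing)
  open import Algebra.Structures using (IsAbelianGroup)
  open import Algebra.Solver.Ring.AlmostCommutativeRing
  open import Data.Maybe using (Maybe; just; nothing)
  import Algebra.Solver.Ring
  open import Data.Product using (_,_)
  open import Relation.Nullary using (yes; no)
  open import Relation.Binary.PropositionalEquality as ≡ using (_≡_; cong; cong₂)
  open import Level using (0ℓ)

  infix 4 _≈_
  -- A record rather than a bare function type, so that both series can be recovered from the type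
  -- of a proof by unification.
  record _≈_ (f g : Series) : Set where
    constructor mk
    field at : ∀ n → f n ≡ g n
  open _≈_ public

  ≈-refl : ∀ {f} → f ≈ f
  ≈-refl = mk λ _ → ≡.refl

  tail : Series → Series
  tail f n = f (suc n)

  infixl 7 _·_
  infixl 6 _⊕_
  infix 8 ⊖_

  opaque

    -- The recursion is f g = f(0) g + q (tail f) g; the ring laws then follow by induction on the
    -- index with f generalised. `⊛-·` identifies this product with `_⊛_`.
    _·_ : Series → Series → Series
    (f · g) zero    = f 0 ℤ.* g 0
    (f · g) (suc n) = f 0 ℤ.* g (suc n) ℤ.+ (tail f · g) n

    _⊕_ : Series → Series → Series
    (f ⊕ g) n = f n ℤ.+ g n

    ⊖_ : Series → Series
    (⊖ f) n = ℤ.- f n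

    ι : ℤ → Series
    ι c zero    = c
    ι c (suc _) = 0ℤ

    0ˢ : Series
    0ˢ _ = 0ℤ

  1ˢ : Series
  1ˢ = ι 1ℤ

  private
    variable
      f g h f′ g′ : Series

  opaque
    unfolding _·_

    ·-cong-at : ∀ n → (∀ i → f i ≡ f′ i) → (∀ i → g i ≡ g′ i) → (f · g) n ≡ (f′ · g′) n
    ·-cong-at zero    p q = cong₂ ℤ._*_ (p 0) (q 0)
    ·-cong-at (suc n) p q =
      cong₂ ℤ._+_ (cong₂ ℤ._*_ (p 0) (q (suc n))) (·-cong-at n (λ i → p (suc i)) q)

    ·-last : ∀ f g n → (f · g) (suc n) ≡ (f · tail g) n ℤ.+ f (suc n) ℤ.* g 0
    ·-last f g zero    = ≡.refl
    ·-last f g (suc n) = ≡.trans (cong (λ x → f 0 ℤ.* g (2 ℕ.+ n) ℤ.+ x) (·-last (tail f) g n))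
      (≡.sym (ℤP.+-assoc (f 0 ℤ.* g (2 ℕ.+ n)) _ _))

    ·-comm-at : ∀ f g n → (f · g) n ≡ (g · f) n
    ·-comm-at f g zero    = ℤP.*-comm (f 0) (g 0)
    ·-comm-at f g (suc n) = begin
      f 0 ℤ.* g (suc n) ℤ.+ (tail f · g) n  ≡⟨ ℤP.+-comm (f 0 ℤ.* g (suc n)) _ ⟩
      (tail f · g) n ℤ.+ f 0 ℤ.* g (suc n)  ≡⟨ cong₂ ℤ._+_ (·-comm-at (tail f) g n) (ℤP.*-comm (f 0) (g (suc n))) ⟩
      (g · tail f) n ℤ.+ g (suc n) ℤ.* f 0  ≡⟨ ≡.sym (·-last g f n) ⟩
      (g · f) (suc n)                       ∎
      where open ≡.≡-Reasoning

    ·-distribʳ-at : ∀ f g h n → ((f ⊕ g) · h) n ≡ (f · h) n ℤ.+ (g · h) n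
    ·-distribʳ-at f g h zero    = ℤP.*-distribʳ-+ (h 0) (f 0) (g 0)
    ·-distribʳ-at f g h (suc n) = ≡.trans
      (cong (λ x → (f 0 ℤ.+ g 0) ℤ.* h (suc n) ℤ.+ x) (·-distribʳ-at (tail f) (tail g) h n))
      (solve 5 (λ a b c x y → (a :+ b) :* c :+ (x :+ y) := (a :* c :+ x) :+ (b :* c :+ y)) ≡.refl
        (f 0) (g 0) (h (suc n)) ((tail f · h) n) ((tail g · h) n))
      where open +-*-Solver

    ·-scale-at : ∀ c f g n → ((λ i → c ℤ.* f i) · g) n ≡ c ℤ.* (f · g) n
    ·-scale-at c f g zero    = ℤP.*-assoc c (f 0) (g 0)
    ·-scale-at c f g (suc n) = ≡.trans
      (cong (λ x → c ℤ.* f 0 ℤ.* g (suc n) ℤ.+ x) (·-scale-at c (tail f) g n))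
      (solve 4 (λ c a b x → c :* a :* b :+ c :* x := c :* (a :* b :+ x)) ≡.refl
        c (f 0) (g (suc n)) ((tail f · g) n))
      where open +-*-Solver

    ·-assoc-at : ∀ f g h n → ((f · g) · h) n ≡ (f · (g · h)) n
    ·-assoc-at f g h zero    = ℤP.*-assoc (f 0) (g 0) (h 0)
    ·-assoc-at f g h (suc n) = begin
      f 0 ℤ.* g 0 ℤ.* h (suc n) ℤ.+ (tail (f · g) · h) n
        ≡⟨ cong (λ x → f 0 ℤ.* g 0 ℤ.* h (suc n) ℤ.+ x)
             (≡.trans (·-distribʳ-at (λ i → f 0 ℤ.* g (suc i)) (tail f · g) h n)
               (cong₂ ℤ._+_ (·-scale-at (f 0) (tail g) h n) (·-assoc-at (tail f) g h n))) ⟩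
      f 0 ℤ.* g 0 ℤ.* h (suc n) ℤ.+ (f 0 ℤ.* (tail g · h) n ℤ.+ (tail f · (g · h)) n)
        ≡⟨ solve 5 (λ a b c x y → a :* b :* c :+ (a :* x :+ y) := a :* (b :* c :+ x) :+ y) ≡.refl
             (f 0) (g 0) (h (suc n)) ((tail g · h) n) ((tail f · (g · h)) n) ⟩
      f 0 ℤ.* (g 0 ℤ.* h (suc n) ℤ.+ (tail g · h) n) ℤ.+ (tail f · (g · h)) n ∎
      where
      open ≡.≡-Reasoning
      open +-*-Solver

    ·-zeroˡ-at : ∀ f n → (0ˢ · f) n ≡ 0ℤ
    ·-zeroˡ-at f zero    = ≡.refl
    ·-zeroˡ-at f (suc n) = ≡.trans (ℤP.+-identityˡ _) (·-zeroˡ-at f n)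

    ι-scale-at : ∀ c f n → (ι c · f) n ≡ c ℤ.* f n
    ι-scale-at c f zero    = ≡.refl
    ι-scale-at c f (suc n) = ≡.trans (cong (λ x → c ℤ.* f (suc n) ℤ.+ x) (·-zeroˡ-at f n)) (ℤP.+-identityʳ _)

    ⊕-cong-≈ : f ≈ f′ → g ≈ g′ → f ⊕ g ≈ f′ ⊕ g′
    ⊕-cong-≈ p q = mk λ n → cong₂ ℤ._+_ (at p n) (at q n)

    ⊕-isAbelianGroup : IsAbelianGroup _≈_ _⊕_ 0ˢ ⊖_
    ⊕-isAbelianGroup = record
      { isGroup = record
        { isMonoid = record
          { isSemigroup = record
            { isMagma = record
              { isEquivalence = record
                { refl  = ≈-refl
                ; sym   = λ p → mk λ n → ≡.sym (at p n)
                ; trans = λ p q → mk λ n → ≡.trans (at p n) (at q n) }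
              ; ∙-cong = ⊕-cong-≈ }
            ; assoc = λ f g h → mk λ n → ℤP.+-assoc (f n) (g n) (h n) }
          ; identity = (λ f → mk λ n → ℤP.+-identityˡ (f n)) , (λ f → mk λ n → ℤP.+-identityʳ (f n)) }
        ; inverse = (λ f → mk λ n → ℤP.+-inverseˡ (f n)) , (λ f → mk λ n → ℤP.+-inverseʳ (f n))
        ; ⁻¹-cong = λ p → mk λ n → cong ℤ.-_ (at p n) }
      ; comm = λ f g → mk λ n → ℤP.+-comm (f n) (g n) }

    ·-identityˡ-at : ∀ f n → (1ˢ · f) n ≡ f n
    ·-identityˡ-at f n = ≡.trans (ι-scale-at 1ℤ f n) (ℤP.*-identityˡ (f n))

    ·-distribʳ : ∀ f g h → (g ⊕ h) · f ≈ g · f ⊕ h · f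
    ·-distribʳ f g h = mk (·-distribʳ-at g h f)

  seriesRing : CommutativeRing 0ℓ 0ℓ
  seriesRing = record
    { Carrier = Series ; _≈_ = _≈_ ; _+_ = _⊕_ ; _*_ = _·_ ; -_ = ⊖_ ; 0# = 0ˢ ; 1# = 1ˢ
    ; isCommutativeRing = record
      { isRing = record
        { +-isAbelianGroup = ⊕-isAbelianGroup
        ; *-cong = λ p q → mk λ n → ·-cong-at n (at p) (at q)
        ; *-assoc = λ f g h → mk (·-assoc-at f g h)
        ; *-identity = (λ f → mk (·-identityˡ-at f))
                     , (λ f → mk λ n → ≡.trans (·-comm-at f 1ˢ n) (·-identityˡ-at f n))
        ; distrib = (λ f g h → mk λ n → ≡.trans (·-comm-at f (g ⊕ h) n)
                       (≡.trans (at (·-distribʳ f g h) n)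
                         (at (⊕-cong-≈ (mk (·-comm-at g f)) (mk (·-comm-at h f))) n)))
                  , ·-distribʳ }
      ; *-comm = λ f g → mk (·-comm-at f g) } }

  module SR = CommutativeRing seriesRing
  open SR using (setoid; semiring)
    renaming (refl to ≈refl; sym to ≈sym; trans to ≈trans; +-cong to ⊕-cong; *-cong to ·-cong; -‿cong to ⊖-cong)
    public
  open import Algebra.Properties.Semiring.Exp semiring public using (_^_; ^-congˡ)

  ·-congˡ : ∀ k → f ≈ g → k · f ≈ k · g
  ·-congˡ k = ·-cong (≈refl {k})

  ·-congʳ : ∀ k → f ≈ g → f · k ≈ g · k
  ·-congʳ k p = ·-cong p (≈refl {k})

  opaque
    unfolding _·_

    ι-+ : ∀ a b → ι (a ℤ.+ b) ≈ ι a ⊕ ι b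
    ι-+ a b = mk λ { zero → ≡.refl ; (suc _) → ≡.refl }

    ι-* : ∀ a b → ι (a ℤ.* b) ≈ ι a · ι b
    ι-* a b = mk λ { zero → ≡.refl
                   ; (suc n) → ≡.sym (≡.trans (ι-scale-at a (ι b) (suc n)) (ℤP.*-zeroʳ a)) }

    ι-neg : ∀ a → ι (ℤ.- a) ≈ ⊖ ι a
    ι-neg a = mk λ { zero → ≡.refl ; (suc _) → ≡.refl }

    ι-0 : ι 0ℤ ≈ 0ˢ
    ι-0 = mk λ { zero → ≡.refl ; (suc _) → ≡.refl }

  ι-morphism : CommutativeRing.rawRing ℤP.+-*-commutativeRing
               -Raw-AlmostCommutative⟶ fromCommutativeRing seriesRing
  ι-morphism = record
    { ⟦_⟧ = ι ; +-homo = ι-+ ; *-homo = ι-* ; -‿homo = ι-neg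
    ; 0-homo = ι-0 ; 1-homo = ≈-refl }

  ι-≟ : ∀ a b → Maybe (ι a ≈ ι b)
  ι-≟ a b with a ℤ.≟ b
  ... | yes ≡.refl = just ≈-refl
  ... | no _       = nothing

  module Solver = Algebra.Solver.Ring (CommutativeRing.rawRing ℤP.+-*-commutativeRing)
    (fromCommutativeRing seriesRing) ι-morphism ι-≟

  module ≈-Reasoning where
    open import Relation.Binary.Reasoning.Setoid setoid public

-- The operators φ, U and D, and cancellation of factors.

module Operators where
  open SeriesRing
  open import Data.Nat as ℕ using (ℕ; zero; suc; _∸_)
  import Data.Nat.Properties as ℕP
  open import Data.Integer as ℤ using (ℤ; +_; 0ℤ; 1ℤ)
  import Data.Integer.Properties as ℤP
  open import Data.Integer.Solver using (module +-*-Solver)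
  open import Data.List using (_∷_; map; zipWith; upTo; applyUpTo)
  open import Relation.Binary.PropositionalEquality as ≡ using (_≡_; cong; cong₂)

  opaque

    q : Series
    q zero          = 0ℤ
    q (suc zero)    = 1ℤ
    q (suc (suc _)) = 0ℤ

    -- Peeling off seven indices at a time keeps the definition structural, with no division of the
    -- index by 7.
    φ : Series → Series
    φ f 0 = f 0
    φ f 1 = 0ℤ
    φ f 2 = 0ℤ
    φ f 3 = 0ℤ
    φ f 4 = 0ℤ
    φ f 5 = 0ℤ
    φ f 6 = 0ℤ
    φ f (suc (suc (suc (suc (suc (suc (suc n))))))) = φ (tail f) n

    U : Series → Series
    U f n = f (n ℕ.* 7)

    D : Series → Series
    D f n = + n ℤ.* f n

  private
    variable
      f g : Series

  opaque
    unfolding _·_ φ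

    ·-at-suc : ∀ f g n → f 0 ≡ 0ℤ → (f · g) (suc n) ≡ (tail f · g) n
    ·-at-suc f g n p = ≡.trans (cong (λ x → x ℤ.* g (suc n) ℤ.+ (tail f · g) n) p) (ℤP.+-identityˡ _)

    q·-suc : ∀ f n → (q · f) (suc n) ≡ f n
    q·-suc f n = ≡.trans (·-at-suc q f n ≡.refl)
      (≡.trans (·-cong-at n (λ { zero → ≡.refl ; (suc _) → ≡.refl }) (λ _ → ≡.refl))
        (at (SR.*-identityˡ f) n))

    q^·-shift : ∀ k f n → (q ^ k · f) (k ℕ.+ n) ≡ f n
    q^·-shift zero    f n = at (SR.*-identityˡ f) n
    q^·-shift (suc k) f n = ≡.trans (at (SR.*-assoc q (q ^ k) f) (suc (k ℕ.+ n)))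
      (≡.trans (q·-suc (q ^ k · f) (k ℕ.+ n)) (q^·-shift k f n))

    q^·-low : ∀ k f n → n ℕ.< k → (q ^ k · f) n ≡ 0ℤ
    q^·-low (suc k) f zero    _ = ≡.trans (at (SR.*-assoc q (q ^ k) f) 0) ≡.refl
    q^·-low (suc k) f (suc n) (ℕ.s≤s p) = ≡.trans (at (SR.*-assoc q (q ^ k) f) (suc n))
      (≡.trans (q·-suc (q ^ k · f) n) (q^·-low k f n p))

    φ-cong-at : ∀ n → (∀ i → f i ≡ g i) → φ f n ≡ φ g n
    φ-cong-at 0 p = p 0
    φ-cong-at 1 p = ≡.refl
    φ-cong-at 2 p = ≡.refl
    φ-cong-at 3 p = ≡.refl
    φ-cong-at 4 p = ≡.refl
    φ-cong-at 5 p = ≡.refl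
    φ-cong-at 6 p = ≡.refl
    φ-cong-at (suc (suc (suc (suc (suc (suc (suc n))))))) p = φ-cong-at n (λ i → p (suc i))

    φ-cong : f ≈ g → φ f ≈ φ g
    φ-cong p = mk λ n → φ-cong-at n (at p)

    φ-+-at : ∀ f g n → φ (f ⊕ g) n ≡ φ f n ℤ.+ φ g n
    φ-+-at f g 0 = ≡.refl
    φ-+-at f g 1 = ≡.refl
    φ-+-at f g 2 = ≡.refl
    φ-+-at f g 3 = ≡.refl
    φ-+-at f g 4 = ≡.refl
    φ-+-at f g 5 = ≡.refl
    φ-+-at f g 6 = ≡.refl
    φ-+-at f g (suc (suc (suc (suc (suc (suc (suc n))))))) = φ-+-at (tail f) (tail g) n

    φ-+ : ∀ f g → φ (f ⊕ g) ≈ φ f ⊕ φ g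
    φ-+ f g = mk (φ-+-at f g)

    φ-scale-at : ∀ c f n → φ (λ i → c ℤ.* f i) n ≡ c ℤ.* φ f n
    φ-scale-at c f 0 = ≡.refl
    φ-scale-at c f 1 = ≡.sym (ℤP.*-zeroʳ c)
    φ-scale-at c f 2 = ≡.sym (ℤP.*-zeroʳ c)
    φ-scale-at c f 3 = ≡.sym (ℤP.*-zeroʳ c)
    φ-scale-at c f 4 = ≡.sym (ℤP.*-zeroʳ c)
    φ-scale-at c f 5 = ≡.sym (ℤP.*-zeroʳ c)
    φ-scale-at c f 6 = ≡.sym (ℤP.*-zeroʳ c)
    φ-scale-at c f (suc (suc (suc (suc (suc (suc (suc n))))))) = φ-scale-at c (tail f) n

    φ·-shift : ∀ f g n → (φ f · g) (7 ℕ.+ n) ≡ f 0 ℤ.* g (7 ℕ.+ n) ℤ.+ (φ (tail f) · g) n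
    φ·-shift f g n = cong (λ x → f 0 ℤ.* g (7 ℕ.+ n) ℤ.+ x)
      (≡.trans (skip (tail (φ f)) (5 ℕ.+ n)) (≡.trans (skip (tail (tail (φ f))) (4 ℕ.+ n))
      (≡.trans (skip (λ i → φ f (3 ℕ.+ i)) (3 ℕ.+ n)) (≡.trans (skip (λ i → φ f (4 ℕ.+ i)) (2 ℕ.+ n))
      (≡.trans (skip (λ i → φ f (5 ℕ.+ i)) (1 ℕ.+ n)) (skip (λ i → φ f (6 ℕ.+ i)) n))))))
      where
      skip : ∀ k m → {{k 0 ≡ 0ℤ}} → (k · g) (suc m) ≡ (tail k · g) m
      skip k m {{p}} = ·-at-suc k g m p
      instance
        r : 0ℤ ≡ 0ℤ
        r = ≡.refl

    φ-·-at : ∀ f g n → φ (f · g) n ≡ (φ f · φ g) n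
    φ-·-at f g 0 = ≡.refl
    φ-·-at f g 1 = ≡.sym (cong (ℤ._+ 0ℤ) (ℤP.*-zeroʳ (f 0)))
    φ-·-at f g 2 = ≡.sym (cong (ℤ._+ 0ℤ) (ℤP.*-zeroʳ (f 0)))
    φ-·-at f g 3 = ≡.sym (cong (ℤ._+ 0ℤ) (ℤP.*-zeroʳ (f 0)))
    φ-·-at f g 4 = ≡.sym (cong (ℤ._+ 0ℤ) (ℤP.*-zeroʳ (f 0)))
    φ-·-at f g 5 = ≡.sym (cong (ℤ._+ 0ℤ) (ℤP.*-zeroʳ (f 0)))
    φ-·-at f g 6 = ≡.sym (cong (ℤ._+ 0ℤ) (ℤP.*-zeroʳ (f 0)))
    φ-·-at f g (suc (suc (suc (suc (suc (suc (suc n))))))) = begin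
      φ (tail (f · g)) n                                   ≡⟨ φ-+-at (λ i → f 0 ℤ.* g (suc i)) (tail f · g) n ⟩
      φ (λ i → f 0 ℤ.* g (suc i)) n ℤ.+ φ (tail f · g) n   ≡⟨ cong₂ ℤ._+_ (φ-scale-at (f 0) (tail g) n) (φ-·-at (tail f) g n) ⟩
      f 0 ℤ.* φ (tail g) n ℤ.+ (φ (tail f) · φ g) n        ≡⟨ ≡.sym (φ·-shift f (φ g) n) ⟩
      (φ f · φ g) (7 ℕ.+ n)                                ∎
      where open ≡.≡-Reasoning

    φ-· : ∀ f g → φ (f · g) ≈ φ f · φ g
    φ-· f g = mk (φ-·-at f g)

    φ-ι-at : ∀ c n → φ (ι c) n ≡ ι c n
    φ-0-at : ∀ n → φ 0ˢ n ≡ 0ℤ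
    φ-0-at 0 = ≡.refl
    φ-0-at 1 = ≡.refl
    φ-0-at 2 = ≡.refl
    φ-0-at 3 = ≡.refl
    φ-0-at 4 = ≡.refl
    φ-0-at 5 = ≡.refl
    φ-0-at 6 = ≡.refl
    φ-0-at (suc (suc (suc (suc (suc (suc (suc n))))))) = φ-0-at n
    φ-ι-at c 0 = ≡.refl
    φ-ι-at c 1 = ≡.refl
    φ-ι-at c 2 = ≡.refl
    φ-ι-at c 3 = ≡.refl
    φ-ι-at c 4 = ≡.refl
    φ-ι-at c 5 = ≡.refl
    φ-ι-at c 6 = ≡.refl
    φ-ι-at c (suc (suc (suc (suc (suc (suc (suc n))))))) = φ-0-at n

    φ-ι : ∀ c → φ (ι c) ≈ ι c
    φ-ι c = mk (φ-ι-at c)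

    φ-0 : φ 0ˢ ≈ 0ˢ
    φ-0 = mk φ-0-at

    U-0 : U 0ˢ ≈ 0ˢ
    U-0 = ≈-refl

    ⊖-scale : ∀ f → ⊖ f ≈ (λ i → ℤ.- 1ℤ ℤ.* f i)
    ⊖-scale f = mk λ n → ≡.sym (ℤP.-1*i≡-i (f n))

    φ-⊖ : ∀ f → φ (⊖ f) ≈ ⊖ φ f
    φ-⊖ f = ≈trans (φ-cong (⊖-scale f)) (≈trans (mk (φ-scale-at (ℤ.- 1ℤ) f)) (≈sym (⊖-scale (φ f))))

    φ-^ : ∀ f k → φ (f ^ k) ≈ φ f ^ k
    φ-^ f zero    = φ-ι 1ℤ
    φ-^ f (suc k) = ≈trans (φ-· f (f ^ k)) (·-congˡ (φ f) (φ-^ f k))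

    U-cong : f ≈ g → U f ≈ U g
    U-cong p = mk λ n → at p (n ℕ.* 7)

    U-⊕ : ∀ f g → U (f ⊕ g) ≈ U f ⊕ U g
    U-⊕ f g = ≈-refl

    Uφ-at : ∀ f n → φ f (n ℕ.* 7) ≡ f n
    Uφ-at f zero    = ≡.refl
    Uφ-at f (suc n) = Uφ-at (tail f) n

    U-φ : ∀ f → U (φ f) ≈ f
    U-φ f = mk (Uφ-at f)

    φ-injective : φ f ≈ φ g → f ≈ g
    φ-injective {f} {g} p = ≈trans (≈sym (U-φ f)) (≈trans (U-cong p) (U-φ g))

    U-φ·-at : ∀ f g n → (φ f · g) (n ℕ.* 7) ≡ (f · U g) n
    U-φ·-at f g zero    = ≡.refl
    U-φ·-at f g (suc n) = ≡.trans (φ·-shift f g (n ℕ.* 7))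
      (cong (λ x → f 0 ℤ.* g (7 ℕ.+ n ℕ.* 7) ℤ.+ x) (U-φ·-at (tail f) g n))

    -- A series in q⁷ does not mix residue classes modulo 7. This linearity over the image of φ is
    -- what lets known factors pass through U.
    U-φ· : ∀ f g → U (φ f · g) ≈ f · U g
    U-φ· f g = mk (U-φ·-at f g)

    φ-off : ∀ f j n → j ℕ.< 6 → φ f (suc j ℕ.+ n ℕ.* 7) ≡ 0ℤ
    φ-off f 0 zero _ = ≡.refl
    φ-off f 1 zero _ = ≡.refl
    φ-off f 2 zero _ = ≡.refl
    φ-off f 3 zero _ = ≡.refl
    φ-off f 4 zero _ = ≡.refl
    φ-off f 5 zero _ = ≡.refl
    φ-off f (suc (suc (suc (suc (suc (suc _)))))) n
      (ℕ.s≤s (ℕ.s≤s (ℕ.s≤s (ℕ.s≤s (ℕ.s≤s (ℕ.s≤s ()))))))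
    φ-off f j (suc n) p = ≡.trans
      (cong (φ f) (≡.trans (≡.sym (ℕP.+-assoc (suc j) 7 (n ℕ.* 7)))
        (≡.trans (cong (ℕ._+ n ℕ.* 7) (ℕP.+-comm (suc j) 7)) (ℕP.+-assoc 7 (suc j) (n ℕ.* 7)))))
      (φ-off (tail f) j n p)

    U-q^φ : ∀ i f → i ℕ.< 6 → U (q ^ suc i · φ f) ≈ 0ˢ
    U-q^φ i f i<6 = mk λ
      { zero    → q^·-low (suc i) (φ f) 0 (ℕ.s≤s ℕ.z≤n)
      ; (suc n) → ≡.trans (cong (q ^ suc i · φ f) (split n))
          (≡.trans (q^·-shift (suc i) (φ f) (suc (5 ∸ i) ℕ.+ n ℕ.* 7))
            (φ-off f (5 ∸ i) n (ℕ.s≤s (ℕP.m∸n≤m 5 i)))) }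
      where
      split : ∀ n → 7 ℕ.+ n ℕ.* 7 ≡ suc i ℕ.+ (suc (5 ∸ i) ℕ.+ n ℕ.* 7)
      split n = ≡.sym (≡.trans (≡.sym (ℕP.+-assoc (suc i) (suc (5 ∸ i)) (n ℕ.* 7)))
        (cong (ℕ._+ n ℕ.* 7) (≡.trans (ℕP.+-suc (suc i) (5 ∸ i))
          (cong (λ x → suc (suc x)) (ℕP.m+[n∸m]≡n (ℕP.≤-pred i<6))))))

    φ-q : φ q ≈ q ^ 7
    φ-q = mk λ
      { 0 → ≡.refl ; 1 → ≡.refl ; 2 → ≡.refl ; 3 → ≡.refl ; 4 → ≡.refl ; 5 → ≡.refl ; 6 → ≡.refl
      ; 7 → ≡.refl
      ; (suc (suc (suc (suc (suc (suc (suc (suc n)))))))) → ≡.trans (lemma (suc n))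
          (≡.sym (≡.trans (≡.sym (at (SR.*-identityʳ (q ^ 7)) (8 ℕ.+ n))) (q^·-shift 7 1ˢ (suc n)))) }
      where
      lemma : ∀ n → φ (tail q) n ≡ ι 1ℤ n
      lemma n = ≡.trans (φ-cong-at n (λ { zero → ≡.refl ; (suc _) → ≡.refl })) (φ-ι-at 1ℤ n)

    D-cong : f ≈ g → D f ≈ D g
    D-cong p = mk λ n → cong (+ n ℤ.*_) (at p n)

    D-⊕ : ∀ f g → D (f ⊕ g) ≈ D f ⊕ D g
    D-⊕ f g = mk λ n → ℤP.*-distribˡ-+ (+ n) (f n) (g n)

    D-⊖ : ∀ f → D (⊖ f) ≈ ⊖ D f
    D-⊖ f = mk λ n → ≡.sym (ℤP.neg-distribʳ-* (+ n) (f n))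

    D-ι : ∀ c → D (ι c) ≈ 0ˢ
    D-ι c = mk λ { zero → ≡.refl ; (suc n) → ℤP.*-zeroʳ (+ suc n) }

    tail-D : ∀ f → tail (D f) ≈ D (tail f) ⊕ tail f
    tail-D f = mk λ n → ≡.trans (cong (ℤ._* f (suc n)) (ℤP.+-comm 1ℤ (+ n)))
      (≡.trans (ℤP.*-distribʳ-+ (f (suc n)) (+ n) 1ℤ) (cong (λ x → + n ℤ.* f (suc n) ℤ.+ x) (ℤP.*-identityˡ _)))

    D-·-at : ∀ f g n → D (f · g) n ≡ (D f · g) n ℤ.+ (f · D g) n
    D-·-at f g zero    = ≡.sym (≡.trans (ℤP.+-identityˡ (f 0 ℤ.* D g 0)) (ℤP.*-zeroʳ (f 0)))
    D-·-at f g (suc n) = begin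
      + suc n ℤ.* (f 0 ℤ.* g (suc n) ℤ.+ (tail f · g) n)
        ≡⟨ solve 4 (λ k a b x → (con 1ℤ :+ k) :* (a :* b :+ x) := a :* ((con 1ℤ :+ k) :* b) :+ (k :* x :+ x)) ≡.refl
             (+ n) (f 0) (g (suc n)) ((tail f · g) n) ⟩
      f 0 ℤ.* D g (suc n) ℤ.+ (D (tail f · g) n ℤ.+ (tail f · g) n)
        ≡⟨ cong (λ x → f 0 ℤ.* D g (suc n) ℤ.+ (x ℤ.+ (tail f · g) n)) (D-·-at (tail f) g n) ⟩
      f 0 ℤ.* D g (suc n) ℤ.+ ((D (tail f) · g) n ℤ.+ (tail f · D g) n ℤ.+ (tail f · g) n)
        ≡⟨ solve 4 (λ a b c d → a :+ (b :+ c :+ d) := (b :+ d) :+ (a :+ c)) ≡.refl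
             (f 0 ℤ.* D g (suc n)) ((D (tail f) · g) n) ((tail f · D g) n) ((tail f · g) n) ⟩
      ((D (tail f) · g) n ℤ.+ (tail f · g) n) ℤ.+ (f 0 ℤ.* D g (suc n) ℤ.+ (tail f · D g) n)
        ≡⟨ cong (ℤ._+ (f · D g) (suc n)) (≡.sym (≡.trans (·-at-suc (D f) g n ≡.refl)
             (≡.trans (·-cong-at n (at (tail-D f)) (λ _ → ≡.refl)) (·-distribʳ-at (D (tail f)) (tail f) g n)))) ⟩
      (D f · g) (suc n) ℤ.+ (f · D g) (suc n) ∎
      where
      open ≡.≡-Reasoning
      open +-*-Solver

    D-· : ∀ f g → D (f · g) ≈ D f · g ⊕ f · D g
    D-· f g = mk (D-·-at f g)

    D-φ-at : ∀ f n → D (φ f) n ≡ + 7 ℤ.* φ (D f) n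
    D-φ-at f 0 = ≡.refl
    D-φ-at f 1 = ≡.refl
    D-φ-at f 2 = ≡.refl
    D-φ-at f 3 = ≡.refl
    D-φ-at f 4 = ≡.refl
    D-φ-at f 5 = ≡.refl
    D-φ-at f 6 = ≡.refl
    D-φ-at f (suc (suc (suc (suc (suc (suc (suc n))))))) = begin
      + (7 ℕ.+ n) ℤ.* φ (tail f) n                       ≡⟨ ℤP.*-distribʳ-+ (φ (tail f) n) (+ 7) (+ n) ⟩
      + 7 ℤ.* φ (tail f) n ℤ.+ D (φ (tail f)) n          ≡⟨ cong (λ x → + 7 ℤ.* φ (tail f) n ℤ.+ x) (D-φ-at (tail f) n) ⟩
      + 7 ℤ.* φ (tail f) n ℤ.+ + 7 ℤ.* φ (D (tail f)) n  ≡⟨ ℤP.+-comm (+ 7 ℤ.* φ (tail f) n) _ ⟩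
      + 7 ℤ.* φ (D (tail f)) n ℤ.+ + 7 ℤ.* φ (tail f) n  ≡⟨ ≡.sym (ℤP.*-distribˡ-+ (+ 7) (φ (D (tail f)) n) (φ (tail f) n)) ⟩
      + 7 ℤ.* (φ (D (tail f)) n ℤ.+ φ (tail f) n)        ≡⟨ cong (+ 7 ℤ.*_) (≡.sym (φ-+-at (D (tail f)) (tail f) n)) ⟩
      + 7 ℤ.* φ (D (tail f) ⊕ tail f) n                  ≡⟨ cong (+ 7 ℤ.*_) (φ-cong-at n (λ i → ≡.sym (at (tail-D f) i))) ⟩
      + 7 ℤ.* φ (D f) (7 ℕ.+ n)                          ∎
      where open ≡.≡-Reasoning

    D-φ : ∀ f → D (φ f) ≈ ι (+ 7) · φ (D f)
    D-φ f = mk λ n → ≡.trans (D-φ-at f n) (≡.sym (ι-scale-at (+ 7) (φ (D f)) n))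

    map-applyUpTo : ∀ {A B : Set} (k : A → B) (l : ℕ → A) n → map k (applyUpTo l n) ≡ applyUpTo (λ i → k (l i)) n
    map-applyUpTo k l zero    = ≡.refl
    map-applyUpTo k l (suc n) = cong (k (l 0) ∷_) (map-applyUpTo k (λ i → l (suc i)) n)

    ⊛-sum : ∀ f g n → Σℤ (applyUpTo (λ i → f i ℤ.* g (n ∸ i)) (suc n)) ≡ (f · g) n
    ⊛-sum f g zero    = ℤP.+-identityʳ _
    ⊛-sum f g (suc n) = cong (λ x → f 0 ℤ.* g (suc n) ℤ.+ x) (⊛-sum (tail f) g n)

    ⊛-· : ∀ f g → f ⊛ g ≈ f · g
    ⊛-· f g = mk λ n → ≡.trans (cong Σℤ (map-applyUpTo (λ i → f i ℤ.* g (n ∸ i)) (λ i → i) (suc n))) (⊛-sum f g n)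

    -- `invRev` lists coefficients from n down to 0, so zipping it with ascending indices is a
    -- convolution. The index map `l` is kept free because dropping the head of `upTo` leaves the
    -- indices composed with `suc`.
    invRev-sum : ∀ a (c : Series) (l : ℕ → ℕ) n →
      Σℤ (zipWith (λ i b → c i ℤ.* b) (applyUpTo l (suc n)) (invRev a n)) ≡ ((λ i → c (l i)) · inv a) n
    invRev-sum a c l zero    = ℤP.+-identityʳ _
    invRev-sum a c l (suc n) = cong (λ x → c (l 0) ℤ.* inv a (suc n) ℤ.+ x) (invRev-sum a c (λ i → l (suc i)) n)

    inv-right : ∀ a → a 0 ≡ 1ℤ → a · inv a ≈ 1ˢ
    inv-right a p = mk λ
      { zero    → ≡.trans (ℤP.*-identityʳ (a 0)) p
      ; (suc n) → ≡.trans (cong₂ (λ x y → x ℤ.* inv a (suc n) ℤ.+ y) p (≡.sym (invRev-sum a (tail a) (λ i → i) n)))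
          (≡.trans (cong (ℤ._+ s n) (ℤP.*-identityˡ (ℤ.- s n))) (ℤP.+-inverseˡ (s n))) }
      where
      s : ℕ → ℤ
      s n = Σℤ (zipWith (λ i b → a (suc i) ℤ.* b) (upTo (suc n)) (invRev a n))

    ·-vanish : ∀ f g n → (∀ j → j ℕ.≤ n → g j ≡ 0ℤ) → (f · g) n ≡ 0ℤ
    ·-vanish f g zero    p = ≡.trans (cong (f 0 ℤ.*_) (p 0 ℕ.z≤n)) (ℤP.*-zeroʳ (f 0))
    ·-vanish f g (suc n) p = cong₂ ℤ._+_
      (≡.trans (cong (f 0 ℤ.*_) (p (suc n) ℕP.≤-refl)) (ℤP.*-zeroʳ (f 0)))
      (·-vanish (tail f) g n (λ j j≤n → p j (ℕP.m≤n⇒m≤1+n j≤n)))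

    ·-leading : ∀ f g n → (∀ j → j ℕ.< n → g j ≡ 0ℤ) → (f · g) n ≡ f 0 ℤ.* g n
    ·-leading f g zero    p = ≡.refl
    ·-leading f g (suc n) p = ≡.trans (cong (λ x → f 0 ℤ.* g (suc n) ℤ.+ x) (·-vanish (tail f) g n (λ j j≤n → p j (ℕ.s≤s j≤n))))
      (ℤP.+-identityʳ _)

  -- Fractions are avoided throughout: an equation with denominators is multiplied out, and the
  -- factor is cancelled afterwards. Units, q and positive integers suffice as factors.
  Regular : Series → Set
  Regular a = ∀ {f g} → a · f ≈ a · g → f ≈ g

  unit-regular : ∀ a → a 0 ≡ 1ℤ → Regular a
  unit-regular a p {f} {g} e = ≈trans (lemma f) (≈trans (·-congʳ (inv a) e) (≈sym (lemma g)))
    where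
    lemma : ∀ f → f ≈ a · f · inv a
    lemma f = ≈trans (≈sym (SR.*-identityˡ f)) (≈trans (·-congʳ f (≈sym (inv-right a p)))
      (solve 3 (λ a b f → a :* b :* f := a :* f :* b) ≈-refl a (inv a) f))
      where open Solver

  opaque
    unfolding _·_ φ

    q-regular : Regular q
    q-regular {f} {g} e = mk λ n → ≡.trans (≡.sym (q·-suc f n)) (≡.trans (at e (suc n)) (q·-suc g n))

    ι-regular : ∀ m → Regular (ι (+ suc m))
    ι-regular m {f} {g} e = mk λ n → ℤP.*-cancelˡ-≡ (+ suc m) (f n) (g n)
      (≡.trans (≡.sym (ι-scale-at (+ suc m) f n)) (≡.trans (at e n) (ι-scale-at (+ suc m) g n)))

  ·-regular : ∀ {a b} → Regular a → Regular b → Regular (a · b)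
  ·-regular {a} {b} ra rb e = rb (ra (≈trans (≈sym (SR.*-assoc a b _)) (≈trans e (SR.*-assoc a b _))))

  ^-regular : ∀ {a} k → Regular a → Regular (a ^ k)
  ^-regular zero    ra e = ≈trans (≈sym (SR.*-identityˡ _)) (≈trans e (SR.*-identityˡ _))
  ^-regular (suc k) ra   = ·-regular ra (^-regular k ra)

  ≈-regular : ∀ {a b} → a ≈ b → Regular a → Regular b
  ≈-regular a≈b ra {f} {g} e = ra (≈trans (·-congʳ f a≈b) (≈trans e (·-congʳ g (≈sym a≈b))))

-- A decision procedure for identities in y and r.

module Evaluation where
  open SeriesRing
  open Operators
  open import Data.Nat as ℕ using (ℕ; zero; suc)
  open import Data.Integer as ℤ using (ℤ; +_; -[1+_]; 0ℤ; 1ℤ; -1ℤ)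
  import Data.Nat.Properties as ℕP
  open import Data.List using (List; []; _∷_; map; length)
  open import Data.Bool using (Bool; true; false; T)
  open import Data.Unit using (⊤; tt)
  open import Data.Empty using (⊥)
  open import Data.Product using (_×_; _,_)
  open import Relation.Binary.PropositionalEquality as ≡ using (_≡_)

  open Solver using (_:+_; _:*_; _:-_; :-_; _:^_; con; _:=_) renaming (solve to solve≈)

  infixl 6 _∔_ _⊟_
  infixl 7 _∙_
  infixr 8 _^^_
  data Expr : Set where
    Y R  : Expr
    K    : ℤ → Expr
    _∔_  : Expr → Expr → Expr
    _∙_  : Expr → Expr → Expr
    _^^_ : Expr → ℕ → Expr

  _⊟_ : Expr → Expr → Expr
  a ⊟ b = a ∔ K -1ℤ ∙ b

  ⟦_⟧ : Expr → Series → Series → Series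
  ⟦ Y ⟧      y r = y
  ⟦ R ⟧      y r = r
  ⟦ K c ⟧    y r = ι c
  ⟦ a ∔ b ⟧  y r = ⟦ a ⟧ y r ⊕ ⟦ b ⟧ y r
  ⟦ a ∙ b ⟧  y r = ⟦ a ⟧ y r · ⟦ b ⟧ y r
  ⟦ a ^^ n ⟧ y r = ⟦ a ⟧ y r ^ n

  infixl 6 _+₁_ _+₂_
  infixl 7 _*₁_ _*₂_ _⋆₂_

  _+₁_ : List ℤ → List ℤ → List ℤ
  []      +₁ v       = v
  (a ∷ u) +₁ []      = a ∷ u
  (a ∷ u) +₁ (b ∷ v) = (a ℤ.+ b) ∷ (u +₁ v)

  _*₁_ : List ℤ → List ℤ → List ℤ
  []      *₁ v = []
  (a ∷ u) *₁ v = map (a ℤ.*_) v +₁ (0ℤ ∷ (u *₁ v))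

  _+₂_ : List (List ℤ) → List (List ℤ) → List (List ℤ)
  []      +₂ v       = v
  (a ∷ u) +₂ []      = a ∷ u
  (a ∷ u) +₂ (b ∷ v) = (a +₁ b) ∷ (u +₂ v)

  _⋆₂_ : List ℤ → List (List ℤ) → List (List ℤ)
  a ⋆₂ v = map (a *₁_) v

  _*₂_ : List (List ℤ) → List (List ℤ) → List (List ℤ)
  []      *₂ v = []
  (a ∷ u) *₂ v = (a ⋆₂ v) +₂ ([] ∷ (u *₂ v))

  -- r (1 - r)^4
  y⁷ : List ℤ
  y⁷ = + 0 ∷ + 1 ∷ -[1+ 3 ] ∷ + 6 ∷ -[1+ 3 ] ∷ + 1 ∷ []

  -- One pass is enough after each product: two factors of degree at most 6 in y give degree at most
  -- 12, so what stands above y⁷ has degree at most 5.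
  reduce : List (List ℤ) → List (List ℤ)
  reduce (a ∷ b ∷ c ∷ d ∷ e ∷ f ∷ g ∷ u) = (a ∷ b ∷ c ∷ d ∷ e ∷ f ∷ g ∷ []) +₂ (y⁷ ⋆₂ u)
  reduce u = u

  norm : Expr → List (List ℤ)
  norm^ : List (List ℤ) → ℕ → List (List ℤ)
  norm Y        = [] ∷ (1ℤ ∷ []) ∷ []
  norm R        = (0ℤ ∷ 1ℤ ∷ []) ∷ []
  norm (K c)    = (c ∷ []) ∷ []
  norm (a ∔ b)  = norm a +₂ norm b
  norm (a ∙ b)  = reduce (norm a *₂ norm b)
  norm (a ^^ n) = norm^ (norm a) n
  norm^ u zero    = (1ℤ ∷ []) ∷ []
  norm^ u (suc n) = reduce (u *₂ norm^ u n)

  isZero₁ : List ℤ → Bool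
  isZero₁ []         = true
  isZero₁ (+ 0 ∷ u)  = isZero₁ u
  isZero₁ (_   ∷ u)  = false

  isZero₂ : List (List ℤ) → Bool
  isZero₂ []      = true
  isZero₂ (a ∷ u) with isZero₁ a
  ... | true  = isZero₂ u
  ... | false = false

  -- When y = q φ y₀ and r = φ r₀, a combination of y, …, y⁶ over ℤ[r] has no exponent divisible by 7.
  isMixed : List (List ℤ) → Bool
  isMixed []      = true
  isMixed (a ∷ u) with isZero₁ a
  ... | true  = length u ℕ.≤ᵇ 6
  ... | false = false

  module Eval (y r : Series) where

    ev₁ : List ℤ → Series
    ev₁ []      = 0ˢ
    ev₁ (c ∷ u) = ι c ⊕ r · ev₁ u

    ev₂ : List (List ℤ) → Series
    ev₂ []      = 0ˢ
    ev₂ (a ∷ u) = ev₁ a ⊕ y · ev₂ u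

    ev₁-+ : ∀ u v → ev₁ (u +₁ v) ≈ ev₁ u ⊕ ev₁ v
    ev₁-+ []      v       = ≈sym (SR.+-identityˡ (ev₁ v))
    ev₁-+ (a ∷ u) []      = ≈sym (SR.+-identityʳ (ev₁ (a ∷ u)))
    ev₁-+ (a ∷ u) (b ∷ v) = ≈trans (⊕-cong (ι-+ a b) (·-congˡ r (ev₁-+ u v)))
      (solve≈ 5 (λ a b r x z → a :+ b :+ r :* (x :+ z) := (a :+ r :* x) :+ (b :+ r :* z)) ≈-refl
        (ι a) (ι b) r (ev₁ u) (ev₁ v))

    ev₁-scale : ∀ a v → ev₁ (map (a ℤ.*_) v) ≈ ι a · ev₁ v
    ev₁-scale a []      = ≈sym (SR.zeroʳ (ι a))
    ev₁-scale a (b ∷ v) = ≈trans (⊕-cong (ι-* a b) (·-congˡ r (ev₁-scale a v)))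
      (solve≈ 4 (λ a b r x → a :* b :+ r :* (a :* x) := a :* (b :+ r :* x)) ≈-refl (ι a) (ι b) r (ev₁ v))

    ev₁-* : ∀ u v → ev₁ (u *₁ v) ≈ ev₁ u · ev₁ v
    ev₁-* []      v = ≈sym (SR.zeroˡ (ev₁ v))
    ev₁-* (a ∷ u) v = ≈trans (ev₁-+ (map (a ℤ.*_) v) (0ℤ ∷ (u *₁ v)))
      (≈trans (⊕-cong (ev₁-scale a v) (⊕-cong (≈refl {ι 0ℤ}) (·-congˡ r (ev₁-* u v))))
        (solve≈ 4 (λ a r x z → a :* z :+ (con 0ℤ :+ r :* (x :* z)) := (a :+ r :* x) :* z) ≈-refl
          (ι a) r (ev₁ u) (ev₁ v)))

    ev₂-+ : ∀ u v → ev₂ (u +₂ v) ≈ ev₂ u ⊕ ev₂ v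
    ev₂-+ []      v       = ≈sym (SR.+-identityˡ (ev₂ v))
    ev₂-+ (a ∷ u) []      = ≈sym (SR.+-identityʳ (ev₂ (a ∷ u)))
    ev₂-+ (a ∷ u) (b ∷ v) = ≈trans (⊕-cong (ev₁-+ a b) (·-congˡ y (ev₂-+ u v)))
      (solve≈ 5 (λ a b r x z → a :+ b :+ r :* (x :+ z) := (a :+ r :* x) :+ (b :+ r :* z)) ≈-refl
        (ev₁ a) (ev₁ b) y (ev₂ u) (ev₂ v))

    ev₂-⋆ : ∀ a v → ev₂ (a ⋆₂ v) ≈ ev₁ a · ev₂ v
    ev₂-⋆ a []      = ≈sym (SR.zeroʳ (ev₁ a))
    ev₂-⋆ a (b ∷ v) = ≈trans (⊕-cong (ev₁-* a b) (·-congˡ y (ev₂-⋆ a v)))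
      (solve≈ 4 (λ a b r x → a :* b :+ r :* (a :* x) := a :* (b :+ r :* x)) ≈-refl (ev₁ a) (ev₁ b) y (ev₂ v))

    ev₂-* : ∀ u v → ev₂ (u *₂ v) ≈ ev₂ u · ev₂ v
    ev₂-* []      v = ≈sym (SR.zeroˡ (ev₂ v))
    ev₂-* (a ∷ u) v = ≈trans (ev₂-+ (a ⋆₂ v) ([] ∷ (u *₂ v)))
      (≈trans (⊕-cong (ev₂-⋆ a v) (⊕-cong (≈refl {0ˢ}) (·-congˡ y (ev₂-* u v))))
        (≈trans (⊕-cong ≈-refl (SR.+-identityˡ (y · (ev₂ u · ev₂ v))))
        (solve≈ 4 (λ a r x z → a :* z :+ (r :* (x :* z)) := (a :+ r :* x) :* z) ≈-refl
          (ev₁ a) y (ev₂ u) (ev₂ v))))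

    isZero₁-correct : ∀ u → isZero₁ u ≡ true → ev₁ u ≈ 0ˢ
    isZero₁-correct []              p = ≈-refl
    isZero₁-correct (+ 0 ∷ u)       p = ≈trans (⊕-cong ≈-refl (·-congˡ r (isZero₁-correct u p)))
      (≈trans (⊕-cong ι-0 (SR.zeroʳ r)) (SR.+-identityˡ 0ˢ))

    isZero₂-correct : ∀ u → isZero₂ u ≡ true → ev₂ u ≈ 0ˢ
    isZero₂-correct []      p = ≈-refl
    isZero₂-correct (a ∷ u) p with isZero₁ a in eq
    ... | true = ≈trans (⊕-cong (isZero₁-correct a eq) (·-congˡ y (isZero₂-correct u p)))
      (≈trans (SR.+-identityˡ _) (SR.zeroʳ y))

    module _ (rel : y ^ 7 ≈ r · (1ˢ ⊕ ⊖ r) ^ 4) where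

      ev₁-y⁷ : ev₁ y⁷ ≈ y ^ 7
      ev₁-y⁷ = ≈trans (⊕-cong ≈-refl (·-congˡ r (⊕-cong ≈-refl (·-congˡ r (⊕-cong ≈-refl (·-congˡ r
        (⊕-cong ≈-refl (·-congˡ r (⊕-cong ≈-refl (·-congˡ r (⊕-cong ≈-refl (SR.zeroʳ r))))))))))))
        (≈trans (⊕-cong ≈-refl (·-congˡ r (⊕-cong ≈-refl (·-congˡ r (⊕-cong ≈-refl (·-congˡ r
        (⊕-cong ≈-refl (·-congˡ r (⊕-cong ≈-refl (·-congˡ r (SR.+-identityʳ (ι 1ℤ))))))))))))
        (≈trans (solve≈ 1 (λ r → con 0ℤ :+ r :* (con 1ℤ :+ r :* (con -[1+ 3 ] :+ r :* (con (+ 6) :+ r :* (con -[1+ 3 ] :+ r :* con 1ℤ))))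
                   := r :* (con 1ℤ :- r) :^ 4) ≈-refl r)
          (≈sym rel)))

      ev₂-reduce : ∀ u → ev₂ (reduce u) ≈ ev₂ u
      ev₂-reduce []                              = ≈-refl
      ev₂-reduce (_ ∷ [])                        = ≈-refl
      ev₂-reduce (_ ∷ _ ∷ [])                    = ≈-refl
      ev₂-reduce (_ ∷ _ ∷ _ ∷ [])                = ≈-refl
      ev₂-reduce (_ ∷ _ ∷ _ ∷ _ ∷ [])            = ≈-refl
      ev₂-reduce (_ ∷ _ ∷ _ ∷ _ ∷ _ ∷ [])        = ≈-refl
      ev₂-reduce (_ ∷ _ ∷ _ ∷ _ ∷ _ ∷ _ ∷ [])    = ≈-refl
      ev₂-reduce (a ∷ b ∷ c ∷ d ∷ e ∷ f ∷ g ∷ u) = ≈trans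
        (ev₂-+ (a ∷ b ∷ c ∷ d ∷ e ∷ f ∷ g ∷ []) (y⁷ ⋆₂ u))
        (≈trans (⊕-cong lo (≈trans (ev₂-⋆ y⁷ u) (·-congʳ (ev₂ u) ev₁-y⁷)))
          (solve≈ 9 (λ a b c d e f g y u →
            (a :+ y :* (b :+ y :* (c :+ y :* (d :+ y :* (e :+ y :* (f :+ y :* g)))))) :+ y :^ 7 :* u :=
            a :+ y :* (b :+ y :* (c :+ y :* (d :+ y :* (e :+ y :* (f :+ y :* (g :+ y :* u))))))) ≈-refl
            (ev₁ a) (ev₁ b) (ev₁ c) (ev₁ d) (ev₁ e) (ev₁ f) (ev₁ g) y (ev₂ u)))
        where
        lo : ev₂ (a ∷ b ∷ c ∷ d ∷ e ∷ f ∷ g ∷ []) ≈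
             ev₁ a ⊕ y · (ev₁ b ⊕ y · (ev₁ c ⊕ y · (ev₁ d ⊕ y · (ev₁ e ⊕ y · (ev₁ f ⊕ y · ev₁ g)))))
        lo = ⊕-cong ≈-refl (·-congˡ y (⊕-cong ≈-refl (·-congˡ y (⊕-cong ≈-refl (·-congˡ y
          (⊕-cong ≈-refl (·-congˡ y (⊕-cong ≈-refl (·-congˡ y (⊕-cong ≈-refl (·-congˡ y
          (≈trans (⊕-cong ≈-refl (SR.zeroʳ y)) (SR.+-identityʳ (ev₁ g))))))))))))))

      ev₂-norm : ∀ e → ev₂ (norm e) ≈ ⟦ e ⟧ y r
      ev₂-norm^ : ∀ e n → ev₂ (norm^ (norm e) n) ≈ ⟦ e ⟧ y r ^ n
      ev₂-norm Y        = ≈trans (⊕-cong ≈-refl (·-congˡ y (≈trans (⊕-cong (⊕-cong ≈-refl (SR.zeroʳ r)) (SR.zeroʳ y))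
        (≈trans (SR.+-identityʳ _) (SR.+-identityʳ _))))) (≈trans (SR.+-identityˡ _) (SR.*-identityʳ y))
      ev₂-norm R        = ≈trans (⊕-cong (⊕-cong ≈-refl (·-congˡ r (⊕-cong ≈-refl (SR.zeroʳ r)))) (SR.zeroʳ y))
        (≈trans (SR.+-identityʳ _) (≈trans (⊕-cong ι-0 (·-congˡ r (SR.+-identityʳ _)))
          (≈trans (SR.+-identityˡ _) (SR.*-identityʳ r))))
      ev₂-norm (K c)    = ≈trans (⊕-cong (≈trans (⊕-cong ≈-refl (SR.zeroʳ r)) (SR.+-identityʳ (ι c))) (SR.zeroʳ y))
        (SR.+-identityʳ (ι c))
      ev₂-norm (a ∔ b)  = ≈trans (ev₂-+ (norm a) (norm b)) (⊕-cong (ev₂-norm a) (ev₂-norm b))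
      ev₂-norm (a ∙ b)  = ≈trans (ev₂-reduce (norm a *₂ norm b))
        (≈trans (ev₂-* (norm a) (norm b)) (·-cong (ev₂-norm a) (ev₂-norm b)))
      ev₂-norm (a ^^ n) = ev₂-norm^ a n
      ev₂-norm^ e zero    = ev₂-norm (K 1ℤ)
      ev₂-norm^ e (suc n) = ≈trans (ev₂-reduce (norm e *₂ norm^ (norm e) n))
        (≈trans (ev₂-* (norm e) (norm^ (norm e) n)) (·-cong (ev₂-norm e) (ev₂-norm^ e n)))

      ⟦⟧-decide : ∀ a b → isZero₂ (norm (a ⊟ b)) ≡ true → ⟦ a ⟧ y r ≈ ⟦ b ⟧ y r
      ⟦⟧-decide a b p = ≈trans
        (solve≈ 2 (λ a b → a := (a :+ con -1ℤ :* b) :+ b) ≈-refl (⟦ a ⟧ y r) (⟦ b ⟧ y r))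
        (≈trans (⊕-cong (≈trans (≈sym (ev₂-norm (a ⊟ b))) (isZero₂-correct (norm (a ⊟ b)) p)) ≈-refl)
          (SR.+-identityˡ _))

  YFree : Expr → Set
  YFree Y        = ⊥
  YFree R        = ⊤
  YFree (K _)    = ⊤
  YFree (a ∔ b)  = YFree a × YFree b
  YFree (a ∙ b)  = YFree a × YFree b
  YFree (a ^^ _) = YFree a

  -- Meant for expressions without y, evaluated one level below φ; 0 is a default value for y.
  ⟦_⟧₀ : Expr → Series → Series
  ⟦ e ⟧₀ r = ⟦ e ⟧ 0ˢ r

  φ-⟦⟧ : ∀ {y r} e → YFree e → φ (⟦ e ⟧₀ r) ≈ ⟦ e ⟧ y (φ r)
  φ-⟦⟧ R        p       = ≈-refl
  φ-⟦⟧ (K c)    p       = φ-ι c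
  φ-⟦⟧ {y} {r} (a ∔ b)  (p , s) = ≈trans (φ-+ (⟦ a ⟧₀ r) (⟦ b ⟧₀ r)) (⊕-cong (φ-⟦⟧ a p) (φ-⟦⟧ b s))
  φ-⟦⟧ {y} {r} (a ∙ b)  (p , s) = ≈trans (φ-· (⟦ a ⟧₀ r) (⟦ b ⟧₀ r)) (·-cong (φ-⟦⟧ a p) (φ-⟦⟧ b s))
  φ-⟦⟧ {y} {r} (a ^^ n) p       = ≈trans (φ-^ (⟦ a ⟧₀ r) n) (^-congˡ n (φ-⟦⟧ a p))

  module Derivation (dy dr : Expr) where

    -- D leaves the ring generated by y and r, but only by a common factor ε outside it, of weight
    -- 2. The symbolic ∂ is D / ε.
    ∂ : Expr → Expr
    ∂^ : Expr → Expr → ℕ → Expr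
    ∂ Y        = dy
    ∂ R        = dr
    ∂ (K _)    = K 0ℤ
    ∂ (a ∔ b)  = ∂ a ∔ ∂ b
    ∂ (a ∙ b)  = ∂ a ∙ b ∔ a ∙ ∂ b
    ∂ (a ^^ n) = ∂^ a (∂ a) n
    ∂^ a a′ zero    = K 0ℤ
    ∂^ a a′ (suc n) = a′ ∙ a ^^ n ∔ a ∙ ∂^ a a′ n

    module _ {y r ε : Series} (Dy : D y ≈ ε · ⟦ dy ⟧ y r) (Dr : D r ≈ ε · ⟦ dr ⟧ y r) where

      D-⟦⟧ : ∀ e → D (⟦ e ⟧ y r) ≈ ε · ⟦ ∂ e ⟧ y r
      D-⟦⟧^ : ∀ e n → D (⟦ e ⟧ y r ^ n) ≈ ε · ⟦ ∂^ e (∂ e) n ⟧ y r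
      D-const : ∀ c → D (ι c) ≈ ε · ι 0ℤ
      D-⟦⟧ Y        = Dy
      D-⟦⟧ R        = Dr
      D-⟦⟧ (K c)    = D-const c
      D-⟦⟧ (a ∔ b)  = ≈trans (D-⊕ (⟦ a ⟧ y r) (⟦ b ⟧ y r))
        (≈trans (⊕-cong (D-⟦⟧ a) (D-⟦⟧ b)) (≈sym (SR.distribˡ ε _ _)))
      D-⟦⟧ (a ∙ b)  = ≈trans (D-· (⟦ a ⟧ y r) (⟦ b ⟧ y r))
        (≈trans (⊕-cong (·-congʳ (⟦ b ⟧ y r) (D-⟦⟧ a)) (·-congˡ (⟦ a ⟧ y r) (D-⟦⟧ b)))
          (solve≈ 5 (λ e a b x z → e :* x :* b :+ a :* (e :* z) := e :* (x :* b :+ a :* z)) ≈-refl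
            ε (⟦ a ⟧ y r) (⟦ b ⟧ y r) (⟦ ∂ a ⟧ y r) (⟦ ∂ b ⟧ y r)))
      D-⟦⟧ (a ^^ n) = D-⟦⟧^ a n
      D-⟦⟧^ e zero    = D-const 1ℤ
      D-⟦⟧^ e (suc n) = ≈trans (D-· (⟦ e ⟧ y r) (⟦ e ⟧ y r ^ n))
        (≈trans (⊕-cong (·-congʳ (⟦ e ⟧ y r ^ n) (D-⟦⟧ e)) (·-congˡ (⟦ e ⟧ y r) (D-⟦⟧^ e n)))
          (solve≈ 5 (λ e a b x z → e :* x :* b :+ a :* (e :* z) := e :* (x :* b :+ a :* z)) ≈-refl
            ε (⟦ e ⟧ y r) (⟦ e ⟧ y r ^ n) (⟦ ∂ e ⟧ y r) (⟦ ∂^ e (∂ e) n ⟧ y r)))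
      D-const c = ≈trans (D-ι c) (≈sym (≈trans (·-congˡ ε ι-0) (SR.zeroʳ ε)))

  module _ {y₀ r₀ : Series} where

    open Eval (q · φ y₀) (φ r₀)

    φ-ev₁ : ∀ u → φ (Eval.ev₁ 0ˢ r₀ u) ≈ ev₁ u
    φ-ev₁ []      = φ-0
    φ-ev₁ (c ∷ u) = ≈trans (φ-+ (ι c) (r₀ · Eval.ev₁ 0ˢ r₀ u))
      (⊕-cong (φ-ι c) (≈trans (φ-· r₀ (Eval.ev₁ 0ˢ r₀ u)) (·-congˡ (φ r₀) (φ-ev₁ u))))

    U-y^ev₁ : ∀ i u → i ℕ.< 6 → U ((q · φ y₀) ^ suc i · ev₁ u) ≈ 0ˢ
    U-y^ev₁ i u p = ≈trans (U-cong (≈trans (·-cong (split (suc i)) (≈sym (φ-ev₁ u)))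
        (≈trans (SR.*-assoc _ _ _) (·-congˡ (q ^ suc i)
          (≈trans (·-congʳ _ (≈sym (φ-^ y₀ (suc i)))) (≈sym (φ-· (y₀ ^ suc i) _)))))))
      (U-q^φ i (y₀ ^ suc i · Eval.ev₁ 0ˢ r₀ u) p)
      where
      split : ∀ k → (q · φ y₀) ^ k ≈ q ^ k · φ y₀ ^ k
      split zero    = ≈sym (SR.*-identityˡ 1ˢ)
      split (suc k) = ≈trans (·-congˡ (q · φ y₀) (split k))
        (solve≈ 4 (λ a b c d → a :* b :* (c :* d) := a :* c :* (b :* d)) ≈-refl q (φ y₀) (q ^ k) (φ y₀ ^ k))

    U-y^ev₂ : ∀ i u → i ℕ.+ length u ℕ.≤ 6 → U ((q · φ y₀) ^ suc i · ev₂ u) ≈ 0ˢ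
    U-y^ev₂ i []      l = ≈trans (U-cong (SR.zeroʳ _)) U-0
    U-y^ev₂ i (a ∷ u) l = ≈trans (U-cong (≈trans (SR.distribˡ ((q · φ y₀) ^ suc i) (ev₁ a) _)
        (⊕-cong ≈-refl (solve≈ 3 (λ z y x → z :* (y :* x) := y :* z :* x) ≈-refl
          ((q · φ y₀) ^ suc i) (q · φ y₀) (ev₂ u)))))
      (≈trans (U-⊕ _ _) (≈trans (⊕-cong (U-y^ev₁ i a (ℕP.m+n≤o⇒m≤o (suc i) l′)) (U-y^ev₂ (suc i) u l′))
        (SR.+-identityˡ 0ˢ)))
      where
      l′ : suc i ℕ.+ length u ℕ.≤ 6
      l′ = ≡.subst (ℕ._≤ 6) (ℕP.+-suc i (length u)) l

    U-ev₂ : ∀ u → isMixed u ≡ true → U (ev₂ u) ≈ 0ˢ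
    U-ev₂ []      p = U-0
    U-ev₂ (a ∷ u) p with isZero₁ a in eq
    ... | true = ≈trans (U-cong (≈trans (⊕-cong (isZero₁-correct a eq) (·-congʳ (ev₂ u) (≈sym (SR.*-identityʳ (q · φ y₀)))))
        (SR.+-identityˡ _)))
      (U-y^ev₂ 0 u (ℕP.≤ᵇ⇒≤ (length u) 6 (≡.subst T (≡.sym p) tt)))

    -- The difference of a and b consists of terms in y, ..., y⁶, which U annihilates, while b
    -- without y is φ of its value at r₀, which U undoes.
    U-⟦⟧ : (q · φ y₀) ^ 7 ≈ φ r₀ · (1ˢ ⊕ ⊖ φ r₀) ^ 4 → ∀ a b → YFree b → isMixed (norm (a ⊟ b)) ≡ true →
           U (⟦ a ⟧ (q · φ y₀) (φ r₀)) ≈ ⟦ b ⟧₀ r₀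
    U-⟦⟧ rel a b b-free p = begin
      U ⟦a⟧                        ≈⟨ U-cong (solve≈ 2 (λ a b → a := (a :+ con -1ℤ :* b) :+ b) ≈-refl ⟦a⟧ ⟦b⟧) ⟩
      U (⟦ a ⊟ b ⟧ (q · φ y₀) (φ r₀) ⊕ ⟦b⟧)   ≈⟨ U-⊕ _ _ ⟩
      U (⟦ a ⊟ b ⟧ (q · φ y₀) (φ r₀)) ⊕ U ⟦b⟧ ≈⟨ ⊕-cong (U-cong (≈sym (ev₂-norm rel (a ⊟ b)))) (U-cong (≈sym (φ-⟦⟧ b b-free))) ⟩
      U (ev₂ (norm (a ⊟ b))) ⊕ U (φ (⟦ b ⟧₀ r₀)) ≈⟨ ⊕-cong (U-ev₂ (norm (a ⊟ b)) p) (U-φ (⟦ b ⟧₀ r₀)) ⟩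
      0ˢ ⊕ ⟦ b ⟧₀ r₀               ≈⟨ SR.+-identityˡ _ ⟩
      ⟦ b ⟧₀ r₀                    ∎
      where
      open ≈-Reasoning
      ⟦a⟧ ⟦b⟧ : Series
      ⟦a⟧ = ⟦ a ⟧ (q · φ y₀) (φ r₀)
      ⟦b⟧ = ⟦ b ⟧ (q · φ y₀) (φ r₀)

-- The polynomial identities on which the proof rests.

module Identities where
  open Evaluation
  open import Data.Nat using (ℕ)
  open import Data.Integer as ℤ using (ℤ; +_; 0ℤ; 1ℤ)
  open import Data.List using (List; []; _∷_)
  open import Data.Bool using (true)
  open import Relation.Binary.PropositionalEquality as ≡ using (_≡_)

  -- With D r = 7 ε r (1 - r), logarithmic differentiation of y⁷ = r (1 - r)⁴ forces D y = ε y (1 -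
  -- 5 r).
  open Derivation (Y ∙ (K 1ℤ ⊟ K (+ 5) ∙ R)) (K (+ 7) ∙ R ∙ (K 1ℤ ⊟ R)) public

  k# : ℕ → Expr
  k# k = K (+ k)

  -- f is E / A up to a power of w, where A is the part of E in exponents divisible by 7, and z / f is
  -- ζ = q² E(q⁴⁹) / E; and c, with c² proportional to the weight 2 form W, plays the role of the theta
  -- series of x² + x y + 2 y².
  wᵉ τᵉ nᵉ fᵉ f*ᵉ cᵉ zᵉ : Expr
  wᵉ = k# 1 ⊟ R
  τᵉ = k# 1 ⊟ k# 8 ∙ R ∔ k# 5 ∙ R ^^ 2 ∔ R ^^ 3
  nᵉ = k# 1 ⊟ R ∔ R ^^ 2
  zᵉ = wᵉ ^^ 2 ∙ Y ^^ 2
  fᵉ = wᵉ ^^ 3 ⊟ wᵉ ^^ 3 ∙ Y ⊟ zᵉ ∔ Y ^^ 5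
  cᵉ = wᵉ ^^ 2 ∙ nᵉ ∔ k# 2 ∙ wᵉ ^^ 2 ∙ (k# 1 ∔ k# 2 ∙ R) ∙ Y
     ∔ k# 2 ∙ wᵉ ∙ (k# 2 ⊟ k# 3 ∙ R) ∙ Y ^^ 2 ∔ k# 2 ∙ (k# 3 ⊟ R) ∙ Y ^^ 4

  -- The cofactor of f in its norm from ℤ[r][y] to ℤ[r], up to a power of w.
  f*ᵉ = polyᵉ ((+ 1 ∷ - 3 ∷ + 19 ∷ - 76 ∷ + 141 ∷ - 135 ∷ + 69 ∷ - 18 ∷ + 2 ∷ [])
             ∷ (+ 1 ∷ + 5 ∷ - 39 ∷ + 88 ∷ - 100 ∷ + 66 ∷ - 26 ∷ + 5 ∷ [])
             ∷ (+ 2 ∷ - 2 ∷ - 3 ∷ - 9 ∷ + 36 ∷ - 35 ∷ + 11 ∷ [])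
             ∷ (+ 3 ∷ - 3 ∷ - 15 ∷ + 39 ∷ - 37 ∷ + 14 ∷ - 1 ∷ [])
             ∷ (+ 5 ∷ - 14 ∷ + 24 ∷ - 30 ∷ + 18 ∷ - 3 ∷ [])
             ∷ (+ 7 ∷ - 14 ∷ - 7 ∷ + 21 ∷ - 7 ∷ [])
             ∷ (+ 11 ∷ - 31 ∷ + 26 ∷ - 5 ∷ + 1 ∷ []) ∷ [])
    where
    -_ : ℕ → ℤ
    - n = ℤ.- (+ n)
    poly₁ᵉ : List ℤ → Expr
    poly₁ᵉ []      = K 0ℤ
    poly₁ᵉ (a ∷ u) = K a ∔ R ∙ poly₁ᵉ u
    polyᵉ : List (List ℤ) → Expr
    polyᵉ []      = K 0ℤ
    polyᵉ (a ∷ u) = poly₁ᵉ a ∔ Y ∙ polyᵉ u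

  Identity Constant : Expr → Expr → Set
  Identity a b = isZero₂ (norm (a ⊟ b)) ≡ true
  Constant a b = isMixed (norm (a ⊟ b)) ≡ true

  -- Rationalises division by f: the right side contains no y, hence is φ of a series and passes
  -- through U.
  norm-f : Identity (fᵉ ∙ f*ᵉ) (τᵉ ^^ 2 ∙ wᵉ ^^ 6)
  norm-f = ≡.refl

  -- The numerator of D log ζ: since ζ = z / f, it is ε (∂ z / z - ∂ f / f) = ε ψᵉ / f. The term 2 -
  -- 24 r is 2 (-7 r) + 2 (1 - 5 r), from z = w² y².
  ψᵉ : Expr
  ψᵉ = (k# 2 ⊟ k# 24 ∙ R) ∙ fᵉ ⊟ ∂ fᵉ

  z-derivative : Identity (∂ zᵉ) (zᵉ ∙ (k# 2 ⊟ k# 24 ∙ R))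
  z-derivative = ≡.refl

  -- Divided by the norm of f, this evaluates U of D log ζ, which is twice the weight 2 form `W`.
  ψ-constant : Constant (ψᵉ ∙ f*ᵉ) (k# 2 ∙ nᵉ ^^ 2 ∙ τᵉ ∙ wᵉ ^^ 6)
  ψ-constant = ≡.refl

  -- As W = 4 ψ - 7 φ W, where ψ is ε ψᵉ / f and φ W is ε n² / τ, this says that W is ε c² up to
  -- powers of τ and w.
  c-square : Identity (wᵉ ^^ 4 ∙ (k# 4 ∙ τᵉ ∙ ψᵉ ⊟ k# 7 ∙ nᵉ ^^ 2 ∙ fᵉ)) (fᵉ ∙ cᵉ ^^ 2)
  c-square = ≡.refl

  -- Since φ t = r w / τ, the quadratic 1 + 13 t + 49 t² becomes n³ / τ² under φ: the elliptic
  -- points, its zeros, are totally ramified for the cubic map r (1 - r) / τ.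
  n-cube : Identity (τᵉ ^^ 2 ∔ k# 13 ∙ (R ∙ wᵉ) ∙ τᵉ ∔ k# 49 ∙ (R ∙ wᵉ) ^^ 2) (nᵉ ^^ 3)
  n-cube = ≡.refl

  -- The counterpart of `n-cube` for t itself instead of φ t, with t f⁴ = y τ w¹¹ and c in place of
  -- n.
  c-cube : Identity (fᵉ ^^ 8 ∔ k# 13 ∙ (Y ∙ τᵉ ∙ wᵉ ^^ 11) ∙ fᵉ ^^ 4 ∔ k# 49 ∙ (Y ∙ τᵉ ∙ wᵉ ^^ 11) ^^ 2)
                    (fᵉ ∙ cᵉ ^^ 3 ∙ wᵉ ^^ 14)
  c-cube = ≡.refl

  -- The companion formula for E₄(q⁷): it amounts to φ (ω (1 + 245 t + 2401 t²)) = ω (1 + 5 t + t²).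
  E₄-level-7 : Identity
    (nᵉ ∙ (τᵉ ^^ 2 ∔ k# 245 ∙ (R ∙ wᵉ) ∙ τᵉ ∔ k# 2401 ∙ (R ∙ wᵉ) ^^ 2) ∙ fᵉ ∙ wᵉ ^^ 22)
    (cᵉ ∙ (fᵉ ^^ 8 ∔ k# 5 ∙ (Y ∙ τᵉ ∙ wᵉ ^^ 11) ∙ fᵉ ^^ 4 ∔ (Y ∙ τᵉ ∙ wᵉ ^^ 11) ^^ 2))
  E₄-level-7 = ≡.refl

  -- Watson's expression for ζ⁷ with ζ = z / f and φ t = r w / τ substituted, multiplied by τ² f⁷.
  modularᵉ : Expr
  modularᵉ = R ∙ wᵉ ∙ τᵉ ∙ (k# 7 ∙ zᵉ ^^ 4 ∙ fᵉ ^^ 3 ∔ k# 35 ∙ zᵉ ^^ 5 ∙ fᵉ ^^ 2 ∔ k# 49 ∙ zᵉ ^^ 6 ∙ fᵉ)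
    ∔ (R ∙ wᵉ) ^^ 2 ∙ (fᵉ ^^ 7 ∔ k# 7 ∙ zᵉ ∙ fᵉ ^^ 6 ∔ k# 21 ∙ zᵉ ^^ 2 ∙ fᵉ ^^ 5 ∔ k# 49 ∙ zᵉ ^^ 3 ∙ fᵉ ^^ 4
                      ∔ k# 147 ∙ zᵉ ^^ 4 ∙ fᵉ ^^ 3 ∔ k# 343 ∙ zᵉ ^^ 5 ∙ fᵉ ^^ 2 ∔ k# 343 ∙ zᵉ ^^ 6 ∙ fᵉ)

  modular-equation : Identity (zᵉ ^^ 7 ∙ τᵉ ^^ 2) modularᵉ
  modular-equation = ≡.refl

-- Euler's pentagonal number theorem.

module Pentagonal where
  open SeriesRing
  open Operators
  open import Data.Nat as ℕ using (ℕ; zero; suc; _≤_; _<_; z≤n; s≤s)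
  import Data.Nat.Properties as ℕP
  open import Data.Nat.Solver using (module +-*-Solver)
  open import Data.Integer as ℤ using (ℤ; +_; 0ℤ; 1ℤ)
  open import Data.Bool using (if_then_else_)
  open import Relation.Binary.PropositionalEquality as ≡ using (_≡_; cong; cong₂; subst)

  open Solver using (_:+_; _:*_; _:-_; :-_; con; _:=_) renaming (solve to solve≈)

  private
    variable
      f g h f′ g′ : Series
      N : ℕ

  -- Congruence modulo q^(N+1).
  infix 4 _≈[_]_
  record _≈[_]_ (f : Series) (N : ℕ) (g : Series) : Set where
    constructor mk
    field below : ∀ n → n ≤ N → f n ≡ g n
  open _≈[_]_

  ≈⇒≈[] : f ≈ g → f ≈[ N ] g
  ≈⇒≈[] p = mk λ n _ → at p n

  ≈[]⇒≈ : (∀ N → f ≈[ N ] g) → f ≈ g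
  ≈[]⇒≈ p = mk λ n → below (p n) n ℕP.≤-refl

  ≈[]-sym : f ≈[ N ] g → g ≈[ N ] f
  ≈[]-sym p = mk λ n l → ≡.sym (below p n l)

  ≈[]-trans : f ≈[ N ] g → g ≈[ N ] h → f ≈[ N ] h
  ≈[]-trans p s = mk λ n l → ≡.trans (below p n l) (below s n l)

  ≈[]-weaken : ∀ {M N} → M ≤ N → f ≈[ N ] g → f ≈[ M ] g
  ≈[]-weaken M≤N p = mk λ n l → below p n (ℕP.≤-trans l M≤N)

  opaque
    unfolding _·_ φ

    ·-cong-below : ∀ n → (∀ i → i ≤ n → f i ≡ f′ i) → (∀ i → i ≤ n → g i ≡ g′ i) → (f · g) n ≡ (f′ · g′) n
    ·-cong-below zero    p s = cong₂ ℤ._*_ (p 0 z≤n) (s 0 z≤n)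
    ·-cong-below (suc n) p s = cong₂ ℤ._+_ (cong₂ ℤ._*_ (p 0 z≤n) (s (suc n) ℕP.≤-refl))
      (·-cong-below n (λ i l → p (suc i) (s≤s l)) (λ i l → s i (ℕP.m≤n⇒m≤1+n l)))

    ·-cong[] : f ≈[ N ] f′ → g ≈[ N ] g′ → f · g ≈[ N ] f′ · g′
    ·-cong[] p s = mk λ n l →
      ·-cong-below n (λ i k → below p i (ℕP.≤-trans k l)) (λ i k → below s i (ℕP.≤-trans k l))

    ⊕-cong[] : f ≈[ N ] f′ → g ≈[ N ] g′ → f ⊕ g ≈[ N ] f′ ⊕ g′
    ⊕-cong[] p s = mk λ n l → cong₂ ℤ._+_ (below p n l) (below s n l)

    D-cong[] : f ≈[ N ] g → D f ≈[ N ] D g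
    D-cong[] p = mk λ n l → cong (+ n ℤ.*_) (below p n l)

    φ-cong-below : ∀ n → (∀ i → i ≤ n → f i ≡ g i) → φ f n ≡ φ g n
    φ-cong-below 0 p = p 0 z≤n
    φ-cong-below 1 p = ≡.refl
    φ-cong-below 2 p = ≡.refl
    φ-cong-below 3 p = ≡.refl
    φ-cong-below 4 p = ≡.refl
    φ-cong-below 5 p = ≡.refl
    φ-cong-below 6 p = ≡.refl
    φ-cong-below (suc (suc (suc (suc (suc (suc (suc n))))))) p = φ-cong-below n
      (λ i l → p (suc i) (ℕP.≤-trans (s≤s l) (ℕP.m≤n+m (suc n) 6)))

    φ-cong[] : f ≈[ N ] g → φ f ≈[ N ] φ g
    φ-cong[] p = mk λ n l → φ-cong-below n (λ i k → below p i (ℕP.≤-trans k l))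

    U-cong[] : f ≈[ N ℕ.* 7 ] g → U f ≈[ N ] U g
    U-cong[] p = mk λ n l → below p (n ℕ.* 7) (ℕP.*-monoˡ-≤ 7 l)

    q^·-high : ∀ k f → N < k → q ^ k · f ≈[ N ] 0ˢ
    q^·-high k f N<k = mk λ n l → q^·-low k f n (ℕP.≤-<-trans l N<k)

    q^·-cong[] : ∀ k → f ≈[ N ] g → q ^ k · f ≈[ k ℕ.+ N ] q ^ k · g
    q^·-cong[] {f} {N} {g} zero    p = ≈[]-trans (≈⇒≈[] (SR.*-identityˡ f)) (≈[]-trans p (≈⇒≈[] (≈sym (SR.*-identityˡ g))))
    q^·-cong[] {f} {N} {g} (suc k) p = ≈[]-trans (≈⇒≈[] (SR.*-assoc q (q ^ k) f))
      (≈[]-trans (mk λ { zero _ → ≡.refl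
                       ; (suc n) (s≤s l) → ≡.trans (q·-suc (q ^ k · f) n)
                           (≡.trans (below (q^·-cong[] k p) n l) (≡.sym (q·-suc (q ^ k · g) n))) })
                 (≈⇒≈[] (≈sym (SR.*-assoc q (q ^ k) g))))

    oneMinusQ^-≈ : ∀ m → oneMinusQ^ (suc m) ≈ 1ˢ ⊕ ⊖ q ^ suc m
    oneMinusQ^-≈ m = mk λ
      { zero    → ≡.refl
      ; (suc j) → cong (λ x → 0ℤ ℤ.+ ℤ.- x) (≡.sym (≡.trans (q·-suc (q ^ m) j) (lemma m j))) }
      where
      lemma : ∀ m j → (q ^ m) j ≡ (if j ℕ.≡ᵇ m then 1ℤ else 0ℤ)
      lemma zero    zero    = ≡.refl
      lemma zero    (suc j) = ≡.refl
      lemma (suc m) zero    = ≡.refl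
      lemma (suc m) (suc j) = ≡.trans (q·-suc (q ^ m) j) (lemma m j)

    eulerTrunc-0 : eulerTrunc 0 ≈ 1ˢ
    eulerTrunc-0 = mk λ { zero → ≡.refl ; (suc _) → ≡.refl }

    q^-0 : ∀ m → (q ^ suc m) 0 ≡ 0ℤ
    q^-0 m = ≡.refl

    ⊕-0 : ∀ f g → (f ⊕ g) 0 ≡ f 0 ℤ.+ g 0
    ⊕-0 f g = ≡.refl

    ·-0 : ∀ f g → (f · g) 0 ≡ f 0 ℤ.* g 0
    ·-0 f g = ≡.refl

    ⊖-0 : ∀ f → (⊖ f) 0 ≡ ℤ.- f 0
    ⊖-0 f = ≡.refl

    ι-at-0 : ∀ c → ι c 0 ≡ c
    ι-at-0 c = ≡.refl

    φ-at-0 : ∀ f → φ f 0 ≡ f 0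
    φ-at-0 f = ≡.refl

    inv-at-0 : ∀ f → inv f 0 ≡ 1ℤ
    inv-at-0 f = ≡.refl

  1-q^ : ℕ → Series
  1-q^ m = 1ˢ ⊕ ⊖ q ^ m

  P : ℕ → Series
  P = eulerTrunc

  P-suc : ∀ n → P (suc n) ≈ P n · 1-q^ (suc n)
  P-suc n = ≈trans (⊛-· (P n) (oneMinusQ^ (suc n))) (·-congˡ (P n) (oneMinusQ^-≈ n))

  1-q^-at-0 : ∀ n → 1-q^ (suc n) 0 ≡ 1ℤ
  1-q^-at-0 n = ≡.trans (⊕-0 _ _) (≡.trans (cong₂ ℤ._+_ (ι-at-0 1ℤ) (≡.trans (⊖-0 _) (cong ℤ.-_ (q^-0 n)))) ≡.refl)

  P-at-0 : ∀ n → P n 0 ≡ 1ℤ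
  P-at-0 zero    = ≡.refl
  P-at-0 (suc n) = ≡.trans (at (P-suc n) 0) (≡.trans (·-0 _ _) (cong₂ ℤ._*_ (P-at-0 n) (1-q^-at-0 n)))

  iP : ℕ → Series
  iP n = inv (P n)

  P-iP : ∀ n → P n · iP n ≈ 1ˢ
  P-iP n = inv-right (P n) (P-at-0 n)

  iP-suc : ∀ n → iP n ≈ 1-q^ (suc n) · iP (suc n)
  iP-suc n = unit-regular (P n) (P-at-0 n) (≈trans (P-iP n) (≈trans (≈sym (P-iP (suc n)))
    (≈trans (·-congʳ (iP (suc n)) (P-suc n)) (SR.*-assoc (P n) (1-q^ (suc n)) (iP (suc n))))))

  P-stable-suc : ∀ n → P (suc n) ≈[ n ] P n
  P-stable-suc n = ≈[]-trans (≈⇒≈[] (≈trans (P-suc n)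
      (solve≈ 2 (λ p s → p :* (con 1ℤ :- s) := p :+ s :* (:- p)) ≈-refl (P n) (q ^ suc n))))
    (≈[]-trans (⊕-cong[] (≈⇒≈[] ≈-refl) (q^·-high (suc n) (⊖ P n) ℕP.≤-refl)) (≈⇒≈[] (SR.+-identityʳ (P n))))

  P-stable : ∀ d n → P (d ℕ.+ n) ≈[ n ] P n
  P-stable zero    n = ≈⇒≈[] ≈-refl
  P-stable (suc d) n = ≈[]-trans (≈[]-weaken (ℕP.m≤n+m n d) (P-stable-suc (d ℕ.+ n))) (P-stable d n)

  E : Series
  E = qPochInf

  E-P : ∀ N → E ≈[ N ] P N
  E-P N = mk λ n l → subst (λ M → P n n ≡ P M n) (ℕP.m∸n+n≡m l)
    (≡.sym (below (P-stable (N ℕ.∸ n) n) n ℕP.≤-refl))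

  tri : ℕ → ℕ
  tri zero    = 0
  tri (suc n) = suc n ℕ.+ tri n

  n≤tri : ∀ n → n ≤ tri n
  n≤tri zero    = z≤n
  n≤tri (suc n) = ℕP.m≤m+n (suc n) (tri n)

  sgn : ℕ → Series
  sgn n = (⊖ 1ˢ) ^ n

  q^-+ : ∀ a b → q ^ (a ℕ.+ b) ≈ q ^ a · q ^ b
  q^-+ zero    b = ≈sym (SR.*-identityˡ (q ^ b))
  q^-+ (suc a) b = ≈trans (·-congˡ q (q^-+ a b)) (≈sym (SR.*-assoc q (q ^ a) (q ^ b)))

  q^-≡ : ∀ {a b} → a ≡ b → q ^ a ≈ q ^ b
  q^-≡ ≡.refl = ≈-refl

  -- With s = n + 1 the exponents s² + s (s - 1) / 2 and s² + s (s + 1) / 2 are the pentagonal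
  -- numbers s (3 s ∓ 1) / 2.
  pent : ℕ → Series
  pent zero    = 1ˢ
  pent (suc n) = pent n ⊕ sgn (suc n) · (q ^ (suc n ℕ.* suc n ℕ.+ tri n) ⊕ q ^ (suc n ℕ.* suc n ℕ.+ tri (suc n)))

  -- Shanks' finite form of the pentagonal number theorem: the sum over s ≤ n of
  -- (-1)^s (P n / P s) q^(s n + s (s + 1) / 2) equals the n-th partial sum.
  shanksTerm : ℕ → ℕ → Series
  shanksTerm n s = sgn s · P n · iP s · q ^ (s ℕ.* n ℕ.+ tri s)

  shanksSum : ℕ → ℕ → Series
  shanksSum n zero    = shanksTerm n 0
  shanksSum n (suc m) = shanksSum n m ⊕ shanksTerm n (suc m)

  shanksRemainder : ℕ → ℕ → Series
  shanksRemainder n s = sgn s · P n · iP s · q ^ (suc s ℕ.* suc n ℕ.+ tri s)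

  -- Because (1 - q^s) / P s = 1 / P (s - 1), replacing n by n + 1 in term s produces exactly what
  -- carries the remainder from s - 1 to s.
  shanks-telescope : ∀ n m → shanksSum (suc n) m ⊕ shanksRemainder n m ≈ shanksSum n m
  shanks-telescope n zero = ≈trans
    (⊕-cong (·-congʳ _ (·-congʳ (iP 0) (·-congˡ 1ˢ (P-suc n)))) (·-congˡ _ (q^-≡ {1 ℕ.* suc n ℕ.+ 0} {suc n} (≡.trans (ℕP.+-identityʳ (suc n ℕ.+ 0)) (ℕP.+-identityʳ (suc n))))))
    (solve≈ 3 (λ p i x → con 1ℤ :* (p :* (con 1ℤ :- x)) :* i :* con 1ℤ :+ con 1ℤ :* p :* i :* x
                       := con 1ℤ :* p :* i :* con 1ℤ) ≈-refl (P n) (iP 0) (q ^ suc n))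
  shanks-telescope n (suc m) = begin
    (S ⊕ shanksTerm (suc n) s) ⊕ shanksRemainder n s
      ≈⟨ ⊕-cong (⊕-cong ≈-refl (·-cong (·-congʳ (iP s) (·-congˡ (sgn s) (P-suc n))) e₁)) (·-congˡ _ e₂) ⟩
    (S ⊕ sgn s · (P n · 1-q^ (suc n)) · iP s · (q ^ s · A)) ⊕ sgn s · P n · iP s · (q ^ s · A · q ^ suc n)
      ≈⟨ solve≈ 7 (λ S g p i u a x →
           (S :+ (:- con 1ℤ :* g) :* (p :* (con 1ℤ :- x)) :* i :* (u :* a)) :+ (:- con 1ℤ :* g) :* p :* i :* (u :* a :* x)
           := S :+ g :* p :* ((con 1ℤ :- u) :* i) :* a :+ (:- con 1ℤ :* g) :* p :* i :* a) ≈-refl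
           S (sgn m) (P n) (iP s) (q ^ s) A (q ^ suc n) ⟩
    S ⊕ sgn m · P n · (1-q^ s · iP s) · A ⊕ sgn s · P n · iP s · A
      ≈⟨ ⊕-cong (⊕-cong ≈-refl (·-cong (·-congˡ _ (≈sym (iP-suc m))) (q^-≡ e₃))) ≈-refl ⟩
    S ⊕ shanksRemainder n m ⊕ shanksTerm n s
      ≈⟨ ⊕-cong (shanks-telescope n m) ≈-refl ⟩
    shanksSum n m ⊕ shanksTerm n s ∎
    where
    open ≈-Reasoning
    s : ℕ
    s = suc m
    S A : Series
    S = shanksSum (suc n) m
    A = q ^ (s ℕ.* n ℕ.+ tri s)
    module N = +-*-Solver
    e₁ : q ^ (s ℕ.* suc n ℕ.+ tri s) ≈ q ^ s · A
    e₁ = ≈trans (q^-≡ (N.solve 3 (λ s n t → s N.:* (N.con 1 N.:+ n) N.:+ t N.:= s N.:+ (s N.:* n N.:+ t)) ≡.refl s n (tri s)))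
      (q^-+ s _)
    e₂ : q ^ (suc s ℕ.* suc n ℕ.+ tri s) ≈ q ^ s · A · q ^ suc n
    e₂ = ≈trans (q^-≡ (N.solve 3 (λ s n t → (N.con 1 N.:+ s) N.:* (N.con 1 N.:+ n) N.:+ t
           N.:= (s N.:+ (s N.:* n N.:+ t)) N.:+ (N.con 1 N.:+ n)) ≡.refl s n (tri s)))
      (≈trans (q^-+ (s ℕ.+ (s ℕ.* n ℕ.+ tri s)) (suc n)) (·-congʳ _ (q^-+ s _)))
    e₃ : s ℕ.* n ℕ.+ tri s ≡ s ℕ.* suc n ℕ.+ tri m
    e₃ = N.solve 3 (λ m n t → (N.con 1 N.:+ m) N.:* n N.:+ (N.con 1 N.:+ m N.:+ t)
           N.:= (N.con 1 N.:+ m) N.:* (N.con 1 N.:+ n) N.:+ t) ≡.refl m n (tri m)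

  shanks : ∀ n → shanksSum n n ≈ pent n
  shanks zero    = ≈trans (solve≈ 2 (λ p i → con 1ℤ :* p :* i :* con 1ℤ := p :* i) ≈-refl (P 0) (iP 0)) (P-iP 0)
  shanks (suc n) = begin
    shanksSum (suc n) n ⊕ shanksTerm (suc n) (suc n)
      ≈⟨ ⊕-cong ≈-refl (·-congʳ _ (≈trans (SR.*-assoc (sgn (suc n)) _ _) (·-congˡ _ (P-iP (suc n))))) ⟩
    shanksSum (suc n) n ⊕ sgn (suc n) · 1ˢ · B
      ≈⟨ solve≈ 4 (λ S g A B → S :+ (:- con 1ℤ :* g) :* con 1ℤ :* B := (S :+ g :* con 1ℤ :* A) :+ (:- con 1ℤ :* g) :* (A :+ B)) ≈-refl
           (shanksSum (suc n) n) (sgn n) A B ⟩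
    (shanksSum (suc n) n ⊕ sgn n · 1ˢ · A) ⊕ sgn (suc n) · (A ⊕ B)
      ≈⟨ ⊕-cong (⊕-cong ≈-refl (·-congʳ A (≈trans (·-congˡ (sgn n) (≈sym (P-iP n))) (≈sym (SR.*-assoc (sgn n) _ _))))) ≈-refl ⟩
    (shanksSum (suc n) n ⊕ shanksRemainder n n) ⊕ sgn (suc n) · (A ⊕ B)
      ≈⟨ ⊕-cong (≈trans (shanks-telescope n n) (shanks n)) ≈-refl ⟩
    pent (suc n) ∎
    where
    open ≈-Reasoning
    A B : Series
    A = q ^ (suc n ℕ.* suc n ℕ.+ tri n)
    B = q ^ (suc n ℕ.* suc n ℕ.+ tri (suc n))

  -- For s ≥ 1 the exponent s n + s (s + 1) / 2 exceeds n, so only the term s = 0 is visible.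
  shanksSum-leading : ∀ n m → shanksSum n m ≈[ n ] P n
  shanksSum-leading n zero    = ≈⇒≈[] (≈trans (·-congʳ _ (·-congˡ _ iP0))
    (solve≈ 1 (λ p → con 1ℤ :* p :* con 1ℤ :* con 1ℤ := p) ≈-refl (P n)))
    where
    iP0 : iP 0 ≈ 1ˢ
    iP0 = ≈trans (≈sym (SR.*-identityˡ (iP 0))) (≈trans (·-congʳ (iP 0) (≈sym eulerTrunc-0)) (P-iP 0))
  shanksSum-leading n (suc m) = ≈[]-trans (⊕-cong[] (shanksSum-leading n m)
      (≈[]-trans (≈⇒≈[] (SR.*-comm _ _)) (q^·-high _ (sgn (suc m) · P n · iP (suc m)) large)))
    (≈⇒≈[] (SR.+-identityʳ (P n)))
    where
    large : n < suc m ℕ.* n ℕ.+ tri (suc m)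
    large = ℕP.≤-trans (ℕP.≤-reflexive (ℕP.+-comm 1 n)) (ℕP.+-mono-≤ (ℕP.m≤m+n n (m ℕ.* n)) (s≤s z≤n))

  pentagonal : ∀ n → E ≈[ n ] pent n
  pentagonal n = ≈[]-trans (E-P n) (≈[]-trans (≈[]-sym (shanksSum-leading n n)) (≈⇒≈[] (shanks n)))

-- A finite form of Jacobi's triple product.

module TripleProduct where
  open SeriesRing
  open Operators
  open Pentagonal
  open import Data.Nat as ℕ using (ℕ; zero; suc; _<_; s≤s)
  import Data.Nat.Properties as ℕP
  open import Data.Nat.Solver using (module +-*-Solver)
  open import Data.Integer using (+_; 0ℤ; 1ℤ)
  open import Relation.Binary.PropositionalEquality as ≡ using (_≡_; cong)

  open Solver using (_:+_; _:*_; _:-_; :-_; _:^_; con; _:=_) renaming (solve to solve≈)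
  private module N = +-*-Solver

  odd : ℕ → Series
  odd zero    = 1ˢ
  odd (suc k) = odd k ⊕ ι (+ 2)

  -- The coefficient of z^k in ∏_{j=1}^{n} (1 - z q^j) ∏_{j=0}^{n} (1 - z⁻¹ q^j), for k ≥ 0;
  -- it changes sign under k ↦ -1 - k.
  tripleCoeff : ℕ → ℕ → Series
  tripleCoeff zero    zero    = 1ˢ
  tripleCoeff zero    (suc k) = 0ˢ
  tripleCoeff (suc n) zero    =
    (1ˢ ⊕ q ^ suc n ⊕ q ^ suc n · q ^ suc n) · tripleCoeff n 0 ⊕ ⊖ (q ^ suc n · tripleCoeff n 1)
  tripleCoeff (suc n) (suc k) =
    (1ˢ ⊕ q ^ suc n · q ^ suc n) · tripleCoeff n (suc k)
    ⊕ ⊖ (q ^ suc n · (tripleCoeff n k ⊕ tripleCoeff n (suc (suc k))))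

  tripleCoeff-vanishes : ∀ n k → n < k → tripleCoeff n k ≈ 0ˢ
  tripleCoeff-vanishes zero    (suc k) _         = ≈-refl
  tripleCoeff-vanishes (suc n) (suc k) (s≤s n<k) = ≈trans
    (⊕-cong (·-congˡ _ (tripleCoeff-vanishes n (suc k) (ℕP.m<n⇒m<1+n n<k)))
      (⊖-cong (·-congˡ _ (⊕-cong (tripleCoeff-vanishes n k n<k)
        (tripleCoeff-vanishes n (suc (suc k)) (ℕP.m<n⇒m<1+n (ℕP.m<n⇒m<1+n n<k)))))))
    (≈trans (⊕-cong (·-congˡ _ (≈sym ι-0)) (⊖-cong (·-congˡ _ (⊕-cong (≈sym ι-0) (≈sym ι-0)))))
    (≈trans (solve≈ 2 (λ a b → a :* con 0ℤ :- (b :* (con 0ℤ :+ con 0ℤ)) := con 0ℤ) ≈-refl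
      (1ˢ ⊕ q ^ suc n · q ^ suc n) (q ^ suc n)) ι-0))

  -- z d/dz of the product at z = 1: the antisymmetry c(-1-k) = -c(k) folds the sum of k c(k) into
  -- that of (2 k + 1) c(k) over k ≥ 0. As 1 - z⁻¹ is a factor of the product, the value is the rest
  -- of it at z = 1, the square of P n.
  weightedSum : ℕ → ℕ → Series
  weightedSum n zero    = odd 0 · tripleCoeff n 0
  weightedSum n (suc m) = weightedSum n m ⊕ odd (suc m) · tripleCoeff n (suc m)

  -- Stands in for differentiation, so that no variable z is needed: the step to n + 1 multiplies by
  -- (1 - q^(n+1))², up to boundary terms that vanish once m > n.
  weightedSum-step : ∀ n m → weightedSum (suc n) m ≈
    1-q^ (suc n) ^ 2 · weightedSum n m
    ⊕ q ^ suc n · (odd (suc m) · tripleCoeff n m ⊕ ⊖ (odd m · tripleCoeff n (suc m)))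
  weightedSum-step n zero = solve≈ 3 (λ x a b →
    con 1ℤ :* ((con 1ℤ :+ x :+ x :* x) :* a :- (x :* b)) :=
    (con 1ℤ :- x) :^ 2 :* (con 1ℤ :* a) :+ x :* ((con 1ℤ :+ con (+ 2)) :* a :- (con 1ℤ :* b))) ≈-refl
    (q ^ suc n) (tripleCoeff n 0) (tripleCoeff n 1)
  weightedSum-step n (suc m) = ≈trans (⊕-cong (weightedSum-step n m) ≈-refl)
    (solve≈ 6 (λ x w o a b c →
      ((con 1ℤ :- x) :^ 2 :* w :+ x :* ((o :+ con (+ 2)) :* a :- (o :* b)))
        :+ (o :+ con (+ 2)) :* ((con 1ℤ :+ x :* x) :* b :- (x :* (a :+ c)))
      := (con 1ℤ :- x) :^ 2 :* (w :+ (o :+ con (+ 2)) :* b)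
        :+ x :* ((o :+ con (+ 2) :+ con (+ 2)) :* b :- ((o :+ con (+ 2)) :* c))) ≈-refl
      (q ^ suc n) (weightedSum n m) (odd m) (tripleCoeff n m) (tripleCoeff n (suc m)) (tripleCoeff n (suc (suc m))))

  weightedSum-square : ∀ n → weightedSum n n ≈ P n ^ 2
  weightedSum-square zero = ≈trans (solve≈ 0 (con 1ℤ :* con 1ℤ := con 1ℤ :^ 2) ≈-refl) (^-congˡ 2 (≈sym eulerTrunc-0))
  weightedSum-square (suc n) = begin
    weightedSum (suc n) (suc n)
      ≈⟨ weightedSum-step n (suc n) ⟩
    1-q^ (suc n) ^ 2 · (weightedSum n n ⊕ odd (suc n) · tripleCoeff n (suc n))
      ⊕ q ^ suc n · (odd (suc (suc n)) · tripleCoeff n (suc n) ⊕ ⊖ (odd (suc n) · tripleCoeff n (suc (suc n))))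
      ≈⟨ ⊕-cong (·-congˡ _ (⊕-cong (weightedSum-square n) (·-congˡ _ z₁)))
                (·-congˡ _ (⊕-cong (·-congˡ _ z₁) (⊖-cong (·-congˡ _ z₂)))) ⟩
    1-q^ (suc n) ^ 2 · (P n ^ 2 ⊕ odd (suc n) · ι 0ℤ)
      ⊕ q ^ suc n · (odd (suc (suc n)) · ι 0ℤ ⊕ ⊖ (odd (suc n) · ι 0ℤ))
      ≈⟨ solve≈ 5 (λ u p a b x → u :^ 2 :* (p :^ 2 :+ a :* con 0ℤ) :+ x :* (b :* con 0ℤ :- (a :* con 0ℤ)) := (p :* u) :^ 2) ≈-refl
           (1-q^ (suc n)) (P n) (odd (suc n)) (odd (suc (suc n))) (q ^ suc n) ⟩
    (P n · 1-q^ (suc n)) ^ 2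
      ≈⟨ ^-congˡ 2 (≈sym (P-suc n)) ⟩
    P (suc n) ^ 2 ∎
    where
    open ≈-Reasoning
    z₁ : tripleCoeff n (suc n) ≈ ι 0ℤ
    z₁ = ≈trans (tripleCoeff-vanishes n (suc n) ℕP.≤-refl) (≈sym ι-0)
    z₂ : tripleCoeff n (suc (suc n)) ≈ ι 0ℤ
    z₂ = ≈trans (tripleCoeff-vanishes n (suc (suc n)) (ℕP.n≤1+n _)) (≈sym ι-0)

  P-≡ : ∀ {a b} → a ≡ b → P a ≈ P b
  P-≡ ≡.refl = ≈-refl

  -- The coefficient is (-1)^k q^(k (k + 1) / 2) times the q-binomial coefficient of 2 n + 1 over n
  -- - k; its denominators are multiplied out.
  ClosedForm : ℕ → Set
  ClosedForm n = ∀ k d → k ℕ.+ d ≡ n →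
    tripleCoeff n k · (P d · P (suc (k ℕ.+ k ℕ.+ d))) ≈ sgn k · q ^ tri k · P (suc (n ℕ.+ n))

  module Step (n : ℕ) (closed : ClosedForm n) where

    M : Series
    M = P (suc (n ℕ.+ n))

    -- The neighbour k + 1 over the denominators that belong to k. The factor 1 - q^d is 0 at d = 0,
    -- which covers the edge k = n where the neighbour vanishes.
    next : ∀ k d → k ℕ.+ d ≡ n →
      tripleCoeff n (suc k) · (P d · P (suc (suc (k ℕ.+ k ℕ.+ d)))) ≈
      1-q^ d · (sgn (suc k) · (q ^ tri k · q · q ^ k)) · M
    next k zero e = ≈trans (·-congʳ _ (≈trans (tripleCoeff-vanishes n (suc k)
        (s≤s (ℕP.≤-reflexive (≡.trans (≡.sym e) (ℕP.+-identityʳ k))))) (≈sym ι-0)))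
      (solve≈ 3 (λ a b c → con 0ℤ :* a := (con 1ℤ :- con 1ℤ) :* b :* c) ≈-refl _ _ M)
    next k (suc d) e = begin
      tripleCoeff n (suc k) · (P (suc d) · P (suc (suc (k ℕ.+ k ℕ.+ suc d))))
        ≈⟨ ·-congˡ _ (·-cong (P-suc d) (P-≡ (cong suc (N.solve 2 (λ k d → N.con 1 N.:+ (k N.:+ k N.:+ (N.con 1 N.:+ d))
              N.:= (N.con 1 N.:+ k) N.:+ (N.con 1 N.:+ k) N.:+ d) ≡.refl k d)))) ⟩
      tripleCoeff n (suc k) · (P d · 1-q^ (suc d) · P (suc (suc k ℕ.+ suc k ℕ.+ d)))
        ≈⟨ solve≈ 4 (λ t p u r → t :* (p :* u :* r) := u :* (t :* (p :* r))) ≈-refl _ (P d) (1-q^ (suc d)) _ ⟩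
      1-q^ (suc d) · (tripleCoeff n (suc k) · (P d · P (suc (suc k ℕ.+ suc k ℕ.+ d))))
        ≈⟨ ·-congˡ _ (closed (suc k) d (≡.trans (≡.sym (ℕP.+-suc k d)) e)) ⟩
      1-q^ (suc d) · (sgn (suc k) · q ^ tri (suc k) · M)
        ≈⟨ ·-congˡ _ (·-congʳ M (·-congˡ _ (q^-+ (suc k) (tri k)))) ⟩
      1-q^ (suc d) · (sgn (suc k) · (q · q ^ k · q ^ tri k) · M)
        ≈⟨ solve≈ 6 (λ u s q b t m → u :* (s :* (q :* b :* t) :* m) := u :* (s :* (t :* q :* b)) :* m) ≈-refl
             (1-q^ (suc d)) (sgn (suc k)) q (q ^ k) (q ^ tri k) M ⟩
      1-q^ (suc d) · (sgn (suc k) · (q ^ tri k · q · q ^ k)) · M ∎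
      where open ≈-Reasoning

    -- The second factor is q (1 - q^(d-1)), written so that no subtraction in the exponent is
    -- needed and d = 0 is included.
    nextButOne : ∀ k d → k ℕ.+ d ≡ n →
      tripleCoeff n (suc (suc k)) · (P d · P (suc (suc (suc (k ℕ.+ k ℕ.+ d))))) ≈
      1-q^ d · (q ⊕ ⊖ q ^ d) · (sgn k · (q ^ tri k · q ^ 2 · q ^ k · q ^ k)) · M
    nextButOne k zero e = ≈trans (·-congʳ _ (≈trans (tripleCoeff-vanishes n (suc (suc k))
        (s≤s (ℕP.m≤n⇒m≤1+n (ℕP.≤-reflexive (≡.trans (≡.sym e) (ℕP.+-identityʳ k)))))) (≈sym ι-0)))
      (solve≈ 4 (λ a b c d → con 0ℤ :* a := (con 1ℤ :- con 1ℤ) :* b :* c :* d) ≈-refl _ _ _ M)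
    nextButOne k (suc d) e = begin
      tripleCoeff n (suc (suc k)) · (P (suc d) · P (suc (suc (suc (k ℕ.+ k ℕ.+ suc d)))))
        ≈⟨ ·-congˡ _ (·-cong (P-suc d) (P-≡ (cong (λ x → suc (suc x))
             (N.solve 2 (λ k d → N.con 1 N.:+ (k N.:+ k N.:+ (N.con 1 N.:+ d))
              N.:= (N.con 1 N.:+ k) N.:+ (N.con 1 N.:+ k) N.:+ d) ≡.refl k d)))) ⟩
      tripleCoeff n (suc (suc k)) · (P d · 1-q^ (suc d) · P (suc (suc (suc k ℕ.+ suc k ℕ.+ d))))
        ≈⟨ solve≈ 4 (λ t p u r → t :* (p :* u :* r) := u :* (t :* (p :* r))) ≈-refl _ (P d) (1-q^ (suc d)) _ ⟩
      1-q^ (suc d) · (tripleCoeff n (suc (suc k)) · (P d · P (suc (suc (suc k ℕ.+ suc k ℕ.+ d)))))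
        ≈⟨ ·-congˡ _ (next (suc k) d (≡.trans (≡.sym (ℕP.+-suc k d)) e)) ⟩
      1-q^ (suc d) · (1-q^ d · (sgn (suc (suc k)) · (q ^ tri (suc k) · q · q ^ suc k)) · M)
        ≈⟨ ·-congˡ _ (·-congʳ M (·-congˡ _ (·-congˡ _ (·-congʳ _ (·-congʳ q (q^-+ (suc k) (tri k))))))) ⟩
      1-q^ (suc d) · (1-q^ d · (sgn (suc (suc k)) · (q · q ^ k · q ^ tri k · q · q ^ suc k)) · M)
        ≈⟨ solve≈ 6 (λ q a s b t m →
             (con 1ℤ :- (q :* a)) :* ((con 1ℤ :- a) :* ((:- con 1ℤ :* (:- con 1ℤ :* s)) :* (q :* b :* t :* q :* (q :* b))) :* m)
             := (con 1ℤ :- (q :* a)) :* (q :- (q :* a)) :* (s :* (t :* q :^ 2 :* b :* b)) :* m) ≈-refl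
             q (q ^ d) (sgn k) (q ^ k) (q ^ tri k) M ⟩
      1-q^ (suc d) · (q ⊕ ⊖ q ^ suc d) · (sgn k · (q ^ tri k · q ^ 2 · q ^ k · q ^ k)) · M ∎
      where open ≈-Reasoning

    top : ∀ m → m ≡ n ℕ.+ n → P (suc (suc (suc m))) ≈ M · (1ˢ ⊕ ⊖ (q · q · (q ^ n · q ^ n))) · (1ˢ ⊕ ⊖ (q · q · q · (q ^ n · q ^ n)))
    top _ ≡.refl = ≈trans (P-suc (suc (suc (n ℕ.+ n)))) (·-cong
      (≈trans (P-suc (suc (n ℕ.+ n))) (·-congˡ M (⊕-cong ≈-refl (⊖-cong (≈trans (·-congˡ q (·-congˡ q (q^-+ n n)))
        (solve≈ 2 (λ q a → q :* (q :* (a :* a)) := q :* q :* (a :* a)) ≈-refl q (q ^ n)))))))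
      (⊕-cong ≈-refl (⊖-cong (≈trans (·-congˡ q (·-congˡ q (·-congˡ q (q^-+ n n))))
        (solve≈ 2 (λ q a → q :* (q :* (q :* (a :* a))) := q :* q :* q :* (a :* a)) ≈-refl q (q ^ n))))))

    closed-0 : tripleCoeff (suc n) 0 · (P (suc n) · P (suc (suc n))) ≈ sgn 0 · q ^ tri 0 · P (suc (suc n ℕ.+ suc n))
    closed-0 = begin
      T · (P (suc n) · P (suc (suc n)))
        ≈⟨ ·-congˡ T (·-congʳ _ (P-suc n)) ⟩
      T · (P n · (1ˢ ⊕ ⊖ X) · P (suc (suc n)))
        ≈⟨ solve≈ 5 (λ X a b p r → ((con 1ℤ :+ X :+ X :* X) :* a :- (X :* b)) :* (p :* (con 1ℤ :- X) :* r)
             := (con 1ℤ :+ X :+ X :* X) :* (con 1ℤ :- X) :* (a :* (p :* r)) :- (X :* (con 1ℤ :- X) :* (b :* (p :* r)))) ≈-refl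
             X (tripleCoeff n 0) (tripleCoeff n 1) (P n) (P (suc (suc n))) ⟩
      (1ˢ ⊕ X ⊕ X · X) · (1ˢ ⊕ ⊖ X) · (tripleCoeff n 0 · (P n · P (suc (suc n))))
        ⊕ ⊖ (X · (1ˢ ⊕ ⊖ X) · (tripleCoeff n 1 · (P n · P (suc (suc n)))))
        ≈⟨ ⊕-cong (·-congˡ _ (≈trans (·-congˡ _ (·-congˡ _ (P-suc (suc n))))
               (≈trans (solve≈ 4 (λ a b c d → a :* (b :* (c :* d)) := a :* (b :* c) :* d) ≈-refl
                 (tripleCoeff n 0) (P n) (P (suc n)) (1-q^ (suc (suc n)))) (·-congʳ _ (closed 0 n ≡.refl)))))
             (⊖-cong (·-congˡ _ (next 0 n ≡.refl))) ⟩
      (1ˢ ⊕ X ⊕ X · X) · (1ˢ ⊕ ⊖ X) · (sgn 0 · q ^ 0 · M · 1-q^ (suc (suc n)))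
        ⊕ ⊖ (X · (1ˢ ⊕ ⊖ X) · (1-q^ n · (sgn 1 · (q ^ 0 · q · q ^ 0)) · M))
        ≈⟨ solve≈ 3 (λ q a m →
             (con 1ℤ :+ q :* a :+ q :* a :* (q :* a)) :* (con 1ℤ :- (q :* a)) :* (con 1ℤ :* con 1ℤ :* m :* (con 1ℤ :- (q :* (q :* a))))
             :- (q :* a :* (con 1ℤ :- (q :* a)) :* ((con 1ℤ :- a) :* ((:- con 1ℤ :* con 1ℤ) :* (con 1ℤ :* q :* con 1ℤ)) :* m))
             := con 1ℤ :* con 1ℤ :* (m :* (con 1ℤ :- (q :* q :* (a :* a))) :* (con 1ℤ :- (q :* q :* q :* (a :* a))))) ≈-refl
             q (q ^ n) M ⟩
      sgn 0 · q ^ tri 0 · (M · (1ˢ ⊕ ⊖ (q · q · (q ^ n · q ^ n))) · (1ˢ ⊕ ⊖ (q · q · q · (q ^ n · q ^ n))))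
        ≈⟨ ·-congˡ _ (≈sym (≈trans (P-≡ (cong (λ x → suc (suc x)) (ℕP.+-suc n n))) (top (n ℕ.+ n) ≡.refl))) ⟩
      sgn 0 · q ^ tri 0 · P (suc (suc n ℕ.+ suc n)) ∎
      where
      open ≈-Reasoning
      X T : Series
      X = q ^ suc n
      T = tripleCoeff (suc n) 0

    closed-suc : ∀ k d → k ℕ.+ d ≡ n →
      tripleCoeff (suc n) (suc k) · (P d · P (suc (suc k ℕ.+ suc k ℕ.+ d))) ≈
      sgn (suc k) · q ^ tri (suc k) · P (suc (suc n ℕ.+ suc n))
    closed-suc k d e = begin
      T · (P d · P (suc (suc k ℕ.+ suc k ℕ.+ d)))
        ≈⟨ ·-congˡ T (·-congˡ _ (P-≡ (cong suc (N.solve 2 (λ k d → (N.con 1 N.:+ k) N.:+ (N.con 1 N.:+ k) N.:+ d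
             N.:= N.con 2 N.:+ (k N.:+ k N.:+ d)) ≡.refl k d)))) ⟩
      T · (P d · P (suc (suc S)))
        ≈⟨ solve≈ 6 (λ X a b c p r → ((con 1ℤ :+ X :* X) :* b :- (X :* (a :+ c))) :* (p :* r)
             := (con 1ℤ :+ X :* X) :* (b :* (p :* r)) :- (X :* (a :* (p :* r) :+ c :* (p :* r)))) ≈-refl
             X (tripleCoeff n k) (tripleCoeff n (suc k)) (tripleCoeff n (suc (suc k))) (P d) (P (suc (suc S))) ⟩
      (1ˢ ⊕ X · X) · (tripleCoeff n (suc k) · (P d · P (suc (suc S))))
        ⊕ ⊖ (X · (tripleCoeff n k · (P d · P (suc (suc S))) ⊕ tripleCoeff n (suc (suc k)) · (P d · P (suc (suc S)))))
        ≈⟨ ⊕-cong (·-congˡ _ term₁) (⊖-cong (·-cong X-≈ (⊕-cong term₀ (nextButOne k d e)))) ⟩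
      (1ˢ ⊕ X · X) · (1-q^ d · (sgn (suc k) · (t · q · b)) · M · (1ˢ ⊕ ⊖ (q · q · q · (b · b) · a)))
        ⊕ ⊖ (q · (b · a) · (sgn k · t · M · (1ˢ ⊕ ⊖ (q · q · (b · b) · a)) · (1ˢ ⊕ ⊖ (q · q · q · (b · b) · a))
           ⊕ 1-q^ d · (q ⊕ ⊖ a) · (sgn k · (t · q ^ 2 · b · b)) · M))
        ≈⟨ ⊕-cong (·-congʳ _ (⊕-cong ≈-refl (·-cong X-≈ X-≈))) ≈-refl ⟩
      (1ˢ ⊕ q · (b · a) · (q · (b · a))) · (1-q^ d · (sgn (suc k) · (t · q · b)) · M · (1ˢ ⊕ ⊖ (q · q · q · (b · b) · a)))
        ⊕ ⊖ (q · (b · a) · (sgn k · t · M · (1ˢ ⊕ ⊖ (q · q · (b · b) · a)) · (1ˢ ⊕ ⊖ (q · q · q · (b · b) · a))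
           ⊕ 1-q^ d · (q ⊕ ⊖ a) · (sgn k · (t · q ^ 2 · b · b)) · M))
        ≈⟨ solve≈ 6 (λ q a b t s m →
             (con 1ℤ :+ q :* (b :* a) :* (q :* (b :* a))) :*
               ((con 1ℤ :- a) :* ((:- con 1ℤ :* s) :* (t :* q :* b)) :* m :* (con 1ℤ :- (q :* q :* q :* (b :* b) :* a)))
             :- (q :* (b :* a) :* (s :* t :* m :* (con 1ℤ :- (q :* q :* (b :* b) :* a)) :* (con 1ℤ :- (q :* q :* q :* (b :* b) :* a))
               :+ (con 1ℤ :- a) :* (q :- a) :* (s :* (t :* q :^ 2 :* b :* b)) :* m))
             := (:- con 1ℤ :* s) :* (q :* b :* t) :*
               (m :* (con 1ℤ :- (q :* q :* (b :* a :* (b :* a)))) :* (con 1ℤ :- (q :* q :* q :* (b :* a :* (b :* a)))))) ≈-refl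
             q a b t (sgn k) M ⟩
      sgn (suc k) · (q · b · t) · (M · (1ˢ ⊕ ⊖ (q · q · (b · a · (b · a)))) · (1ˢ ⊕ ⊖ (q · q · q · (b · a · (b · a)))))
        ≈⟨ ·-cong (·-congˡ _ (≈sym (q^-+ (suc k) (tri k)))) (≈sym (≈trans (P-≡ (cong (λ x → suc (suc x)) (ℕP.+-suc n n)))
             (≈trans (top (n ℕ.+ n) ≡.refl) (·-cong (·-congˡ M (⊕-cong ≈-refl (⊖-cong (·-congˡ _ (·-cong ba ba)))))
               (⊕-cong ≈-refl (⊖-cong (·-congˡ _ (·-cong ba ba)))))))) ⟩
      sgn (suc k) · q ^ tri (suc k) · P (suc (suc n ℕ.+ suc n)) ∎
      where
      open ≈-Reasoning
      S : ℕ
      S = suc (k ℕ.+ k ℕ.+ d)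
      X T a b t : Series
      X = q ^ suc n
      T = tripleCoeff (suc n) (suc k)
      a = q ^ d
      b = q ^ k
      t = q ^ tri k
      ba : q ^ n ≈ b · a
      ba = ≈trans (q^-≡ (≡.sym e)) (q^-+ k d)
      X-≈ : X ≈ q · (b · a)
      X-≈ = ·-congˡ q ba
      b²a : q ^ (k ℕ.+ k ℕ.+ d) ≈ b · b · a
      b²a = ≈trans (q^-+ (k ℕ.+ k) d) (·-congʳ a (q^-+ k k))
      P₃ : P (suc (suc S)) ≈ P (suc S) · (1ˢ ⊕ ⊖ (q · q · q · (b · b) · a))
      P₃ = ≈trans (P-suc (suc S)) (·-congˡ _ (⊕-cong ≈-refl (⊖-cong (≈trans (·-congˡ q (·-congˡ q (·-congˡ q b²a)))
        (solve≈ 3 (λ q b a → q :* (q :* (q :* (b :* b :* a))) := q :* q :* q :* (b :* b) :* a) ≈-refl q b a)))))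
      P₂ : P (suc S) ≈ P S · (1ˢ ⊕ ⊖ (q · q · (b · b) · a))
      P₂ = ≈trans (P-suc S) (·-congˡ _ (⊕-cong ≈-refl (⊖-cong (≈trans (·-congˡ q (·-congˡ q b²a))
        (solve≈ 3 (λ q b a → q :* (q :* (b :* b :* a)) := q :* q :* (b :* b) :* a) ≈-refl q b a)))))
      regroup : ∀ x y z w → x · (y · (z · w)) ≈ x · (y · z) · w
      regroup = solve≈ 4 (λ x y z w → x :* (y :* (z :* w)) := x :* (y :* z) :* w) ≈-refl
      term₁ : tripleCoeff n (suc k) · (P d · P (suc (suc S))) ≈
              1-q^ d · (sgn (suc k) · (t · q · b)) · M · (1ˢ ⊕ ⊖ (q · q · q · (b · b) · a))
      term₁ = ≈trans (·-congˡ _ (·-congˡ _ P₃)) (≈trans (regroup _ (P d) _ _) (·-congʳ _ (next k d e)))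
      term₀ : tripleCoeff n k · (P d · P (suc (suc S))) ≈
              sgn k · t · M · (1ˢ ⊕ ⊖ (q · q · (b · b) · a)) · (1ˢ ⊕ ⊖ (q · q · q · (b · b) · a))
      term₀ = ≈trans (·-congˡ _ (·-congˡ _ P₃)) (≈trans (regroup _ (P d) _ _) (·-congʳ _
        (≈trans (·-congˡ _ (·-congˡ _ P₂)) (≈trans (regroup _ (P d) _ _) (·-congʳ _ (closed k d e))))))

  closedForm : ∀ n → ClosedForm n
  closedForm zero    zero    zero    _ = ≈trans (·-congˡ 1ˢ (·-congʳ (P 1) eulerTrunc-0))
    (solve≈ 1 (λ p → con 1ℤ :* (con 1ℤ :* p) := con 1ℤ :* con 1ℤ :* p) ≈-refl (P 1))
  closedForm (suc n) zero    (suc d) ≡.refl = Step.closed-0 n (closedForm n)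
  closedForm (suc n) (suc k) d       e = Step.closed-suc n (closedForm n) k d (ℕP.suc-injective e)

-- Jacobi's formula for the cube of the Euler product, and series with few residues modulo 7.

module JacobiCube where
  open SeriesRing
  open Operators
  open Pentagonal
  open TripleProduct
  open import Data.Nat as ℕ using (ℕ; zero; suc; _≤_; _<_)
  import Data.Nat.Properties as ℕP
  open import Data.Nat.Solver using (module +-*-Solver)
  open import Data.Integer using (+_; -[1+_]; 0ℤ; 1ℤ)
  open import Data.Fin using (zero; suc)
  open import Relation.Binary.PropositionalEquality as ≡ using (_≡_; cong; subst)

  open Solver using (con; :-_; _:+_; _:*_; _:-_; _:=_) renaming (solve to solve≈)
  private
    module N = +-*-Solver
    variable
      f g f′ g′ : Series

  jacobiSum : ℕ → Series
  jacobiSum zero    = sgn 0 · odd 0 · q ^ tri 0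
  jacobiSum (suc n) = jacobiSum n ⊕ sgn (suc n) · odd (suc n) · q ^ tri (suc n)

  -- In the closed form both E / P d and the remaining quotient of Euler products are 1 modulo
  -- q^(d+1). The factor `q ^ tri k`, with tri k ≥ k, raises the precision to k + d.
  E·tripleCoeff : ∀ k d → E · tripleCoeff (k ℕ.+ d) k ≈[ k ℕ.+ d ] sgn k · q ^ tri k
  E·tripleCoeff k d = ≈[]-trans (≈⇒≈[] exact)
    (≈[]-trans (≈[]-weaken (ℕP.+-monoˡ-≤ d (n≤tri k)) (q^·-cong[] (tri k) approx))
      (≈⇒≈[] (≈trans (·-congˡ _ (SR.*-identityʳ (sgn k))) (SR.*-comm _ _))))
    where
    S : ℕ
    S = suc (k ℕ.+ k ℕ.+ d)
    M : Series
    M = P (suc (k ℕ.+ d ℕ.+ (k ℕ.+ d)))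
    c : Series
    c = tripleCoeff (k ℕ.+ d) k
    exact : E · c ≈ q ^ tri k · (sgn k · (E · iP d · (M · iP S)))
    exact = begin
      E · c
        ≈⟨ solve≈ 2 (λ e c → e :* c := e :* (c :* (con 1ℤ :* con 1ℤ))) ≈-refl E c ⟩
      E · (c · (1ˢ · 1ˢ))
        ≈⟨ ·-congˡ E (·-congˡ c (·-cong (≈sym (P-iP d)) (≈sym (P-iP S)))) ⟩
      E · (c · (P d · iP d · (P S · iP S)))
        ≈⟨ solve≈ 6 (λ e c p i r j → e :* (c :* (p :* i :* (r :* j))) := e :* i :* j :* (c :* (p :* r))) ≈-refl E c (P d) (iP d) (P S) (iP S) ⟩
      E · iP d · iP S · (c · (P d · P S))
        ≈⟨ ·-congˡ _ (closedForm (k ℕ.+ d) k d ≡.refl) ⟩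
      E · iP d · iP S · (sgn k · q ^ tri k · M)
        ≈⟨ solve≈ 6 (λ e i j s t m → e :* i :* j :* (s :* t :* m) := t :* (s :* (e :* i :* (m :* j)))) ≈-refl
             E (iP d) (iP S) (sgn k) (q ^ tri k) M ⟩
      q ^ tri k · (sgn k · (E · iP d · (M · iP S))) ∎
      where open ≈-Reasoning
    M-≈ : M ≈[ d ] P S
    M-≈ = ≈[]-trans (≈⇒≈[] (P-≡ (N.solve 2 (λ k d → N.con 1 N.:+ (k N.:+ d N.:+ (k N.:+ d))
          N.:= d N.:+ (N.con 1 N.:+ (k N.:+ k N.:+ d))) ≡.refl k d)))
      (≈[]-weaken (ℕP.m≤n⇒m≤1+n (ℕP.m≤n+m d (k ℕ.+ k))) (P-stable d S))
    approx : sgn k · (E · iP d · (M · iP S)) ≈[ d ] sgn k · 1ˢ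
    approx = ·-cong[] (≈⇒≈[] ≈-refl) (≈[]-trans
      (·-cong[] (≈[]-trans (·-cong[] (E-P d) (≈⇒≈[] ≈-refl)) (≈⇒≈[] (P-iP d)))
                (≈[]-trans (·-cong[] M-≈ (≈⇒≈[] ≈-refl)) (≈⇒≈[] (P-iP S))))
      (≈⇒≈[] (SR.*-identityˡ 1ˢ)))

  E·weightedSum : ∀ n m → m ≤ n → E · weightedSum n m ≈[ n ] jacobiSum m
  E·weightedSum n zero    _ = ≈[]-trans
    (≈⇒≈[] (solve≈ 2 (λ e c → e :* (con 1ℤ :* c) := e :* c) ≈-refl E (tripleCoeff n 0)))
    (≈[]-trans (E·tripleCoeff 0 n) (≈⇒≈[] (solve≈ 0 (con 1ℤ :* con 1ℤ := con 1ℤ :* con 1ℤ :* con 1ℤ) ≈-refl)))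
  E·weightedSum n (suc m) l = ≈[]-trans (≈⇒≈[] (solve≈ 4 (λ e w o c → e :* (w :+ o :* c) := e :* w :+ o :* (e :* c)) ≈-refl
      E (weightedSum n m) (odd (suc m)) (tripleCoeff n (suc m))))
    (≈[]-trans (⊕-cong[] (E·weightedSum n m (ℕP.≤-trans (ℕP.n≤1+n m) l)) (·-cong[] (≈⇒≈[] ≈-refl)
        (subst (λ n → E · tripleCoeff n (suc m) ≈[ n ] sgn (suc m) · q ^ tri (suc m)) (ℕP.m+[n∸m]≡n l)
          (E·tripleCoeff (suc m) (n ℕ.∸ suc m)))))
      (≈⇒≈[] (⊕-cong ≈-refl (solve≈ 3 (λ o s t → o :* (s :* t) := s :* o :* t) ≈-refl
        (odd (suc m)) (sgn (suc m)) (q ^ tri (suc m))))))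

  -- Two factors E are replaced by P n, which gives the weighted sum; the third turns each
  -- coefficient in it into a signed power of q.
  jacobi : ∀ n → E ^ 3 ≈[ n ] jacobiSum n
  jacobi n = ≈[]-trans (·-cong[] (≈⇒≈[] ≈-refl) square)
    (≈[]-trans (≈⇒≈[] (·-congˡ E (≈sym (weightedSum-square n)))) (E·weightedSum n n ℕP.≤-refl))
    where
    square : E ^ 2 ≈[ n ] P n ^ 2
    square = ·-cong[] (E-P n) (·-cong[] (E-P n) (≈⇒≈[] ≈-refl))

  φ-q^ : ∀ k → φ (q ^ k) ≈ q ^ (k ℕ.* 7)
  φ-q^ zero    = φ-ι 1ℤ
  φ-q^ (suc k) = ≈trans (φ-· q (q ^ k)) (≈trans (·-cong φ-q (φ-q^ k)) (≈sym (q^-+ 7 (k ℕ.* 7))))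

  -- The series supported on the residues 0, 1, i and the residue of u, a multiple of q^j with j < 7.
  module Shape (i : ℕ) (u : Series) where

    shape : Series → Series → Series → Series → Series
    shape a b c g = φ a ⊕ q · φ b ⊕ q ^ i · φ c ⊕ u · φ (φ g)

    -- Only g has to be known: it is the original sum over again, entering with q⁴⁹ for q. The
    -- components a, b, c are recovered later by U.
    record HasShape (f g : Series) : Set where
      constructor mkShape
      field
        {a b c} : Series
        eq : f ≈ shape a b c g

    shape-≈ : f′ ≈ f → HasShape f g → HasShape f′ g
    shape-≈ p (mkShape e) = mkShape (≈trans p e)

    shape-≈ʳ : g ≈ g′ → HasShape f g → HasShape f g′
    shape-≈ʳ p (mkShape e) = mkShape (≈trans e (⊕-cong ≈-refl (·-congˡ u (φ-cong (φ-cong p)))))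

    add₀ : ∀ {t} x → t ≈ φ x → HasShape f g → HasShape (f ⊕ t) g
    add₀ x p (mkShape {a} {b} {c} e) = mkShape {a = a ⊕ x} {b} {c} (≈trans (⊕-cong e p)
      (≈trans (solve≈ 5 (λ a b c d x → a :+ b :+ c :+ d :+ x := a :+ x :+ b :+ c :+ d) ≈-refl _ _ _ _ (φ x))
        (⊕-cong (⊕-cong (⊕-cong (≈sym (φ-+ a x)) ≈-refl) ≈-refl) ≈-refl)))

    add₁ : ∀ {t} x → t ≈ q · φ x → HasShape f g → HasShape (f ⊕ t) g
    add₁ x p (mkShape {a} {b} {c} e) = mkShape {a = a} {b ⊕ x} {c} (≈trans (⊕-cong e p)
      (≈trans (solve≈ 6 (λ a b c d x q → a :+ q :* b :+ c :+ d :+ q :* x := a :+ q :* (b :+ x) :+ c :+ d) ≈-refl _ (φ b) _ _ (φ x) q)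
        (⊕-cong (⊕-cong (⊕-cong ≈-refl (·-congˡ q (≈sym (φ-+ b x)))) ≈-refl) ≈-refl)))

    addᵢ : ∀ {t} x → t ≈ q ^ i · φ x → HasShape f g → HasShape (f ⊕ t) g
    addᵢ x p (mkShape {a} {b} {c} e) = mkShape {a = a} {b} {c ⊕ x} (≈trans (⊕-cong e p)
      (≈trans (solve≈ 6 (λ a b c d x q → a :+ b :+ q :* c :+ d :+ q :* x := a :+ b :+ q :* (c :+ x) :+ d) ≈-refl _ _ (φ c) _ (φ x) (q ^ i))
        (⊕-cong (⊕-cong ≈-refl (·-congˡ (q ^ i) (≈sym (φ-+ c x)))) ≈-refl)))

    addᵤ : ∀ {t} x → t ≈ u · φ (φ x) → HasShape f g → HasShape (f ⊕ t) (g ⊕ x)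
    addᵤ {g = g} x p (mkShape {a} {b} {c} e) = mkShape {a = a} {b} {c} (≈trans (⊕-cong e p)
      (≈trans (solve≈ 6 (λ a b c d x q → a :+ b :+ c :+ q :* d :+ q :* x := a :+ b :+ c :+ q :* (d :+ x)) ≈-refl _ _ _ (φ (φ g)) (φ (φ x)) u)
        (⊕-cong ≈-refl (·-congˡ u (≈trans (≈sym (φ-+ (φ g) (φ x))) (φ-cong (≈sym (φ-+ g x))))))))

    zeroShape : HasShape 0ˢ 0ˢ
    zeroShape = mkShape {a = 0ˢ} {0ˢ} {0ˢ} (≈sym (≈trans
      (⊕-cong (⊕-cong (⊕-cong φ0 (·-congˡ q φ0)) (·-congˡ (q ^ i) φ0)) (·-congˡ u (≈trans (φ-cong φ-0) φ0)))
      (≈trans (solve≈ 3 (λ a b c → con 0ℤ :+ a :* con 0ℤ :+ b :* con 0ℤ :+ c :* con 0ℤ := con 0ℤ) ≈-refl q (q ^ i) u) ι-0)))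
      where
      φ0 : φ 0ˢ ≈ ι 0ℤ
      φ0 = ≈trans φ-0 (≈sym ι-0)

  -- Pentagonal numbers are 0, 1, 2, 5 modulo 7 and triangular ones 0, 1, 3, 6. The marked classes 2
  -- and 6 are those where 24 e + 1, respectively 8 e + 1, is divisible by 7; it is then divisible
  -- by 49 and the sum reproduces itself, with factor -q² and -7 q⁶.
  module PS = Shape 5 (⊖ q ^ 2)
  module JS = Shape 3 (ι -[1+ 6 ] · q ^ 6)

  φ-sgn : ∀ n → φ (sgn n) ≈ sgn n
  φ-sgn n = ≈trans (φ-^ (⊖ 1ˢ) n) (^-congˡ n (≈trans (φ-⊖ 1ˢ) (⊖-cong (φ-ι 1ℤ))))

  φ-odd : ∀ n → φ (odd n) ≈ odd n
  φ-odd zero    = φ-ι 1ℤ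
  φ-odd (suc n) = ≈trans (φ-+ (odd n) (ι (+ 2))) (⊕-cong (φ-odd n) (φ-ι (+ 2)))

  sgn-7 : ∀ m → sgn (m ℕ.* 7) ≈ sgn m
  sgn-7 zero    = ≈-refl
  sgn-7 (suc m) = ≈trans (solve≈ 1 (λ s → :- con 1ℤ :* (:- con 1ℤ :* (:- con 1ℤ :* (:- con 1ℤ :* (:- con 1ℤ :* (:- con 1ℤ :* (:- con 1ℤ :* s))))))
      := :- con 1ℤ :* s) ≈-refl (sgn (m ℕ.* 7))) (·-congˡ (⊖ 1ˢ) (sgn-7 m))

  odd-7 : ∀ m → odd (3 ℕ.+ m ℕ.* 7) ≈ ι (+ 7) · odd m
  odd-7 zero    = solve≈ 0 (con 1ℤ :+ con (+ 2) :+ con (+ 2) :+ con (+ 2) := con (+ 7) :* con 1ℤ) ≈-refl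
  odd-7 (suc m) = ≈trans (⊕-cong (⊕-cong (⊕-cong (⊕-cong (⊕-cong (⊕-cong (⊕-cong (odd-7 m) ≈-refl) ≈-refl) ≈-refl) ≈-refl) ≈-refl) ≈-refl) ≈-refl)
    (solve≈ 1 (λ o → con (+ 7) :* o :+ con (+ 2) :+ con (+ 2) :+ con (+ 2) :+ con (+ 2) :+ con (+ 2) :+ con (+ 2) :+ con (+ 2)
      := con (+ 7) :* (o :+ con (+ 2))) ≈-refl (odd m))

  tri-7 : ∀ m → tri (3 ℕ.+ m ℕ.* 7) ≡ 6 ℕ.+ tri m ℕ.* 49
  tri-7 zero    = ≡.refl
  tri-7 (suc m) = ≡.trans (cong (λ x → 10 ℕ.+ k ℕ.+ (9 ℕ.+ k ℕ.+ (8 ℕ.+ k ℕ.+ (7 ℕ.+ k ℕ.+ (6 ℕ.+ k ℕ.+ (5 ℕ.+ k ℕ.+ (4 ℕ.+ k ℕ.+ x))))))) (tri-7 m))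
    (N.solve 2 (λ m t → let k = m N.:* N.con 7 in
      N.con 10 N.:+ k N.:+ (N.con 9 N.:+ k N.:+ (N.con 8 N.:+ k N.:+ (N.con 7 N.:+ k N.:+ (N.con 6 N.:+ k N.:+ (N.con 5 N.:+ k N.:+ (N.con 4 N.:+ k N.:+ (N.con 6 N.:+ t N.:* N.con 49)))))))
      N.:= N.con 6 N.:+ (N.con 1 N.:+ m N.:+ t) N.:* N.con 49) ≡.refl m (tri m))
    where
    k : ℕ
    k = m ℕ.* 7

  φ-term : ∀ κ i {e} e′ → φ κ ≈ κ → e ≡ i ℕ.+ e′ ℕ.* 7 → κ · q ^ e ≈ q ^ i · φ (κ · q ^ e′)
  φ-term κ i e′ inv-κ p = ≈trans (·-congˡ κ (≈trans (q^-≡ p) (q^-+ i (e′ ℕ.* 7))))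
    (≈trans (solve≈ 3 (λ k a b → k :* (a :* b) := a :* (k :* b)) ≈-refl κ (q ^ i) (q ^ (e′ ℕ.* 7)))
      (·-congˡ (q ^ i) (≈trans (·-cong (≈sym inv-κ) (≈sym (φ-q^ e′))) (≈sym (φ-· κ (q ^ e′))))))

  module _ (κ : Series) (inv-κ : φ κ ≈ κ) (e : ℕ) where

    φ-term₀ : ∀ e′ → e ≡ e′ ℕ.* 7 → κ · q ^ e ≈ φ (κ · q ^ e′)
    φ-term₀ e′ p = ≈trans (φ-term κ 0 e′ inv-κ p) (SR.*-identityˡ _)

    φ-term₁ : ∀ e′ → e ≡ 1 ℕ.+ e′ ℕ.* 7 → κ · q ^ e ≈ q · φ (κ · q ^ e′)
    φ-term₁ e′ p = ≈trans (φ-term κ 1 e′ inv-κ p) (·-congʳ _ (SR.*-identityʳ q))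

    φφ-term : ∀ i e′ → e ≡ i ℕ.+ e′ ℕ.* 7 ℕ.* 7 → κ · q ^ e ≈ q ^ i · φ (φ (κ · q ^ e′))
    φφ-term i e′ p = ≈trans (φ-term κ i (e′ ℕ.* 7) inv-κ p)
      (·-congˡ (q ^ i) (φ-cong (≈trans (φ-term κ 0 e′ inv-κ ≡.refl) (SR.*-identityˡ _))))

-- The partial sums sorted by exponents modulo 7.

module ResidueClasses where
  open SeriesRing
  open Operators
  open Pentagonal
  open TripleProduct
  open JacobiCube
  open import Data.Nat as ℕ using (ℕ; zero; suc)
  open import Data.Nat.Solver using (module +-*-Solver)
  open import Data.Integer using (+_; -[1+_]; 0ℤ; 1ℤ)
  open import Relation.Binary.PropositionalEquality as ≡ using (_≡_; cong)

  open Solver using (con; _:^_; :-_; _:+_; _:*_; _:-_; _:=_) renaming (solve to solve≈)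
  private
    module N = +-*-Solver

  module PentStep (m : ℕ) where
    open PS
    k : ℕ
    k = m ℕ.* 7

    sgn-6 : sgn (6 ℕ.+ k) ≈ ⊖ sgn (suc m)
    sgn-6 = ≈trans (solve≈ 1 (λ s → :- con 1ℤ :* (:- con 1ℤ :* (:- con 1ℤ :* (:- con 1ℤ :* (:- con 1ℤ :* (:- con 1ℤ :* s)))))
      := :- (:- con 1ℤ :* s)) ≈-refl (sgn k)) (⊖-cong (·-congˡ (⊖ 1ˢ) (sgn-7 m)))

    sgn-8 : sgn (8 ℕ.+ k) ≈ ⊖ sgn (suc m)
    sgn-8 = ≈trans (solve≈ 1 (λ s → :- con 1ℤ :* (:- con 1ℤ :* s) := s) ≈-refl (sgn (6 ℕ.+ k))) sgn-6

    marked : ∀ {s} e e′ → s ≈ ⊖ sgn (suc m) → e ≡ 2 ℕ.+ e′ ℕ.* 7 ℕ.* 7 → s · q ^ e ≈ ⊖ q ^ 2 · φ (φ (sgn (suc m) · q ^ e′))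
    marked e e′ p r = ≈trans (·-congʳ _ p) (≈trans (solve≈ 2 (λ s x → :- s :* x := :- (s :* x)) ≈-refl (sgn (suc m)) (q ^ e))
      (≈trans (⊖-cong (φφ-term (sgn (suc m)) (φ-sgn (suc m)) e 2 e′ r))
        (solve≈ 2 (λ s x → :- (s :* x) := :- s :* x) ≈-refl (q ^ 2) _)))

    next : ∀ {g} n → HasShape (pent n ⊕ sgn (suc n) · q ^ (suc n ℕ.* suc n ℕ.+ tri n) ⊕ sgn (suc n) · q ^ (suc n ℕ.* suc n ℕ.+ tri (suc n))) g →
           HasShape (pent (suc n)) g
    next n = shape-≈ (solve≈ 4 (λ p s a b → p :+ s :* (a :+ b) := p :+ s :* a :+ s :* b) ≈-refl (pent n) (sgn (suc n)) _ _)

    -- Exponents congruent to 2 arise only at the indices 7 (m + 1) ∓ 1, where they give the two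
    -- terms of index m + 1 with reversed sign. The block from 7 m + 4 to 7 m + 10 is cut so that
    -- both indices fall into it.
    step : HasShape (pent (3 ℕ.+ k)) (pent m) → HasShape (pent (10 ℕ.+ k)) (pent (suc m))
    step h = shape-≈ʳ (solve≈ 4 (λ p s a b → p :+ s :* a :+ s :* b := p :+ s :* (a :+ b)) ≈-refl (pent m) (sgn (suc m)) _ _)
      (next (9 ℕ.+ k)
      -- In each of the fourteen terms the witness is the exponent less its residue, divided by 7.
      -- It is a polynomial in m and `tri m`, since `tri-7` unfolds the triangular number that
      -- occurs.
      (add₁ _ (φ-term₁ (sgn (10 ℕ.+ k)) (φ-sgn (10 ℕ.+ k)) _ (m ℕ.* m ℕ.* 7 ℕ.+ m ℕ.* 27 ℕ.+ tri m ℕ.* 7 ℕ.+ 22)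
        (≡.trans (cong (λ x → (10 ℕ.+ k) ℕ.* (10 ℕ.+ k) ℕ.+ (10 ℕ.+ k ℕ.+ (9 ℕ.+ k ℕ.+ (8 ℕ.+ k ℕ.+ (7 ℕ.+ k ℕ.+ (6 ℕ.+ k ℕ.+ (5 ℕ.+ k ℕ.+ (4 ℕ.+ k ℕ.+ x)))))))) (tri-7 m)) (N.solve 2 (λ m t → let k = m N.:* N.con 7 in (N.con 10 N.:+ k) N.:* (N.con 10 N.:+ k) N.:+ (N.con 10 N.:+ k N.:+ (N.con 9 N.:+ k N.:+ (N.con 8 N.:+ k N.:+ (N.con 7 N.:+ k N.:+ (N.con 6 N.:+ k N.:+ (N.con 5 N.:+ k N.:+ (N.con 4 N.:+ k N.:+ (N.con 6 N.:+ t N.:* N.con 49)))))))) N.:= N.con 1 N.:+ (m N.:* m N.:* N.con 7 N.:+ m N.:* N.con 27 N.:+ t N.:* N.con 7 N.:+ N.con 22) N.:* N.con 7) ≡.refl m (tri m))))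
      (addᵢ _ (φ-term (sgn (10 ℕ.+ k)) 5 (m ℕ.* m ℕ.* 7 ℕ.+ m ℕ.* 26 ℕ.+ tri m ℕ.* 7 ℕ.+ 20) (φ-sgn (10 ℕ.+ k))
        (≡.trans (cong (λ x → (10 ℕ.+ k) ℕ.* (10 ℕ.+ k) ℕ.+ (9 ℕ.+ k ℕ.+ (8 ℕ.+ k ℕ.+ (7 ℕ.+ k ℕ.+ (6 ℕ.+ k ℕ.+ (5 ℕ.+ k ℕ.+ (4 ℕ.+ k ℕ.+ x))))))) (tri-7 m)) (N.solve 2 (λ m t → let k = m N.:* N.con 7 in (N.con 10 N.:+ k) N.:* (N.con 10 N.:+ k) N.:+ (N.con 9 N.:+ k N.:+ (N.con 8 N.:+ k N.:+ (N.con 7 N.:+ k N.:+ (N.con 6 N.:+ k N.:+ (N.con 5 N.:+ k N.:+ (N.con 4 N.:+ k N.:+ (N.con 6 N.:+ t N.:* N.con 49))))))) N.:= N.con 5 N.:+ (m N.:* m N.:* N.con 7 N.:+ m N.:* N.con 26 N.:+ t N.:* N.con 7 N.:+ N.con 20) N.:* N.con 7) ≡.refl m (tri m))))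
      (next (8 ℕ.+ k)
      (add₀ _ (φ-term₀ (sgn (9 ℕ.+ k)) (φ-sgn (9 ℕ.+ k)) _ (m ℕ.* m ℕ.* 7 ℕ.+ m ℕ.* 24 ℕ.+ tri m ℕ.* 7 ℕ.+ 18)
        (≡.trans (cong (λ x → (9 ℕ.+ k) ℕ.* (9 ℕ.+ k) ℕ.+ (9 ℕ.+ k ℕ.+ (8 ℕ.+ k ℕ.+ (7 ℕ.+ k ℕ.+ (6 ℕ.+ k ℕ.+ (5 ℕ.+ k ℕ.+ (4 ℕ.+ k ℕ.+ x))))))) (tri-7 m)) (N.solve 2 (λ m t → let k = m N.:* N.con 7 in (N.con 9 N.:+ k) N.:* (N.con 9 N.:+ k) N.:+ (N.con 9 N.:+ k N.:+ (N.con 8 N.:+ k N.:+ (N.con 7 N.:+ k N.:+ (N.con 6 N.:+ k N.:+ (N.con 5 N.:+ k N.:+ (N.con 4 N.:+ k N.:+ (N.con 6 N.:+ t N.:* N.con 49))))))) N.:= (m N.:* m N.:* N.con 7 N.:+ m N.:* N.con 24 N.:+ t N.:* N.con 7 N.:+ N.con 18) N.:* N.con 7) ≡.refl m (tri m))))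
      (addᵢ _ (φ-term (sgn (9 ℕ.+ k)) 5 (m ℕ.* m ℕ.* 7 ℕ.+ m ℕ.* 23 ℕ.+ tri m ℕ.* 7 ℕ.+ 16) (φ-sgn (9 ℕ.+ k))
        (≡.trans (cong (λ x → (9 ℕ.+ k) ℕ.* (9 ℕ.+ k) ℕ.+ (8 ℕ.+ k ℕ.+ (7 ℕ.+ k ℕ.+ (6 ℕ.+ k ℕ.+ (5 ℕ.+ k ℕ.+ (4 ℕ.+ k ℕ.+ x)))))) (tri-7 m)) (N.solve 2 (λ m t → let k = m N.:* N.con 7 in (N.con 9 N.:+ k) N.:* (N.con 9 N.:+ k) N.:+ (N.con 8 N.:+ k N.:+ (N.con 7 N.:+ k N.:+ (N.con 6 N.:+ k N.:+ (N.con 5 N.:+ k N.:+ (N.con 4 N.:+ k N.:+ (N.con 6 N.:+ t N.:* N.con 49)))))) N.:= N.con 5 N.:+ (m N.:* m N.:* N.con 7 N.:+ m N.:* N.con 23 N.:+ t N.:* N.con 7 N.:+ N.con 16) N.:* N.con 7) ≡.refl m (tri m))))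
      (next (7 ℕ.+ k)
      (addᵤ _ (marked _ (suc m ℕ.* suc m ℕ.+ tri (suc m)) sgn-8
        (≡.trans (cong (λ x → (8 ℕ.+ k) ℕ.* (8 ℕ.+ k) ℕ.+ (8 ℕ.+ k ℕ.+ (7 ℕ.+ k ℕ.+ (6 ℕ.+ k ℕ.+ (5 ℕ.+ k ℕ.+ (4 ℕ.+ k ℕ.+ x)))))) (tri-7 m)) (N.solve 2 (λ m t → let k = m N.:* N.con 7 in (N.con 8 N.:+ k) N.:* (N.con 8 N.:+ k) N.:+ (N.con 8 N.:+ k N.:+ (N.con 7 N.:+ k N.:+ (N.con 6 N.:+ k N.:+ (N.con 5 N.:+ k N.:+ (N.con 4 N.:+ k N.:+ (N.con 6 N.:+ t N.:* N.con 49)))))) N.:= N.con 2 N.:+ ((N.con 1 N.:+ m) N.:* (N.con 1 N.:+ m) N.:+ (N.con 1 N.:+ m N.:+ t)) N.:* N.con 7 N.:* N.con 7) ≡.refl m (tri m))))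
      (add₁ _ (φ-term₁ (sgn (8 ℕ.+ k)) (φ-sgn (8 ℕ.+ k)) _ (m ℕ.* m ℕ.* 7 ℕ.+ m ℕ.* 20 ℕ.+ tri m ℕ.* 7 ℕ.+ 13)
        (≡.trans (cong (λ x → (8 ℕ.+ k) ℕ.* (8 ℕ.+ k) ℕ.+ (7 ℕ.+ k ℕ.+ (6 ℕ.+ k ℕ.+ (5 ℕ.+ k ℕ.+ (4 ℕ.+ k ℕ.+ x))))) (tri-7 m)) (N.solve 2 (λ m t → let k = m N.:* N.con 7 in (N.con 8 N.:+ k) N.:* (N.con 8 N.:+ k) N.:+ (N.con 7 N.:+ k N.:+ (N.con 6 N.:+ k N.:+ (N.con 5 N.:+ k N.:+ (N.con 4 N.:+ k N.:+ (N.con 6 N.:+ t N.:* N.con 49))))) N.:= N.con 1 N.:+ (m N.:* m N.:* N.con 7 N.:+ m N.:* N.con 20 N.:+ t N.:* N.con 7 N.:+ N.con 13) N.:* N.con 7) ≡.refl m (tri m))))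
      (next (6 ℕ.+ k)
      (add₀ _ (φ-term₀ (sgn (7 ℕ.+ k)) (φ-sgn (7 ℕ.+ k)) _ (m ℕ.* m ℕ.* 7 ℕ.+ m ℕ.* 18 ℕ.+ tri m ℕ.* 7 ℕ.+ 11)
        (≡.trans (cong (λ x → (7 ℕ.+ k) ℕ.* (7 ℕ.+ k) ℕ.+ (7 ℕ.+ k ℕ.+ (6 ℕ.+ k ℕ.+ (5 ℕ.+ k ℕ.+ (4 ℕ.+ k ℕ.+ x))))) (tri-7 m)) (N.solve 2 (λ m t → let k = m N.:* N.con 7 in (N.con 7 N.:+ k) N.:* (N.con 7 N.:+ k) N.:+ (N.con 7 N.:+ k N.:+ (N.con 6 N.:+ k N.:+ (N.con 5 N.:+ k N.:+ (N.con 4 N.:+ k N.:+ (N.con 6 N.:+ t N.:* N.con 49))))) N.:= (m N.:* m N.:* N.con 7 N.:+ m N.:* N.con 18 N.:+ t N.:* N.con 7 N.:+ N.con 11) N.:* N.con 7) ≡.refl m (tri m))))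
      (add₀ _ (φ-term₀ (sgn (7 ℕ.+ k)) (φ-sgn (7 ℕ.+ k)) _ (m ℕ.* m ℕ.* 7 ℕ.+ m ℕ.* 17 ℕ.+ tri m ℕ.* 7 ℕ.+ 10)
        (≡.trans (cong (λ x → (7 ℕ.+ k) ℕ.* (7 ℕ.+ k) ℕ.+ (6 ℕ.+ k ℕ.+ (5 ℕ.+ k ℕ.+ (4 ℕ.+ k ℕ.+ x)))) (tri-7 m)) (N.solve 2 (λ m t → let k = m N.:* N.con 7 in (N.con 7 N.:+ k) N.:* (N.con 7 N.:+ k) N.:+ (N.con 6 N.:+ k N.:+ (N.con 5 N.:+ k N.:+ (N.con 4 N.:+ k N.:+ (N.con 6 N.:+ t N.:* N.con 49)))) N.:= (m N.:* m N.:* N.con 7 N.:+ m N.:* N.con 17 N.:+ t N.:* N.con 7 N.:+ N.con 10) N.:* N.con 7) ≡.refl m (tri m))))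
      (next (5 ℕ.+ k)
      (add₁ _ (φ-term₁ (sgn (6 ℕ.+ k)) (φ-sgn (6 ℕ.+ k)) _ (m ℕ.* m ℕ.* 7 ℕ.+ m ℕ.* 15 ℕ.+ tri m ℕ.* 7 ℕ.+ 8)
        (≡.trans (cong (λ x → (6 ℕ.+ k) ℕ.* (6 ℕ.+ k) ℕ.+ (6 ℕ.+ k ℕ.+ (5 ℕ.+ k ℕ.+ (4 ℕ.+ k ℕ.+ x)))) (tri-7 m)) (N.solve 2 (λ m t → let k = m N.:* N.con 7 in (N.con 6 N.:+ k) N.:* (N.con 6 N.:+ k) N.:+ (N.con 6 N.:+ k N.:+ (N.con 5 N.:+ k N.:+ (N.con 4 N.:+ k N.:+ (N.con 6 N.:+ t N.:* N.con 49)))) N.:= N.con 1 N.:+ (m N.:* m N.:* N.con 7 N.:+ m N.:* N.con 15 N.:+ t N.:* N.con 7 N.:+ N.con 8) N.:* N.con 7) ≡.refl m (tri m))))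
      (addᵤ _ (marked _ (suc m ℕ.* suc m ℕ.+ tri m) sgn-6
        (≡.trans (cong (λ x → (6 ℕ.+ k) ℕ.* (6 ℕ.+ k) ℕ.+ (5 ℕ.+ k ℕ.+ (4 ℕ.+ k ℕ.+ x))) (tri-7 m)) (N.solve 2 (λ m t → let k = m N.:* N.con 7 in (N.con 6 N.:+ k) N.:* (N.con 6 N.:+ k) N.:+ (N.con 5 N.:+ k N.:+ (N.con 4 N.:+ k N.:+ (N.con 6 N.:+ t N.:* N.con 49))) N.:= N.con 2 N.:+ ((N.con 1 N.:+ m) N.:* (N.con 1 N.:+ m) N.:+ t) N.:* N.con 7 N.:* N.con 7) ≡.refl m (tri m))))
      (next (4 ℕ.+ k)
      (addᵢ _ (φ-term (sgn (5 ℕ.+ k)) 5 (m ℕ.* m ℕ.* 7 ℕ.+ m ℕ.* 12 ℕ.+ tri m ℕ.* 7 ℕ.+ 5) (φ-sgn (5 ℕ.+ k))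
        (≡.trans (cong (λ x → (5 ℕ.+ k) ℕ.* (5 ℕ.+ k) ℕ.+ (5 ℕ.+ k ℕ.+ (4 ℕ.+ k ℕ.+ x))) (tri-7 m)) (N.solve 2 (λ m t → let k = m N.:* N.con 7 in (N.con 5 N.:+ k) N.:* (N.con 5 N.:+ k) N.:+ (N.con 5 N.:+ k N.:+ (N.con 4 N.:+ k N.:+ (N.con 6 N.:+ t N.:* N.con 49))) N.:= N.con 5 N.:+ (m N.:* m N.:* N.con 7 N.:+ m N.:* N.con 12 N.:+ t N.:* N.con 7 N.:+ N.con 5) N.:* N.con 7) ≡.refl m (tri m))))
      (add₀ _ (φ-term₀ (sgn (5 ℕ.+ k)) (φ-sgn (5 ℕ.+ k)) _ (m ℕ.* m ℕ.* 7 ℕ.+ m ℕ.* 11 ℕ.+ tri m ℕ.* 7 ℕ.+ 5)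
        (≡.trans (cong (λ x → (5 ℕ.+ k) ℕ.* (5 ℕ.+ k) ℕ.+ (4 ℕ.+ k ℕ.+ x)) (tri-7 m)) (N.solve 2 (λ m t → let k = m N.:* N.con 7 in (N.con 5 N.:+ k) N.:* (N.con 5 N.:+ k) N.:+ (N.con 4 N.:+ k N.:+ (N.con 6 N.:+ t N.:* N.con 49)) N.:= (m N.:* m N.:* N.con 7 N.:+ m N.:* N.con 11 N.:+ t N.:* N.con 7 N.:+ N.con 5) N.:* N.con 7) ≡.refl m (tri m))))
      (next (3 ℕ.+ k)
      (addᵢ _ (φ-term (sgn (4 ℕ.+ k)) 5 (m ℕ.* m ℕ.* 7 ℕ.+ m ℕ.* 9 ℕ.+ tri m ℕ.* 7 ℕ.+ 3) (φ-sgn (4 ℕ.+ k))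
        (≡.trans (cong (λ x → (4 ℕ.+ k) ℕ.* (4 ℕ.+ k) ℕ.+ (4 ℕ.+ k ℕ.+ x)) (tri-7 m)) (N.solve 2 (λ m t → let k = m N.:* N.con 7 in (N.con 4 N.:+ k) N.:* (N.con 4 N.:+ k) N.:+ (N.con 4 N.:+ k N.:+ (N.con 6 N.:+ t N.:* N.con 49)) N.:= N.con 5 N.:+ (m N.:* m N.:* N.con 7 N.:+ m N.:* N.con 9 N.:+ t N.:* N.con 7 N.:+ N.con 3) N.:* N.con 7) ≡.refl m (tri m))))
      (add₁ _ (φ-term₁ (sgn (4 ℕ.+ k)) (φ-sgn (4 ℕ.+ k)) _ (m ℕ.* m ℕ.* 7 ℕ.+ m ℕ.* 8 ℕ.+ tri m ℕ.* 7 ℕ.+ 3)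
        (≡.trans (cong (λ x → (4 ℕ.+ k) ℕ.* (4 ℕ.+ k) ℕ.+ x) (tri-7 m)) (N.solve 2 (λ m t → let k = m N.:* N.con 7 in (N.con 4 N.:+ k) N.:* (N.con 4 N.:+ k) N.:+ (N.con 6 N.:+ t N.:* N.con 49) N.:= N.con 1 N.:+ (m N.:* m N.:* N.con 7 N.:+ m N.:* N.con 8 N.:+ t N.:* N.con 7 N.:+ N.con 3) N.:* N.con 7) ≡.refl m (tri m))))
      h)))))))))))))))))))))

  pent-shape : ∀ m → PS.HasShape (pent (3 ℕ.+ m ℕ.* 7)) (pent m)
  pent-shape (suc m) = PentStep.step m (pent-shape m)
  pent-shape zero    = shape-≈ʳ (≈trans (SR.+-identityˡ _) (SR.*-identityˡ 1ˢ)) (shape-≈ eq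
      (addᵢ (sgn 2 · q ^ 0) (φ-term (sgn 2) 5 0 (φ-sgn 2) ≡.refl)
      (addᵢ (sgn 3 · q ^ 1) (φ-term (sgn 3) 5 1 (φ-sgn 3) ≡.refl)
      (add₁ (sgn 1 · q ^ 0) (φ-term₁ (sgn 1) (φ-sgn 1) 1 0 ≡.refl)
      (add₁ (sgn 3 · q ^ 2) (φ-term₁ (sgn 3) (φ-sgn 3) 15 2 ≡.refl)
      (add₀ (sgn 0 · q ^ 0) (φ-term₀ (sgn 0) (φ-sgn 0) 0 0 ≡.refl)
      (add₀ (sgn 2 · q ^ 1) (φ-term₀ (sgn 2) (φ-sgn 2) 7 1 ≡.refl)
      (addᵤ (sgn 0 · q ^ 0) (≈trans (solve≈ 1 (λ s → :- con 1ℤ :* con 1ℤ :* s := :- (con 1ℤ :* s)) ≈-refl (q ^ 2))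
          (≈trans (⊖-cong (φφ-term (sgn 0) (φ-sgn 0) 2 2 0 ≡.refl)) (solve≈ 2 (λ s x → :- (s :* x) := :- s :* x) ≈-refl (q ^ 2) _)))
      zeroShape))))))))
    where
    open PS
    eq : pent 3 ≈ 0ˢ ⊕ sgn 1 · q ^ 2 ⊕ sgn 2 · q ^ 7 ⊕ sgn 0 · q ^ 0 ⊕ sgn 3 · q ^ 15 ⊕ sgn 1 · q ^ 1 ⊕ sgn 3 · q ^ 12 ⊕ sgn 2 · q ^ 5
    eq = ≈trans (solve≈ 1 (λ q → con 1ℤ :+ :- con 1ℤ :* con 1ℤ :* (q :^ 1 :+ q :^ 2)
          :+ :- con 1ℤ :* (:- con 1ℤ :* con 1ℤ) :* (q :^ 5 :+ q :^ 7)
          :+ :- con 1ℤ :* (:- con 1ℤ :* (:- con 1ℤ :* con 1ℤ)) :* (q :^ 12 :+ q :^ 15)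
        := con 0ℤ :+ :- con 1ℤ :* con 1ℤ :* q :^ 2 :+ :- con 1ℤ :* (:- con 1ℤ :* con 1ℤ) :* q :^ 7 :+ con 1ℤ :* con 1ℤ
          :+ :- con 1ℤ :* (:- con 1ℤ :* (:- con 1ℤ :* con 1ℤ)) :* q :^ 15 :+ :- con 1ℤ :* con 1ℤ :* q :^ 1
          :+ :- con 1ℤ :* (:- con 1ℤ :* (:- con 1ℤ :* con 1ℤ)) :* q :^ 12 :+ :- con 1ℤ :* (:- con 1ℤ :* con 1ℤ) :* q :^ 5) ≈-refl q)
      (⊕-cong (⊕-cong (⊕-cong (⊕-cong (⊕-cong (⊕-cong (⊕-cong ι-0 ≈-refl) ≈-refl) ≈-refl) ≈-refl) ≈-refl) ≈-refl) ≈-refl)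

  signedOdd : ℕ → Series
  signedOdd n = sgn n · odd n

  φ-signedOdd : ∀ n → φ (signedOdd n) ≈ signedOdd n
  φ-signedOdd n = ≈trans (φ-· (sgn n) (odd n)) (·-cong (φ-sgn n) (φ-odd n))

  jacobi-marked : ∀ {κ} g e e′ → κ ≈ ι -[1+ 6 ] · signedOdd g → e ≡ 6 ℕ.+ e′ ℕ.* 7 ℕ.* 7 →
                  κ · q ^ e ≈ ι -[1+ 6 ] · q ^ 6 · φ (φ (signedOdd g · q ^ e′))
  jacobi-marked g e e′ p r = ≈trans (·-congʳ _ p) (≈trans (SR.*-assoc _ _ _)
    (≈trans (·-congˡ _ (φφ-term (signedOdd g) (φ-signedOdd g) e 6 e′ r)) (≈sym (SR.*-assoc _ _ _))))

  module JacobiStep (m : ℕ) where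
    open JS
    k : ℕ
    k = m ℕ.* 7

    -- 7 m + 10 is the only index of the block congruent to 3 modulo 7, where 2 n + 1 becomes 7 (2
    -- (m + 1) + 1); its parity is opposite to that of m + 1, whence the sign.
    κ-10 : signedOdd (10 ℕ.+ k) ≈ ι -[1+ 6 ] · signedOdd (suc m)
    κ-10 = ≈trans (·-cong (≈trans (solve≈ 1 (λ s →
        :- con 1ℤ :* (:- con 1ℤ :* (:- con 1ℤ :* (:- con 1ℤ :* (:- con 1ℤ :* (:- con 1ℤ :* (:- con 1ℤ :* (:- con 1ℤ :* (:- con 1ℤ :* (:- con 1ℤ :* s)))))))))
        := :- (:- con 1ℤ :* s)) ≈-refl (sgn k)) (⊖-cong (·-congˡ (⊖ 1ˢ) (sgn-7 m)))) (odd-7 (suc m)))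
      (solve≈ 2 (λ s o → :- s :* (con (+ 7) :* o) := con -[1+ 6 ] :* (s :* o)) ≈-refl (sgn (suc m)) (odd (suc m)))

    step : HasShape (jacobiSum (6 ℕ.+ k)) (jacobiSum m) → HasShape (jacobiSum (13 ℕ.+ k)) (jacobiSum (suc m))
    step h =
      (add₀ _ (φ-term₀ (signedOdd (13 ℕ.+ k)) (φ-signedOdd (13 ℕ.+ k)) _ (m ℕ.* m ℕ.* 0 ℕ.+ m ℕ.* 10 ℕ.+ tri m ℕ.* 7 ℕ.+ 13)
        (≡.trans (cong (λ x → (13 ℕ.+ k ℕ.+ (12 ℕ.+ k ℕ.+ (11 ℕ.+ k ℕ.+ (10 ℕ.+ k ℕ.+ (9 ℕ.+ k ℕ.+ (8 ℕ.+ k ℕ.+ (7 ℕ.+ k ℕ.+ (6 ℕ.+ k ℕ.+ (5 ℕ.+ k ℕ.+ (4 ℕ.+ k ℕ.+ x))))))))))) (tri-7 m)) (N.solve 2 (λ m t → let k = m N.:* N.con 7 in (N.con 13 N.:+ k N.:+ (N.con 12 N.:+ k N.:+ (N.con 11 N.:+ k N.:+ (N.con 10 N.:+ k N.:+ (N.con 9 N.:+ k N.:+ (N.con 8 N.:+ k N.:+ (N.con 7 N.:+ k N.:+ (N.con 6 N.:+ k N.:+ (N.con 5 N.:+ k N.:+ (N.con 4 N.:+ k N.:+ (N.con 6 N.:+ t N.:* N.con 49))))))))))) N.:= (m N.:* m N.:* N.con 0 N.:+ m N.:* N.con 10 N.:+ t N.:* N.con 7 N.:+ N.con 13) N.:*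 N.con 7) ≡.refl m (tri m))))
      (add₁ _ (φ-term₁ (signedOdd (12 ℕ.+ k)) (φ-signedOdd (12 ℕ.+ k)) _ (m ℕ.* m ℕ.* 0 ℕ.+ m ℕ.* 9 ℕ.+ tri m ℕ.* 7 ℕ.+ 11)
        (≡.trans (cong (λ x → (12 ℕ.+ k ℕ.+ (11 ℕ.+ k ℕ.+ (10 ℕ.+ k ℕ.+ (9 ℕ.+ k ℕ.+ (8 ℕ.+ k ℕ.+ (7 ℕ.+ k ℕ.+ (6 ℕ.+ k ℕ.+ (5 ℕ.+ k ℕ.+ (4 ℕ.+ k ℕ.+ x)))))))))) (tri-7 m)) (N.solve 2 (λ m t → let k = m N.:* N.con 7 in (N.con 12 N.:+ k N.:+ (N.con 11 N.:+ k N.:+ (N.con 10 N.:+ k N.:+ (N.con 9 N.:+ k N.:+ (N.con 8 N.:+ k N.:+ (N.con 7 N.:+ k N.:+ (N.con 6 N.:+ k N.:+ (N.con 5 N.:+ k N.:+ (N.con 4 N.:+ k N.:+ (N.con 6 N.:+ t N.:* N.con 49)))))))))) N.:= N.con 1 N.:+ (m N.:* m N.:* N.con 0 N.:+ m N.:* N.con 9 N.:+ t N.:* N.con 7 N.:+ N.con 11) N.:* N.con 7) ≡.refl m (tri m))))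
      (addᵢ _ (φ-term (signedOdd (11 ℕ.+ k)) 3 (m ℕ.* m ℕ.* 0 ℕ.+ m ℕ.* 8 ℕ.+ tri m ℕ.* 7 ℕ.+ 9) (φ-signedOdd (11 ℕ.+ k))
        (≡.trans (cong (λ x → (11 ℕ.+ k ℕ.+ (10 ℕ.+ k ℕ.+ (9 ℕ.+ k ℕ.+ (8 ℕ.+ k ℕ.+ (7 ℕ.+ k ℕ.+ (6 ℕ.+ k ℕ.+ (5 ℕ.+ k ℕ.+ (4 ℕ.+ k ℕ.+ x))))))))) (tri-7 m)) (N.solve 2 (λ m t → let k = m N.:* N.con 7 in (N.con 11 N.:+ k N.:+ (N.con 10 N.:+ k N.:+ (N.con 9 N.:+ k N.:+ (N.con 8 N.:+ k N.:+ (N.con 7 N.:+ k N.:+ (N.con 6 N.:+ k N.:+ (N.con 5 N.:+ k N.:+ (N.con 4 N.:+ k N.:+ (N.con 6 N.:+ t N.:* N.con 49))))))))) N.:= N.con 3 N.:+ (m N.:* m N.:* N.con 0 N.:+ m N.:* N.con 8 N.:+ t N.:* N.con 7 N.:+ N.con 9) N.:* N.con 7) ≡.refl m (tri m))))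
      (addᵤ _ (jacobi-marked (suc m) _ (tri (suc m)) κ-10
        (≡.trans (cong (λ x → (10 ℕ.+ k ℕ.+ (9 ℕ.+ k ℕ.+ (8 ℕ.+ k ℕ.+ (7 ℕ.+ k ℕ.+ (6 ℕ.+ k ℕ.+ (5 ℕ.+ k ℕ.+ (4 ℕ.+ k ℕ.+ x)))))))) (tri-7 m)) (N.solve 2 (λ m t → let k = m N.:* N.con 7 in (N.con 10 N.:+ k N.:+ (N.con 9 N.:+ k N.:+ (N.con 8 N.:+ k N.:+ (N.con 7 N.:+ k N.:+ (N.con 6 N.:+ k N.:+ (N.con 5 N.:+ k N.:+ (N.con 4 N.:+ k N.:+ (N.con 6 N.:+ t N.:* N.con 49)))))))) N.:= N.con 6 N.:+ (N.con 1 N.:+ m N.:+ t) N.:* N.con 7 N.:* N.con 7) ≡.refl m (tri m))))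
      (addᵢ _ (φ-term (signedOdd (9 ℕ.+ k)) 3 (m ℕ.* m ℕ.* 0 ℕ.+ m ℕ.* 6 ℕ.+ tri m ℕ.* 7 ℕ.+ 6) (φ-signedOdd (9 ℕ.+ k))
        (≡.trans (cong (λ x → (9 ℕ.+ k ℕ.+ (8 ℕ.+ k ℕ.+ (7 ℕ.+ k ℕ.+ (6 ℕ.+ k ℕ.+ (5 ℕ.+ k ℕ.+ (4 ℕ.+ k ℕ.+ x))))))) (tri-7 m)) (N.solve 2 (λ m t → let k = m N.:* N.con 7 in (N.con 9 N.:+ k N.:+ (N.con 8 N.:+ k N.:+ (N.con 7 N.:+ k N.:+ (N.con 6 N.:+ k N.:+ (N.con 5 N.:+ k N.:+ (N.con 4 N.:+ k N.:+ (N.con 6 N.:+ t N.:* N.con 49))))))) N.:= N.con 3 N.:+ (m N.:* m N.:* N.con 0 N.:+ m N.:* N.con 6 N.:+ t N.:* N.con 7 N.:+ N.con 6) N.:* N.con 7) ≡.refl m (tri m))))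
      (add₁ _ (φ-term₁ (signedOdd (8 ℕ.+ k)) (φ-signedOdd (8 ℕ.+ k)) _ (m ℕ.* m ℕ.* 0 ℕ.+ m ℕ.* 5 ℕ.+ tri m ℕ.* 7 ℕ.+ 5)
        (≡.trans (cong (λ x → (8 ℕ.+ k ℕ.+ (7 ℕ.+ k ℕ.+ (6 ℕ.+ k ℕ.+ (5 ℕ.+ k ℕ.+ (4 ℕ.+ k ℕ.+ x)))))) (tri-7 m)) (N.solve 2 (λ m t → let k = m N.:* N.con 7 in (N.con 8 N.:+ k N.:+ (N.con 7 N.:+ k N.:+ (N.con 6 N.:+ k N.:+ (N.con 5 N.:+ k N.:+ (N.con 4 N.:+ k N.:+ (N.con 6 N.:+ t N.:* N.con 49)))))) N.:= N.con 1 N.:+ (m N.:* m N.:* N.con 0 N.:+ m N.:* N.con 5 N.:+ t N.:* N.con 7 N.:+ N.con 5) N.:* N.con 7) ≡.refl m (tri m))))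
      (add₀ _ (φ-term₀ (signedOdd (7 ℕ.+ k)) (φ-signedOdd (7 ℕ.+ k)) _ (m ℕ.* m ℕ.* 0 ℕ.+ m ℕ.* 4 ℕ.+ tri m ℕ.* 7 ℕ.+ 4)
        (≡.trans (cong (λ x → (7 ℕ.+ k ℕ.+ (6 ℕ.+ k ℕ.+ (5 ℕ.+ k ℕ.+ (4 ℕ.+ k ℕ.+ x))))) (tri-7 m)) (N.solve 2 (λ m t → let k = m N.:* N.con 7 in (N.con 7 N.:+ k N.:+ (N.con 6 N.:+ k N.:+ (N.con 5 N.:+ k N.:+ (N.con 4 N.:+ k N.:+ (N.con 6 N.:+ t N.:* N.con 49))))) N.:= (m N.:* m N.:* N.con 0 N.:+ m N.:* N.con 4 N.:+ t N.:* N.con 7 N.:+ N.con 4) N.:* N.con 7) ≡.refl m (tri m))))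
      h)))))))

  jacobi-shape : ∀ m → JS.HasShape (jacobiSum (6 ℕ.+ m ℕ.* 7)) (jacobiSum m)
  jacobi-shape (suc m) = JacobiStep.step m (jacobi-shape m)
  jacobi-shape zero    = shape-≈ʳ (SR.+-identityˡ _) (shape-≈ eq
      (add₀ _ (φ-term₀ (signedOdd 6) (φ-signedOdd 6) 21 3 ≡.refl)
      (add₁ _ (φ-term₁ (signedOdd 5) (φ-signedOdd 5) 15 2 ≡.refl)
      (addᵢ _ (φ-term (signedOdd 4) 3 1 (φ-signedOdd 4) ≡.refl)
      (addᵤ _ (jacobi-marked 0 6 0 (·-cong-3) ≡.refl)
      (addᵢ _ (φ-term (signedOdd 2) 3 0 (φ-signedOdd 2) ≡.refl)
      (add₁ _ (φ-term₁ (signedOdd 1) (φ-signedOdd 1) 1 0 ≡.refl)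
      (add₀ _ (φ-term₀ (signedOdd 0) (φ-signedOdd 0) 0 0 ≡.refl)
      zeroShape))))))))
    where
    open JS
    ·-cong-3 : signedOdd 3 ≈ ι -[1+ 6 ] · signedOdd 0
    ·-cong-3 = solve≈ 0 (:- con 1ℤ :* (:- con 1ℤ :* (:- con 1ℤ :* con 1ℤ)) :* (con 1ℤ :+ con (+ 2) :+ con (+ 2) :+ con (+ 2))
      := con -[1+ 6 ] :* (con 1ℤ :* con 1ℤ)) ≈-refl
    eq : jacobiSum 6 ≈ 0ˢ ⊕ signedOdd 0 · q ^ 0 ⊕ signedOdd 1 · q ^ 1 ⊕ signedOdd 2 · q ^ 3 ⊕ signedOdd 3 · q ^ 6
         ⊕ signedOdd 4 · q ^ 10 ⊕ signedOdd 5 · q ^ 15 ⊕ signedOdd 6 · q ^ 21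
    eq = ⊕-cong (⊕-cong (⊕-cong (⊕-cong (⊕-cong (⊕-cong (≈sym (SR.+-identityˡ _)) ≈-refl) ≈-refl) ≈-refl) ≈-refl) ≈-refl) ≈-refl

-- The 7-dissection of the Euler product and the two relations between its components.

module EulerDissection where
  open SeriesRing
  open Operators
  open Pentagonal
  open TripleProduct
  open JacobiCube
  open ResidueClasses
  open import Data.Nat as ℕ using (ℕ; zero; suc; _<_; z≤n; s≤s)
  import Data.Nat.Properties as ℕP
  open import Data.Integer using (+_; -[1+_]; 0ℤ; 1ℤ; -1ℤ)
  open import Data.Fin using (zero; suc)
  open import Data.Vec using (Vec; []; _∷_; lookup)
  open import Relation.Binary.PropositionalEquality as ≡ using (_≡_)

  open Solver using (Polynomial; op; con; var; _:^_; :-_; _:+_; _:*_; _:-_; _:=_) renaming (solve to solve≈)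
  private
    variable
      f g g′ : Series
      N : ℕ

  tail-cong[] : f ≈[ suc N ] g → tail f ≈[ N ] tail g
  tail-cong[] p = mk λ n l → _≈[_]_.below p (suc n) (s≤s l)

  opaque
    unfolding _·_ φ

    tail-q· : ∀ f → tail (q · f) ≈ f
    tail-q· f = mk (q·-suc f)

    tail-U-at-0 : ∀ f → tail (U f) 0 ≡ f 7
    tail-U-at-0 f = ≡.refl

    U-at-0 : ∀ f → U f 0 ≡ f 0
    U-at-0 f = ≡.refl

    E-at-0 : E 0 ≡ 1ℤ
    E-at-0 = ≡.refl

    E-at-1 : E 1 ≡ -1ℤ
    E-at-1 = ≡.refl

    E-at-5 : E 5 ≡ 1ℤ
    E-at-5 = ≡.refl

  U-q^φ′ : ∀ i f → 0 < i → i < 7 → U (q ^ (7 ℕ.+ i) · φ f) ≈ 0ˢ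
  U-q^φ′ (suc i) f _ (s≤s i<6) = ≈trans (U-cong (≈trans (·-congʳ (φ f) (≈trans (q^-+ 7 (suc i)) (·-congʳ (q ^ suc i) (≈sym φ-q))))
    (SR.*-assoc (φ q) (q ^ suc i) (φ f)))) (≈trans (U-φ· q (q ^ suc i · φ f)) (≈trans (·-congˡ q (U-q^φ i f i<6)) (SR.zeroʳ q)))

  U-q⁷φ : ∀ f → U (q ^ 7 · φ f) ≈ q · f
  U-q⁷φ f = ≈trans (U-cong (·-congʳ (φ f) (≈sym φ-q))) (≈trans (U-φ· q (φ f)) (·-congˡ q (U-φ f)))

  -- q⁶ and q² move the classes 1 and 5 to exponents divisible by 7; U then yields q times the
  -- component, and `tail` removes that q.
  a₀ b₀ c₀ e₀ : Series
  a₀ = U E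
  b₀ = tail (U (q ^ 6 · E))
  c₀ = tail (U (q ^ 2 · E))
  e₀ = φ E

  pattern lt₁ = s≤s z≤n
  pattern lt₂ = s≤s lt₁
  pattern lt₃ = s≤s lt₂
  pattern lt₄ = s≤s lt₃
  pattern lt₅ = s≤s lt₄
  pattern lt₆ = s≤s lt₅
  pattern lt₇ = s≤s lt₆

  U-⊕₄ : ∀ {w x y z w′ x′ y′ z′} → U w ≈ w′ → U x ≈ x′ → U y ≈ y′ → U z ≈ z′ →
         U (w ⊕ x ⊕ y ⊕ z) ≈ w′ ⊕ x′ ⊕ y′ ⊕ z′
  U-⊕₄ p q r s = ≈trans (U-⊕ _ _) (⊕-cong (≈trans (U-⊕ _ _) (⊕-cong (≈trans (U-⊕ _ _) (⊕-cong p q)) r)) s)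

  first second third fourth : ∀ x → Series
  first x = x ⊕ 0ˢ ⊕ 0ˢ ⊕ 0ˢ
  second x = 0ˢ ⊕ x ⊕ 0ˢ ⊕ 0ˢ
  third x = 0ˢ ⊕ 0ˢ ⊕ x ⊕ 0ˢ
  fourth x = 0ˢ ⊕ 0ˢ ⊕ 0ˢ ⊕ x

  first-≈ : ∀ x → first x ≈ x
  first-≈ x = ≈trans (SR.+-identityʳ _) (≈trans (SR.+-identityʳ _) (SR.+-identityʳ _))
  second-≈ : ∀ x → second x ≈ x
  second-≈ x = ≈trans (SR.+-identityʳ _) (≈trans (SR.+-identityʳ _) (SR.+-identityˡ _))
  third-≈ : ∀ x → third x ≈ x
  third-≈ x = ≈trans (SR.+-identityʳ _) (≈trans (⊕-cong (SR.+-identityʳ 0ˢ) ≈-refl) (SR.+-identityˡ _))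
  fourth-≈ : ∀ x → fourth x ≈ x
  fourth-≈ x = ≈trans (⊕-cong (≈trans (SR.+-identityʳ _) (SR.+-identityʳ 0ˢ)) ≈-refl) (SR.+-identityˡ x)

  q·q^ : ∀ i j f → q ^ i · (q ^ j · f) ≈ q ^ (i ℕ.+ j) · f
  q·q^ i j f = ≈trans (≈sym (SR.*-assoc (q ^ i) (q ^ j) f)) (·-congʳ f (≈sym (q^-+ i j)))

  -- The partial sums only provide components that vary with N. Extracting them by U shows that they
  -- agree up to order N with the fixed series, so the equation holds to every order.
  E-dissection : E ≈ φ a₀ ⊕ q · φ b₀ ⊕ q ^ 5 · φ c₀ ⊕ ⊖ q ^ 2 · φ e₀
  E-dissection = ≈[]⇒≈ λ N → lemma N (pent-shape (suc N))
    where
    open PS using (HasShape; mkShape; shape)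
    lemma : ∀ N → HasShape (pent (3 ℕ.+ suc N ℕ.* 7)) (pent (suc N)) → E ≈[ N ] shape a₀ b₀ c₀ E
    lemma N (mkShape {a} {b} {c} eq) = ≈[]-trans E-≈ (≈[]-trans (≈⇒≈[] eq)
      (⊕-cong[] (⊕-cong[] (⊕-cong[] (φ-cong[] (≈[]-sym a-≈)) (·-cong[] (≈⇒≈[] ≈-refl) (φ-cong[] (≈[]-sym b-≈))))
        (·-cong[] (≈⇒≈[] ≈-refl) (φ-cong[] (≈[]-sym c-≈))))
        (·-cong[] (≈⇒≈[] ≈-refl) (φ-cong[] (φ-cong[] (≈[]-sym (≈[]-weaken (ℕP.n≤1+n N) (pentagonal (suc N)))))))))
      where
      -- The partial sum belongs to N + 1 because `tail` costs one coefficient.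
      M : ℕ
      M = 3 ℕ.+ suc N ℕ.* 7
      E-≈M : E ≈[ suc N ℕ.* 7 ] pent M
      E-≈M = ≈[]-weaken (ℕP.m≤n+m (suc N ℕ.* 7) 3) (pentagonal M)
      E-≈ : E ≈[ N ] pent M
      E-≈ = ≈[]-weaken (ℕP.≤-trans (ℕP.m≤m*n N 7) (ℕP.m≤n+m (N ℕ.* 7) 10)) (pentagonal M)
      pN : Series
      pN = pent (suc N)
      U-part : ∀ k x → U (q ^ k · shape a b c pN) ≈ x → U (q ^ k · E) ≈[ suc N ] x
      U-part k x p = ≈[]-trans (U-cong[] (·-cong[] (≈⇒≈[] ≈-refl) E-≈M)) (≈⇒≈[] (≈trans (U-cong (·-congˡ (q ^ k) eq)) p))
      expand : ∀ k → q ^ k · shape a b c pN ≈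
               q ^ (k ℕ.+ 0) · φ a ⊕ q ^ (k ℕ.+ 1) · φ b ⊕ q ^ (k ℕ.+ 5) · φ c ⊕ q ^ (k ℕ.+ 2) · φ (⊖ φ pN)
      expand k = ≈trans (solve≈ 8 (λ x a q b r c t d → x :* (a :+ q :* b :+ r :* c :+ :- t :* d)
          := x :* (con 1ℤ :* a) :+ x :* (q :^ 1 :* b) :+ x :* (r :* c) :+ x :* (t :* :- d)) ≈-refl
          (q ^ k) (φ a) q (φ b) (q ^ 5) (φ c) (q ^ 2) (φ (φ pN)))
        (⊕-cong (⊕-cong (⊕-cong (q·q^ k 0 _) (q·q^ k 1 _)) (q·q^ k 5 _)) (≈trans (·-congˡ _ (·-congˡ _ (≈sym (φ-⊖ (φ pN))))) (q·q^ k 2 _)))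
      a-≈ : a₀ ≈[ N ] a
      a-≈ = ≈[]-trans (≈⇒≈[] (U-cong (≈sym (SR.*-identityˡ E)))) (≈[]-weaken (ℕP.n≤1+n N) (U-part 0 a (≈trans (U-cong (expand 0))
        (≈trans (U-⊕₄ (≈trans (U-cong (SR.*-identityˡ _)) (U-φ a)) (U-q^φ 0 b lt₁) (U-q^φ 4 c lt₅) (U-q^φ 1 _ lt₂)) (first-≈ a)))))
      b-≈ : b₀ ≈[ N ] b
      b-≈ = ≈[]-trans (tail-cong[] (U-part 6 (q · b) (≈trans (U-cong (expand 6))
        (≈trans (U-⊕₄ (U-q^φ 5 a lt₆) (U-q⁷φ b) (U-q^φ′ 4 c lt₁ lt₅) (U-q^φ′ 1 _ lt₁ lt₂)) (second-≈ (q · b))))))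
        (≈⇒≈[] (tail-q· b))
      c-≈ : c₀ ≈[ N ] c
      c-≈ = ≈[]-trans (tail-cong[] (U-part 2 (q · c) (≈trans (U-cong (expand 2))
        (≈trans (U-⊕₄ (U-q^φ 1 a lt₂) (U-q^φ 2 b lt₃) (U-q⁷φ c) (U-q^φ 3 _ lt₄)) (third-≈ (q · c))))))
        (≈⇒≈[] (tail-q· c))

  U-E³ : ∀ (k : ℕ) (x : Series → Series) → (∀ {a b c g} → U (q ^ k · JS.shape a b c g) ≈ x g) →
         (∀ {N g g′} → g ≈[ N ] g′ → x g ≈[ N ] x g′) → U (q ^ k · E ^ 3) ≈ x (E ^ 3)
  U-E³ k x p x-cong = ≈[]⇒≈ λ N → lemma N (jacobi-shape N)
    where
    open JS using (HasShape; mkShape)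
    lemma : ∀ N → HasShape (jacobiSum (6 ℕ.+ N ℕ.* 7)) (jacobiSum N) → U (q ^ k · E ^ 3) ≈[ N ] x (E ^ 3)
    lemma N (mkShape eq) = ≈[]-trans
      (U-cong[] (·-cong[] (≈⇒≈[] ≈-refl) (≈[]-weaken (ℕP.m≤n+m (N ℕ.* 7) 6) (jacobi (6 ℕ.+ N ℕ.* 7)))))
      (≈[]-trans (≈⇒≈[] (≈trans (U-cong (·-congˡ _ eq)) p)) (x-cong (≈[]-sym (jacobi N))))

  expand-JS : ∀ k {a b c g} → q ^ k · JS.shape a b c g ≈
    q ^ (k ℕ.+ 0) · φ a ⊕ q ^ (k ℕ.+ 1) · φ b ⊕ q ^ (k ℕ.+ 3) · φ c ⊕ q ^ (k ℕ.+ 6) · φ (ι -[1+ 6 ] · φ g)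
  expand-JS k {a} {b} {c} {g} = ≈trans (solve≈ 8 (λ x a q b r c t d → x :* (a :+ q :* b :+ r :* c :+ con -[1+ 6 ] :* t :* d)
      := x :* (con 1ℤ :* a) :+ x :* (q :^ 1 :* b) :+ x :* (r :* c) :+ x :* (t :* (con -[1+ 6 ] :* d))) ≈-refl
      (q ^ k) (φ a) q (φ b) (q ^ 3) (φ c) (q ^ 6) (φ (φ g)))
    (⊕-cong (⊕-cong (⊕-cong (q·q^ k 0 _) (q·q^ k 1 _)) (q·q^ k 3 _))
      (≈trans (·-congˡ _ (·-congˡ _ (≈trans (·-congʳ _ (≈sym (φ-ι -[1+ 6 ]))) (≈sym (φ-· (ι -[1+ 6 ]) (φ g)))))) (q·q^ k 6 _)))

  U-qE³ : U (q ^ 1 · E ^ 3) ≈ q · (ι -[1+ 6 ] · φ (E ^ 3))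
  U-qE³ = U-E³ 1 (λ g → q · (ι -[1+ 6 ] · φ g))
    (λ {a} {b} {c} {g} → ≈trans (U-cong (expand-JS 1)) (≈trans (U-⊕₄ (U-q^φ 0 a lt₁) (U-q^φ 1 b lt₂) (U-q^φ 3 c lt₄) (U-q⁷φ _)) (fourth-≈ _)))
    (λ p → ·-cong[] (≈⇒≈[] ≈-refl) (·-cong[] (≈⇒≈[] ≈-refl) (φ-cong[] p)))

  -- U sees the exponents of E³ congruent to 2 modulo 7, and no triangular number is.
  U-q⁵E³ : U (q ^ 5 · E ^ 3) ≈ 0ˢ
  U-q⁵E³ = U-E³ 5 (λ _ → 0ˢ)
    (λ {a} {b} {c} {g} → ≈trans (U-cong (expand-JS 5)) (≈trans (U-⊕₄ (U-q^φ 4 a lt₅) (U-q^φ 5 b lt₆) (U-q^φ′ 1 c lt₁ lt₂) (U-q^φ′ 4 _ lt₁ lt₅)) (first-≈ 0ˢ)))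
    (λ _ → ≈⇒≈[] ≈-refl)

  φ-poly : ∀ {n} (p : Polynomial n) (ρ ρ′ : Vec Series n) → (∀ i → φ (lookup ρ i) ≈ lookup ρ′ i) →
           φ (Solver.⟦ p ⟧ ρ) ≈ Solver.⟦ p ⟧ ρ′
  φ-poly (op Solver.[+] p s) ρ ρ′ e = ≈trans (φ-+ _ _) (⊕-cong (φ-poly p ρ ρ′ e) (φ-poly s ρ ρ′ e))
  φ-poly (op Solver.[*] p s) ρ ρ′ e = ≈trans (φ-· _ _) (·-cong (φ-poly p ρ ρ′ e) (φ-poly s ρ ρ′ e))
  φ-poly (con c)   ρ ρ′ e = φ-ι c
  φ-poly (var x)   ρ ρ′ e = e x
  φ-poly (p :^ n)  ρ ρ′ e = ≈trans (φ-^ _ n) (^-congˡ n (φ-poly p ρ ρ′ e))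
  φ-poly (:- p)    ρ ρ′ e = ≈trans (φ-⊖ _) (⊖-cong (φ-poly p ρ ρ′ e))

  -- q E³ split by residues modulo 7: the component in q^i φ(…) is cubePart i.
  cubePart : ℕ → Polynomial 5
  cubePart n = part n (var zero) (var (suc zero)) (var (suc (suc zero))) (var (suc (suc (suc zero)))) (var (suc (suc (suc (suc zero)))))
    where
    k : ℕ → Polynomial 5
    k m = con (+ m)
    part : ℕ → (a b c e q : Polynomial 5) → Polynomial 5
    part 0 a b c e q = q :* (k 6 :* a :* b :* c :- e :^ 3)
    part 1 a b c e q = a :^ 3 :+ q :* (k 3 :* b :^ 2 :* c :- k 6 :* a :* c :* e)
    part 2 a b c e q = k 3 :* a :^ 2 :* b :- k 6 :* q :* b :* c :* e :+ q :^ 2 :* c :^ 3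
    part 3 a b c e q = k 3 :* (a :* b :^ 2 :- a :^ 2 :* e :+ q :* c :* e :^ 2)
    part 4 a b c e q = b :^ 3 :- k 6 :* a :* b :* e :+ k 3 :* q :* a :* c :^ 2
    part 5 a b c e q = k 3 :* (a :* e :^ 2 :- b :^ 2 :* e :+ q :* b :* c :^ 2)
    part _ a b c e q = k 3 :* (a :^ 2 :* c :+ b :* e :^ 2 :- q :* c :^ 2 :* e)

  cube : ℕ → Series
  cube i = Solver.⟦ cubePart i ⟧ (a₀ ∷ b₀ ∷ c₀ ∷ e₀ ∷ q ∷ [])

  sum₇ : (ℕ → Series) → Series
  sum₇ f = f 0 ⊕ f 1 ⊕ f 2 ⊕ f 3 ⊕ f 4 ⊕ f 5 ⊕ f 6

  sum₇-cong : ∀ (f g : ℕ → Series) → (∀ i → f i ≈ g i) → sum₇ f ≈ sum₇ g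
  sum₇-cong f g p = ⊕-cong (⊕-cong (⊕-cong (⊕-cong (⊕-cong (⊕-cong (p 0) (p 1)) (p 2)) (p 3)) (p 4)) (p 5)) (p 6)

  U-sum₇ : ∀ f → U (sum₇ f) ≈ sum₇ (λ i → U (f i))
  U-sum₇ f = ≈trans (U-⊕ _ _) (⊕-cong (≈trans (U-⊕ _ _) (⊕-cong (≈trans (U-⊕ _ _) (⊕-cong (≈trans (U-⊕ _ _) (⊕-cong
    (≈trans (U-⊕ _ _) (⊕-cong (U-⊕ _ _) ≈-refl)) ≈-refl)) ≈-refl)) ≈-refl)) ≈-refl)

  qE³ : q ^ 1 · E ^ 3 ≈ sum₇ (λ i → q ^ i · φ (cube i))
  qE³ = ≈trans (·-congˡ (q ^ 1) (^-congˡ 3 E-dissection)) (≈trans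
    (solve≈ 5 (λ a b c e q → q :^ 1 :* (a :+ q :* b :+ q :^ 5 :* c :+ :- (q :^ 2) :* e) :^ 3 :=
       con 1ℤ :* (q :^ 7 :* (k 6 :* a :* b :* c :- e :^ 3))
       :+ q :^ 1 :* (a :^ 3 :+ q :^ 7 :* (k 3 :* b :^ 2 :* c :- k 6 :* a :* c :* e))
       :+ q :^ 2 :* (k 3 :* a :^ 2 :* b :- k 6 :* q :^ 7 :* b :* c :* e :+ (q :^ 7) :^ 2 :* c :^ 3)
       :+ q :^ 3 :* (k 3 :* (a :* b :^ 2 :- a :^ 2 :* e :+ q :^ 7 :* c :* e :^ 2))
       :+ q :^ 4 :* (b :^ 3 :- k 6 :* a :* b :* e :+ k 3 :* q :^ 7 :* a :* c :^ 2)
       :+ q :^ 5 :* (k 3 :* (a :* e :^ 2 :- b :^ 2 :* e :+ q :^ 7 :* b :* c :^ 2))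
       :+ q :^ 6 :* (k 3 :* (a :^ 2 :* c :+ b :* e :^ 2 :- q :^ 7 :* c :^ 2 :* e))) ≈-refl
       (φ a₀) (φ b₀) (φ c₀) (φ e₀) q)
    (sum₇-cong (λ i → q ^ i · Solver.⟦ cubePart i ⟧ ρ′) (λ i → q ^ i · φ (cube i)) λ { 0 → part 0 ; 1 → part 1 ; 2 → part 2 ; 3 → part 3 ; 4 → part 4 ; 5 → part 5 ; (suc (suc (suc (suc (suc (suc n)))))) → last n }))
    where
    k : ∀ {n} → ℕ → Polynomial n
    k m = con (+ m)
    ρ′ : Vec Series 5
    ρ′ = φ a₀ ∷ φ b₀ ∷ φ c₀ ∷ φ e₀ ∷ q ^ 7 ∷ []
    φ-env : ∀ i → φ (lookup (a₀ ∷ b₀ ∷ c₀ ∷ e₀ ∷ q ∷ []) i) ≈ lookup ρ′ i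
    φ-env zero                         = ≈-refl
    φ-env (suc zero)                   = ≈-refl
    φ-env (suc (suc zero))             = ≈-refl
    φ-env (suc (suc (suc zero)))       = ≈-refl
    φ-env (suc (suc (suc (suc zero)))) = φ-q
    part : ∀ i → q ^ i · Solver.⟦ cubePart i ⟧ ρ′ ≈ q ^ i · φ (cube i)
    part i = ·-congˡ (q ^ i) (≈sym (φ-poly (cubePart i) _ ρ′ φ-env))
    last : ∀ n → q ^ (6 ℕ.+ n) · Solver.⟦ cubePart (6 ℕ.+ n) ⟧ ρ′ ≈ q ^ (6 ℕ.+ n) · φ (cube (6 ℕ.+ n))
    last n = part (6 ℕ.+ n)

  sum-zeros : ∀ {a b c d e f g : Series} → a ≈ 0ˢ → b ≈ 0ˢ → c ≈ 0ˢ → d ≈ 0ˢ → e ≈ 0ˢ → f ≈ 0ˢ → g ≈ 0ˢ →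
              ∀ {z} → a ⊕ b ⊕ c ⊕ d ⊕ e ⊕ f ⊕ g ⊕ z ≈ z
  sum-zeros pa pb pc pd pe pf pg = ≈trans (⊕-cong (⊕-cong (⊕-cong (⊕-cong (⊕-cong (⊕-cong (⊕-cong
      (z pa) (z pb)) (z pc)) (z pd)) (z pe)) (z pf)) (z pg)) ≈-refl)
    (solve≈ 1 (λ z → con 0ℤ :+ con 0ℤ :+ con 0ℤ :+ con 0ℤ :+ con 0ℤ :+ con 0ℤ :+ con 0ℤ :+ z := z) ≈-refl _)
    where
    z : ∀ {x : Series} → x ≈ 0ˢ → x ≈ ι 0ℤ
    z p = ≈trans p (≈sym ι-0)

  cube-0 : cube 0 ≈ q · (ι -[1+ 6 ] · φ (E ^ 3))
  cube-0 = ≈trans (≈sym (≈trans (U-cong qE³) (≈trans (U-sum₇ λ i → q ^ i · φ (cube i))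
      (≈trans (⊕-cong (⊕-cong (⊕-cong (⊕-cong (⊕-cong (⊕-cong (≈trans (U-cong (SR.*-identityˡ _)) (U-φ (cube 0)))
        (U-q^φ 0 _ lt₁)) (U-q^φ 1 _ lt₂)) (U-q^φ 2 _ lt₃)) (U-q^φ 3 _ lt₄)) (U-q^φ 4 _ lt₅)) (U-q^φ 5 _ lt₆))
      (≈trans (solve≈ 2 (λ x z → x :+ z :+ z :+ z :+ z :+ z :+ z := z :+ z :+ z :+ z :+ z :+ z :+ z :+ (x :- z)) ≈-refl (cube 0) 0ˢ)
        (≈trans (sum-zeros ≈-refl ≈-refl ≈-refl ≈-refl ≈-refl ≈-refl ≈-refl) (≈trans (⊕-cong ≈-refl (⊖-cong (≈sym ι-0)))
          (solve≈ 1 (λ x → x :- con 0ℤ := x) ≈-refl (cube 0))))))))) U-qE³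

  cube-3 : q · cube 3 ≈ 0ˢ
  cube-3 = ≈trans (≈sym (≈trans (U-cong (≈trans (≈trans (·-congʳ _ (q^-+ 4 1)) (≈trans (SR.*-assoc _ _ _) (·-congˡ (q ^ 4) qE³)))
        distribute)) (≈trans (U-sum₇ λ i → q ^ (4 ℕ.+ i) · φ (cube i))
      (≈trans (⊕-cong (⊕-cong (⊕-cong (⊕-cong (⊕-cong (⊕-cong (U-q^φ 3 _ lt₄) (U-q^φ 4 _ lt₅)) (U-q^φ 5 _ lt₆))
        (U-q⁷φ (cube 3))) (U-q^φ′ 1 _ lt₁ lt₂)) (U-q^φ′ 2 _ lt₁ lt₃)) (U-q^φ′ 3 _ lt₁ lt₄))
      (≈trans (solve≈ 2 (λ x z → z :+ z :+ z :+ x :+ z :+ z :+ z := z :+ z :+ z :+ z :+ z :+ z :+ z :+ (x :- z)) ≈-refl (q · cube 3) 0ˢ)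
        (≈trans (sum-zeros ≈-refl ≈-refl ≈-refl ≈-refl ≈-refl ≈-refl ≈-refl) (≈trans (⊕-cong ≈-refl (⊖-cong (≈sym ι-0)))
          (solve≈ 1 (λ x → x :- con 0ℤ := x) ≈-refl (q · cube 3))))))))) U-q⁵E³
    where
    distribute : q ^ 4 · sum₇ (λ i → q ^ i · φ (cube i)) ≈ sum₇ (λ i → q ^ (4 ℕ.+ i) · φ (cube i))
    distribute = ≈trans (solve≈ 8 (λ x a b c d e f g → x :* (a :+ b :+ c :+ d :+ e :+ f :+ g)
        := x :* a :+ x :* b :+ x :* c :+ x :* d :+ x :* e :+ x :* f :+ x :* g) ≈-refl (q ^ 4) _ _ _ _ _ _ _)
      (sum₇-cong (λ i → q ^ 4 · (q ^ i · φ (cube i))) (λ i → q ^ (4 ℕ.+ i) · φ (cube i)) λ i → q·q^ 4 i (φ (cube i)))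

  -- The class 6 of E³ computed twice: the cube of the dissection gives 6 a b c - e³, Jacobi's
  -- formula gives -7 e³.
  relation₁ : a₀ · b₀ · c₀ ≈ ⊖ e₀ ^ 3
  relation₁ = ι-regular 5 (q-regular (≈trans
    (solve≈ 5 (λ a b c e q → q :* (con (+ 6) :* (a :* b :* c)) := q :* (con (+ 6) :* a :* b :* c :- e :^ 3) :+ q :* e :^ 3)
      ≈-refl a₀ b₀ c₀ e₀ q)
    (≈trans (⊕-cong (≈trans cube-0 (·-congˡ q (·-congˡ _ (φ-^ E 3)))) ≈-refl)
      (solve≈ 2 (λ e q → q :* (con -[1+ 6 ] :* e :^ 3) :+ q :* e :^ 3 := q :* (con (+ 6) :* :- (e :^ 3))) ≈-refl e₀ q))))

  -- The class 2 of E³, absent by Jacobi's formula, is three times the difference of the two sides.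
  relation₂ : a₀ · b₀ ^ 2 ⊕ q · c₀ · e₀ ^ 2 ≈ a₀ ^ 2 · e₀
  relation₂ = ι-regular 2 (q-regular (≈trans
    (solve≈ 5 (λ a b c e q → q :* (con (+ 3) :* (a :* b :^ 2 :+ q :* c :* e :^ 2))
      := q :* (con (+ 3) :* (a :* b :^ 2 :- a :^ 2 :* e :+ q :* c :* e :^ 2)) :+ q :* (con (+ 3) :* (a :^ 2 :* e)))
      ≈-refl a₀ b₀ c₀ e₀ q)
    (≈trans (⊕-cong cube-3 ≈-refl) (SR.+-identityˡ _))))

-- The generators y and r, their relation and their derivatives.

module Generators where
  open SeriesRing
  open Operators
  open Evaluation
  open Identities
  open Pentagonal
  open EulerDissection
  open import Data.Nat using (zero; suc)
  open import Data.Integer as ℤ using (ℤ; +_; 0ℤ; 1ℤ; -1ℤ)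
  open import Data.Product using (_,_)
  open import Data.Unit using (tt)
  open import Relation.Binary.PropositionalEquality as ≡ using (_≡_; cong; cong₂)

  open Solver using (_:^_; :-_; _:+_; _:*_; _:-_; _:=_; con) renaming (solve to solve≈)
  open ≈-Reasoning

  Unit : Series → Set
  Unit f = f 0 ≡ 1ℤ

  ·-unit : ∀ f g → Unit f → Unit g → Unit (f · g)
  ·-unit f g p s = ≡.trans (·-0 f g) (cong₂ ℤ._*_ p s)

  ^-unit : ∀ f n → Unit f → Unit (f ^ n)
  ^-unit f zero    p = ι-at-0 1ℤ
  ^-unit f (suc n) p = ·-unit f (f ^ n) p (^-unit f n p)

  φ-unit : ∀ f → Unit f → Unit (φ f)
  φ-unit f p = ≡.trans (φ-at-0 f) p

  opaque
    unfolding _·_ φ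

    D-q : D q ≈ q
    D-q = mk λ { 0 → ≡.refl ; 1 → ≡.refl ; (suc (suc n)) → at (D-ι 0ℤ) (suc (suc n)) }

    q·-at-0 : ∀ f → (q · f) 0 ≡ 0ℤ
    q·-at-0 f = ≡.refl

  E-unit : Unit E
  E-unit = E-at-0

  a₀-unit : Unit a₀
  a₀-unit = ≡.trans (U-at-0 E) E-at-0

  b₀-at-0 : b₀ 0 ≡ -1ℤ
  b₀-at-0 = ≡.trans (tail-U-at-0 (q ^ 6 · E)) (≡.trans (q^·-shift 6 E 1) E-at-1)

  c₀-unit : Unit c₀
  c₀-unit = ≡.trans (tail-U-at-0 (q ^ 2 · E)) (≡.trans (q^·-shift 2 E 5) E-at-5)

  e₀-unit : Unit e₀
  e₀-unit = φ-unit E E-unit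

  -- Ratios of the components of E to the first one. The sign in `y₀` compensates b₀(0) = -1, and
  -- `r₀₀` is r₀ / q; both are units.
  i₀ y₀ z₀ g₀ r₀₀ r₀ w₀ : Series
  i₀ = inv a₀
  y₀ = ⊖ (b₀ · i₀)
  z₀ = e₀ · i₀
  g₀ = c₀ · i₀
  r₀₀ = z₀ · g₀
  r₀ = q · r₀₀
  w₀ = ⟦ wᵉ ⟧₀ r₀

  a₀i₀ : a₀ · i₀ ≈ 1ˢ
  a₀i₀ = inv-right a₀ a₀-unit

  i₀-unit : Unit i₀
  i₀-unit = inv-at-0 a₀

  y₀-unit : Unit y₀
  y₀-unit = ≡.trans (⊖-0 _) (≡.trans (cong ℤ.-_ (≡.trans (·-0 b₀ i₀) (cong₂ ℤ._*_ b₀-at-0 i₀-unit))) ≡.refl)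

  z₀-unit : Unit z₀
  z₀-unit = ·-unit e₀ i₀ e₀-unit i₀-unit

  r₀₀-unit : Unit r₀₀
  r₀₀-unit = ·-unit z₀ g₀ z₀-unit (·-unit c₀ i₀ c₀-unit i₀-unit)

  r₀-at-0 : r₀ 0 ≡ 0ℤ
  r₀-at-0 = q·-at-0 r₀₀

  y₀g₀ : y₀ · g₀ ≈ z₀ ^ 3
  y₀g₀ = begin
    y₀ · g₀                        ≈⟨ solve≈ 3 (λ b i c → :- (b :* i) :* (c :* i) := :- ((b :* i) :* (c :* i) :* con 1ℤ)) ≈-refl b₀ i₀ c₀ ⟩
    ⊖ ((b₀ · i₀) · (c₀ · i₀) · 1ˢ)  ≈⟨ ⊖-cong (·-congˡ _ (≈sym a₀i₀)) ⟩
    ⊖ ((b₀ · i₀) · (c₀ · i₀) · (a₀ · i₀)) ≈⟨ solve≈ 4 (λ a b c i → :- ((b :* i) :* (c :* i) :* (a :* i)) := :- (a :* b :* c :* i :^ 3)) ≈-refl a₀ b₀ c₀ i₀ ⟩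
    ⊖ (a₀ · b₀ · c₀ · i₀ ^ 3)       ≈⟨ ⊖-cong (·-congʳ _ relation₁) ⟩
    ⊖ (⊖ e₀ ^ 3 · i₀ ^ 3)           ≈⟨ solve≈ 2 (λ e i → :- (:- (e :^ 3) :* i :^ 3) := (e :* i) :^ 3) ≈-refl e₀ i₀ ⟩
    z₀ ^ 3                         ∎

  y₀² : y₀ ^ 2 ≈ z₀ · w₀
  y₀² = begin
    y₀ ^ 2
      ≈⟨ solve≈ 2 (λ b i → (:- (b :* i)) :^ 2 := (b :* i) :^ 2 :* con 1ℤ) ≈-refl b₀ i₀ ⟩
    (b₀ · i₀) ^ 2 · 1ˢ
      ≈⟨ ·-congˡ _ (≈sym a₀i₀) ⟩
    (b₀ · i₀) ^ 2 · (a₀ · i₀)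
      ≈⟨ solve≈ 6 (λ a b c e q i → (b :* i) :^ 2 :* (a :* i) :=
           (a :* b :^ 2 :+ q :* c :* e :^ 2) :* i :^ 3 :- q :* c :* e :^ 2 :* i :^ 3) ≈-refl a₀ b₀ c₀ e₀ q i₀ ⟩
    (a₀ · b₀ ^ 2 ⊕ q · c₀ · e₀ ^ 2) · i₀ ^ 3 ⊕ ⊖ (q · c₀ · e₀ ^ 2 · i₀ ^ 3)
      ≈⟨ ⊕-cong (·-congʳ _ relation₂) ≈-refl ⟩
    a₀ ^ 2 · e₀ · i₀ ^ 3 ⊕ ⊖ (q · c₀ · e₀ ^ 2 · i₀ ^ 3)
      ≈⟨ ⊕-cong (solve≈ 3 (λ a e i → a :^ 2 :* e :* i :^ 3 := (a :* i) :^ 2 :* (e :* i)) ≈-refl a₀ e₀ i₀) ≈-refl ⟩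
    (a₀ · i₀) ^ 2 · (e₀ · i₀) ⊕ ⊖ (q · c₀ · e₀ ^ 2 · i₀ ^ 3)
      ≈⟨ ⊕-cong (·-congʳ _ (^-congˡ 2 a₀i₀)) ≈-refl ⟩
    1ˢ ^ 2 · (e₀ · i₀) ⊕ ⊖ (q · c₀ · e₀ ^ 2 · i₀ ^ 3)
      ≈⟨ solve≈ 4 (λ c e q i → con 1ℤ :^ 2 :* (e :* i) :- q :* c :* e :^ 2 :* i :^ 3
           := (e :* i) :* (con 1ℤ :+ con -1ℤ :* (q :* ((e :* i) :* (c :* i))))) ≈-refl c₀ e₀ q i₀ ⟩
    z₀ · w₀ ∎

  -- Elimination of z₀ and g₀: the relations of the dissection read z₀³ = y₀ g₀ and y₀² = z₀ w₀, so
  -- y₀⁸ = z₀ w₀⁴ y₀ g₀, and q z₀ g₀ is r₀.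
  relation₀ : q · y₀ ^ 7 ≈ r₀ · w₀ ^ 4
  relation₀ = unit-regular y₀ y₀-unit (begin
    y₀ · (q · y₀ ^ 7)          ≈⟨ solve≈ 2 (λ y q → y :* (q :* y :^ 7) := q :* (y :^ 2) :^ 4) ≈-refl y₀ q ⟩
    q · (y₀ ^ 2) ^ 4           ≈⟨ ·-congˡ q (^-congˡ 4 y₀²) ⟩
    q · (z₀ · w₀) ^ 4          ≈⟨ solve≈ 3 (λ q z w → q :* (z :* w) :^ 4 := q :* z :* w :^ 4 :* z :^ 3) ≈-refl q z₀ w₀ ⟩
    q · z₀ · w₀ ^ 4 · z₀ ^ 3   ≈⟨ ·-congˡ _ (≈sym y₀g₀) ⟩
    q · z₀ · w₀ ^ 4 · (y₀ · g₀) ≈⟨ solve≈ 5 (λ q z w y g → q :* z :* w :^ 4 :* (y :* g) := y :* (q :* (z :* g) :* w :^ 4)) ≈-refl q z₀ w₀ y₀ g₀ ⟩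
    y₀ · (r₀ · w₀ ^ 4)         ∎)

  y r w : Series
  y = q · φ y₀
  r = φ r₀
  w = ⟦ wᵉ ⟧ y r

  φw₀ : φ w₀ ≈ w
  φw₀ = φ-⟦⟧ {y} {r₀} wᵉ (tt , tt , tt)

  y-rel : y ^ 7 ≈ r · (1ˢ ⊕ ⊖ r) ^ 4
  y-rel = begin
    y ^ 7             ≈⟨ solve≈ 2 (λ q y → (q :* y) :^ 7 := q :^ 7 :* y :^ 7) ≈-refl q (φ y₀) ⟩
    q ^ 7 · φ y₀ ^ 7  ≈⟨ ·-cong (≈sym φ-q) (≈sym (φ-^ y₀ 7)) ⟩
    φ q · φ (y₀ ^ 7)  ≈⟨ ≈sym (φ-· q (y₀ ^ 7)) ⟩
    φ (q · y₀ ^ 7)    ≈⟨ φ-cong relation₀ ⟩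
    φ (r₀ · w₀ ^ 4)   ≈⟨ ≈trans (φ-· r₀ (w₀ ^ 4)) (·-congˡ r (≈trans (φ-^ w₀ 4) (^-congˡ 4 φw₀))) ⟩
    r · w ^ 4         ≈⟨ ·-congˡ r (^-congˡ 4 (solve≈ 1 (λ r → con 1ℤ :+ con -1ℤ :* r := con 1ℤ :- r) ≈-refl r)) ⟩
    r · (1ˢ ⊕ ⊖ r) ^ 4 ∎

  ⟪_⟫ ⟪_⟫₀ : Expr → Series
  ⟪ e ⟫ = ⟦ e ⟧ y r
  ⟪ e ⟫₀ = ⟦ e ⟧₀ r₀

  identity : ∀ {a b} → Identity a b → ⟪ a ⟫ ≈ ⟪ b ⟫
  identity {a} {b} p = Eval.⟦⟧-decide y r y-rel a b p

  constant : ∀ {a b} → Constant a b → YFree b → U ⟪ a ⟫ ≈ ⟪ b ⟫₀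
  constant {a} {b} p f = U-⟦⟧ y-rel a b f p

  φ-⟪⟫ : ∀ e → YFree e → φ ⟪ e ⟫₀ ≈ ⟪ e ⟫
  φ-⟪⟫ e p = φ-⟦⟧ {y} {r₀} e p

  valueAt0 : Expr → ℤ
  valueAt0 Y        = 0ℤ
  valueAt0 R        = 0ℤ
  valueAt0 (K c)    = c
  valueAt0 (a ∔ b)  = valueAt0 a ℤ.+ valueAt0 b
  valueAt0 (a ∙ b)  = valueAt0 a ℤ.* valueAt0 b
  valueAt0 (a ^^ n) = valueAt0 a ℤ.^ n

  ⟦⟧-at-0 : ∀ {y r : Series} → y 0 ≡ 0ℤ → r 0 ≡ 0ℤ → ∀ e → ⟦ e ⟧ y r 0 ≡ valueAt0 e
  ⟦⟧-at-0 p s Y        = p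
  ⟦⟧-at-0 p s R        = s
  ⟦⟧-at-0 p s (K c)    = ι-at-0 c
  ⟦⟧-at-0 p s (a ∔ b)  = ≡.trans (⊕-0 _ _) (cong₂ ℤ._+_ (⟦⟧-at-0 p s a) (⟦⟧-at-0 p s b))
  ⟦⟧-at-0 p s (a ∙ b)  = ≡.trans (·-0 _ _) (cong₂ ℤ._*_ (⟦⟧-at-0 p s a) (⟦⟧-at-0 p s b))
  ⟦⟧-at-0 {y} {r} p s (a ^^ n) = power n
    where
    power : ∀ n → (⟦ a ⟧ y r ^ n) 0 ≡ valueAt0 a ℤ.^ n
    power zero    = ι-at-0 1ℤ
    power (suc n) = ≡.trans (·-0 _ _) (cong₂ ℤ._*_ (⟦⟧-at-0 p s a) (power n))

  ⟪⟫-unit : ∀ e → valueAt0 e ≡ 1ℤ → Unit ⟪ e ⟫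
  ⟪⟫-unit e p = ≡.trans (⟦⟧-at-0 (q·-at-0 (φ y₀)) (≡.trans (φ-at-0 r₀) r₀-at-0) e) p

  opaque
    unfolding _·_
    0ˢ-at-0 : 0ˢ 0 ≡ 0ℤ
    0ˢ-at-0 = ≡.refl

  ⟪⟫₀-unit : ∀ e → valueAt0 e ≡ 1ℤ → Unit ⟪ e ⟫₀
  ⟪⟫₀-unit e p = ≡.trans (⟦⟧-at-0 0ˢ-at-0 r₀-at-0 e) p

  cancel : ∀ e → valueAt0 e ≡ 1ℤ → Regular ⟪ e ⟫
  cancel e p = unit-regular ⟪ e ⟫ (⟪⟫-unit e p)

  cancel₀ : ∀ e → valueAt0 e ≡ 1ℤ → Regular ⟪ e ⟫₀
  cancel₀ e p = unit-regular ⟪ e ⟫₀ (⟪⟫₀-unit e p)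

  y-regular : Regular y
  y-regular = ·-regular q-regular (unit-regular (φ y₀) (φ-unit y₀ y₀-unit))

  r-regular : Regular r
  r-regular = ≈-regular (≈trans (·-congʳ (φ r₀₀) (≈sym φ-q)) (≈sym (φ-· q r₀₀)))
    (·-regular (^-regular 7 q-regular) (unit-regular (φ r₀₀) (φ-unit r₀₀ r₀₀-unit)))

  A z g : Series
  A = φ a₀
  z = q ^ 2 · φ z₀
  g = q ^ 5 · φ g₀

  A-regular : Regular A
  A-regular = unit-regular A (φ-unit a₀ a₀-unit)

  wz : w · z ≈ y ^ 2
  wz = begin
    w · (q ^ 2 · φ z₀)     ≈⟨ ·-congʳ _ (≈sym φw₀) ⟩
    φ w₀ · (q ^ 2 · φ z₀)  ≈⟨ solve≈ 3 (λ w q z → w :* (q :* z) := q :* (z :* w)) ≈-refl (φ w₀) (q ^ 2) (φ z₀) ⟩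
    q ^ 2 · (φ z₀ · φ w₀)  ≈⟨ ·-congˡ _ (≈trans (≈sym (φ-· z₀ w₀)) (≈trans (φ-cong (≈sym y₀²)) (φ-^ y₀ 2))) ⟩
    q ^ 2 · φ y₀ ^ 2       ≈⟨ solve≈ 2 (λ q y → q :^ 2 :* y :^ 2 := (q :* y) :^ 2) ≈-refl q (φ y₀) ⟩
    y ^ 2                  ∎

  yg : y · g ≈ z ^ 3
  yg = begin
    q · φ y₀ · (q ^ 5 · φ g₀) ≈⟨ solve≈ 3 (λ q y g → q :* y :* (q :^ 5 :* g) := q :^ 6 :* (y :* g)) ≈-refl q (φ y₀) (φ g₀) ⟩
    q ^ 6 · (φ y₀ · φ g₀)     ≈⟨ ·-congˡ _ (≈trans (≈sym (φ-· y₀ g₀)) (≈trans (φ-cong y₀g₀) (φ-^ z₀ 3))) ⟩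
    q ^ 6 · φ z₀ ^ 3          ≈⟨ solve≈ 2 (λ q z → q :^ 6 :* z :^ 3 := (q :^ 2 :* z) :^ 3) ≈-refl q (φ z₀) ⟩
    z ^ 3                     ∎

  w³g : w ^ 3 · g ≈ y ^ 5
  w³g = y-regular (begin
    y · (w ^ 3 · g)   ≈⟨ solve≈ 3 (λ y w g → y :* (w :^ 3 :* g) := w :^ 3 :* (y :* g)) ≈-refl y w g ⟩
    w ^ 3 · (y · g)   ≈⟨ ·-congˡ _ yg ⟩
    w ^ 3 · z ^ 3     ≈⟨ solve≈ 2 (λ w z → w :^ 3 :* z :^ 3 := (w :* z) :^ 3) ≈-refl w z ⟩
    (w · z) ^ 3       ≈⟨ ^-congˡ 3 wz ⟩
    (y ^ 2) ^ 3       ≈⟨ solve≈ 1 (λ y → (y :^ 2) :^ 3 := y :* y :^ 5) ≈-refl y ⟩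
    y · y ^ 5         ∎)

  scaled : ∀ x → a₀ · (x · i₀) ≈ x
  scaled x = ≈trans (solve≈ 3 (λ a x i → a :* (x :* i) := (a :* i) :* x) ≈-refl a₀ x i₀)
    (≈trans (·-congʳ x a₀i₀) (SR.*-identityˡ x))

  A·φ : ∀ x → φ x ≈ A · φ (x · i₀)
  A·φ x = ≈trans (φ-cong (≈sym (scaled x))) (φ-· a₀ (x · i₀))

  E-factor : E ≈ A · (1ˢ ⊕ ⊖ y ⊕ ⊖ z ⊕ g)
  E-factor = begin
    E ≈⟨ E-dissection ⟩
    A ⊕ q · φ b₀ ⊕ q ^ 5 · φ c₀ ⊕ ⊖ q ^ 2 · φ e₀
      ≈⟨ ⊕-cong (⊕-cong (⊕-cong ≈-refl (·-congˡ q b-≈)) (·-congˡ _ (A·φ c₀))) (·-congˡ _ (A·φ e₀)) ⟩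
    A ⊕ q · (⊖ (A · φ y₀)) ⊕ q ^ 5 · (A · φ g₀) ⊕ ⊖ q ^ 2 · (A · φ z₀)
      ≈⟨ solve≈ 5 (λ A q y z g → A :+ q :* (:- (A :* y)) :+ q :^ 5 :* (A :* g) :+ :- (q :^ 2) :* (A :* z)
           := A :* (con 1ℤ :+ :- (q :* y) :+ :- (q :^ 2 :* z) :+ q :^ 5 :* g)) ≈-refl A q (φ y₀) (φ z₀) (φ g₀) ⟩
    A · (1ˢ ⊕ ⊖ y ⊕ ⊖ z ⊕ g) ∎
    where
    b-≈ : φ b₀ ≈ ⊖ (A · φ y₀)
    b-≈ = ≈trans (A·φ b₀) (≈trans (solve≈ 2 (λ A x → A :* x := :- (A :* :- x)) ≈-refl A (φ (b₀ · i₀)))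
      (⊖-cong (·-congˡ A (≈sym (φ-⊖ (b₀ · i₀))))))

  -- E / A = 1 - y - z + g with z = y² / w and g = y⁵ / w³, so w³ is the common denominator.
  E·w³ : E · w ^ 3 ≈ A · ⟪ fᵉ ⟫
  E·w³ = begin
    E · w ^ 3 ≈⟨ ·-congʳ _ E-factor ⟩
    A · (1ˢ ⊕ ⊖ y ⊕ ⊖ z ⊕ g) · w ^ 3
      ≈⟨ solve≈ 5 (λ A y z g w → A :* (con 1ℤ :+ :- y :+ :- z :+ g) :* w :^ 3
           := A :* (w :^ 3 :+ :- (w :^ 3 :* y) :+ :- (w :^ 2 :* (w :* z)) :+ w :^ 3 :* g)) ≈-refl A y z g w ⟩
    A · (w ^ 3 ⊕ ⊖ (w ^ 3 · y) ⊕ ⊖ (w ^ 2 · (w · z)) ⊕ w ^ 3 · g)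
      ≈⟨ ·-congˡ A (⊕-cong (⊕-cong ≈-refl (⊖-cong (·-congˡ _ wz))) w³g) ⟩
    A · (w ^ 3 ⊕ ⊖ (w ^ 3 · y) ⊕ ⊖ (w ^ 2 · y ^ 2) ⊕ y ^ 5)
      ≈⟨ solve≈ 3 (λ A y w → A :* (w :^ 3 :+ :- (w :^ 3 :* y) :+ :- (w :^ 2 :* y :^ 2) :+ y :^ 5)
           := A :* (w :^ 3 :+ con -1ℤ :* (w :^ 3 :* y) :+ con -1ℤ :* (w :^ 2 :* y :^ 2) :+ y :^ 5)) ≈-refl A y w ⟩
    A · ⟪ fᵉ ⟫ ∎

  iE ζ : Series
  iE = inv E
  ζ = q ^ 2 · φ (φ E) · iE

  E·iE : E · iE ≈ 1ˢ
  E·iE = inv-right E E-unit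

  ζ·E : ζ · E ≈ q ^ 2 · φ (φ E)
  ζ·E = ≈trans (solve≈ 3 (λ x i e → x :* i :* e := x :* (e :* i)) ≈-refl (q ^ 2 · φ (φ E)) iE E)
    (≈trans (·-congˡ _ E·iE) (SR.*-identityʳ _))

  ζ·f : ζ · ⟪ fᵉ ⟫ ≈ ⟪ zᵉ ⟫
  ζ·f = A-regular (begin
    A · (ζ · ⟪ fᵉ ⟫)    ≈⟨ solve≈ 3 (λ A x f → A :* (x :* f) := x :* (A :* f)) ≈-refl A ζ ⟪ fᵉ ⟫ ⟩
    ζ · (A · ⟪ fᵉ ⟫)    ≈⟨ ·-congˡ ζ (≈sym E·w³) ⟩
    ζ · (E · w ^ 3)     ≈⟨ ≈sym (SR.*-assoc ζ E (w ^ 3)) ⟩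
    ζ · E · w ^ 3       ≈⟨ ·-congʳ _ ζ·E ⟩
    q ^ 2 · φ e₀ · w ^ 3 ≈⟨ ·-congʳ _ (·-congˡ _ (A·φ e₀)) ⟩
    q ^ 2 · (A · φ z₀) · w ^ 3 ≈⟨ solve≈ 4 (λ q A z w → q :* (A :* z) :* w :^ 3 := A :* (w :^ 2 :* (w :* (q :* z)))) ≈-refl (q ^ 2) A (φ z₀) w ⟩
    A · (w ^ 2 · (w · z)) ≈⟨ ·-congˡ A (·-congˡ _ wz) ⟩
    A · ⟪ zᵉ ⟫          ∎)

  ζ-regular : Regular ζ
  ζ-regular = ·-regular (·-regular (^-regular 2 q-regular) (unit-regular _ (φ-unit _ (φ-unit E E-unit)))) (unit-regular iE (inv-at-0 E))

  -- D r₀ / (r₀ w₀), with q cancelled from numerator and denominator so that only a unit is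
  -- inverted.
  ε₀ ε : Series
  ε₀ = (r₀₀ ⊕ D r₀₀) · inv (r₀₀ · w₀)
  ε = φ ε₀

  w₀-unit : Unit w₀
  w₀-unit = ⟪⟫₀-unit wᵉ ≡.refl

  Dr₀ : D r₀ ≈ ε₀ · (r₀ · w₀)
  Dr₀ = begin
    D (q · r₀₀)                 ≈⟨ ≈trans (D-· q r₀₀) (⊕-cong (·-congʳ r₀₀ D-q) ≈-refl) ⟩
    q · r₀₀ ⊕ q · D r₀₀         ≈⟨ solve≈ 3 (λ q r d → q :* r :+ q :* d := (r :+ d) :* q :* con 1ℤ) ≈-refl q r₀₀ (D r₀₀) ⟩
    (r₀₀ ⊕ D r₀₀) · q · 1ˢ      ≈⟨ ·-congˡ _ (≈sym (inv-right (r₀₀ · w₀) (·-unit r₀₀ w₀ r₀₀-unit w₀-unit))) ⟩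
    (r₀₀ ⊕ D r₀₀) · q · (r₀₀ · w₀ · inv (r₀₀ · w₀))
      ≈⟨ solve≈ 5 (λ x q r w i → x :* q :* (r :* w :* i) := x :* i :* (q :* r :* w)) ≈-refl (r₀₀ ⊕ D r₀₀) q r₀₀ w₀ (inv (r₀₀ · w₀)) ⟩
    ε₀ · (r₀ · w₀)              ∎

  Dr : D r ≈ ε · ⟪ K (+ 7) ∙ R ∙ (K 1ℤ ⊟ R) ⟫
  Dr = begin
    D (φ r₀)                       ≈⟨ D-φ r₀ ⟩
    ι (+ 7) · φ (D r₀)             ≈⟨ ·-congˡ _ (≈trans (φ-cong Dr₀) (≈trans (φ-· ε₀ (r₀ · w₀)) (·-congˡ ε (≈trans (φ-· r₀ w₀) (·-congˡ r φw₀))))) ⟩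
    ι (+ 7) · (ε · (r · w))        ≈⟨ solve≈ 4 (λ s e r w → s :* (e :* (r :* w)) := e :* (s :* r :* w)) ≈-refl (ι (+ 7)) ε r w ⟩
    ε · (ι (+ 7) · r · w)          ∎

  D-^ : ∀ f n → D (f ^ suc n) ≈ ι (+ suc n) · f ^ n · D f
  D-^ f zero    = ≈trans (D-· f 1ˢ) (≈trans (⊕-cong ≈-refl (·-congˡ f (≈trans (D-ι 1ℤ) (≈sym ι-0))))
    (solve≈ 2 (λ f d → d :* con 1ℤ :+ f :* con 0ℤ := con 1ℤ :* con 1ℤ :* d) ≈-refl f (D f)))
  D-^ f (suc n) = ≈trans (D-· f (f ^ suc n)) (≈trans (⊕-cong ≈-refl (·-congˡ f (D-^ f n)))
    (≈trans (solve≈ 4 (λ f p d s → d :* (f :* p) :+ f :* (s :* p :* d) := (con 1ℤ :+ s) :* (f :* p) :* d) ≈-refl f (f ^ n) (D f) (ι (+ suc n)))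
      (·-congʳ _ (·-congʳ _ (≈sym (ι-+ 1ℤ (+ suc n)))))))

  -- From differentiating y⁷ = r w⁴ and multiplying by y; the factor 7 r w⁴ is then cancelled.
  Dy : D y ≈ ε · ⟪ Y ∙ (K 1ℤ ⊟ K (+ 5) ∙ R) ⟫
  Dy = ·-regular (·-regular (ι-regular 6) r-regular) (^-regular 4 (cancel wᵉ ≡.refl)) (begin
    ι (+ 7) · r · w ^ 4 · D y
      ≈⟨ solve≈ 4 (λ s r x d → s :* r :* x :* d := s :* (r :* x) :* d) ≈-refl (ι (+ 7)) r (w ^ 4) (D y) ⟩
    ι (+ 7) · (r · w ^ 4) · D y
      ≈⟨ ·-congʳ _ (·-congˡ _ (≈sym y⁷-≈)) ⟩
    ι (+ 7) · y ^ 7 · D y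
      ≈⟨ solve≈ 2 (λ y d → con (+ 7) :* y :^ 7 :* d := y :* (con (+ 7) :* y :^ 6 :* d)) ≈-refl y (D y) ⟩
    y · (ι (+ 7) · y ^ 6 · D y)
      ≈⟨ ·-congˡ y (≈trans (≈sym D-y⁷) (≈trans (D-cong y⁷-≈) D-rw⁴)) ⟩
    y · (w ^ 4 · D r ⊕ r · (ι (+ 4) · w ^ 3 · (⊖ D r)))
      ≈⟨ ·-congˡ y (⊕-cong (·-congˡ _ Dr) (·-congˡ r (·-congˡ _ (⊖-cong Dr)))) ⟩
    y · (w ^ 4 · (ε · (ι (+ 7) · r · w)) ⊕ r · (ι (+ 4) · w ^ 3 · (⊖ (ε · (ι (+ 7) · r · w)))))
      ≈⟨ solve≈ 3 (λ y r e → let w = con 1ℤ :+ con -1ℤ :* r in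
           y :* (w :^ 4 :* (e :* (con (+ 7) :* r :* w)) :+ r :* (con (+ 4) :* w :^ 3 :* (:- (e :* (con (+ 7) :* r :* w)))))
           := con (+ 7) :* r :* w :^ 4 :* (e :* (y :* (con 1ℤ :+ con -1ℤ :* (con (+ 5) :* r))))) ≈-refl y r ε ⟩
    ι (+ 7) · r · w ^ 4 · (ε · ⟪ Y ∙ (K 1ℤ ⊟ K (+ 5) ∙ R) ⟫) ∎)
    where
    y⁷-≈ : y ^ 7 ≈ r · w ^ 4
    y⁷-≈ = ≈trans y-rel (·-congˡ r (^-congˡ 4 (solve≈ 1 (λ r → con 1ℤ :- r := con 1ℤ :+ con -1ℤ :* r) ≈-refl r)))
    D-y⁷ : D (y ^ 7) ≈ ι (+ 7) · y ^ 6 · D y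
    D-y⁷ = D-^ y 6
    Dw : D w ≈ ⊖ D r
    Dw = ≈trans (D-⊕ (ι 1ℤ) (ι -1ℤ · r)) (≈trans (⊕-cong (D-ι 1ℤ) (D-· (ι -1ℤ) r))
      (≈trans (⊕-cong (≈sym ι-0) (⊕-cong (·-congʳ r (≈trans (D-ι -1ℤ) (≈sym ι-0))) ≈-refl))
        (solve≈ 2 (λ r d → con 0ℤ :+ (con 0ℤ :* r :+ con -1ℤ :* d) := :- d) ≈-refl r (D r))))
    D-rw⁴ : D (r · w ^ 4) ≈ w ^ 4 · D r ⊕ r · (ι (+ 4) · w ^ 3 · (⊖ D r))
    D-rw⁴ = ≈trans (D-· r (w ^ 4)) (⊕-cong (SR.*-comm (D r) (w ^ 4)) (·-congˡ r (≈trans (D-^ w 3) (·-congˡ _ Dw))))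

-- Lambert series, the logarithmic derivative of the Euler product, and a Hecke relation.

module DivisorSums where
  open SeriesRing
  open Operators
  open Pentagonal
  open JacobiCube
  open EulerDissection
  open Generators using (D-q)
  open import Data.Nat as ℕ using (ℕ; zero; suc; _≤_; _<_; z≤n; s≤s)
  import Data.Nat.Properties as ℕP
  open import Data.Nat.Divisibility as ℕD using (_∣_; _∣?_; divides)
  open import Data.Nat.Primality using (Prime; prime?; euclidsLemma)
  open import Data.Nat.Solver using (module +-*-Solver)
  open import Data.Integer using (ℤ; +_; -[1+_]; 0ℤ; 1ℤ; -1ℤ)
  import Data.Integer.Properties as ℤP
  open import Data.Bool using (if_then_else_)
  open import Data.Sum using (inj₁; inj₂)
  open import Data.Empty using (⊥-elim)
  open import Relation.Nullary using (¬_; Dec; yes; no; does)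
  open import Relation.Nullary.Decidable using (toWitness; dec-true; dec-false)
  open import Relation.Binary.PropositionalEquality as ≡ using (_≡_; cong; subst)

  open Solver using (_:^_; :-_; _:+_; _:*_; _:-_; _:=_; con) renaming (solve to solve≈)
  private
    module N = +-*-Solver
    variable
      f : Series
  open ≈-Reasoning

  divisorIndicator : ℕ → ℕ → ℤ
  divisorIndicator a n = if does (a ∣? n) then 1ℤ else 0ℤ

  indicator-yes : ∀ {a n} → a ∣ n → divisorIndicator a n ≡ 1ℤ
  indicator-yes {a} {n} p = cong (λ b → if b then 1ℤ else 0ℤ) (dec-true (a ∣? n) p)

  indicator-no : ∀ {a n} → ¬ a ∣ n → divisorIndicator a n ≡ 0ℤ
  indicator-no {a} {n} p = cong (λ b → if b then 1ℤ else 0ℤ) (dec-false (a ∣? n) p)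

  indicator-⇔ : ∀ {a m b n} → (a ∣ m → b ∣ n) → (b ∣ n → a ∣ m) → divisorIndicator a m ≡ divisorIndicator b n
  indicator-⇔ {a} {m} {b} {n} to from with a ∣? m
  ... | yes p = ≡.sym (indicator-yes (to p))
  ... | no ¬p = ≡.sym (indicator-no (λ s → ¬p (from s)))

  -- L a = q^a / (1 - q^a)
  L : ℕ → Series
  L a zero    = 0ℤ
  L a (suc n) = divisorIndicator a (suc n)

  prime-7 : Prime 7
  prime-7 = toWitness {a? = prime? 7} _

  7∤ : ∀ j b → 0 < j → j < 7 → ¬ 7 ∣ j ℕ.+ b ℕ.* 7
  7∤ (suc j) b _ l p = ℕD.>⇒∤ l (ℕD.∣m+n∣m⇒∣n (subst (7 ∣_) (ℕP.+-comm (suc j) (b ℕ.* 7)) p) (ℕD.n∣m*n b))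

  opaque
    unfolding _·_ φ

    L-unfold : ∀ a → L (suc a) ≈ q ^ suc a · (1ˢ ⊕ L (suc a))
    L-unfold a = mk λ n → go n (n ℕP.<? suc a)
      where
      small : ∀ n → n < suc a → L (suc a) n ≡ 0ℤ
      small zero    _ = ≡.refl
      small (suc n) l = indicator-no (ℕD.>⇒∤ l)
      large : ∀ m → L (suc a) (suc a ℕ.+ m) ≡ (1ˢ ⊕ L (suc a)) m
      large zero    = indicator-yes (subst (λ n → suc a ∣ suc n) (≡.sym (ℕP.+-identityʳ a)) ℕD.∣-refl)
      large (suc m) = ≡.trans (indicator-⇔
          (λ p → ℕD.∣m+n∣m⇒∣n {m = suc a} p ℕD.∣-refl) (ℕD.∣m∣n⇒∣m+n ℕD.∣-refl))
        (≡.sym (ℤP.+-identityˡ (L (suc a) (suc m))))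
      go : ∀ n → Dec (n < suc a) → L (suc a) n ≡ (q ^ suc a · (1ˢ ⊕ L (suc a))) n
      go n (yes l) = ≡.trans (small n l) (≡.sym (q^·-low (suc a) _ n l))
      go n (no ¬l) = subst (λ n → L (suc a) n ≡ (q ^ suc a · (1ˢ ⊕ L (suc a))) n) (ℕP.m+[n∸m]≡n (ℕP.≮⇒≥ ¬l))
        (≡.trans (large _) (≡.sym (q^·-shift (suc a) (1ˢ ⊕ L (suc a)) _)))

    -- An index a prime to 7 divides 7 n exactly when it divides n.
    U-L : ∀ j b → 0 < j → j < 7 → U (L (j ℕ.+ b ℕ.* 7)) ≈ L (j ℕ.+ b ℕ.* 7)
    U-L (suc j) b 0<j j<7 = mk λ
      { zero    → ≡.refl
      ; (suc n) → indicator-⇔ (descend (suc n)) (λ p → ℕD.∣m⇒∣m*n 7 p) }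
      where
      m : ℕ
      m = suc j ℕ.+ b ℕ.* 7
      descend : ∀ n → m ∣ n ℕ.* 7 → m ∣ n
      descend n (divides x e) with euclidsLemma x m prime-7 (divides n (≡.sym e))
      ... | inj₁ (divides x′ e′) = divides x′ (ℕP.*-cancelʳ-≡ n (x′ ℕ.* m) 7 (≡.trans e (≡.trans (cong (ℕ._* m) e′)
            (N.solve 2 (λ x m → x N.:* N.con 7 N.:* m N.:= x N.:* m N.:* N.con 7) ≡.refl x′ m))))
      ... | inj₂ p = ⊥-elim (7∤ (suc j) b 0<j j<7 p)

    D-q^ : ∀ n → D (q ^ n) ≈ ι (+ n) · q ^ n
    D-q^ zero    = ≈trans (D-ι 1ℤ) (≈sym (≈trans (·-congʳ _ ι-0) (SR.zeroˡ _)))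
    D-q^ (suc n) = ≈trans (D-· q (q ^ n)) (≈trans (⊕-cong (·-congʳ _ D-q) (·-congˡ q (D-q^ n)))
      (≈trans (solve≈ 3 (λ q x k → q :* x :+ q :* (k :* x) := (con 1ℤ :+ k) :* (q :* x)) ≈-refl q (q ^ n) (ι (+ n)))
        (·-congʳ _ (≈sym (ι-+ 1ℤ (+ n))))))

  1-q^-regular : ∀ a → Regular (1-q^ (suc a))
  1-q^-regular a = unit-regular (1-q^ (suc a)) (1-q^-at-0 a)

  L-equation : ∀ a → 1-q^ (suc a) · L (suc a) ≈ q ^ suc a
  L-equation a = ≈trans (solve≈ 2 (λ x l → (con 1ℤ :- x) :* l := l :- x :* l) ≈-refl (q ^ suc a) (L (suc a)))
    (≈trans (⊕-cong (L-unfold a) ≈-refl)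
      (solve≈ 2 (λ x l → x :* (con 1ℤ :+ l) :- x :* l := x) ≈-refl (q ^ suc a) (L (suc a))))

  L-7 : ∀ b → L (suc b ℕ.* 7) ≈ φ (L (suc b))
  L-7 b = 1-q^-regular (6 ℕ.+ b ℕ.* 7) (≈trans (L-equation (6 ℕ.+ b ℕ.* 7)) (≈sym (≈trans (·-congʳ _ (≈sym φ-1-q^))
    (≈trans (≈sym (φ-· (1-q^ (suc b)) (L (suc b)))) (≈trans (φ-cong (L-equation b)) (φ-q^ (suc b)))))))
    where
    φ-1-q^ : φ (1-q^ (suc b)) ≈ 1-q^ (suc b ℕ.* 7)
    φ-1-q^ = ≈trans (φ-+ 1ˢ _) (⊕-cong (φ-ι 1ℤ) (≈trans (φ-⊖ _) (⊖-cong (φ-q^ (suc b)))))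

  -- From 1 - X Y = (1 - X) (1 - Y) + X (1 - Y) + Y (1 - X) for X = q^a and Y = q^b. It reduces a
  -- product of Lambert terms to the index a + b.
  L-product : ∀ i j → L (suc i) · L (suc j) ≈ L (suc (suc (i ℕ.+ j))) · (1ˢ ⊕ L (suc i) ⊕ L (suc j))
  L-product i j = ·-regular (·-regular (1-q^-regular i) (1-q^-regular j)) (1-q^-regular (suc (i ℕ.+ j))) (begin
    x · y · z · (a · b)
      ≈⟨ solve≈ 5 (λ x y z a b → x :* y :* z :* (a :* b) := (x :* a) :* (y :* b) :* z) ≈-refl x y z a b ⟩
    (x · a) · (y · b) · z
      ≈⟨ ·-cong (·-cong (L-equation i) (L-equation j)) z-≈ ⟩
    X · Y · (1ˢ ⊕ ⊖ (X · Y))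
      ≈⟨ solve≈ 2 (λ X Y → X :* Y :* (con 1ℤ :- X :* Y) :=
           X :* Y :* ((con 1ℤ :- X) :* (con 1ℤ :- Y) :+ X :* (con 1ℤ :- Y) :+ Y :* (con 1ℤ :- X))) ≈-refl X Y ⟩
    X · Y · (x · y ⊕ X · y ⊕ Y · x)
      ≈⟨ ·-cong (≈sym XY) (⊕-cong (⊕-cong ≈-refl (·-congʳ y (≈sym (L-equation i)))) (·-congʳ x (≈sym (L-equation j)))) ⟩
    q ^ suc (suc (i ℕ.+ j)) · (x · y ⊕ x · a · y ⊕ y · b · x)
      ≈⟨ ·-congʳ _ (≈sym (L-equation (suc (i ℕ.+ j)))) ⟩
    z · c · (x · y ⊕ x · a · y ⊕ y · b · x)
      ≈⟨ solve≈ 6 (λ x y z a b c → z :* c :* (x :* y :+ x :* a :* y :+ y :* b :* x) := x :* y :* z :* (c :* (con 1ℤ :+ a :+ b))) ≈-refl x y z a b c ⟩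
    x · y · z · (c · (1ˢ ⊕ a ⊕ b)) ∎)
    where
    X Y x y z a b c : Series
    X = q ^ suc i
    Y = q ^ suc j
    x = 1-q^ (suc i)
    y = 1-q^ (suc j)
    z = 1-q^ (suc (suc (i ℕ.+ j)))
    a = L (suc i)
    b = L (suc j)
    c = L (suc (suc (i ℕ.+ j)))
    XY : q ^ suc (suc (i ℕ.+ j)) ≈ X · Y
    XY = ≈trans (q^-≡ (cong suc (≡.sym (ℕP.+-suc i j)))) (q^-+ (suc i) (suc j))
    z-≈ : z ≈ 1ˢ ⊕ ⊖ (X · Y)
    z-≈ = ⊕-cong ≈-refl (⊖-cong XY)

  D-L : ∀ a → D (L (suc a)) ≈ ι (+ suc a) · (L (suc a) ⊕ L (suc a) ^ 2)
  D-L a = 1-q^-regular a (begin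
    x · D l
      ≈⟨ solve≈ 4 (λ X l d n → (con 1ℤ :- X) :* d := (:- (n :* X) :* l :+ (con 1ℤ :- X) :* d) :+ n :* X :* l) ≈-refl X l (D l) n ⟩
    (⊖ (n · X) · l ⊕ x · D l) ⊕ n · X · l
      ≈⟨ ⊕-cong (≈trans (⊕-cong (·-congʳ l (≈sym Dx)) ≈-refl) (≈trans (≈sym (D-· x l)) (≈trans (D-cong (L-equation a)) (D-q^ (suc a))))) ≈-refl ⟩
    n · X ⊕ n · X · l
      ≈⟨ solve≈ 3 (λ X l n → n :* X :+ n :* X :* l := X :* (n :* (con 1ℤ :+ l))) ≈-refl X l n ⟩
    X · (n · (1ˢ ⊕ l))
      ≈⟨ ·-congʳ _ (≈sym (L-equation a)) ⟩
    x · l · (n · (1ˢ ⊕ l))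
      ≈⟨ solve≈ 3 (λ x l n → x :* l :* (n :* (con 1ℤ :+ l)) := x :* (n :* (l :+ l :^ 2))) ≈-refl x l n ⟩
    x · (n · (l ⊕ l ^ 2)) ∎)
    where
    X x l n : Series
    X = q ^ suc a
    x = 1-q^ (suc a)
    l = L (suc a)
    n = ι (+ suc a)
    Dx : D x ≈ ⊖ (n · X)
    Dx = ≈trans (D-⊕ 1ˢ (⊖ X)) (≈trans (⊕-cong (D-ι 1ℤ) (≈trans (D-⊖ X) (⊖-cong (D-q^ (suc a))))) (SR.+-identityˡ _))

  L-small : ∀ a N → N < suc a → L (suc a) ≈[ N ] 0ˢ
  L-small a N l = ≈[]-trans (≈⇒≈[] (L-unfold a)) (q^·-high (suc a) _ l)

  sum : ℕ → (ℕ → Series) → Series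
  sum zero    f = 0ˢ
  sum (suc n) f = sum n f ⊕ f n

  n# : ℕ → Series
  n# i = ι (+ suc i)

  -- S p N = Σ_{a=1}^{N} a^p L a, with limit Σ_{n} σ_p(n) q^n
  S : ℕ → ℕ → Series
  S p n = sum n (λ i → n# i ^ p · L (suc i))

  -- `L a` starts at q^a, so the coefficient n of the limit can be read off from the n-th partial
  -- sum.
  Φ : ℕ → Series
  Φ p n = S p n n

  S-stable : ∀ p d N → S p (d ℕ.+ N) ≈[ N ] S p N
  S-stable p zero    N = ≈⇒≈[] ≈-refl
  S-stable p (suc d) N = ≈[]-trans (⊕-cong[] (S-stable p d N)
      (≈[]-trans (·-cong[] (≈⇒≈[] ≈-refl) (L-small (d ℕ.+ N) N (s≤s (ℕP.m≤n+m N d)))) (≈⇒≈[] (SR.zeroʳ _))))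
    (≈⇒≈[] (SR.+-identityʳ _))

  S-≤ : ∀ p {M N} → N ≤ M → S p M ≈[ N ] S p N
  S-≤ p {M} {N} l = subst (λ M → S p M ≈[ N ] S p N) (ℕP.m∸n+n≡m l) (S-stable p (M ℕ.∸ N) N)

  Φ-S : ∀ p N → Φ p ≈[ N ] S p N
  Φ-S p N = mk λ n l → ≡.sym (_≈[_]_.below (S-≤ p l) n ℕP.≤-refl)

  D-P : ∀ n → D (P n) ≈ ⊖ (P n · S 1 n)
  D-P zero    = ≈trans (D-cong eulerTrunc-0) (≈trans (D-ι 1ℤ) (≈trans (≈sym ι-0)
    (≈trans (solve≈ 1 (λ p → con 0ℤ := :- (p :* con 0ℤ)) ≈-refl (P 0)) (⊖-cong (·-congˡ (P 0) ι-0)))))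
  D-P (suc n) = begin
    D (P (suc n))
      ≈⟨ ≈trans (D-cong (P-suc n)) (D-· (P n) x) ⟩
    D (P n) · x ⊕ P n · D x
      ≈⟨ ⊕-cong (·-congʳ x (D-P n)) (·-congˡ (P n) Dx) ⟩
    ⊖ (P n · S 1 n) · x ⊕ P n · (⊖ (n# n · (x · L (suc n))))
      ≈⟨ solve≈ 5 (λ p s x l k → :- (p :* s) :* x :+ p :* (:- (k :* (x :* l))) := :- (p :* x :* (s :+ k :^ 1 :* l))) ≈-refl
           (P n) (S 1 n) x (L (suc n)) (n# n) ⟩
    ⊖ (P n · x · S 1 (suc n))
      ≈⟨ ⊖-cong (·-congʳ _ (≈sym (P-suc n))) ⟩
    ⊖ (P (suc n) · S 1 (suc n)) ∎
    where
    x : Series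
    x = 1-q^ (suc n)
    Dx : D x ≈ ⊖ (n# n · (x · L (suc n)))
    Dx = ≈trans (D-⊕ 1ˢ _) (≈trans (⊕-cong (D-ι 1ℤ) (≈trans (D-⊖ _) (⊖-cong (≈trans (D-q^ (suc n)) (·-congˡ _ (≈sym (L-equation n)))))))
      (SR.+-identityˡ _))

  D-E : D E ≈ ⊖ (E · Φ 1)
  D-E = ≈[]⇒≈ λ N → ≈[]-trans (D-cong[] (E-P N)) (≈[]-trans (≈⇒≈[] (D-P N))
    (⊖-cong[] (·-cong[] (≈[]-sym (E-P N)) (≈[]-sym (Φ-S 1 N)))))
    where
    ⊖-cong[] : ∀ {f g N} → f ≈[ N ] g → ⊖ f ≈[ N ] ⊖ g
    ⊖-cong[] {f} {g} p = ≈[]-trans (≈⇒≈[] (solve≈ 1 (λ f → :- f := con -1ℤ :* f) ≈-refl f))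
      (≈[]-trans (·-cong[] (≈⇒≈[] ≈-refl) p) (≈⇒≈[] (solve≈ 1 (λ f → con -1ℤ :* f := :- f) ≈-refl g)))

  U-ι· : ∀ c f → U (ι c · f) ≈ ι c · U f
  U-ι· c f = ≈trans (U-cong (·-congʳ f (≈sym (φ-ι c)))) (U-φ· (ι c) f)

  -- Each multiple 7 b of 7 contributes 7 b L b on the left; every other a contributes a L a.
  U-S : ∀ n → U (S 1 (n ℕ.* 7)) ⊕ ι (+ 7) · φ (S 1 n) ≈ S 1 (n ℕ.* 7) ⊕ ι (+ 7) · S 1 n
  U-S zero    = ⊕-cong U-0 (·-congˡ _ φ-0)
  U-S (suc n) = begin
    U (S₇ ⊕ t 0 ⊕ t 1 ⊕ t 2 ⊕ t 3 ⊕ t 4 ⊕ t 5 ⊕ t 6) ⊕ ι (+ 7) · φ (S 1 n ⊕ last)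
      ≈⟨ ⊕-cong (≈trans (U-⊕ _ _) (⊕-cong (≈trans (U-⊕ _ _) (⊕-cong (≈trans (U-⊕ _ _) (⊕-cong (≈trans (U-⊕ _ _)
           (⊕-cong (≈trans (U-⊕ _ _) (⊕-cong (≈trans (U-⊕ _ _) (⊕-cong (U-⊕ _ _) ≈-refl)) ≈-refl)) ≈-refl)) ≈-refl)) ≈-refl)) ≈-refl))
           (·-congˡ _ (φ-+ (S 1 n) last)) ⟩
    (U S₇ ⊕ U (t 0) ⊕ U (t 1) ⊕ U (t 2) ⊕ U (t 3) ⊕ U (t 4) ⊕ U (t 5) ⊕ U (t 6)) ⊕ ι (+ 7) · (φ (S 1 n) ⊕ φ last)
      ≈⟨ ⊕-cong (⊕-cong (⊕-cong (⊕-cong (⊕-cong (⊕-cong (⊕-cong (⊕-cong ≈-refl (ut 0 lt₁)) (ut 1 lt₂)) (ut 2 lt₃)) (ut 3 lt₄)) (ut 4 lt₅)) (ut 5 lt₆)) u6)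
           (·-congˡ _ (⊕-cong ≈-refl φ-last)) ⟩
    (U S₇ ⊕ t 0 ⊕ t 1 ⊕ t 2 ⊕ t 3 ⊕ t 4 ⊕ t 5 ⊕ ι (+ 7) · n# n · L (suc n)) ⊕ ι (+ 7) · (φ (S 1 n) ⊕ n# n · L (suc n ℕ.* 7))
      ≈⟨ solve≈ 12 (λ u a b c d e f s k l g l₇ →
           (u :+ a :+ b :+ c :+ d :+ e :+ f :+ s :* k :* l) :+ s :* (g :+ k :* l₇)
           := (u :+ s :* g) :+ a :+ b :+ c :+ d :+ e :+ f :+ (s :* k :* l₇ :+ s :* k :* l)) ≈-refl
           (U S₇) (t 0) (t 1) (t 2) (t 3) (t 4) (t 5) (ι (+ 7)) (n# n) (L (suc n)) (φ (S 1 n)) (L (suc n ℕ.* 7)) ⟩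
    (U S₇ ⊕ ι (+ 7) · φ (S 1 n)) ⊕ t 0 ⊕ t 1 ⊕ t 2 ⊕ t 3 ⊕ t 4 ⊕ t 5 ⊕ (ι (+ 7) · n# n · L (suc n ℕ.* 7) ⊕ ι (+ 7) · n# n · L (suc n))
      ≈⟨ ⊕-cong (⊕-cong (⊕-cong (⊕-cong (⊕-cong (⊕-cong (⊕-cong (U-S n) ≈-refl) ≈-refl) ≈-refl) ≈-refl) ≈-refl) ≈-refl) (⊕-cong (≈sym t6) ≈-refl) ⟩
    (S₇ ⊕ ι (+ 7) · S 1 n) ⊕ t 0 ⊕ t 1 ⊕ t 2 ⊕ t 3 ⊕ t 4 ⊕ t 5 ⊕ (t 6 ⊕ ι (+ 7) · n# n · L (suc n))
      ≈⟨ solve≈ 12 (λ u a b c d e f g s k l v →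
           (u :+ s :* v) :+ a :+ b :+ c :+ d :+ e :+ f :+ (g :+ s :* k :* l)
           := (u :+ a :+ b :+ c :+ d :+ e :+ f :+ g) :+ s :* (v :+ k :^ 1 :* l)) ≈-refl
           S₇ (t 0) (t 1) (t 2) (t 3) (t 4) (t 5) (t 6) (ι (+ 7)) (n# n) (L (suc n)) (S 1 n) ⟩
    (S₇ ⊕ t 0 ⊕ t 1 ⊕ t 2 ⊕ t 3 ⊕ t 4 ⊕ t 5 ⊕ t 6) ⊕ ι (+ 7) · (S 1 n ⊕ last) ∎
    where
    m : ℕ
    m = n ℕ.* 7
    S₇ last : Series
    S₇ = S 1 m
    last = n# n ^ 1 · L (suc n)
    t : ℕ → Series
    t j = n# (j ℕ.+ m) ^ 1 · L (suc (j ℕ.+ m))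
    ^1 : ∀ x → x ^ 1 ≈ x
    ^1 = SR.*-identityʳ
    ut : ∀ j → j < 6 → U (t j) ≈ t j
    ut j l = ≈trans (U-cong (·-congʳ _ (^1 (n# (j ℕ.+ m))))) (≈trans (U-ι· _ _) (·-cong (≈sym (^1 (n# (j ℕ.+ m)))) (U-L (suc j) n (s≤s z≤n) (s≤s l))))
    n#-7 : n# (6 ℕ.+ m) ≈ ι (+ 7) · n# n
    n#-7 = ≈trans (ι-≡ (≡.trans (cong +_ (ℕP.*-comm (suc n) 7)) (ℤP.pos-* 7 (suc n)))) (ι-* (+ 7) (+ suc n))
      where
      ι-≡ : ∀ {a b} → a ≡ b → ι a ≈ ι b
      ι-≡ ≡.refl = ≈-refl
    t6 : t 6 ≈ ι (+ 7) · n# n · L (suc n ℕ.* 7)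
    t6 = ·-congʳ _ (≈trans (^1 _) n#-7)
    φ-last : φ last ≈ n# n · L (suc n ℕ.* 7)
    φ-last = ≈trans (φ-· _ (L (suc n))) (·-cong (≈trans (φ-cong (^1 _)) (φ-ι _)) (≈sym (L-7 n)))
    u6 : U (t 6) ≈ ι (+ 7) · n# n · L (suc n)
    u6 = ≈trans (U-cong t6) (≈trans (U-cong (SR.*-assoc _ _ _)) (≈trans (U-ι· (+ 7) _) (≈trans (·-congˡ _ (U-ι· (+ suc n) _))
      (≈trans (≈sym (SR.*-assoc _ _ _)) (·-congˡ _ (≈trans (U-cong (L-7 n)) (U-φ (L (suc n)))))))))

  -- The Hecke relation σ(7 n) = 8 σ(n) - 7 σ(n / 7) for the sum of divisors, as the limit of `U-S`.
  U-Φ : U (Φ 1) ≈ ι (+ 8) · Φ 1 ⊕ ⊖ (ι (+ 7) · φ (Φ 1))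
  U-Φ = ≈[]⇒≈ λ N → ≈[]-trans (U-cong[] (Φ-S 1 (N ℕ.* 7)))
    (≈[]-trans (≈⇒≈[] (≈trans (solve≈ 2 (λ u p → u := u :+ con (+ 7) :* p :+ con -[1+ 6 ] :* p) ≈-refl (U (S 1 (N ℕ.* 7))) (φ (S 1 N)))
        (⊕-cong (U-S N) ≈-refl)))
    (≈[]-trans (⊕-cong[] (⊕-cong[] (≈[]-trans (S-≤ 1 (ℕP.m≤m*n N 7)) (≈[]-sym (Φ-S 1 N))) (·-cong[] (≈⇒≈[] ≈-refl) (≈[]-sym (Φ-S 1 N))))
        (·-cong[] (≈⇒≈[] ≈-refl) (φ-cong[] (≈[]-sym (Φ-S 1 N)))))
      (≈⇒≈[] (solve≈ 2 (λ x p → x :+ con (+ 7) :* x :+ con -[1+ 6 ] :* p := con (+ 8) :* x :- con (+ 7) :* p) ≈-refl (Φ 1) (φ (Φ 1))))))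

-- Ramanujan's differential equation for E₂.

module RamanujanIdentity where
  open SeriesRing
  open Operators
  open Pentagonal
  open EulerDissection
  open DivisorSums
  open import Data.Nat as ℕ using (ℕ; zero; suc; _≤_; _<_; z≤n; s≤s)
  import Data.Nat.Properties as ℕP
  open import Data.Integer using (+_; -[1+_]; 0ℤ; 1ℤ; -1ℤ)
  open import Relation.Binary.PropositionalEquality as ≡ using (_≡_; cong; subst)

  open Solver using (_:^_; :-_; _:+_; _:*_; _:-_; _:=_; con) renaming (solve to solve≈)
  open ≈-Reasoning

  Table : Set
  Table = ℕ → ℕ → Series

  sum-head : ∀ n f → sum (suc n) f ≈ f 0 ⊕ sum n (λ i → f (suc i))
  sum-head zero    f = SR.+-comm 0ˢ (f 0)
  sum-head (suc n) f = ≈trans (⊕-cong (sum-head n f) ≈-refl) (SR.+-assoc _ _ _)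

  sum-⊕ : ∀ n f g → sum n (λ i → f i ⊕ g i) ≈ sum n f ⊕ sum n g
  sum-⊕ zero    f g = ≈sym (SR.+-identityˡ 0ˢ)
  sum-⊕ (suc n) f g = ≈trans (⊕-cong (sum-⊕ n f g) ≈-refl)
    (solve≈ 4 (λ a b c d → a :+ b :+ (c :+ d) := a :+ c :+ (b :+ d)) ≈-refl (sum n f) (sum n g) (f n) (g n))

  -- diagonal t k = Σ_{i + j = k} t i j and triangle t M = Σ_{i + j < M} t i j
  diagonal : Table → ℕ → Series
  diagonal t zero    = t 0 0
  diagonal t (suc k) = t 0 (suc k) ⊕ diagonal (λ i j → t (suc i) j) k

  triangle : Table → ℕ → Series
  triangle t zero    = 0ˢ
  triangle t (suc M) = sum (suc M) (t 0) ⊕ triangle (λ i j → t (suc i) j) M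

  sum-diagonal : ∀ t M → sum M (diagonal t) ≈ triangle t M
  sum-diagonal t zero    = ≈-refl
  sum-diagonal t (suc M) = begin
    sum (suc M) (diagonal t)
      ≈⟨ sum-head M (diagonal t) ⟩
    t 0 0 ⊕ sum M (λ k → t 0 (suc k) ⊕ diagonal t′ k)
      ≈⟨ ⊕-cong ≈-refl (≈trans (sum-⊕ M _ _) (⊕-cong ≈-refl (sum-diagonal t′ M))) ⟩
    t 0 0 ⊕ (sum M (λ k → t 0 (suc k)) ⊕ triangle t′ M)
      ≈⟨ ≈sym (SR.+-assoc _ _ _) ⟩
    t 0 0 ⊕ sum M (λ k → t 0 (suc k)) ⊕ triangle t′ M
      ≈⟨ ⊕-cong (≈sym (sum-head M (t 0))) ≈-refl ⟩
    triangle t (suc M) ∎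
    where
    t′ : Table
    t′ i j = t (suc i) j

  diagonal-cong : ∀ {t u} → (∀ i j → t i j ≈ u i j) → ∀ k → diagonal t k ≈ diagonal u k
  diagonal-cong p zero    = p 0 0
  diagonal-cong p (suc k) = ⊕-cong (p 0 (suc k)) (diagonal-cong (λ i j → p (suc i) j) k)

  diagonal-last : ∀ t k → diagonal t (suc k) ≈ diagonal (λ i j → t i (suc j)) k ⊕ t (suc k) 0
  diagonal-last t zero    = ≈-refl
  diagonal-last t (suc k) = ≈trans (⊕-cong ≈-refl (diagonal-last (λ i j → t (suc i) j) k)) (≈sym (SR.+-assoc _ _ _))

  diagonal-flip : ∀ t k → diagonal t k ≈ diagonal (λ i j → t j i) k
  diagonal-flip t zero    = ≈-refl
  diagonal-flip t (suc k) = ≈trans (⊕-cong ≈-refl (diagonal-flip (λ i j → t (suc i) j) k))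
    (≈trans (SR.+-comm _ _) (≈sym (diagonal-last (λ i j → t j i) k)))

  diagonal-sum : ∀ (f : ℕ → ℕ → Series) k → diagonal (λ i j → f i (i ℕ.+ j)) k ≈ sum (suc k) (λ i → f i k)
  diagonal-sum f zero    = ≈sym (SR.+-identityˡ (f 0 0))
  diagonal-sum f (suc k) = ≈trans (⊕-cong ≈-refl (diagonal-sum (λ i m → f (suc i) (suc m)) k))
    (≈sym (sum-head (suc k) (λ i → f i (suc k))))

  diagonal-⊕ : ∀ t u k → diagonal (λ i j → t i j ⊕ u i j) k ≈ diagonal t k ⊕ diagonal u k
  diagonal-⊕ t u zero    = ≈-refl
  diagonal-⊕ t u (suc k) = ≈trans (⊕-cong ≈-refl (diagonal-⊕ (λ i j → t (suc i) j) (λ i j → u (suc i) j) k))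
    (solve≈ 4 (λ a b c d → a :+ b :+ (c :+ d) := a :+ c :+ (b :+ d)) ≈-refl _ _ _ _)

  triangle-square : ∀ {N} (t : Table) M m n → M ≤ m → M ≤ n → (∀ i j → M ≤ i ℕ.+ j → t i j ≈[ N ] 0ˢ) →
                    triangle t M ≈[ N ] sum m (λ i → sum n (t i))
  triangle-square t zero m n _ _ p = ≈[]-sym (vanish m)
    where
    row : ∀ i n → sum n (t i) ≈[ _ ] 0ˢ
    row i zero    = ≈⇒≈[] ≈-refl
    row i (suc n) = ≈[]-trans (⊕-cong[] (row i n) (p i n z≤n)) (≈⇒≈[] (SR.+-identityˡ 0ˢ))
    vanish : ∀ m → sum m (λ i → sum n (t i)) ≈[ _ ] 0ˢ
    vanish zero    = ≈⇒≈[] ≈-refl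
    vanish (suc m) = ≈[]-trans (⊕-cong[] (vanish m) (row m n)) (≈⇒≈[] (SR.+-identityˡ 0ˢ))
  triangle-square {N} t (suc M) (suc m) n (s≤s M≤m) M<n p = ≈[]-trans
    (⊕-cong[] (≈[]-sym (subst (λ n → sum n (t 0) ≈[ N ] sum (suc M) (t 0)) (ℕP.m∸n+n≡m M<n) (row (n ℕ.∸ suc M))))
      (triangle-square (λ i j → t (suc i) j) M m n M≤m (ℕP.≤-trans (ℕP.n≤1+n M) M<n) (λ i j l → p (suc i) j (s≤s l))))
    (≈⇒≈[] (≈sym (sum-head m (λ i → sum n (t i)))))
    where
    row : ∀ d → sum (d ℕ.+ suc M) (t 0) ≈[ N ] sum (suc M) (t 0)
    row zero    = ≈⇒≈[] ≈-refl
    row (suc d) = ≈[]-trans (⊕-cong[] (row d) (p 0 (d ℕ.+ suc M) (ℕP.m≤n+m (suc M) d))) (≈⇒≈[] (SR.+-identityʳ _))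

  -- form a (a + b) - form a b = 2 a (a + b): summing L a L b = L (a + b) (1 + L a + L b) with
  -- these weights leaves Φ² on one side and single sums on the other.
  form : Series → Series → Series
  form a b = a ^ 2 ⊕ a · b ⊕ b ^ 2

  table : Table
  table i j = form (n# i) (n# j) · (L (suc i) · L (suc j))

  square-sum : ∀ m n → sum m (λ i → sum n (table i)) ≈ S 2 m · S 0 n ⊕ S 1 m · S 1 n ⊕ S 0 m · S 2 n
  square-sum m n = outer m
    where
    row : ∀ i n → sum n (table i) ≈ n# i ^ 2 · L (suc i) · S 0 n ⊕ n# i · L (suc i) · S 1 n ⊕ L (suc i) · S 2 n
    row i zero    = ≈trans (≈sym ι-0) (≈trans (solve≈ 2 (λ a l → con 0ℤ := a :^ 2 :* l :* con 0ℤ :+ a :* l :* con 0ℤ :+ l :* con 0ℤ) ≈-refl (n# i) (L (suc i)))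
      (⊕-cong (⊕-cong (·-congˡ _ ι-0) (·-congˡ _ ι-0)) (·-congˡ _ ι-0)))
    row i (suc n) = ≈trans (⊕-cong (row i n) ≈-refl) (solve≈ 7 (λ a l b k s₀ s₁ s₂ →
      (a :^ 2 :* l :* s₀ :+ a :* l :* s₁ :+ l :* s₂) :+ (a :^ 2 :+ a :* b :+ b :^ 2) :* (l :* k)
      := a :^ 2 :* l :* (s₀ :+ b :^ 0 :* k) :+ a :* l :* (s₁ :+ b :^ 1 :* k) :+ l :* (s₂ :+ b :^ 2 :* k)) ≈-refl
      (n# i) (L (suc i)) (n# n) (L (suc n)) (S 0 n) (S 1 n) (S 2 n))
    outer : ∀ m → sum m (λ i → sum n (table i)) ≈ S 2 m · S 0 n ⊕ S 1 m · S 1 n ⊕ S 0 m · S 2 n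
    outer zero    = ≈trans (≈sym ι-0) (≈trans (solve≈ 3 (λ a b c → con 0ℤ := con 0ℤ :* a :+ con 0ℤ :* b :+ con 0ℤ :* c) ≈-refl (S 0 n) (S 1 n) (S 2 n))
      (⊕-cong (⊕-cong (·-congʳ _ ι-0) (·-congʳ _ ι-0)) (·-congʳ _ ι-0)))
    outer (suc m) = ≈trans (⊕-cong (outer m) (row m n)) (solve≈ 8 (λ s₂ s₁ s₀ t₀ t₁ t₂ a l →
      (s₂ :* t₀ :+ s₁ :* t₁ :+ s₀ :* t₂) :+ (a :^ 2 :* l :* t₀ :+ a :* l :* t₁ :+ l :* t₂)
      := (s₂ :+ a :^ 2 :* l) :* t₀ :+ (s₁ :+ a :^ 1 :* l) :* t₁ :+ (s₀ :+ a :^ 0 :* l) :* t₂) ≈-refl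
      (S 2 m) (S 1 m) (S 0 m) (S 0 n) (S 1 n) (S 2 n) (n# m) (L (suc m)))

  n#-+ : ∀ i j → n# (suc (i ℕ.+ j)) ≈ n# i ⊕ n# j
  n#-+ i j = ≈trans (ι-≡ (cong (λ x → + suc x) (≡.sym (ℕP.+-suc i j)))) (ι-+ (+ suc i) (+ suc j))
    where
    ι-≡ : ∀ {a b} → a ≡ b → ι a ≈ ι b
    ι-≡ ≡.refl = ≈-refl

  n#-suc : ∀ i → n# (suc i) ≈ n# i ⊕ 1ˢ
  n#-suc i = ≈trans (ι-+ 1ℤ (+ suc i)) (SR.+-comm _ _)

  -- The sums of the first m integers and of their squares; the factor 6 clears the denominators of
  -- both.
  6·formSum : ∀ c m → ι (+ 6) · sum m (λ i → n# i ^ 2 ⊕ ⊖ (n# i · c) ⊕ c ^ 2) ⊕ ι (+ 3) · c · (ι (+ m) · n# m)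
              ≈ ι (+ m) · n# m · (ι (+ 2) · ι (+ m) ⊕ 1ˢ) ⊕ ι (+ 6) · c ^ 2 · ι (+ m)
  6·formSum c zero = ≈trans (⊕-cong (·-congˡ _ (≈sym ι-0)) ≈-refl)
    (solve≈ 1 (λ c → con (+ 6) :* con 0ℤ :+ con (+ 3) :* c :* (con 0ℤ :* con 1ℤ) := con 0ℤ :* con 1ℤ :* (con (+ 2) :* con 0ℤ :+ con 1ℤ) :+ con (+ 6) :* c :^ 2 :* con 0ℤ) ≈-refl c)
  6·formSum c (suc m) = begin
    ι (+ 6) · (s ⊕ (a ^ 2 ⊕ ⊖ (a · c) ⊕ c ^ 2)) ⊕ ι (+ 3) · c · (a · n# (suc m))
      ≈⟨ ⊕-cong ≈-refl (·-congˡ _ (·-congˡ a (≈trans (n#-suc m) (⊕-cong a-≈ ≈-refl)))) ⟩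
    ι (+ 6) · (s ⊕ (a ^ 2 ⊕ ⊖ (a · c) ⊕ c ^ 2)) ⊕ ι (+ 3) · c · (a · (b ⊕ 1ˢ ⊕ 1ˢ))
      ≈⟨ solve≈ 4 (λ s a b c → con (+ 6) :* (s :+ (a :^ 2 :- a :* c :+ c :^ 2)) :+ con (+ 3) :* c :* (a :* (b :+ con 1ℤ :+ con 1ℤ))
           := (con (+ 6) :* s :+ con (+ 3) :* c :* (b :* a)) :+ con (+ 6) :* (a :^ 2 :- a :* c :+ c :^ 2) :+ con (+ 6) :* (c :* a)) ≈-refl s a b c ⟩
    (ι (+ 6) · s ⊕ ι (+ 3) · c · (b · a)) ⊕ ι (+ 6) · (a ^ 2 ⊕ ⊖ (a · c) ⊕ c ^ 2) ⊕ ι (+ 6) · (c · a)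
      ≈⟨ ⊕-cong (⊕-cong (6·formSum c m) ≈-refl) ≈-refl ⟩
    b · a · (ι (+ 2) · b ⊕ 1ˢ) ⊕ ι (+ 6) · c ^ 2 · b ⊕ ι (+ 6) · (a ^ 2 ⊕ ⊖ (a · c) ⊕ c ^ 2) ⊕ ι (+ 6) · (c · a)
      ≈⟨ ⊕-cong (⊕-cong (⊕-cong (·-congʳ _ (·-congˡ b a-≈)) ≈-refl) (·-congˡ _ (⊕-cong (⊕-cong (^-congˡ 2 a-≈) (⊖-cong (·-congʳ c a-≈))) ≈-refl))) (·-congˡ _ (·-congˡ c a-≈)) ⟩
    b · (b ⊕ 1ˢ) · (ι (+ 2) · b ⊕ 1ˢ) ⊕ ι (+ 6) · c ^ 2 · b ⊕ ι (+ 6) · ((b ⊕ 1ˢ) ^ 2 ⊕ ⊖ ((b ⊕ 1ˢ) · c) ⊕ c ^ 2) ⊕ ι (+ 6) · (c · (b ⊕ 1ˢ))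
      ≈⟨ solve≈ 2 (λ b c → b :* (b :+ con 1ℤ) :* (con (+ 2) :* b :+ con 1ℤ) :+ con (+ 6) :* c :^ 2 :* b
             :+ con (+ 6) :* ((b :+ con 1ℤ) :^ 2 :- ((b :+ con 1ℤ) :* c) :+ c :^ 2) :+ con (+ 6) :* (c :* (b :+ con 1ℤ))
           := (b :+ con 1ℤ) :* (b :+ con 1ℤ :+ con 1ℤ) :* (con (+ 2) :* (b :+ con 1ℤ) :+ con 1ℤ) :+ con (+ 6) :* c :^ 2 :* (b :+ con 1ℤ)) ≈-refl b c ⟩
    (b ⊕ 1ˢ) · (b ⊕ 1ˢ ⊕ 1ˢ) · (ι (+ 2) · (b ⊕ 1ˢ) ⊕ 1ˢ) ⊕ ι (+ 6) · c ^ 2 · (b ⊕ 1ˢ)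
      ≈⟨ ≈sym (⊕-cong (·-cong (·-cong a-≈ (≈trans (n#-suc m) (⊕-cong a-≈ ≈-refl))) (⊕-cong (·-congˡ _ a-≈) ≈-refl)) (·-congˡ _ a-≈)) ⟩
    a · n# (suc m) · (ι (+ 2) · a ⊕ 1ˢ) ⊕ ι (+ 6) · c ^ 2 · a ∎
    where
    s a b : Series
    s = sum m (λ i → n# i ^ 2 ⊕ ⊖ (n# i · c) ⊕ c ^ 2)
    a = n# m
    b = ι (+ m)
    a-≈ : a ≈ b ⊕ 1ˢ
    a-≈ = ≈trans (ι-+ 1ℤ (+ m)) (SR.+-comm _ _)

  -- On a diagonal c = a + b is constant, so `L-product` takes L c out and the weight becomes a² - a
  -- c + c². By symmetry the sums with L a and with L b coincide; the pure weights add up to (5 c³ -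
  -- 6 c² + c) / 6.
  diagonal-table : ∀ k → let c = n# (suc k); s = suc k in
    ι (+ 6) · diagonal table k ≈
    L (suc (suc k)) · (ι (+ 5) · c ^ 3 ⊕ ⊖ (ι (+ 6) · c ^ 2) ⊕ c ⊕ ι (+ 12) · (S 2 s ⊕ ⊖ (c · S 1 s) ⊕ c ^ 2 · S 0 s))
  diagonal-table k = begin
    ι (+ 6) · diagonal table k
      ≈⟨ ·-congˡ _ (≈trans (diagonal-cong factor k) pull) ⟩
    ι (+ 6) · (l · diagonal (λ i j → G i j ⊕ G i j · L (suc i) ⊕ G i j · L (suc j)) k)
      ≈⟨ ·-congˡ _ (·-congˡ l (≈trans (diagonal-⊕ _ _ k) (⊕-cong (diagonal-⊕ _ _ k) flipped))) ⟩
    ι (+ 6) · (l · (diagonal G k ⊕ X ⊕ X))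
      ≈⟨ solve≈ 3 (λ l g x → con (+ 6) :* (l :* (g :+ x :+ x)) := l :* (con (+ 6) :* g :+ con (+ 12) :* x)) ≈-refl l (diagonal G k) X ⟩
    l · (ι (+ 6) · diagonal G k ⊕ ι (+ 12) · X)
      ≈⟨ ·-congˡ l (⊕-cong constant-part (·-congˡ _ X-≈)) ⟩
    l · (ι (+ 5) · c ^ 3 ⊕ ⊖ (ι (+ 6) · c ^ 2) ⊕ c ⊕ ι (+ 12) · (S 2 (suc k) ⊕ ⊖ (c · S 1 (suc k)) ⊕ c ^ 2 · S 0 (suc k))) ∎
    where
    c l X : Series
    c = n# (suc k)
    l = L (suc (suc k))
    G : Table
    G i j = form (n# i) (n# j)
    X = diagonal (λ i j → G i j · L (suc i)) k
    factor : ∀ i j → table i j ≈ L (suc (suc (i ℕ.+ j))) · (G i j ⊕ G i j · L (suc i) ⊕ G i j · L (suc j))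
    factor i j = ≈trans (·-congˡ _ (L-product i j)) (solve≈ 4 (λ g l a b → g :* (l :* (con 1ℤ :+ a :+ b)) := l :* (g :+ g :* a :+ g :* b)) ≈-refl
      (G i j) (L (suc (suc (i ℕ.+ j)))) (L (suc i)) (L (suc j)))
    scale : ∀ (h : ℕ → Series) (t : Table) k → diagonal (λ i j → h (i ℕ.+ j) · t i j) k ≈ h k · diagonal t k
    scale h t zero    = ≈-refl
    scale h t (suc k) = ≈trans (⊕-cong ≈-refl (scale (λ m → h (suc m)) (λ i j → t (suc i) j) k)) (≈sym (SR.distribˡ _ _ _))
    pull : diagonal (λ i j → L (suc (suc (i ℕ.+ j))) · (G i j ⊕ G i j · L (suc i) ⊕ G i j · L (suc j))) k ≈
           l · diagonal (λ i j → G i j ⊕ G i j · L (suc i) ⊕ G i j · L (suc j)) k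
    pull = scale (λ m → L (suc (suc m))) _ k
    G-sym : ∀ i j → G i j ≈ G j i
    G-sym i j = solve≈ 2 (λ a b → a :^ 2 :+ a :* b :+ b :^ 2 := b :^ 2 :+ b :* a :+ a :^ 2) ≈-refl (n# i) (n# j)
    flipped : diagonal (λ i j → G i j · L (suc j)) k ≈ X
    flipped = ≈trans (diagonal-flip _ k) (diagonal-cong (λ i j → ·-congʳ _ (G-sym j i)) k)
    G-c : ∀ i j → G i j ≈ n# i ^ 2 ⊕ ⊖ (n# i · n# (suc (i ℕ.+ j))) ⊕ n# (suc (i ℕ.+ j)) ^ 2
    G-c i j = ≈trans (solve≈ 2 (λ a b → a :^ 2 :+ a :* b :+ b :^ 2 := a :^ 2 :- a :* (a :+ b) :+ (a :+ b) :^ 2) ≈-refl (n# i) (n# j))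
      (≈sym (⊕-cong (⊕-cong ≈-refl (⊖-cong (·-congˡ _ (n#-+ i j)))) (^-congˡ 2 (n#-+ i j))))
    constant-part : ι (+ 6) · diagonal G k ≈ ι (+ 5) · c ^ 3 ⊕ ⊖ (ι (+ 6) · c ^ 2) ⊕ c
    constant-part = begin
      ι (+ 6) · diagonal G k
        ≈⟨ ·-congˡ _ (≈trans (diagonal-cong G-c k) (diagonal-sum (λ i m → n# i ^ 2 ⊕ ⊖ (n# i · n# (suc m)) ⊕ n# (suc m) ^ 2) k)) ⟩
      ι (+ 6) · s
        ≈⟨ solve≈ 2 (λ s x → con (+ 6) :* s := (con (+ 6) :* s :+ x) :- x) ≈-refl s (ι (+ 3) · c · (n# k · c)) ⟩
      (ι (+ 6) · s ⊕ ι (+ 3) · c · (n# k · c)) ⊕ ⊖ (ι (+ 3) · c · (n# k · c))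
        ≈⟨ ⊕-cong (6·formSum c (suc k)) ≈-refl ⟩
      n# k · c · (ι (+ 2) · n# k ⊕ 1ˢ) ⊕ ι (+ 6) · c ^ 2 · n# k ⊕ ⊖ (ι (+ 3) · c · (n# k · c))
        ≈⟨ ⊕-cong (⊕-cong (·-cong (·-congˡ _ c-≈) ≈-refl) (·-congʳ _ (·-congˡ _ (^-congˡ 2 c-≈)))) (⊖-cong (·-cong (·-congˡ _ c-≈) (·-congˡ _ c-≈))) ⟩
      n# k · d · (ι (+ 2) · n# k ⊕ 1ˢ) ⊕ ι (+ 6) · d ^ 2 · n# k ⊕ ⊖ (ι (+ 3) · d · (n# k · d))
        ≈⟨ solve≈ 1 (λ a → a :* (a :+ con 1ℤ) :* (con (+ 2) :* a :+ con 1ℤ) :+ con (+ 6) :* (a :+ con 1ℤ) :^ 2 :* a :- con (+ 3) :* (a :+ con 1ℤ) :* (a :* (a :+ con 1ℤ))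
             := con (+ 5) :* (a :+ con 1ℤ) :^ 3 :- con (+ 6) :* (a :+ con 1ℤ) :^ 2 :+ (a :+ con 1ℤ)) ≈-refl (n# k) ⟩
      ι (+ 5) · d ^ 3 ⊕ ⊖ (ι (+ 6) · d ^ 2) ⊕ d
        ≈⟨ ≈sym (⊕-cong (⊕-cong (·-congˡ _ (^-congˡ 3 c-≈)) (⊖-cong (·-congˡ _ (^-congˡ 2 c-≈)))) c-≈) ⟩
      ι (+ 5) · c ^ 3 ⊕ ⊖ (ι (+ 6) · c ^ 2) ⊕ c ∎
      where
      s d : Series
      s = sum (suc k) (λ i → n# i ^ 2 ⊕ ⊖ (n# i · c) ⊕ c ^ 2)
      d = n# k ⊕ 1ˢ
      c-≈ : c ≈ d
      c-≈ = n#-suc k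
    X-≈ : X ≈ S 2 (suc k) ⊕ ⊖ (c · S 1 (suc k)) ⊕ c ^ 2 · S 0 (suc k)
    X-≈ = ≈trans (diagonal-cong (λ i j → ·-congʳ _ (G-c i j)) k)
      (≈trans (diagonal-sum (λ i m → (n# i ^ 2 ⊕ ⊖ (n# i · n# (suc m)) ⊕ n# (suc m) ^ 2) · L (suc i)) k) (linear (suc k)))
      where
      linear : ∀ m → sum m (λ i → (n# i ^ 2 ⊕ ⊖ (n# i · c) ⊕ c ^ 2) · L (suc i)) ≈ S 2 m ⊕ ⊖ (c · S 1 m) ⊕ c ^ 2 · S 0 m
      linear zero    = ≈trans (≈sym ι-0) (≈trans (solve≈ 1 (λ c → con 0ℤ := con 0ℤ :- c :* con 0ℤ :+ c :^ 2 :* con 0ℤ) ≈-refl c)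
        (⊕-cong (⊕-cong ι-0 (⊖-cong (·-congˡ _ ι-0))) (·-congˡ _ ι-0)))
      linear (suc m) = ≈trans (⊕-cong (linear m) ≈-refl) (solve≈ 6 (λ a l c s₂ s₁ s₀ →
        (s₂ :- c :* s₁ :+ c :^ 2 :* s₀) :+ (a :^ 2 :- a :* c :+ c :^ 2) :* l
        := (s₂ :+ a :^ 2 :* l) :- c :* (s₁ :+ a :^ 1 :* l) :+ c :^ 2 :* (s₀ :+ a :^ 0 :* l)) ≈-refl (n# m) (L (suc m)) c (S 2 m) (S 1 m) (S 0 m))

  D-S₁ : ∀ m → D (S 1 (suc m)) ≈ D (S 1 m) ⊕ n# m ^ 2 · (L (suc m) ⊕ L (suc m) ^ 2)
  D-S₁ m = ≈trans (D-⊕ _ _) (⊕-cong ≈-refl (≈trans (D-· (n# m ^ 1) (L (suc m)))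
    (≈trans (⊕-cong (·-congʳ _ (≈trans (D-cong (SR.*-identityʳ _)) (≈trans (D-ι _) (≈sym ι-0)))) (·-congˡ _ (D-L m)))
      (solve≈ 2 (λ n l → con 0ℤ :* l :+ n :^ 1 :* (n :* (l :+ l :^ 2)) := n :^ 2 :* (l :+ l :^ 2)) ≈-refl (n# m) (L (suc m))))))

  -- An exact identity between square and triangle. In the step the new border of the square and the
  -- new diagonal cancel in all terms with S 0 and S 2 and leave 24 c S₁ L c, the cross term of 12
  -- S₁²; what remains belongs to 6 D S₁, 5 S₃ and S₁.
  defect : ∀ N → let M = suc N in
    ι (+ 6) · (ι (+ 2) · (S 0 M · S 2 M) ⊕ S 1 M ^ 2) ⊕ ⊖ (ι (+ 6) · sum N (diagonal table)) ≈
    ι (+ 12) · S 1 M ^ 2 ⊕ ι (+ 6) · D (S 1 M) ⊕ ⊖ (ι (+ 5) · S 3 M) ⊕ ⊖ S 1 M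
  defect zero = begin
    ι (+ 6) · (ι (+ 2) · ((0ˢ ⊕ 1ˢ ^ 0 · l) · (0ˢ ⊕ 1ˢ ^ 2 · l)) ⊕ (0ˢ ⊕ 1ˢ ^ 1 · l) ^ 2) ⊕ ⊖ (ι (+ 6) · 0ˢ)
      ≈⟨ solve≈ 2 (λ z l → con (+ 6) :* (con (+ 2) :* ((z :+ con 1ℤ :^ 0 :* l) :* (z :+ con 1ℤ :^ 2 :* l)) :+ (z :+ con 1ℤ :^ 1 :* l) :^ 2) :- con (+ 6) :* z
           := con (+ 6) :* (con (+ 2) :* ((z :+ l) :* (z :+ l)) :+ (z :+ l) :^ 2) :- con (+ 6) :* z) ≈-refl 0ˢ l ⟩
    ι (+ 6) · (ι (+ 2) · ((0ˢ ⊕ l) · (0ˢ ⊕ l)) ⊕ (0ˢ ⊕ l) ^ 2) ⊕ ⊖ (ι (+ 6) · 0ˢ)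
      ≈⟨ ⊕-cong (·-congˡ _ (⊕-cong (·-congˡ _ (·-cong zl zl)) (^-congˡ 2 zl))) (⊖-cong (·-congˡ _ (≈sym ι-0))) ⟩
    ι (+ 6) · (ι (+ 2) · (l · l) ⊕ l ^ 2) ⊕ ⊖ (ι (+ 6) · ι 0ℤ)
      ≈⟨ solve≈ 1 (λ l → con (+ 6) :* (con (+ 2) :* (l :* l) :+ l :^ 2) :- con (+ 6) :* con 0ℤ
           := con (+ 12) :* (con 1ℤ :^ 1 :* l) :^ 2 :+ con (+ 6) :* (con 0ℤ :+ con 1ℤ :^ 2 :* (l :+ l :^ 2)) :- con (+ 5) :* (con 1ℤ :^ 3 :* l) :- con 1ℤ :^ 1 :* l) ≈-refl l ⟩
    ι (+ 12) · (1ˢ ^ 1 · l) ^ 2 ⊕ ι (+ 6) · (ι 0ℤ ⊕ 1ˢ ^ 2 · (l ⊕ l ^ 2)) ⊕ ⊖ (ι (+ 5) · (1ˢ ^ 3 · l)) ⊕ ⊖ (1ˢ ^ 1 · l)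
      ≈⟨ ≈sym (⊕-cong (⊕-cong (⊕-cong (·-congˡ _ (^-congˡ 2 (SR.+-identityˡ _)))
           (·-congˡ _ (≈trans (D-S₁ 0) (⊕-cong (≈trans (D-cong (≈sym ι-0)) (≈trans (D-ι 0ℤ) (≈sym ι-0))) ≈-refl))))
           (⊖-cong (·-congˡ _ (SR.+-identityˡ _)))) (⊖-cong (SR.+-identityˡ _))) ⟩
    ι (+ 12) · S 1 1 ^ 2 ⊕ ι (+ 6) · D (S 1 1) ⊕ ⊖ (ι (+ 5) · S 3 1) ⊕ ⊖ S 1 1 ∎
    where
    l : Series
    l = L 1
    zl : 0ˢ ⊕ l ≈ l
    zl = SR.+-identityˡ l
  defect (suc N) = begin
    ι (+ 6) · (ι (+ 2) · (S 0 (suc M) · S 2 (suc M)) ⊕ S 1 (suc M) ^ 2) ⊕ ⊖ (ι (+ 6) · (T ⊕ diagonal table N))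
      ≈⟨ solve≈ 7 (λ s₀ s₁ s₂ c l t d →
           con (+ 6) :* (con (+ 2) :* ((s₀ :+ c :^ 0 :* l) :* (s₂ :+ c :^ 2 :* l)) :+ (s₁ :+ c :^ 1 :* l) :^ 2) :- con (+ 6) :* (t :+ d)
           := (con (+ 6) :* (con (+ 2) :* (s₀ :* s₂) :+ s₁ :^ 2) :- con (+ 6) :* t)
              :+ (con (+ 12) :* (s₀ :* (c :^ 2 :* l) :+ s₂ :* l :+ s₁ :* c :* l) :+ con (+ 18) :* (c :^ 2 :* l :^ 2)) :- con (+ 6) :* d) ≈-refl
           (S 0 M) (S 1 M) (S 2 M) c l T (diagonal table N) ⟩
    (ι (+ 6) · (ι (+ 2) · (S 0 M · S 2 M) ⊕ S 1 M ^ 2) ⊕ ⊖ (ι (+ 6) · T))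
      ⊕ (ι (+ 12) · (S 0 M · (c ^ 2 · l) ⊕ S 2 M · l ⊕ S 1 M · c · l) ⊕ ι (+ 18) · (c ^ 2 · l ^ 2)) ⊕ ⊖ (ι (+ 6) · diagonal table N)
      ≈⟨ ⊕-cong (⊕-cong (defect N) ≈-refl) (⊖-cong (diagonal-table N)) ⟩
    (ι (+ 12) · S 1 M ^ 2 ⊕ ι (+ 6) · D (S 1 M) ⊕ ⊖ (ι (+ 5) · S 3 M) ⊕ ⊖ S 1 M)
      ⊕ (ι (+ 12) · (S 0 M · (c ^ 2 · l) ⊕ S 2 M · l ⊕ S 1 M · c · l) ⊕ ι (+ 18) · (c ^ 2 · l ^ 2))
      ⊕ ⊖ (l · (ι (+ 5) · c ^ 3 ⊕ ⊖ (ι (+ 6) · c ^ 2) ⊕ c ⊕ ι (+ 12) · (S 2 M ⊕ ⊖ (c · S 1 M) ⊕ c ^ 2 · S 0 M)))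
      ≈⟨ solve≈ 7 (λ s₀ s₁ s₂ s₃ d c l →
           (con (+ 12) :* s₁ :^ 2 :+ con (+ 6) :* d :- con (+ 5) :* s₃ :- s₁)
           :+ (con (+ 12) :* (s₀ :* (c :^ 2 :* l) :+ s₂ :* l :+ s₁ :* c :* l) :+ con (+ 18) :* (c :^ 2 :* l :^ 2))
           :- l :* (con (+ 5) :* c :^ 3 :- con (+ 6) :* c :^ 2 :+ c :+ con (+ 12) :* (s₂ :- c :* s₁ :+ c :^ 2 :* s₀))
           := con (+ 12) :* (s₁ :+ c :^ 1 :* l) :^ 2 :+ con (+ 6) :* (d :+ c :^ 2 :* (l :+ l :^ 2)) :- con (+ 5) :* (s₃ :+ c :^ 3 :* l) :- (s₁ :+ c :^ 1 :* l)) ≈-refl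
           (S 0 M) (S 1 M) (S 2 M) (S 3 M) (D (S 1 M)) c l ⟩
    ι (+ 12) · S 1 (suc M) ^ 2 ⊕ ι (+ 6) · (D (S 1 M) ⊕ c ^ 2 · (l ⊕ l ^ 2)) ⊕ ⊖ (ι (+ 5) · S 3 (suc M)) ⊕ ⊖ S 1 (suc M)
      ≈⟨ ⊕-cong (⊕-cong (⊕-cong ≈-refl (·-congˡ _ (≈sym (D-S₁ M)))) ≈-refl) ≈-refl ⟩
    ι (+ 12) · S 1 (suc M) ^ 2 ⊕ ι (+ 6) · D (S 1 (suc M)) ⊕ ⊖ (ι (+ 5) · S 3 (suc M)) ⊕ ⊖ S 1 (suc M) ∎
    where
    M : ℕ
    M = suc N
    c l T : Series
    c = n# M
    l = L (suc M)
    T = sum N (diagonal table)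

  -- With E₂ = 1 - 24 Φ 1 this is 12 D E₂ = E₂² - E₄. It is the limit of `defect`, whose left side
  -- tends to 0 because square and triangle agree to order N.
  ramanujan : ι (+ 12) · Φ 1 ^ 2 ⊕ ι (+ 6) · D (Φ 1) ≈ ι (+ 5) · Φ 3 ⊕ Φ 1
  ramanujan = ≈trans (solve≈ 4 (λ p d s t → con (+ 12) :* p :^ 2 :+ con (+ 6) :* d
        := (con (+ 12) :* p :^ 2 :+ con (+ 6) :* d :+ con -[1+ 4 ] :* s :+ con -1ℤ :* p) :+ (con (+ 5) :* s :+ p)) ≈-refl (Φ 1) (D (Φ 1)) (Φ 3) 0ˢ)
    (≈trans (⊕-cong (≈[]⇒≈ vanishing) ≈-refl) (SR.+-identityˡ _))
    where
    vanishing : ∀ N → ι (+ 12) · Φ 1 ^ 2 ⊕ ι (+ 6) · D (Φ 1) ⊕ ι -[1+ 4 ] · Φ 3 ⊕ ι -1ℤ · Φ 1 ≈[ N ] 0ˢ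
    vanishing N = ≈[]-trans
      (⊕-cong[] (⊕-cong[] (⊕-cong[] (·-cong[] ι≈ (·-cong[] p₁ (·-cong[] p₁ (≈⇒≈[] ≈-refl)))) (·-cong[] ι≈ (D-cong[] p₁))) (·-cong[] ι≈ p₃)) (·-cong[] ι≈ p₁))
      (≈[]-trans (≈⇒≈[] (≈trans (solve≈ 3 (λ p d s → con (+ 12) :* p :^ 2 :+ con (+ 6) :* d :+ con -[1+ 4 ] :* s :+ con -1ℤ :* p
            := con (+ 12) :* p :^ 2 :+ con (+ 6) :* d :- con (+ 5) :* s :- p) ≈-refl (S 1 M) (D (S 1 M)) (S 3 M))
          (≈trans (≈sym (defect N)) (⊕-cong (·-congˡ _ (≈trans (solve≈ 3 (λ a b c → con (+ 2) :* (a :* c) :+ b :^ 2 := c :* a :+ b :* b :+ a :* c) ≈-refl (S 0 M) (S 1 M) (S 2 M)) (≈sym (square-sum M M))))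
            (≈trans (⊖-cong (·-congˡ _ (sum-diagonal table N))) (solve≈ 1 (λ x → :- (con (+ 6) :* x) := con -[1+ 5 ] :* x) ≈-refl (triangle table N)))))))
        (≈[]-trans (⊕-cong[] (·-cong[] ι≈ (≈[]-sym (triangle-square table N M M (ℕP.n≤1+n N) (ℕP.n≤1+n N) small))) (≈⇒≈[] ≈-refl))
          (≈⇒≈[] (≈trans (solve≈ 1 (λ x → con (+ 6) :* x :+ con -[1+ 5 ] :* x := con 0ℤ) ≈-refl (triangle table N)) ι-0))))
      where
      M : ℕ
      M = suc N
      ι≈ : ∀ {c} → ι c ≈[ N ] ι c
      ι≈ = ≈⇒≈[] ≈-refl
      p₁ : Φ 1 ≈[ N ] S 1 M
      p₁ = ≈[]-weaken (ℕP.n≤1+n N) (Φ-S 1 M)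
      p₃ : Φ 3 ≈[ N ] S 3 M
      p₃ = ≈[]-weaken (ℕP.n≤1+n N) (Φ-S 3 M)
      small : ∀ i j → N ≤ i ℕ.+ j → table i j ≈[ N ] 0ˢ
      small i j l = ≈[]-trans (≈⇒≈[] (·-congˡ _ (L-product i j)))
        (≈[]-trans (·-cong[] (≈⇒≈[] ≈-refl) (·-cong[] (L-small (suc (i ℕ.+ j)) N (s≤s (ℕP.m≤n⇒m≤1+n l))) (≈⇒≈[] ≈-refl)))
          (≈⇒≈[] (≈trans (·-congˡ _ (SR.zeroˡ _)) (SR.zeroʳ _))))

-- E₄ as a Lambert series, and uniqueness of solutions of equations in D and φ.

module Eisenstein where
  open SeriesRing
  open Operators
  open Evaluation
  open EulerDissection
  open Generators
  open DivisorSums using (Φ; sum; n#; L; divisorIndicator)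
  open RamanujanIdentity using (sum-head)
  open import Data.Nat as ℕ using (ℕ; zero; suc; _≤_; _<_; z≤n; s≤s)
  import Data.Nat.Properties as ℕP
  open import Data.Nat.Divisibility using (_∣?_)
  open import Data.Nat.Induction using (<-rec)
  open import Data.Integer as ℤ using (ℤ; +_; 0ℤ; 1ℤ)
  import Data.Integer.Properties as ℤP
  open import Algebra.Properties.AbelianGroup ℤP.+-0-abelianGroup using (∙-cancelˡ)
  open import Data.List using (List; []; _∷_; map; filter; upTo; applyUpTo)
  open import Data.Nat.ListAction using () renaming (sum to sumℕ)
  open import Relation.Nullary using (yes; no)
  open import Relation.Binary.PropositionalEquality as ≡ using (_≡_; cong; cong₂)

  open Solver using (_:^_; _:*_; _:=_) renaming (solve to solve≈)
  open ≈-Reasoning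

  sumℕ-filter : ∀ n (xs : List ℕ) →
    + sumℕ (map (λ d → d ℕ.* d ℕ.* d) (filter (λ d → d ∣? n) xs)) ≡ Σℤ (map (λ d → + (d ℕ.* d ℕ.* d) ℤ.* divisorIndicator d n) xs)
  sumℕ-filter n []       = ≡.refl
  sumℕ-filter n (d ∷ xs) with d ∣? n
  ... | yes _ = cong₂ ℤ._+_ (≡.sym (ℤP.*-identityʳ (+ (d ℕ.* d ℕ.* d)))) (sumℕ-filter n xs)
  ... | no  _ = ≡.trans (sumℕ-filter n xs)
    (≡.sym (≡.trans (cong (λ x → x ℤ.+ Σℤ (map (λ d → + (d ℕ.* d ℕ.* d) ℤ.* divisorIndicator d n) xs)) (ℤP.*-zeroʳ (+ (d ℕ.* d ℕ.* d))))
      (ℤP.+-identityˡ _)))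

  opaque
    unfolding _·_ φ

    sum-at : ∀ m f k → sum m f k ≡ Σℤ (applyUpTo (λ i → f i k) m)
    sum-at zero    f k = ≡.refl
    sum-at (suc m) f k = ≡.trans (at (sum-head m f) k) (cong (λ x → f 0 k ℤ.+ x) (sum-at m (λ i → f (suc i)) k))

    cube-at : ∀ i k → (n# i ^ 3 · L (suc i)) k ≡ + (suc i ℕ.* suc i ℕ.* suc i) ℤ.* L (suc i) k
    cube-at i k = ≡.trans (at (·-congʳ (L (suc i)) n³) k) (ι-scale-at _ (L (suc i)) k)
      where
      n³ : n# i ^ 3 ≈ ι (+ (suc i ℕ.* suc i ℕ.* suc i))
      n³ = ≈sym (≈trans (ι-≡ (≡.trans (ℤP.pos-* (suc i ℕ.* suc i) (suc i)) (cong (ℤ._* + suc i) (ℤP.pos-* (suc i) (suc i)))))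
        (≈trans (ι-* _ _) (≈trans (·-congʳ _ (ι-* _ _)) (solve≈ 1 (λ a → a :* a :* a := a :^ 3) ≈-refl (n# i)))))
        where
        ι-≡ : ∀ {a b} → a ≡ b → ι a ≈ ι b
        ι-≡ ≡.refl = ≈-refl

    E₄-Φ : E₄ ≈ 1ˢ ⊕ ι (+ 240) · Φ 3
    E₄-Φ = mk λ { zero → ≡.refl ; (suc n) → ≡.trans (ℤP.pos-* 240 (σ₃ (suc n)))
        (≡.trans (cong (+ 240 ℤ.*_) (σ₃-≡ n)) (≡.sym (≡.trans (ℤP.+-identityˡ _) (ι-scale-at (+ 240) (Φ 3) (suc n))))) }
      where
      apply-cong : ∀ m {f g : ℕ → ℤ} → (∀ i → f i ≡ g i) → Σℤ (applyUpTo f m) ≡ Σℤ (applyUpTo g m)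
      apply-cong zero    p = ≡.refl
      apply-cong (suc m) p = cong₂ ℤ._+_ (p 0) (apply-cong m (λ i → p (suc i)))
      σ₃-≡ : ∀ n → + σ₃ (suc n) ≡ Φ 3 (suc n)
      σ₃-≡ n = ≡.trans (sumℕ-filter (suc n) (map suc (upTo (suc n))))
        (≡.trans (cong Σℤ (≡.trans (cong (map term) (map-applyUpTo suc (λ i → i) (suc n))) (map-applyUpTo term suc (suc n))))
        (≡.trans (apply-cong (suc n) λ i → ≡.sym (cube-at i (suc n)))
          (≡.sym (sum-at (suc n) (λ i → n# i ^ 3 · L (suc i)) (suc n)))))
        where
        term : ℕ → ℤ
        term d = + (d ℕ.* d ℕ.* d) ℤ.* divisorIndicator d (suc n)

    D-vanishes : ∀ {f} → D f ≈ 0ˢ → f ≈ ι (f 0)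
    D-vanishes {f} p = mk λ { zero → ≡.refl
                            ; (suc n) → ℤP.*-cancelˡ-≡ (+ suc n) (f (suc n)) 0ℤ (≡.trans (at p (suc n)) (≡.sym (ℤP.*-zeroʳ (+ suc n)))) }

    φ-vanish : ∀ j f → (∀ i → i ℕ.* 7 ≤ j → f i ≡ 0ℤ) → φ f j ≡ 0ℤ
    φ-vanish 0 f p = p 0 z≤n
    φ-vanish 1 f p = ≡.refl
    φ-vanish 2 f p = ≡.refl
    φ-vanish 3 f p = ≡.refl
    φ-vanish 4 f p = ≡.refl
    φ-vanish 5 f p = ≡.refl
    φ-vanish 6 f p = ≡.refl
    φ-vanish (suc (suc (suc (suc (suc (suc (suc j))))))) f p = φ-vanish j (tail f)
      (λ i l → p (suc i) (s≤s (s≤s (s≤s (s≤s (s≤s (s≤s (s≤s l))))))))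

    -- The constant term satisfies f(0) = (k + 2) f(0), hence is 0. For n > 0 the right side at n
    -- involves only coefficients f(i) with 7 i ≤ n, which vanish by induction.
    φ-fixed-vanishes : ∀ {a b f} k → Unit a → Unit b → a · f ≈ ι (+ (2 ℕ.+ k)) · (b · φ f) → f ≈ 0ˢ
    φ-fixed-vanishes {a} {b} {f} k ua ub e = mk (<-rec (λ n → f n ≡ 0ℤ) step)
      where
      step : ∀ n → (∀ {i} → i < n → f i ≡ 0ℤ) → f n ≡ 0ℤ
      step zero    _ = ℤP.*-cancelˡ-≡ (+ suc k) (f 0) 0ℤ (≡.trans
        (∙-cancelˡ (f 0) (+ suc k ℤ.* f 0) 0ℤ (≡.trans (≡.sym suc-*) (≡.trans (≡.sym fixed) (≡.sym (ℤP.+-identityʳ (f 0))))))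
        (≡.sym (ℤP.*-zeroʳ (+ suc k))))
        where
        fixed : f 0 ≡ + (2 ℕ.+ k) ℤ.* f 0
        fixed = ≡.trans (≡.sym (≡.trans (cong (ℤ._* f 0) ua) (ℤP.*-identityˡ (f 0))))
          (≡.trans (at e 0) (cong (+ (2 ℕ.+ k) ℤ.*_) (≡.trans (cong (ℤ._* f 0) ub) (ℤP.*-identityˡ (f 0)))))
        suc-* : + (2 ℕ.+ k) ℤ.* f 0 ≡ f 0 ℤ.+ + suc k ℤ.* f 0
        suc-* = ≡.trans (ℤP.*-distribʳ-+ (f 0) 1ℤ (+ suc k)) (cong (λ x → x ℤ.+ + suc k ℤ.* f 0) (ℤP.*-identityˡ (f 0)))
      step (suc n) ih = ≡.trans (≡.sym (≡.trans (·-leading a f (suc n) (λ j l → ih l)) (≡.trans (cong (ℤ._* f (suc n)) ua) (ℤP.*-identityˡ (f (suc n))))))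
        (≡.trans (at e (suc n)) (≡.trans (ι-scale-at (+ (2 ℕ.+ k)) (b · φ f) (suc n))
          (≡.trans (cong (+ (2 ℕ.+ k) ℤ.*_) (·-vanish b (φ f) (suc n) (λ j l → φ-vanish j f (λ i l′ → ih (bound i j l l′))))) (ℤP.*-zeroʳ (+ (2 ℕ.+ k))))))
        where
        bound : ∀ i j → j ≤ suc n → i ℕ.* 7 ≤ j → i < suc n
        bound zero    j _ _  = s≤s z≤n
        bound (suc i) j l l′ = ℕP.<-≤-trans (s≤s (ℕP.≤-trans (s≤s (ℕP.m≤m*n i 7)) (ℕP.m≤n+m (suc (i ℕ.* 7)) 5))) (ℕP.≤-trans l′ l)

-- Forms of weight 2 and the parametrisation of t.

module WeightTwo where
  open SeriesRing
  open Operators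
  open Evaluation
  open Identities
  open Pentagonal
  open EulerDissection
  open Generators
  open DivisorSums using (Φ; D-E; U-Φ; D-q^)
  open Eisenstein
  open import Data.Integer using (+_; 0ℤ; 1ℤ; -1ℤ)
  open import Relation.Binary.PropositionalEquality as ≡ using (_≡_; subst)

  open Solver using (_:^_; :-_; _:+_; _:*_; _:-_; _:=_; con) renaming (solve to solve≈)
  open ≈-Reasoning

  D-⟪⟫ : ∀ e → D ⟪ e ⟫ ≈ ε · ⟪ ∂ e ⟫
  D-⟪⟫ = D-⟦⟧ Dy Dr

  -- The derivation one level below φ: the factor 7 in D r came from D φ = 7 φ D, so D r₀ is just ε₀
  -- r₀ (1 - r₀).
  module ∂₀ = Derivation (K 0ℤ) (R ∙ (K 1ℤ ⊟ R))

  D-⟪⟫₀ : ∀ e → D ⟪ e ⟫₀ ≈ ε₀ · ⟪ ∂₀.∂ e ⟫₀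
  D-⟪⟫₀ = ∂₀.D-⟦⟧ D0 Dr₀
    where
    D0 : D 0ˢ ≈ ε₀ · ι 0ℤ
    D0 = ≈trans (D-cong (≈sym ι-0)) (≈trans (D-ι 0ℤ) (≈trans (≈sym ι-0)
      (solve≈ 1 (λ e → con 0ℤ := e :* con 0ℤ) ≈-refl ε₀)))

  identity₀ : ∀ {a b} → Identity a b → YFree a → YFree b → ⟪ a ⟫₀ ≈ ⟪ b ⟫₀
  identity₀ {a} {b} p fa fb = φ-injective (≈trans (φ-⟪⟫ a fa) (≈trans (identity {a} {b} p) (≈sym (φ-⟪⟫ b fb))))

  p u v : Series
  p = Φ 1
  u = φ p
  v = φ u

  -- W = (7 E₂(q⁷) - E₂) / 6 and ψ = (49 E₂(q⁴⁹) - E₂) / 24 are the logarithmic derivatives of t and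
  -- ζ.
  W W₇ t s ψ : Series
  W = 1ˢ ⊕ ι (+ 4) · p ⊕ ⊖ (ι (+ 28) · u)
  W₇ = φ W
  t = q · φ E ^ 4 · iE ^ 4
  s = φ t
  ψ = ι (+ 2) ⊕ p ⊕ ⊖ (ι (+ 49) · v)

  φ-ι· : ∀ c f → φ (ι c · f) ≈ ι c · φ f
  φ-ι· c f = ≈trans (φ-· (ι c) f) (·-congʳ (φ f) (φ-ι c))

  W₇-≈ : W₇ ≈ 1ˢ ⊕ ι (+ 4) · u ⊕ ⊖ (ι (+ 28) · v)
  W₇-≈ = ≈trans (φ-+ _ _) (⊕-cong (≈trans (φ-+ _ _) (⊕-cong (φ-ι 1ℤ) (φ-ι· (+ 4) p))) (≈trans (φ-⊖ _) (⊖-cong (φ-ι· (+ 28) u))))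

  D-φE : D (φ E) ≈ ι (+ 7) · (⊖ (φ E · u))
  D-φE = ≈trans (D-φ E) (·-congˡ _ (≈trans (φ-cong D-E) (≈trans (φ-⊖ _) (⊖-cong (φ-· E p)))))

  D-iE : D iE ≈ iE · p
  D-iE = unit-regular E E-unit (begin
    E · D iE
      ≈⟨ solve≈ 3 (λ a b d → b := (a :* d :+ b) :- a :* d) ≈-refl (D E) (E · D iE) iE ⟩
    (D E · iE ⊕ E · D iE) ⊕ ⊖ (D E · iE)
      ≈⟨ ⊕-cong (≈trans (≈sym (D-· E iE)) (≈trans (D-cong E·iE) (≈trans (D-ι 1ℤ) (≈sym ι-0)))) (⊖-cong (·-congʳ iE D-E)) ⟩
    ι 0ℤ ⊕ ⊖ (⊖ (E · p) · iE)
      ≈⟨ solve≈ 3 (λ e p i → con 0ℤ :- (:- (e :* p) :* i) := e :* (i :* p)) ≈-refl E p iE ⟩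
    E · (iE · p) ∎)

  D-t : D t ≈ t · W
  D-t = begin
    D (q · φ E ^ 4 · iE ^ 4)
      ≈⟨ D-· (q · φ E ^ 4) (iE ^ 4) ⟩
    D (q · φ E ^ 4) · iE ^ 4 ⊕ q · φ E ^ 4 · D (iE ^ 4)
      ≈⟨ ⊕-cong (·-congʳ _ (≈trans (D-· q (φ E ^ 4)) (⊕-cong (·-congʳ _ D-q) (·-congˡ q (≈trans (D-^ (φ E) 3) (·-congˡ _ D-φE))))))
           (·-congˡ _ (≈trans (D-^ iE 3) (·-congˡ _ D-iE))) ⟩
    (q · φ E ^ 4 ⊕ q · (ι (+ 4) · φ E ^ 3 · (ι (+ 7) · (⊖ (φ E · u))))) · iE ^ 4 ⊕ q · φ E ^ 4 · (ι (+ 4) · iE ^ 3 · (iE · p))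
      ≈⟨ solve≈ 5 (λ q e i p u → (q :* e :^ 4 :+ q :* (con (+ 4) :* e :^ 3 :* (con (+ 7) :* (:- (e :* u))))) :* i :^ 4
             :+ q :* e :^ 4 :* (con (+ 4) :* i :^ 3 :* (i :* p))
           := q :* e :^ 4 :* i :^ 4 :* (con 1ℤ :+ con (+ 4) :* p :- con (+ 28) :* u)) ≈-refl q (φ E) iE p u ⟩
    t · W ∎

  D-φφE : D (φ (φ E)) ≈ ⊖ (ι (+ 49) · φ (φ E) · v)
  D-φφE = ≈trans (D-φ (φ E)) (≈trans (·-congˡ _ (≈trans (φ-cong D-φE) (≈trans (φ-ι· (+ 7) _)
      (·-congˡ _ (≈trans (φ-⊖ _) (⊖-cong (φ-· (φ E) u)))))))
    (solve≈ 2 (λ e v → con (+ 7) :* (con (+ 7) :* (:- (e :* v))) := :- (con (+ 49) :* e :* v)) ≈-refl (φ (φ E)) v))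

  D-ζ : D ζ ≈ ζ · ψ
  D-ζ = begin
    D (q ^ 2 · φ (φ E) · iE)
      ≈⟨ ≈trans (D-· (q ^ 2 · φ (φ E)) iE) (⊕-cong (·-congʳ iE (≈trans (D-· (q ^ 2) (φ (φ E)))
           (⊕-cong (·-congʳ _ (D-q^ 2)) (·-congˡ _ D-φφE)))) (·-congˡ _ D-iE)) ⟩
    (ι (+ 2) · q ^ 2 · φ (φ E) ⊕ q ^ 2 · (⊖ (ι (+ 49) · φ (φ E) · v))) · iE ⊕ q ^ 2 · φ (φ E) · (iE · p)
      ≈⟨ solve≈ 5 (λ q e i p v → (con (+ 2) :* q :* e :+ q :* (:- (con (+ 49) :* e :* v))) :* i :+ q :* e :* (i :* p)
           := q :* e :* i :* (con (+ 2) :+ p :- con (+ 49) :* v)) ≈-refl (q ^ 2) (φ (φ E)) iE p v ⟩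
    ζ · ψ ∎

  f : Series
  f = ⟪ fᵉ ⟫

  ψ·f : ψ · f ≈ ε · ⟪ ψᵉ ⟫
  ψ·f = ζ-regular (begin
    ζ · (ψ · f)
      ≈⟨ solve≈ 4 (λ z p f d → z :* (p :* f) := (z :* p :* f :+ z :* d) :- z :* d) ≈-refl ζ ψ f (D f) ⟩
    (ζ · ψ · f ⊕ ζ · D f) ⊕ ⊖ (ζ · D f)
      ≈⟨ ⊕-cong (≈trans (⊕-cong (·-congʳ f (≈sym D-ζ)) ≈-refl) (≈trans (≈sym (D-· ζ f)) (D-cong ζ·f))) (⊖-cong (·-congˡ ζ (D-⟪⟫ fᵉ))) ⟩
    D ⟪ zᵉ ⟫ ⊕ ⊖ (ζ · (ε · ⟪ ∂ fᵉ ⟫))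
      ≈⟨ ⊕-cong (≈trans (D-⟪⟫ zᵉ) (·-congˡ ε (identity {∂ zᵉ} {zᵉ ∙ (k# 2 ⊟ k# 24 ∙ R)} z-derivative))) ≈-refl ⟩
    ε · (⟪ zᵉ ⟫ · k) ⊕ ⊖ (ζ · (ε · ⟪ ∂ fᵉ ⟫))
      ≈⟨ ⊕-cong (·-congˡ ε (·-congʳ k (≈sym ζ·f))) ≈-refl ⟩
    ε · (ζ · f · k) ⊕ ⊖ (ζ · (ε · ⟪ ∂ fᵉ ⟫))
      ≈⟨ solve≈ 5 (λ e z f k d → e :* (z :* f :* k) :- z :* (e :* d) := z :* (e :* (k :* f :+ con -1ℤ :* d))) ≈-refl ε ζ f k ⟪ ∂ fᵉ ⟫ ⟩
    ζ · (ε · ⟪ ψᵉ ⟫) ∎)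
    where
    k : Series
    k = ⟪ k# 2 ⊟ k# 24 ∙ R ⟫

  -- The Hecke relation turns p - 49 v into 8 p - 7 u - 49 u, which is twice 4 p - 28 u. This makes
  -- W accessible to extraction of the coefficient of y⁰.
  U-ψ : U ψ ≈ ι (+ 2) · W
  U-ψ = ≈trans (U-⊕ _ _) (≈trans (⊕-cong (≈trans (U-⊕ _ _) (⊕-cong (≈trans (U-cong (≈sym (φ-ι (+ 2)))) (U-φ (ι (+ 2)))) U-Φ))
      (≈trans (U-cong (≈trans (⊖-cong (≈sym (φ-ι· (+ 49) u))) (≈sym (φ-⊖ _)))) (U-φ _)))
    (solve≈ 2 (λ p u → con (+ 2) :+ (con (+ 8) :* p :- con (+ 7) :* u) :- con (+ 49) :* u
      := con (+ 2) :* (con 1ℤ :+ con (+ 4) :* p :- con (+ 28) :* u)) ≈-refl p u))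

  τ₀ n₀ rw₀ : Series
  τ₀ = ⟪ τᵉ ⟫₀
  n₀ = ⟪ nᵉ ⟫₀
  rw₀ = ⟪ R ∙ wᵉ ⟫₀

  -- 2 W = U ψ, where ψ = ε ψᵉ / f. Multiplying by the norm of f, which passes through U, replaces 1
  -- / f by its cofactor, and `ψ-constant` gives the result.
  W·τ₀ : W · τ₀ ≈ ε₀ · n₀ ^ 2
  W·τ₀ = ·-regular (ι-regular 1) (·-regular (cancel₀ τᵉ ≡.refl) (^-regular 6 (cancel₀ wᵉ ≡.refl))) (begin
    ι (+ 2) · (τ₀ · w₀ ^ 6) · (W · τ₀)
      ≈⟨ solve≈ 3 (λ t x w → con (+ 2) :* (t :* x) :* (w :* t) := t :^ 2 :* x :* (con (+ 2) :* w)) ≈-refl τ₀ (w₀ ^ 6) W ⟩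
    τ₀ ^ 2 · w₀ ^ 6 · (ι (+ 2) · W)
      ≈⟨ ·-congˡ _ (≈sym U-ψ) ⟩
    τ₀ ^ 2 · w₀ ^ 6 · U ψ
      ≈⟨ ≈sym (U-φ· _ ψ) ⟩
    U (φ ⟪ τᵉ ^^ 2 ∙ wᵉ ^^ 6 ⟫₀ · ψ)
      ≈⟨ U-cong (≈trans (·-congʳ ψ (≈trans (φ-⟪⟫ (τᵉ ^^ 2 ∙ wᵉ ^^ 6) _) (≈sym (identity {fᵉ ∙ f*ᵉ} {τᵉ ^^ 2 ∙ wᵉ ^^ 6} norm-f))))
           (≈trans (solve≈ 3 (λ f g p → f :* g :* p := p :* f :* g) ≈-refl f ⟪ f*ᵉ ⟫ ψ) (≈trans (·-congʳ _ ψ·f) (SR.*-assoc ε _ _)))) ⟩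
    U (φ ε₀ · ⟪ ψᵉ ∙ f*ᵉ ⟫)
      ≈⟨ ≈trans (U-φ· ε₀ _) (·-congˡ ε₀ (constant {ψᵉ ∙ f*ᵉ} {k# 2 ∙ nᵉ ^^ 2 ∙ τᵉ ∙ wᵉ ^^ 6} ψ-constant _)) ⟩
    ε₀ · (ι (+ 2) · n₀ ^ 2 · τ₀ · w₀ ^ 6)
      ≈⟨ solve≈ 4 (λ e n t x → e :* (con (+ 2) :* n :^ 2 :* t :* x) := con (+ 2) :* (t :* x) :* (e :* n :^ 2)) ≈-refl ε₀ n₀ τ₀ (w₀ ^ 6) ⟩
    ι (+ 2) · (τ₀ · w₀ ^ 6) · (ε₀ · n₀ ^ 2) ∎)

  -- The quotient f / g has derivative 0, so it is constant, and the equal leading terms q make the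
  -- constant 1.
  same-log-derivative : ∀ {f g f′ g′} → f ≈ q · f′ → g ≈ q · g′ → Unit f′ → Unit g′ → D f · g ≈ f · D g → f ≈ g
  same-log-derivative {f} {g} {f′} {g′} ef eg uf ug e = ≈trans f-gh (≈trans (·-congˡ g h-1) (SR.*-identityʳ g))
    where
    h : Series
    h = f′ · inv g′
    f-gh : f ≈ g · h
    f-gh = ≈trans ef (≈trans (≈trans (≈sym (SR.*-identityʳ _)) (·-congˡ _ (≈sym (inv-right g′ ug))))
      (≈trans (solve≈ 4 (λ q f g i → q :* f :* (g :* i) := q :* g :* (f :* i)) ≈-refl q f′ g′ (inv g′)) (·-congʳ h (≈sym eg))))
    g-regular : Regular g
    g-regular = ≈-regular (≈sym eg) (·-regular q-regular (unit-regular g′ ug))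
    Dh : D h ≈ 0ˢ
    Dh = g-regular (g-regular (begin
      g · (g · D h)
        ≈⟨ solve≈ 4 (λ g h a b → g :* (g :* b) := (a :* h :+ g :* b) :* g :- g :* h :* a) ≈-refl g h (D g) (D h) ⟩
      (D g · h ⊕ g · D h) · g ⊕ ⊖ (g · h · D g)
        ≈⟨ ⊕-cong (·-congʳ g (≈trans (≈sym (D-· g h)) (D-cong (≈sym f-gh)))) (⊖-cong (·-congʳ _ (≈sym f-gh))) ⟩
      D f · g ⊕ ⊖ (f · D g)
        ≈⟨ ⊕-cong e ≈-refl ⟩
      f · D g ⊕ ⊖ (f · D g)
        ≈⟨ solve≈ 2 (λ a g → a :- a := g :* (g :* con 0ℤ)) ≈-refl (f · D g) g ⟩
      g · (g · ι 0ℤ)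
        ≈⟨ ·-congˡ g (·-congˡ g ι-0) ⟩
      g · (g · 0ˢ) ∎))
    h-1 : h ≈ 1ˢ
    h-1 = ≈trans (D-vanishes Dh) (subst (λ c → ι (h 0) ≈ ι c) (·-unit f′ (inv g′) uf (inv-at-0 g′)) ≈-refl)

  iE-unit : Unit iE
  iE-unit = inv-at-0 E

  -- As D log t = W = ε₀ n² / τ, comparing logarithmic derivatives leaves only the polynomial
  -- identity n² + ∂ τ = (1 - 2 r) τ.
  t·τ₀ : t · τ₀ ≈ rw₀
  t·τ₀ = same-log-derivative {f′ = φ E ^ 4 · iE ^ 4 · τ₀} {g′ = r₀₀ · w₀}
    (solve≈ 4 (λ q e i t → q :* e :* i :* t := q :* (e :* i :* t)) ≈-refl q (φ E ^ 4) (iE ^ 4) τ₀)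
    (SR.*-assoc q r₀₀ w₀)
    (·-unit _ τ₀ (·-unit _ _ (^-unit (φ E) 4 (φ-unit E E-unit)) (^-unit iE 4 iE-unit)) (⟪⟫₀-unit τᵉ ≡.refl))
    (·-unit r₀₀ w₀ r₀₀-unit w₀-unit)
    (begin
      D (t · τ₀) · rw₀
        ≈⟨ ·-congʳ rw₀ (≈trans (D-· t τ₀) (⊕-cong (·-congʳ τ₀ D-t) (·-congˡ t (D-⟪⟫₀ τᵉ)))) ⟩
      (t · W · τ₀ ⊕ t · (ε₀ · ⟪ ∂₀.∂ τᵉ ⟫₀)) · rw₀
        ≈⟨ ·-congʳ rw₀ (⊕-cong (≈trans (SR.*-assoc t W τ₀) (·-congˡ t W·τ₀)) ≈-refl) ⟩
      (t · (ε₀ · n₀ ^ 2) ⊕ t · (ε₀ · ⟪ ∂₀.∂ τᵉ ⟫₀)) · rw₀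
        ≈⟨ solve≈ 5 (λ t e n d x → (t :* (e :* n) :+ t :* (e :* d)) :* x := t :* e :* (n :+ d) :* x) ≈-refl t ε₀ (n₀ ^ 2) ⟪ ∂₀.∂ τᵉ ⟫₀ rw₀ ⟩
      t · ε₀ · ⟪ nᵉ ^^ 2 ∔ ∂₀.∂ τᵉ ⟫₀ · rw₀
        ≈⟨ ·-congʳ rw₀ (·-congˡ _ (identity₀ {nᵉ ^^ 2 ∔ ∂₀.∂ τᵉ} {(k# 1 ⊟ k# 2 ∙ R) ∙ τᵉ} ≡.refl _ _)) ⟩
      t · ε₀ · (⟪ k# 1 ⊟ k# 2 ∙ R ⟫₀ · τ₀) · rw₀
        ≈⟨ solve≈ 5 (λ t e k τ x → t :* e :* (k :* τ) :* x := t :* τ :* (e :* (x :* k))) ≈-refl t ε₀ ⟪ k# 1 ⊟ k# 2 ∙ R ⟫₀ τ₀ rw₀ ⟩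
      t · τ₀ · (ε₀ · (rw₀ · ⟪ k# 1 ⊟ k# 2 ∙ R ⟫₀))
        ≈⟨ ·-congˡ _ (≈sym (≈trans (D-⟪⟫₀ (R ∙ wᵉ)) (·-congˡ ε₀ (identity₀ {∂₀.∂ (R ∙ wᵉ)} {R ∙ wᵉ ∙ (k# 1 ⊟ k# 2 ∙ R)} ≡.refl _ _)))) ⟩
      t · τ₀ · D rw₀ ∎)

  τ n c rw yτ : Series
  τ = ⟪ τᵉ ⟫
  n = ⟪ nᵉ ⟫
  c = ⟪ cᵉ ⟫
  rw = ⟪ R ∙ wᵉ ⟫
  yτ = ⟪ Y ∙ τᵉ ∙ wᵉ ^^ 11 ⟫

  s·τ : s · τ ≈ rw
  s·τ = ≈trans (·-congˡ s (≈sym (φ-⟪⟫ τᵉ _))) (≈trans (≈sym (φ-· t τ₀)) (≈trans (φ-cong t·τ₀) (φ-⟪⟫ (R ∙ wᵉ) _)))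

  τ·W₇ : τ · W₇ ≈ ε · n ^ 2
  τ·W₇ = ≈trans (·-congʳ W₇ (≈sym (φ-⟪⟫ τᵉ _))) (≈trans (≈sym (φ-· τ₀ W)) (≈trans (φ-cong (≈trans (SR.*-comm τ₀ W) W·τ₀))
    (≈trans (φ-· ε₀ _) (·-congˡ ε (φ-⟪⟫ (nᵉ ^^ 2) _)))))

  -- The powers of E(q⁷) cancel. The relation converts t^j φ(t)^j into ζ^(4j) and also yields t from
  -- ζ and φ t.
  t·s : t · s ≈ ζ ^ 4
  t·s = begin
    q · φ E ^ 4 · iE ^ 4 · φ t
      ≈⟨ ·-congˡ _ (≈trans (φ-· _ _) (·-cong (≈trans (φ-· q _) (·-cong φ-q (φ-^ (φ E) 4))) (φ-^ iE 4))) ⟩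
    q · φ E ^ 4 · iE ^ 4 · (q ^ 7 · φ (φ E) ^ 4 · φ iE ^ 4)
      ≈⟨ solve≈ 5 (λ q e i d j → q :* e :^ 4 :* i :^ 4 :* (q :^ 7 :* d :^ 4 :* j :^ 4) := (q :^ 2 :* d :* i) :^ 4 :* (e :* j) :^ 4) ≈-refl
           q (φ E) iE (φ (φ E)) (φ iE) ⟩
    ζ ^ 4 · (φ E · φ iE) ^ 4
      ≈⟨ ·-congˡ _ (^-congˡ 4 (≈trans (≈sym (φ-· E iE)) (≈trans (φ-cong E·iE) (φ-ι 1ℤ)))) ⟩
    ζ ^ 4 · 1ˢ ^ 4
      ≈⟨ solve≈ 1 (λ z → z :* con 1ℤ :^ 4 := z) ≈-refl (ζ ^ 4) ⟩
    ζ ^ 4 ∎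

  t·f⁴ : t · f ^ 4 ≈ yτ
  t·f⁴ = ·-regular r-regular (cancel wᵉ ≡.refl) (begin
    rw · (t · f ^ 4)
      ≈⟨ ·-congʳ _ (≈sym s·τ) ⟩
    s · τ · (t · f ^ 4)
      ≈⟨ solve≈ 4 (λ s τ t f → s :* τ :* (t :* f :^ 4) := t :* s :* f :^ 4 :* τ) ≈-refl s τ t f ⟩
    t · s · f ^ 4 · τ
      ≈⟨ ·-congʳ τ (≈trans (·-congʳ _ t·s) (solve≈ 2 (λ z f → z :^ 4 :* f :^ 4 := (z :* f) :^ 4) ≈-refl ζ f)) ⟩
    (ζ · f) ^ 4 · τ
      ≈⟨ ·-congʳ τ (^-congˡ 4 ζ·f) ⟩
    ⟪ zᵉ ^^ 4 ∙ τᵉ ⟫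
      ≈⟨ identity {zᵉ ^^ 4 ∙ τᵉ} {R ∙ wᵉ ∙ (Y ∙ τᵉ ∙ wᵉ ^^ 11)} ≡.refl ⟩
    rw · yτ ∎)

  τw⁴W : τ · w ^ 4 · W ≈ ε · c ^ 2
  τw⁴W = cancel fᵉ ≡.refl (begin
    f · (τ · w ^ 4 · W)
      ≈⟨ ·-congˡ f (·-congˡ _ W-≈) ⟩
    f · (τ · w ^ 4 · (ι (+ 4) · ψ ⊕ ⊖ (ι (+ 7) · W₇)))
      ≈⟨ solve≈ 5 (λ f τ x p w → f :* (τ :* x :* (con (+ 4) :* p :- con (+ 7) :* w)) := x :* (con (+ 4) :* τ :* (p :* f) :- con (+ 7) :* (τ :* w) :* f)) ≈-refl f τ (w ^ 4) ψ W₇ ⟩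
    w ^ 4 · (ι (+ 4) · τ · (ψ · f) ⊕ ⊖ (ι (+ 7) · (τ · W₇) · f))
      ≈⟨ ·-congˡ _ (⊕-cong (·-congˡ _ ψ·f) (⊖-cong (·-congʳ f (·-congˡ _ τ·W₇)))) ⟩
    w ^ 4 · (ι (+ 4) · τ · (ε · ⟪ ψᵉ ⟫) ⊕ ⊖ (ι (+ 7) · (ε · n ^ 2) · f))
      ≈⟨ solve≈ 6 (λ x τ e p n f → x :* (con (+ 4) :* τ :* (e :* p) :- con (+ 7) :* (e :* n) :* f)
           := e :* (x :* (con (+ 4) :* τ :* p :+ con -1ℤ :* (con (+ 7) :* n :* f)))) ≈-refl (w ^ 4) τ ε ⟪ ψᵉ ⟫ (n ^ 2) f ⟩
    ε · ⟪ wᵉ ^^ 4 ∙ (k# 4 ∙ τᵉ ∙ ψᵉ ⊟ k# 7 ∙ nᵉ ^^ 2 ∙ fᵉ) ⟫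
      ≈⟨ ·-congˡ ε (identity {wᵉ ^^ 4 ∙ (k# 4 ∙ τᵉ ∙ ψᵉ ⊟ k# 7 ∙ nᵉ ^^ 2 ∙ fᵉ)} {fᵉ ∙ cᵉ ^^ 2} c-square) ⟩
    ε · (f · c ^ 2)
      ≈⟨ solve≈ 3 (λ e f c → e :* (f :* c) := f :* (e :* c)) ≈-refl ε f (c ^ 2) ⟩
    f · (ε · c ^ 2) ∎)
    where
    W-≈ : W ≈ ι (+ 4) · ψ ⊕ ⊖ (ι (+ 7) · W₇)
    W-≈ = ≈sym (≈trans (⊕-cong ≈-refl (⊖-cong (·-congˡ _ W₇-≈)))
      (solve≈ 3 (λ p u v → con (+ 4) :* (con (+ 2) :+ p :- con (+ 49) :* v) :- con (+ 7) :* (con 1ℤ :+ con (+ 4) :* u :- con (+ 28) :* v)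
        := con 1ℤ :+ con (+ 4) :* p :- con (+ 28) :* u) ≈-refl p u v))

-- The form ω and the expression of E₄ through it.

module WeightFour where
  open SeriesRing
  open Operators
  open Evaluation
  open Identities
  open Pentagonal
  open EulerDissection
  open Generators
  open DivisorSums using (Φ)
  open RamanujanIdentity using (ramanujan)
  open Eisenstein
  open WeightTwo
  open import Data.Nat using (ℕ)
  open import Data.Integer as ℤ using (ℤ; +_; -[1+_]; 0ℤ; 1ℤ; -1ℤ)
  import Data.Integer.Properties as ℤP
  open import Data.Product using (_,_; _×_; proj₁; proj₂)
  open import Relation.Binary.PropositionalEquality as ≡ using (_≡_; cong; cong₂)

  open Solver using (_:^_; :-_; _:+_; _:*_; _:-_; _:=_; con) renaming (solve to solve≈)
  open ≈-Reasoning

  quadratic : ℕ → ℕ → Series → Series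
  quadratic a b x = 1ˢ ⊕ ι (+ a) · x ⊕ ι (+ b) · x ^ 2

  quadratic-unit : ∀ a b x → x 0 ≡ 0ℤ → Unit (quadratic a b x)
  quadratic-unit a b x p = ≡.trans (⊕-0 _ _) (cong₂ ℤ._+_
    (≡.trans (⊕-0 _ _) (cong₂ ℤ._+_ (ι-at-0 1ℤ) (vanishing (ι (+ a)) x p)))
    (vanishing (ι (+ b)) (x ^ 2) (≡.trans (·-0 x (x ^ 1)) (≡.trans (cong (ℤ._* (x ^ 1) 0) p) (ℤP.*-zeroˡ ((x ^ 1) 0))))))
    where
    vanishing : ∀ k x → x 0 ≡ 0ℤ → (k · x) 0 ≡ 0ℤ
    vanishing k x p = ≡.trans (·-0 k x) (≡.trans (cong (k 0 ℤ.*_) p) (ℤP.*-zeroʳ (k 0)))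

  φ-quadratic : ∀ a b x → φ (quadratic a b x) ≈ quadratic a b (φ x)
  φ-quadratic a b x = ≈trans (φ-+ _ _) (⊕-cong (≈trans (φ-+ _ _) (⊕-cong (φ-ι 1ℤ) (φ-ι· (+ a) x)))
    (≈trans (φ-ι· (+ b) _) (·-congˡ _ (φ-^ x 2))))

  t-at-0 : t 0 ≡ 0ℤ
  t-at-0 = ≡.trans (at (SR.*-assoc q (φ E ^ 4) (iE ^ 4)) 0) (q·-at-0 (φ E ^ 4 · iE ^ 4))

  -- The weight 4 form on Γ₀(7) through which everything is expressed; 1 + 13 t + 49 t² accounts
  -- for the elliptic points, where the weight 2 form W vanishes.
  ω : Series
  ω = W ^ 2 · inv (quadratic 13 49 t)

  ω-equation : ω · quadratic 13 49 t ≈ W ^ 2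
  ω-equation = ≈trans (solve≈ 3 (λ w i x → w :* i :* x := w :* (x :* i)) ≈-refl (W ^ 2) (inv (quadratic 13 49 t)) (quadratic 13 49 t))
    (≈trans (·-congˡ _ (inv-right _ (quadratic-unit 13 49 t t-at-0))) (SR.*-identityʳ _))

  s-quadratic : ∀ a b → τ ^ 2 · quadratic a b s ≈ τ ^ 2 ⊕ ι (+ a) · rw · τ ⊕ ι (+ b) · rw ^ 2
  s-quadratic a b = ≈trans (solve≈ 4 (λ τ s a b → τ :^ 2 :* (con 1ℤ :+ a :* s :+ b :* s :^ 2) := τ :^ 2 :+ a :* (s :* τ) :* τ :+ b :* (s :* τ) :^ 2) ≈-refl
      τ s (ι (+ a)) (ι (+ b)))
    (⊕-cong (⊕-cong ≈-refl (·-congʳ τ (·-congˡ _ s·τ))) (·-congˡ _ (^-congˡ 2 s·τ)))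

  t-quadratic : ∀ a b → f ^ 8 · quadratic a b t ≈ f ^ 8 ⊕ ι (+ a) · yτ · f ^ 4 ⊕ ι (+ b) · yτ ^ 2
  t-quadratic a b = ≈trans (solve≈ 4 (λ f t a b → f :^ 8 :* (con 1ℤ :+ a :* t :+ b :* t :^ 2) := f :^ 8 :+ a :* (t :* f :^ 4) :* f :^ 4 :+ b :* (t :* f :^ 4) :^ 2) ≈-refl
      f t (ι (+ a)) (ι (+ b)))
    (⊕-cong (⊕-cong ≈-refl (·-congʳ _ (·-congˡ _ t·f⁴))) (·-congˡ _ (^-congˡ 2 t·f⁴)))

  -- (φ W)² = ε² n⁴ / τ² is divided by n³ / τ²; one factor n survives.
  φω : φ ω ≈ ε ^ 2 · n
  φω = ^-regular 3 (cancel nᵉ ≡.refl) (begin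
    n ^ 3 · φ ω
      ≈⟨ ·-congʳ (φ ω) (≈sym (≈trans (s-quadratic 13 49) (identity {τᵉ ^^ 2 ∔ k# 13 ∙ (R ∙ wᵉ) ∙ τᵉ ∔ k# 49 ∙ (R ∙ wᵉ) ^^ 2} {nᵉ ^^ 3} n-cube))) ⟩
    τ ^ 2 · quadratic 13 49 s · φ ω
      ≈⟨ solve≈ 3 (λ τ x o → τ :* x :* o := τ :* (o :* x)) ≈-refl (τ ^ 2) (quadratic 13 49 s) (φ ω) ⟩
    τ ^ 2 · (φ ω · quadratic 13 49 s)
      ≈⟨ ·-congˡ _ (≈trans (·-congˡ _ (≈sym (φ-quadratic 13 49 t))) (≈trans (≈sym (φ-· ω _)) (≈trans (φ-cong ω-equation) (φ-^ W 2)))) ⟩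
    τ ^ 2 · W₇ ^ 2
      ≈⟨ solve≈ 2 (λ τ w → τ :^ 2 :* w :^ 2 := (τ :* w) :^ 2) ≈-refl τ W₇ ⟩
    (τ · W₇) ^ 2
      ≈⟨ ^-congˡ 2 τ·W₇ ⟩
    (ε · n ^ 2) ^ 2
      ≈⟨ solve≈ 2 (λ e n → (e :* n :^ 2) :^ 2 := n :^ 3 :* (e :^ 2 :* n)) ≈-refl ε n ⟩
    n ^ 3 · (ε ^ 2 · n) ∎)

  scale : Series
  scale = τ ^ 2 · w ^ 22

  -- The same quotient for ω itself: W² contributes c⁴, the quadratic in t contributes c³ / f⁷, by
  -- `c-cube`.
  ω·scale : ω · scale ≈ ε ^ 2 · (c · f ^ 7)
  ω·scale = ·-regular (cancel fᵉ ≡.refl) (^-regular 3 (cancel cᵉ ≡.refl)) (begin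
    f · c ^ 3 · (ω · (τ ^ 2 · w ^ 22))
      ≈⟨ solve≈ 5 (λ f c o τ w → f :* c :* (o :* (τ :* w :^ 22)) := o :* (τ :* w :^ 8) :* (f :* c :* w :^ 14)) ≈-refl f (c ^ 3) ω (τ ^ 2) w ⟩
    ω · (τ ^ 2 · w ^ 8) · (f · c ^ 3 · w ^ 14)
      ≈⟨ ·-congˡ _ (≈sym (≈trans (t-quadratic 13 49) (identity {fᵉ ^^ 8 ∔ k# 13 ∙ (Y ∙ τᵉ ∙ wᵉ ^^ 11) ∙ fᵉ ^^ 4 ∔ k# 49 ∙ (Y ∙ τᵉ ∙ wᵉ ^^ 11) ^^ 2}
           {fᵉ ∙ cᵉ ^^ 3 ∙ wᵉ ^^ 14} c-cube))) ⟩
    ω · (τ ^ 2 · w ^ 8) · (f ^ 8 · quadratic 13 49 t)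
      ≈⟨ solve≈ 5 (λ o τ w f x → o :* (τ :^ 2 :* w :^ 8) :* (f :* x) := τ :^ 2 :* w :^ 8 :* f :* (o :* x)) ≈-refl ω τ w (f ^ 8) (quadratic 13 49 t) ⟩
    τ ^ 2 · w ^ 8 · f ^ 8 · (ω · quadratic 13 49 t)
      ≈⟨ ·-congˡ _ ω-equation ⟩
    τ ^ 2 · w ^ 8 · f ^ 8 · W ^ 2
      ≈⟨ solve≈ 4 (λ τ w f x → τ :^ 2 :* w :^ 8 :* f :* x :^ 2 := f :* (τ :* w :^ 4 :* x) :^ 2) ≈-refl τ w (f ^ 8) W ⟩
    f ^ 8 · (τ · w ^ 4 · W) ^ 2
      ≈⟨ ·-congˡ _ (^-congˡ 2 τw⁴W) ⟩
    f ^ 8 · (ε · c ^ 2) ^ 2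
      ≈⟨ solve≈ 3 (λ f e c → f :^ 8 :* (e :* c :^ 2) :^ 2 := f :* c :^ 3 :* (e :^ 2 :* (c :* f :^ 7))) ≈-refl f ε c ⟩
    f · c ^ 3 · (ε ^ 2 · (c · f ^ 7)) ∎)

  p′ u′ v′ : Series
  p′ = D p
  u′ = φ p′
  v′ = φ u′

  E₄-≈ : E₄ ≈ 1ˢ ⊕ ⊖ (ι (+ 48) · p) ⊕ ι (+ 576) · p ^ 2 ⊕ ι (+ 288) · p′
  E₄-≈ = ≈trans E₄-Φ (≈trans (solve≈ 2 (λ x p → con 1ℤ :+ con (+ 240) :* x := con 1ℤ :+ con (+ 48) :* ((con (+ 5) :* x :+ p) :- p)) ≈-refl (Φ 3) p)
    (≈trans (⊕-cong ≈-refl (·-congˡ _ (⊕-cong (≈sym ramanujan) ≈-refl)))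
      (solve≈ 2 (λ p d → con 1ℤ :+ con (+ 48) :* ((con (+ 12) :* p :^ 2 :+ con (+ 6) :* d) :- p)
        := con 1ℤ :- con (+ 48) :* p :+ con (+ 576) :* p :^ 2 :+ con (+ 288) :* d) ≈-refl p p′)))

  φ-E₄-shape : ∀ x d → φ (1ˢ ⊕ ⊖ (ι (+ 48) · x) ⊕ ι (+ 576) · x ^ 2 ⊕ ι (+ 288) · d)
                     ≈ 1ˢ ⊕ ⊖ (ι (+ 48) · φ x) ⊕ ι (+ 576) · φ x ^ 2 ⊕ ι (+ 288) · φ d
  φ-E₄-shape x d = ≈trans (φ-+ _ _) (⊕-cong (≈trans (φ-+ _ _) (⊕-cong (≈trans (φ-+ _ _) (⊕-cong (φ-ι 1ℤ)
    (≈trans (φ-⊖ _) (⊖-cong (φ-ι· (+ 48) x))))) (≈trans (φ-ι· (+ 576) _) (·-congˡ _ (φ-^ x 2))))) (φ-ι· (+ 288) d))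

  D-ι· : ∀ k f → D (ι k · f) ≈ ι k · D f
  D-ι· k f = ≈trans (D-· (ι k) f) (≈trans (⊕-cong (·-congʳ f (≈trans (D-ι k) (≈sym ι-0))) ≈-refl)
    (solve≈ 3 (λ k f d → con 0ℤ :* f :+ k :* d := k :* d) ≈-refl (ι k) f (D f)))

  D-W : D W ≈ ι (+ 4) · p′ ⊕ ⊖ (ι (+ 196) · u′)
  D-W = ≈trans (D-⊕ _ _) (≈trans (⊕-cong (≈trans (D-⊕ _ _) (⊕-cong (≈trans (D-ι 1ℤ) (≈sym ι-0)) (D-ι· (+ 4) p)))
      (≈trans (D-⊖ _) (⊖-cong (≈trans (D-ι· (+ 28) u) (·-congˡ _ (D-φ p))))))
    (solve≈ 2 (λ p u → con 0ℤ :+ con (+ 4) :* p :- con (+ 28) :* (con (+ 7) :* u) := con (+ 4) :* p :- con (+ 196) :* u) ≈-refl p′ u′))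

  D-W₇ : D W₇ ≈ ι (+ 7) · (ι (+ 4) · u′ ⊕ ⊖ (ι (+ 196) · v′))
  D-W₇ = ≈trans (D-φ W) (·-congˡ _ (≈trans (φ-cong D-W) (≈trans (φ-+ _ _) (⊕-cong (φ-ι· (+ 4) p′) (≈trans (φ-⊖ _) (⊖-cong (φ-ι· (+ 196) u′)))))))

  -- The factor 49 = 7² makes X linear in E₂, since E₂² - 49 E₂(q⁷)² has the factor W. Accordingly
  -- X̂ is Ê₄ - 49 φ Ê₄, with 2352 = 2401 - 49, 48 = 49 - 1, and no linear term because 245 = 49 ·
  -- 5.
  X X̂ J : Series
  X = E₄ ⊕ ⊖ (ι (+ 49) · φ E₄)
  X̂ = ω · (ι (+ 2352) · t ^ 2 ⊕ ⊖ ι (+ 48))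
  J = D W · W₇ ⊕ ⊖ (W · D W₇)

  rhs : Series
  rhs = ι (+ 36) · W ^ 2 · W₇ ⊕ ι (+ 252) · W · W₇ ^ 2 ⊕ ι (+ 72) · J

  -- Eliminating E₂ from X = -12 E₂ W - 36 W² + 72 D W and from its image under q ↦ q⁷.
  X-equation : W₇ · X ⊕ ⊖ (ι (+ 7) · (W · φ X)) ≈ rhs
  X-equation = begin
    W₇ · X ⊕ ⊖ (ι (+ 7) · (W · φ X))
      ≈⟨ ⊕-cong (·-cong W₇-≈ (⊕-cong E₄-≈ (⊖-cong (·-congˡ _ φE₄)))) (⊖-cong (·-congˡ _ (·-congˡ W
           (≈trans (φ-+ _ _) (⊕-cong φE₄ (≈trans (φ-⊖ _) (⊖-cong (≈trans (φ-ι· (+ 49) _) (·-congˡ _ φφE₄))))))))) ⟩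
    _
      ≈⟨ solve≈ 6 (λ p u v p′ u′ v′ →
           let k : ℕ → Solver.Polynomial 6
               k = λ m → con (+ m)
               W = k 1 :+ k 4 :* p :- k 28 :* u
               W₇ = k 1 :+ k 4 :* u :- k 28 :* v
               e : (x d : Solver.Polynomial 6) → Solver.Polynomial 6
               e = λ x d → k 1 :- k 48 :* x :+ k 576 :* x :^ 2 :+ k 288 :* d
               dW = k 4 :* p′ :- k 196 :* u′
               dW₇ = k 7 :* (k 4 :* u′ :- k 196 :* v′)
           in W₇ :* (e p p′ :- k 49 :* e u u′) :- k 7 :* (W :* (e u u′ :- k 49 :* e v v′))
              := k 36 :* W :^ 2 :* W₇ :+ k 252 :* W :* W₇ :^ 2 :+ k 72 :* (dW :* W₇ :- W :* dW₇)) ≈-refl p u v p′ u′ v′ ⟩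
    _
      ≈⟨ ≈sym (⊕-cong (⊕-cong (·-congˡ _ W₇-≈) (·-congˡ _ (^-congˡ 2 W₇-≈))) (·-congˡ _ (⊕-cong (·-cong D-W W₇-≈) (⊖-cong (·-congˡ W D-W₇))))) ⟩
    rhs ∎
    where
    φE₄ : φ E₄ ≈ 1ˢ ⊕ ⊖ (ι (+ 48) · u) ⊕ ι (+ 576) · u ^ 2 ⊕ ι (+ 288) · u′
    φE₄ = ≈trans (φ-cong E₄-≈) (φ-E₄-shape p p′)
    φφE₄ : φ (φ E₄) ≈ 1ˢ ⊕ ⊖ (ι (+ 48) · v) ⊕ ι (+ 576) · v ^ 2 ⊕ ι (+ 288) · v′
    φφE₄ = ≈trans (φ-cong φE₄) (φ-E₄-shape u u′)

  -- The Wronskian J is W₇² D (W / W₇), and W / W₇ = c² / (n² w⁴) is free of ε, so the unknown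
  -- derivative of ε does not enter.
  n²w⁴J : n ^ 2 · w ^ 4 · J ≈ ε · (⟪ ∂ (cᵉ ^^ 2) ⟫ · W₇ ^ 2 ⊕ ⊖ (⟪ ∂ (nᵉ ^^ 2 ∙ wᵉ ^^ 4) ⟫ · W · W₇))
  n²w⁴J = begin
    N · (D W · W₇ ⊕ ⊖ (W · D W₇))
      ≈⟨ solve≈ 6 (λ N w w₇ d d₇ e → N :* (d :* w₇ :- w :* d₇) := ((e :* w :+ N :* d) :* w₇ :- (N :* w) :* d₇) :- e :* w :* w₇) ≈-refl
           N W W₇ (D W) (D W₇) (D N) ⟩
    ((D N · W ⊕ N · D W) · W₇ ⊕ ⊖ (N · W · D W₇)) ⊕ ⊖ (D N · W · W₇)
      ≈⟨ ⊕-cong (⊕-cong (·-congʳ W₇ (≈trans (≈sym (D-· N W)) (≈trans (D-cong proportional) (D-· C W₇)))) (⊖-cong (·-congʳ _ proportional))) ≈-refl ⟩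
    ((D C · W₇ ⊕ C · D W₇) · W₇ ⊕ ⊖ (C · W₇ · D W₇)) ⊕ ⊖ (D N · W · W₇)
      ≈⟨ ⊕-cong (⊕-cong (·-congʳ W₇ (⊕-cong (·-congʳ W₇ (D-⟪⟫ (cᵉ ^^ 2))) ≈-refl)) ≈-refl) (⊖-cong (·-congʳ W₇ (·-congʳ W (D-⟪⟫ (nᵉ ^^ 2 ∙ wᵉ ^^ 4))))) ⟩
    ((ε · dC · W₇ ⊕ C · D W₇) · W₇ ⊕ ⊖ (C · W₇ · D W₇)) ⊕ ⊖ (ε · dN · W · W₇)
      ≈⟨ solve≈ 7 (λ e a w₇ C d₇ b w → ((e :* a :* w₇ :+ C :* d₇) :* w₇ :- C :* w₇ :* d₇) :- e :* b :* w :* w₇ := e :* (a :* w₇ :^ 2 :- b :* w :* w₇)) ≈-refl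
           ε dC W₇ C (D W₇) dN W ⟩
    ε · (dC · W₇ ^ 2 ⊕ ⊖ (dN · W · W₇)) ∎
    where
    N C dN dC : Series
    N = n ^ 2 · w ^ 4
    C = c ^ 2
    dN = ⟪ ∂ (nᵉ ^^ 2 ∙ wᵉ ^^ 4) ⟫
    dC = ⟪ ∂ (cᵉ ^^ 2) ⟫
    proportional : N · W ≈ C · W₇
    proportional = cancel τᵉ ≡.refl (begin
      τ · (n ^ 2 · w ^ 4 · W)  ≈⟨ solve≈ 4 (λ τ n w x → τ :* (n :* w :* x) := n :* (τ :* w :* x)) ≈-refl τ (n ^ 2) (w ^ 4) W ⟩
      n ^ 2 · (τ · w ^ 4 · W)  ≈⟨ ·-congˡ _ τw⁴W ⟩
      n ^ 2 · (ε · c ^ 2)      ≈⟨ solve≈ 3 (λ n e c → n :* (e :* c) := c :* (e :* n)) ≈-refl (n ^ 2) ε C ⟩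
      c ^ 2 · (ε · n ^ 2)      ≈⟨ ·-congˡ _ (≈sym τ·W₇) ⟩
      c ^ 2 · (τ · W₇)         ≈⟨ solve≈ 3 (λ c τ x → c :* (τ :* x) := τ :* (c :* x)) ≈-refl C τ W₇ ⟩
      τ · (c ^ 2 · W₇)         ∎)

  φX̂ : φ X̂ ≈ ε ^ 2 · n · (ι (+ 2352) · s ^ 2 ⊕ ⊖ ι (+ 48))
  φX̂ = ≈trans (φ-· ω _) (·-cong φω (≈trans (φ-+ _ _) (⊕-cong (≈trans (φ-ι· (+ 2352) _) (·-congˡ _ (φ-^ t 2))) (≈trans (φ-⊖ _) (⊖-cong (φ-ι (+ 48)))))))

  multiplier : Series
  multiplier = n ^ 2 · τ ^ 3 · w ^ 22 · f

  X̂-identity : Expr × Expr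
  X̂-identity =
    ( nᵉ ^^ 4 ∙ cᵉ ∙ (k# 2352 ∙ (Y ∙ τᵉ ∙ wᵉ ^^ 11) ^^ 2 ∔ K -[1+ 47 ] ∙ fᵉ ^^ 8)
      ∔ K -[1+ 6 ] ∙ (wᵉ ^^ 18 ∙ fᵉ ∙ nᵉ ^^ 3 ∙ cᵉ ^^ 2 ∙ (k# 2352 ∙ (R ∙ wᵉ) ^^ 2 ∔ K -[1+ 47 ] ∙ τᵉ ^^ 2))
    , wᵉ ^^ 14 ∙ fᵉ ∙ (k# 36 ∙ cᵉ ^^ 4 ∙ nᵉ ^^ 4
        ∔ k# 72 ∙ τᵉ ∙ (∂ (cᵉ ^^ 2) ∙ nᵉ ^^ 4 ∙ wᵉ ^^ 4 ∔ K -1ℤ ∙ (∂ (nᵉ ^^ 2 ∙ wᵉ ^^ 4) ∙ cᵉ ^^ 2 ∙ nᵉ ^^ 2)))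
      ∔ wᵉ ^^ 18 ∙ fᵉ ∙ (k# 252 ∙ cᵉ ^^ 2 ∙ nᵉ ^^ 6) )

  X̂-identity-holds : Identity (proj₁ X̂-identity) (proj₂ X̂-identity)
  X̂-identity-holds = ≡.refl

  -- Every term has weight 6. Once `multiplier` has cleared the denominators, each is ε³ times a
  -- polynomial in y and r, and the polynomials agree by computation.
  X̂-equation : W₇ · X̂ ⊕ ⊖ (ι (+ 7) · (W · φ X̂)) ≈ rhs
  X̂-equation = ·-regular (·-regular (·-regular (^-regular 2 (cancel nᵉ ≡.refl)) (^-regular 3 (cancel τᵉ ≡.refl))) (^-regular 22 (cancel wᵉ ≡.refl)))
                         (cancel fᵉ ≡.refl) (begin
    multiplier · (W₇ · X̂ ⊕ ⊖ (ι (+ 7) · (W · φ X̂)))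
      ≈⟨ solve≈ 9 (λ n τ w f W₇ o t W X →
           n :^ 2 :* τ :^ 3 :* w :^ 22 :* f :* (W₇ :* (o :* (con (+ 2352) :* t :^ 2 :- con (+ 48))) :- con (+ 7) :* (W :* X))
           := n :^ 2 :* (τ :* W₇) :* f :* (o :* (τ :^ 2 :* w :^ 22)) :* (con (+ 2352) :* t :^ 2 :- con (+ 48))
           :- con (+ 7) :* (n :^ 2 :* w :^ 18 :* f :* (τ :* w :^ 4 :* W) :* (τ :^ 2 :* X))) ≈-refl n τ w f W₇ ω t W (φ X̂) ⟩
    n ^ 2 · (τ · W₇) · f · (ω · scale) · (ι (+ 2352) · t ^ 2 ⊕ ⊖ ι (+ 48)) ⊕ ⊖ (ι (+ 7) · (n ^ 2 · w ^ 18 · f · (τ · w ^ 4 · W) · (τ ^ 2 · φ X̂)))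
      ≈⟨ ⊕-cong (·-congʳ _ (·-cong (·-congʳ f (·-congˡ _ τ·W₇)) ω·scale)) (⊖-cong (·-congˡ _ (·-cong (·-congˡ _ τw⁴W) τ²φX̂))) ⟩
    n ^ 2 · (ε · n ^ 2) · f · (ε ^ 2 · (c · f ^ 7)) · (ι (+ 2352) · t ^ 2 ⊕ ⊖ ι (+ 48))
      ⊕ ⊖ (ι (+ 7) · (n ^ 2 · w ^ 18 · f · (ε · c ^ 2) · (ε ^ 2 · n · (ι (+ 2352) · rw ^ 2 ⊕ ι -[1+ 47 ] · τ ^ 2))))
      ≈⟨ solve≈ 7 (λ n e f c t x z →
           n :^ 2 :* (e :* n :^ 2) :* f :* (e :^ 2 :* (c :* f :^ 7)) :* (con (+ 2352) :* t :^ 2 :- con (+ 48))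
             :- con (+ 7) :* (n :^ 2 :* x :* f :* (e :* c :^ 2) :* (e :^ 2 :* n :* z))
           := e :^ 3 :* (n :^ 4 :* c :* (con (+ 2352) :* (t :* f :^ 4) :^ 2 :+ con -[1+ 47 ] :* f :^ 8)
              :+ con -[1+ 6 ] :* (x :* f :* n :^ 3 :* c :^ 2 :* z))) ≈-refl n ε f c t (w ^ 18) (ι (+ 2352) · rw ^ 2 ⊕ ι -[1+ 47 ] · τ ^ 2) ⟩
    ε ^ 3 · (n ^ 4 · c · (ι (+ 2352) · (t · f ^ 4) ^ 2 ⊕ ι -[1+ 47 ] · f ^ 8) ⊕ ι -[1+ 6 ] · (w ^ 18 · f · n ^ 3 · c ^ 2 · (ι (+ 2352) · rw ^ 2 ⊕ ι -[1+ 47 ] · τ ^ 2)))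
      ≈⟨ ·-congˡ _ (⊕-cong (·-congˡ _ (⊕-cong (·-congˡ _ (^-congˡ 2 t·f⁴)) ≈-refl)) ≈-refl) ⟩
    ε ^ 3 · ⟪ proj₁ X̂-identity ⟫
      ≈⟨ ·-congˡ _ (identity {proj₁ X̂-identity} {proj₂ X̂-identity} X̂-identity-holds) ⟩
    ε ^ 3 · ⟪ proj₂ X̂-identity ⟫
      ≈⟨ solve≈ 8 (λ e w f c n τ dC dN →
           e :^ 3 :* (w :^ 14 :* f :* (con (+ 36) :* c :^ 4 :* n :^ 4 :+ con (+ 72) :* τ :* (dC :* n :^ 4 :* w :^ 4 :+ con -1ℤ :* (dN :* c :^ 2 :* n :^ 2)))
             :+ w :^ 18 :* f :* (con (+ 252) :* c :^ 2 :* n :^ 6))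
           := con (+ 36) :* (n :^ 2 :* w :^ 14 :* f :* (e :* c :^ 2) :^ 2 :* (e :* n :^ 2)) :+ con (+ 252) :* (n :^ 2 :* w :^ 18 :* f :* (e :* c :^ 2) :* (e :* n :^ 2) :^ 2)
              :+ con (+ 72) :* (τ :* w :^ 14 :* f :* e :* (dC :* w :^ 4 :* (e :* n :^ 2) :^ 2 :- dN :* (e :* c :^ 2) :* (e :* n :^ 2)))) ≈-refl
           ε w f c n τ dC dN ⟩
    ι (+ 36) · (n ^ 2 · w ^ 14 · f · (ε · c ^ 2) ^ 2 · (ε · n ^ 2)) ⊕ ι (+ 252) · (n ^ 2 · w ^ 18 · f · (ε · c ^ 2) · (ε · n ^ 2) ^ 2)
      ⊕ ι (+ 72) · (τ · w ^ 14 · f · ε · (dC · w ^ 4 · (ε · n ^ 2) ^ 2 ⊕ ⊖ (dN · (ε · c ^ 2) · (ε · n ^ 2))))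
      ≈⟨ ≈sym (⊕-cong (⊕-cong (·-congˡ _ (·-cong (·-congˡ _ (^-congˡ 2 τw⁴W)) τ·W₇)) (·-congˡ _ (·-cong (·-congˡ _ τw⁴W) (^-congˡ 2 τ·W₇))))
           (·-congˡ _ (·-congˡ _ (⊕-cong (·-congˡ _ (^-congˡ 2 τ·W₇)) (⊖-cong (·-cong (·-congˡ dN τw⁴W) τ·W₇)))))) ⟩
    ι (+ 36) · (n ^ 2 · w ^ 14 · f · (τ · w ^ 4 · W) ^ 2 · (τ · W₇)) ⊕ ι (+ 252) · (n ^ 2 · w ^ 18 · f · (τ · w ^ 4 · W) · (τ · W₇) ^ 2)
      ⊕ ι (+ 72) · (τ · w ^ 14 · f · ε · (dC · w ^ 4 · (τ · W₇) ^ 2 ⊕ ⊖ (dN · (τ · w ^ 4 · W) · (τ · W₇))))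
      ≈⟨ solve≈ 9 (λ e w f n τ W W₇ dC dN →
           con (+ 36) :* (n :^ 2 :* w :^ 14 :* f :* (τ :* w :^ 4 :* W) :^ 2 :* (τ :* W₇)) :+ con (+ 252) :* (n :^ 2 :* w :^ 18 :* f :* (τ :* w :^ 4 :* W) :* (τ :* W₇) :^ 2)
             :+ con (+ 72) :* (τ :* w :^ 14 :* f :* e :* (dC :* w :^ 4 :* (τ :* W₇) :^ 2 :- dN :* (τ :* w :^ 4 :* W) :* (τ :* W₇)))
           := con (+ 36) :* (n :^ 2 :* τ :^ 3 :* w :^ 22 :* f :* (W :^ 2 :* W₇)) :+ con (+ 252) :* (n :^ 2 :* τ :^ 3 :* w :^ 22 :* f :* (W :* W₇ :^ 2))
             :+ con (+ 72) :* (τ :^ 3 :* w :^ 18 :* f :* (e :* (dC :* W₇ :^ 2 :- dN :* W :* W₇)))) ≈-refl ε w f n τ W W₇ dC dN ⟩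
    ι (+ 36) · (multiplier · (W ^ 2 · W₇)) ⊕ ι (+ 252) · (multiplier · (W · W₇ ^ 2)) ⊕ ι (+ 72) · (τ ^ 3 · w ^ 18 · f · (ε · (dC · W₇ ^ 2 ⊕ ⊖ (dN · W · W₇))))
      ≈⟨ ⊕-cong ≈-refl (·-congˡ _ (·-congˡ _ (≈sym n²w⁴J))) ⟩
    ι (+ 36) · (multiplier · (W ^ 2 · W₇)) ⊕ ι (+ 252) · (multiplier · (W · W₇ ^ 2)) ⊕ ι (+ 72) · (τ ^ 3 · w ^ 18 · f · (n ^ 2 · w ^ 4 · J))
      ≈⟨ solve≈ 7 (λ n τ w f W W₇ J →
           con (+ 36) :* (n :^ 2 :* τ :^ 3 :* w :^ 22 :* f :* (W :^ 2 :* W₇)) :+ con (+ 252) :* (n :^ 2 :* τ :^ 3 :* w :^ 22 :* f :* (W :* W₇ :^ 2))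
             :+ con (+ 72) :* (τ :^ 3 :* w :^ 18 :* f :* (n :^ 2 :* w :^ 4 :* J))
           := n :^ 2 :* τ :^ 3 :* w :^ 22 :* f :* (con (+ 36) :* W :^ 2 :* W₇ :+ con (+ 252) :* W :* W₇ :^ 2 :+ con (+ 72) :* J)) ≈-refl n τ w f W W₇ J ⟩
    multiplier · rhs ∎)
    where
    dN dC : Series
    dN = ⟪ ∂ (nᵉ ^^ 2 ∙ wᵉ ^^ 4) ⟫
    dC = ⟪ ∂ (cᵉ ^^ 2) ⟫
    τ²φX̂ : τ ^ 2 · φ X̂ ≈ ε ^ 2 · n · (ι (+ 2352) · rw ^ 2 ⊕ ι -[1+ 47 ] · τ ^ 2)
    τ²φX̂ = ≈trans (·-congˡ _ φX̂) (≈trans (solve≈ 3 (λ τ x s → τ :^ 2 :* (x :* (con (+ 2352) :* s :^ 2 :- con (+ 48)))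
        := x :* (con (+ 2352) :* (s :* τ) :^ 2 :+ con -[1+ 47 ] :* τ :^ 2)) ≈-refl τ (ε ^ 2 · n) s)
      (·-congˡ _ (⊕-cong (·-congˡ _ (^-congˡ 2 s·τ)) ≈-refl)))

  W-unit : Unit W
  W-unit = ≡.trans (⊕-0 _ _) (≡.trans (cong₂ ℤ._+_ (≡.trans (⊕-0 _ _) (cong₂ ℤ._+_ (ι-at-0 1ℤ) (times (+ 4) p ≡.refl)))
      (≡.trans (⊖-0 _) (cong ℤ.-_ (times (+ 28) u (φ-at-0 p))))) ≡.refl)
    where
    times : ∀ k x → x 0 ≡ p 0 → (ι k · x) 0 ≡ 0ℤ
    times k x e = ≡.trans (·-0 (ι k) x) (≡.trans (cong (ι k 0 ℤ.*_) (≡.trans e 0ˢ-at-0)) (ℤP.*-zeroʳ (ι k 0)))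

  difference : ∀ {a b} → a ⊕ ⊖ b ≈ 0ˢ → a ≈ b
  difference {a} {b} p = ≈trans (solve≈ 2 (λ a b → a := (a :- b) :+ b) ≈-refl a b) (≈trans (⊕-cong p ≈-refl) (SR.+-identityˡ b))

  -- Both solve the same linear equation, so the difference d satisfies W₇ d = 7 W φ d and vanishes.
  X-≈ : X ≈ X̂
  X-≈ = difference (φ-fixed-vanishes 5 (φ-unit W W-unit) W-unit (begin
    W₇ · (X ⊕ ⊖ X̂)
      ≈⟨ solve≈ 6 (λ a x y b φx φy → a :* (x :- y) := (a :* x :- con (+ 7) :* (b :* φx)) :- (a :* y :- con (+ 7) :* (b :* φy)) :+ con (+ 7) :* (b :* (φx :- φy))) ≈-refl
           W₇ X X̂ W (φ X) (φ X̂) ⟩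
    (W₇ · X ⊕ ⊖ (ι (+ 7) · (W · φ X))) ⊕ ⊖ (W₇ · X̂ ⊕ ⊖ (ι (+ 7) · (W · φ X̂))) ⊕ ι (+ 7) · (W · (φ X ⊕ ⊖ φ X̂))
      ≈⟨ ⊕-cong (⊕-cong X-equation (⊖-cong X̂-equation)) (·-congˡ _ (·-congˡ W (≈sym (≈trans (φ-+ X _) (⊕-cong ≈-refl (φ-⊖ X̂)))))) ⟩
    rhs ⊕ ⊖ rhs ⊕ ι (+ 7) · (W · φ (X ⊕ ⊖ X̂))
      ≈⟨ solve≈ 2 (λ r x → r :- r :+ x := x) ≈-refl rhs (ι (+ 7) · (W · φ (X ⊕ ⊖ X̂))) ⟩
    ι (+ 7) · (W · φ (X ⊕ ⊖ X̂)) ∎))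

  Ê₄ : Series
  Ê₄ = ω · quadratic 245 2401 t

  φÊ₄ : φ Ê₄ ≈ ω · quadratic 5 1 t
  φÊ₄ = ·-regular (·-regular (^-regular 2 (cancel τᵉ ≡.refl)) (^-regular 22 (cancel wᵉ ≡.refl))) (cancel fᵉ ≡.refl) (begin
    τ ^ 2 · w ^ 22 · f · φ Ê₄
      ≈⟨ ·-congˡ _ (≈trans (φ-· ω _) (·-cong φω (φ-quadratic 245 2401 t))) ⟩
    τ ^ 2 · w ^ 22 · f · (ε ^ 2 · n · quadratic 245 2401 s)
      ≈⟨ solve≈ 6 (λ τ w f e n x → τ :* w :* f :* (e :* n :* x) := e :* (n :* (τ :* x) :* f :* w)) ≈-refl (τ ^ 2) (w ^ 22) f (ε ^ 2) n (quadratic 245 2401 s) ⟩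
    ε ^ 2 · (n · (τ ^ 2 · quadratic 245 2401 s) · f · w ^ 22)
      ≈⟨ ·-congˡ _ (≈trans (·-congʳ _ (·-congʳ f (·-congˡ n (s-quadratic 245 2401)))) (≈trans
           (identity {nᵉ ∙ (τᵉ ^^ 2 ∔ k# 245 ∙ (R ∙ wᵉ) ∙ τᵉ ∔ k# 2401 ∙ (R ∙ wᵉ) ^^ 2) ∙ fᵉ ∙ wᵉ ^^ 22}
                     {cᵉ ∙ (fᵉ ^^ 8 ∔ k# 5 ∙ (Y ∙ τᵉ ∙ wᵉ ^^ 11) ∙ fᵉ ^^ 4 ∔ (Y ∙ τᵉ ∙ wᵉ ^^ 11) ^^ 2)} E₄-level-7)
           (·-congˡ c (≈trans (⊕-cong ≈-refl (≈sym (SR.*-identityˡ _))) (≈sym (t-quadratic 5 1)))))) ⟩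
    ε ^ 2 · (c · (f ^ 8 · quadratic 5 1 t))
      ≈⟨ solve≈ 4 (λ e c f x → e :* (c :* (f :^ 8 :* x)) := e :* (c :* f :^ 7) :* f :* x) ≈-refl (ε ^ 2) c f (quadratic 5 1 t) ⟩
    ε ^ 2 · (c · f ^ 7) · f · quadratic 5 1 t
      ≈⟨ ·-congʳ _ (·-congʳ f (≈sym ω·scale)) ⟩
    ω · (τ ^ 2 · w ^ 22) · f · quadratic 5 1 t
      ≈⟨ solve≈ 5 (λ o τ w f x → o :* (τ :* w) :* f :* x := τ :* w :* f :* (o :* x)) ≈-refl ω (τ ^ 2) (w ^ 22) f (quadratic 5 1 t) ⟩
    τ ^ 2 · w ^ 22 · f · (ω · quadratic 5 1 t) ∎)

  -- X determines E₄: a difference d of two candidates satisfies d = 49 φ d.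
  E₄-ω : E₄ ≈ ω · quadratic 245 2401 t
  E₄-ω = difference (φ-fixed-vanishes 47 (ι-at-0 1ℤ) (ι-at-0 1ℤ) (begin
    1ˢ · (E₄ ⊕ ⊖ Ê₄)
      ≈⟨ solve≈ 4 (λ x y φx φy → con 1ℤ :* (x :- y) := (x :- con (+ 49) :* φx) :- (y :- con (+ 49) :* φy) :+ con (+ 49) :* (con 1ℤ :* (φx :- φy))) ≈-refl
           E₄ Ê₄ (φ E₄) (φ Ê₄) ⟩
    X ⊕ ⊖ (Ê₄ ⊕ ⊖ (ι (+ 49) · φ Ê₄)) ⊕ ι (+ 49) · (1ˢ · (φ E₄ ⊕ ⊖ φ Ê₄))
      ≈⟨ ⊕-cong (⊕-cong X-≈ (⊖-cong Ê₄-difference)) (·-congˡ _ (·-congˡ _ (≈sym (≈trans (φ-+ E₄ _) (⊕-cong ≈-refl (φ-⊖ Ê₄)))))) ⟩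
    X̂ ⊕ ⊖ X̂ ⊕ ι (+ 49) · (1ˢ · φ (E₄ ⊕ ⊖ Ê₄))
      ≈⟨ solve≈ 2 (λ r x → r :- r :+ x := x) ≈-refl X̂ (ι (+ 49) · (1ˢ · φ (E₄ ⊕ ⊖ Ê₄))) ⟩
    ι (+ 49) · (1ˢ · φ (E₄ ⊕ ⊖ Ê₄)) ∎))
    where
    Ê₄-difference : Ê₄ ⊕ ⊖ (ι (+ 49) · φ Ê₄) ≈ X̂
    Ê₄-difference = ≈trans (⊕-cong ≈-refl (⊖-cong (·-congˡ _ φÊ₄)))
      (solve≈ 2 (λ o t → o :* (con 1ℤ :+ con (+ 245) :* t :+ con (+ 2401) :* t :^ 2) :- con (+ 49) :* (o :* (con 1ℤ :+ con (+ 5) :* t :+ con (+ 1) :* t :^ 2))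
        := o :* (con (+ 2352) :* t :^ 2 :- con (+ 48))) ≈-refl ω t)

-- The 7-adic contraction of the lattice.

module Contraction where
  open SeriesRing
  open Operators
  open Evaluation
  open Identities
  open Pentagonal
  open EulerDissection
  open Generators
  open DivisorSums using (U-ι·)
  open WeightTwo
  open WeightFour
  open import Data.Nat as ℕ using (ℕ; zero; suc)
  import Data.Nat.Properties as ℕP
  open import Data.Integer as ℤ using (ℤ; +_; -[1+_]; 0ℤ; 1ℤ; -1ℤ)
  open import Data.List using (List; []; _∷_; map)
  open import Data.Product using (_,_; _×_; proj₁; proj₂; ∃-syntax)
  open import Relation.Binary.PropositionalEquality as ≡ using (_≡_; cong; subst)

  open Solver using (_:^_; _:+_; _:*_; _:=_; con) renaming (solve to solve≈)
  open ≈-Reasoning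
  open import Algebra.Properties.Semiring.Exp semiring using (^-homo-*)
  open import Algebra.Properties.CommutativeSemiring.Exp SR.commutativeSemiring using (^-distrib-*)

  ζ⁷ : ζ ^ 7 ≈ s · (ι (+ 7) · ζ ^ 4 ⊕ ι (+ 35) · ζ ^ 5 ⊕ ι (+ 49) · ζ ^ 6)
             ⊕ s ^ 2 · (1ˢ ⊕ ι (+ 7) · ζ ⊕ ι (+ 21) · ζ ^ 2 ⊕ ι (+ 49) · ζ ^ 3 ⊕ ι (+ 147) · ζ ^ 4 ⊕ ι (+ 343) · ζ ^ 5 ⊕ ι (+ 343) · ζ ^ 6)
  ζ⁷ = ·-regular (^-regular 2 (cancel τᵉ ≡.refl)) (^-regular 7 (cancel fᵉ ≡.refl)) (begin
    τ ^ 2 · f ^ 7 · ζ ^ 7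
      ≈⟨ solve≈ 3 (λ τ f z → τ :* f :^ 7 :* z :^ 7 := (z :* f) :^ 7 :* τ) ≈-refl (τ ^ 2) f ζ ⟩
    (ζ · f) ^ 7 · τ ^ 2
      ≈⟨ ·-congʳ _ (^-congˡ 7 ζ·f) ⟩
    ⟪ zᵉ ^^ 7 ∙ τᵉ ^^ 2 ⟫
      ≈⟨ identity {zᵉ ^^ 7 ∙ τᵉ ^^ 2} {modularᵉ} modular-equation ⟩
    value rw ⟪ zᵉ ⟫
      ≈⟨ ≈sym (⊕-cong (·-cong (·-congʳ τ s·τ) (⊕-cong (⊕-cong (·-congʳ _ (·-congˡ _ (z^ 4))) (·-congʳ _ (·-congˡ _ (z^ 5)))) (·-congʳ _ (·-congˡ _ (z^ 6)))))
           (·-cong (^-congˡ 2 s·τ) (⊕-cong (⊕-cong (⊕-cong (⊕-cong (⊕-cong (⊕-cong ≈-refl (·-congʳ _ (·-congˡ _ ζ·f))) (·-congʳ _ (·-congˡ _ (z^ 2)))) (·-congʳ _ (·-congˡ _ (z^ 3))))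
             (·-congʳ _ (·-congˡ _ (z^ 4)))) (·-congʳ _ (·-congˡ _ (z^ 5)))) (·-congʳ _ (·-congˡ _ (z^ 6)))))) ⟩
    value (s · τ) (ζ · f)
      ≈⟨ solve≈ 4 (λ τ f z s → let k : ℕ → Solver.Polynomial 4 ; k = λ m → con (+ m) ; y = z :* f ; x = s :* τ in
           x :* τ :* (k 7 :* y :^ 4 :* f :^ 3 :+ k 35 :* y :^ 5 :* f :^ 2 :+ k 49 :* y :^ 6 :* f)
           :+ x :^ 2 :* (f :^ 7 :+ k 7 :* y :* f :^ 6 :+ k 21 :* y :^ 2 :* f :^ 5 :+ k 49 :* y :^ 3 :* f :^ 4 :+ k 147 :* y :^ 4 :* f :^ 3 :+ k 343 :* y :^ 5 :* f :^ 2 :+ k 343 :* y :^ 6 :* f)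
           := τ :^ 2 :* f :^ 7 :* (s :* (k 7 :* z :^ 4 :+ k 35 :* z :^ 5 :+ k 49 :* z :^ 6)
              :+ s :^ 2 :* (con 1ℤ :+ k 7 :* z :+ k 21 :* z :^ 2 :+ k 49 :* z :^ 3 :+ k 147 :* z :^ 4 :+ k 343 :* z :^ 5 :+ k 343 :* z :^ 6))) ≈-refl τ f ζ s ⟩
    τ ^ 2 · f ^ 7 · (s · (ι (+ 7) · ζ ^ 4 ⊕ ι (+ 35) · ζ ^ 5 ⊕ ι (+ 49) · ζ ^ 6)
      ⊕ s ^ 2 · (1ˢ ⊕ ι (+ 7) · ζ ⊕ ι (+ 21) · ζ ^ 2 ⊕ ι (+ 49) · ζ ^ 3 ⊕ ι (+ 147) · ζ ^ 4 ⊕ ι (+ 343) · ζ ^ 5 ⊕ ι (+ 343) · ζ ^ 6)) ∎)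
    where
    value : Series → Series → Series
    value x y = x · τ · (ι (+ 7) · y ^ 4 · f ^ 3 ⊕ ι (+ 35) · y ^ 5 · f ^ 2 ⊕ ι (+ 49) · y ^ 6 · f)
      ⊕ x ^ 2 · (f ^ 7 ⊕ ι (+ 7) · y · f ^ 6 ⊕ ι (+ 21) · y ^ 2 · f ^ 5 ⊕ ι (+ 49) · y ^ 3 · f ^ 4 ⊕ ι (+ 147) · y ^ 4 · f ^ 3 ⊕ ι (+ 343) · y ^ 5 · f ^ 2 ⊕ ι (+ 343) · y ^ 6 · f)
    z^ : ∀ k → (ζ · f) ^ k ≈ ⟪ zᵉ ⟫ ^ k
    z^ k = ^-congˡ k ζ·f

  V : ℕ → Series
  V m = U (ω · ζ ^ m)

  U-s· : ∀ x → U (s · x) ≈ t · U x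
  U-s· x = U-φ· t x

  -- Watson's equation times ω ζ^m under U: its coefficients are polynomials in φ t, which leave U
  -- as polynomials in t.
  V-recurrence : ∀ m → V (7 ℕ.+ m) ≈
    ι (+ 7) · (t · V (4 ℕ.+ m)) ⊕ ι (+ 35) · (t · V (5 ℕ.+ m)) ⊕ ι (+ 49) · (t · V (6 ℕ.+ m))
    ⊕ ι (+ 1) · (t · (t · V m)) ⊕ ι (+ 7) · (t · (t · V (1 ℕ.+ m))) ⊕ ι (+ 21) · (t · (t · V (2 ℕ.+ m)))
    ⊕ ι (+ 49) · (t · (t · V (3 ℕ.+ m))) ⊕ ι (+ 147) · (t · (t · V (4 ℕ.+ m))) ⊕ ι (+ 343) · (t · (t · V (5 ℕ.+ m)))
    ⊕ ι (+ 343) · (t · (t · V (6 ℕ.+ m)))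
  V-recurrence m = ≈trans (U-cong expand)
    (add (add (add (add (add (add (add (add (add (one 7 4) (one 35 5)) (one 49 6)) (two 1 0)) (two 7 1)) (two 21 2)) (two 49 3)) (two 147 4)) (two 343 5)) (two 343 6))
    where
    x : ℕ → Series
    x k = ω · ζ ^ (k ℕ.+ m)
    add : ∀ {a b c d} → U a ≈ c → U b ≈ d → U (a ⊕ b) ≈ c ⊕ d
    add p q = ≈trans (U-⊕ _ _) (⊕-cong p q)
    one : ∀ c k → U (ι (+ c) · (s · x k)) ≈ ι (+ c) · (t · V (k ℕ.+ m))
    one c k = ≈trans (U-ι· (+ c) _) (·-congˡ _ (U-s· (x k)))
    two : ∀ c k → U (ι (+ c) · (s · (s · x k))) ≈ ι (+ c) · (t · (t · V (k ℕ.+ m)))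
    two c k = ≈trans (U-ι· (+ c) _) (·-congˡ _ (≈trans (U-s· _) (·-congˡ t (U-s· (x k)))))
    expand : ω · ζ ^ (7 ℕ.+ m) ≈ ι (+ 7) · (s · x 4) ⊕ ι (+ 35) · (s · x 5) ⊕ ι (+ 49) · (s · x 6)
      ⊕ ι (+ 1) · (s · (s · x 0)) ⊕ ι (+ 7) · (s · (s · x 1)) ⊕ ι (+ 21) · (s · (s · x 2)) ⊕ ι (+ 49) · (s · (s · x 3))
      ⊕ ι (+ 147) · (s · (s · x 4)) ⊕ ι (+ 343) · (s · (s · x 5)) ⊕ ι (+ 343) · (s · (s · x 6))
    expand = ≈trans (·-congˡ ω (^-homo-* ζ 7 m)) (≈trans (·-congˡ ω (·-congʳ _ ζ⁷))
      (solve≈ 4 (λ o z s y → let k : ℕ → Solver.Polynomial 4 ; k = λ m → con (+ m) in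
        o :* ((s :* (k 7 :* z :^ 4 :+ k 35 :* z :^ 5 :+ k 49 :* z :^ 6)
          :+ s :^ 2 :* (con 1ℤ :+ k 7 :* z :+ k 21 :* z :^ 2 :+ k 49 :* z :^ 3 :+ k 147 :* z :^ 4 :+ k 343 :* z :^ 5 :+ k 343 :* z :^ 6)) :* y)
        := k 7 :* (s :* (o :* (z :* (z :* (z :* (z :* y)))))) :+ k 35 :* (s :* (o :* (z :* (z :* (z :* (z :* (z :* y)))))))
          :+ k 49 :* (s :* (o :* (z :* (z :* (z :* (z :* (z :* (z :* y))))))))
          :+ k 1 :* (s :* (s :* (o :* y))) :+ k 7 :* (s :* (s :* (o :* (z :* y)))) :+ k 21 :* (s :* (s :* (o :* (z :* (z :* y)))))
          :+ k 49 :* (s :* (s :* (o :* (z :* (z :* (z :* y)))))) :+ k 147 :* (s :* (s :* (o :* (z :* (z :* (z :* (z :* y)))))))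
          :+ k 343 :* (s :* (s :* (o :* (z :* (z :* (z :* (z :* (z :* y))))))))
          :+ k 343 :* (s :* (s :* (o :* (z :* (z :* (z :* (z :* (z :* (z :* y)))))))))) ≈-refl ω ζ s (ζ ^ m)))

  ε₀²n₀ : ε₀ ^ 2 · n₀ ≈ ω
  ε₀²n₀ = φ-injective (≈trans (φ-· (ε₀ ^ 2) n₀) (≈trans (·-cong (φ-^ ε₀ 2) (φ-⟪⟫ nᵉ _)) (≈sym φω)))

  scaleᵉ : Expr
  scaleᵉ = τᵉ ^^ 2 ∙ wᵉ ^^ 22

  -- The seven factors f in `ω·scale` absorb the denominators of ζ^m = z^m / f^m for all m ≤ 7,
  -- leaving c f^k z^m; its coefficient of y⁰ is then found by computation.
  V-initial : ∀ m k → k ℕ.+ m ≡ 7 → ∀ c₁ c₂ →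
    Constant (cᵉ ∙ fᵉ ^^ k ∙ zᵉ ^^ m) (nᵉ ∙ wᵉ ^^ 22 ∙ (K c₂ ∙ (R ∙ wᵉ) ^^ 2 ∔ K c₁ ∙ (R ∙ wᵉ) ∙ τᵉ)) →
    V m ≈ ω · (ι c₁ · t ⊕ ι c₂ · t ^ 2)
  V-initial m k k+m c₁ c₂ p = cancel₀ scaleᵉ ≡.refl (begin
    ⟪ scaleᵉ ⟫₀ · V m
      ≈⟨ ≈sym (U-φ· _ _) ⟩
    U (φ ⟪ scaleᵉ ⟫₀ · (ω · ζ ^ m))
      ≈⟨ U-cong (≈trans (·-congʳ _ (φ-⟪⟫ scaleᵉ _)) scaled-≈) ⟩
    U (ε ^ 2 · ⟪ cᵉ ∙ fᵉ ^^ k ∙ zᵉ ^^ m ⟫)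
      ≈⟨ ≈trans (U-cong (·-congʳ _ (≈sym (φ-^ ε₀ 2)))) (≈trans (U-φ· (ε₀ ^ 2) _) (·-congˡ _ (U-⟦⟧ y-rel (cᵉ ∙ fᵉ ^^ k ∙ zᵉ ^^ m) value _ p))) ⟩
    ε₀ ^ 2 · ⟪ value ⟫₀
      ≈⟨ solve≈ 7 (λ e n w a b x τ → e :* (n :* w :* (b :* x :^ 2 :+ a :* x :* τ)) := (e :* n) :* w :* (b :* x :^ 2 :+ a :* x :* τ)) ≈-refl
           (ε₀ ^ 2) n₀ (w₀ ^ 22) (ι c₁) (ι c₂) rw₀ τ₀ ⟩
    (ε₀ ^ 2 · n₀) · w₀ ^ 22 · (ι c₂ · rw₀ ^ 2 ⊕ ι c₁ · rw₀ · τ₀)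
      ≈⟨ ·-cong (·-congʳ _ ε₀²n₀) (⊕-cong (·-congˡ _ (^-congˡ 2 (≈sym t·τ₀))) (·-congʳ τ₀ (·-congˡ _ (≈sym t·τ₀)))) ⟩
    ω · w₀ ^ 22 · (ι c₂ · (t · τ₀) ^ 2 ⊕ ι c₁ · (t · τ₀) · τ₀)
      ≈⟨ solve≈ 6 (λ o w a b t τ → o :* w :* (b :* (t :* τ) :^ 2 :+ a :* (t :* τ) :* τ) := τ :^ 2 :* w :* (o :* (a :* t :+ b :* t :^ 2))) ≈-refl
           ω (w₀ ^ 22) (ι c₁) (ι c₂) t τ₀ ⟩
    ⟪ scaleᵉ ⟫₀ · (ω · (ι c₁ · t ⊕ ι c₂ · t ^ 2)) ∎)
    where
    value : Expr
    value = nᵉ ∙ wᵉ ^^ 22 ∙ (K c₂ ∙ (R ∙ wᵉ) ^^ 2 ∔ K c₁ ∙ (R ∙ wᵉ) ∙ τᵉ)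
    f^ : f ^ 7 ≈ f ^ k · f ^ m
    f^ = subst (λ x → f ^ x ≈ f ^ k · f ^ m) k+m (^-homo-* f k m)
    scaled-≈ : scale · (ω · ζ ^ m) ≈ ε ^ 2 · ⟪ cᵉ ∙ fᵉ ^^ k ∙ zᵉ ^^ m ⟫
    scaled-≈ = ^-regular m (cancel fᵉ ≡.refl) (begin
      f ^ m · (scale · (ω · ζ ^ m))
        ≈⟨ solve≈ 4 (λ f s o z → f :* (s :* (o :* z)) := (o :* s) :* (z :* f)) ≈-refl (f ^ m) scale ω (ζ ^ m) ⟩
      ω · scale · (ζ ^ m · f ^ m)
        ≈⟨ ·-cong (≈trans ω·scale (·-congˡ _ (·-congˡ c f^))) (≈trans (≈sym (^-distrib-* ζ f m)) (^-congˡ m ζ·f)) ⟩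
      ε ^ 2 · (c · (f ^ k · f ^ m)) · ⟪ zᵉ ^^ m ⟫
        ≈⟨ solve≈ 5 (λ e c a b z → e :* (c :* (a :* b)) :* z := b :* (e :* (c :* a :* z))) ≈-refl (ε ^ 2) c (f ^ k) (f ^ m) ⟪ zᵉ ^^ m ⟫ ⟩
      f ^ m · (ε ^ 2 · ⟪ cᵉ ∙ fᵉ ^^ k ∙ zᵉ ^^ m ⟫) ∎)

  V₁ : V 1 ≈ ω · (ι -[1+ 55 ] · t ⊕ ι -[1+ 342 ] · t ^ 2)
  V₁ = V-initial 1 6 ≡.refl -[1+ 55 ] -[1+ 342 ] ≡.refl
  V₂ : V 2 ≈ ω · (ι 0ℤ · t ⊕ ι (+ 49) · t ^ 2)
  V₂ = V-initial 2 5 ≡.refl 0ℤ (+ 49) ≡.refl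
  V₃ : V 3 ≈ ω · (ι -[1+ 1 ] · t ⊕ ι -[1+ 48 ] · t ^ 2)
  V₃ = V-initial 3 4 ≡.refl -[1+ 1 ] -[1+ 48 ] ≡.refl
  V₄ : V 4 ≈ ω · (ι 0ℤ · t ⊕ ι -[1+ 6 ] · t ^ 2)
  V₄ = V-initial 4 3 ≡.refl 0ℤ -[1+ 6 ] ≡.refl
  V₅ : V 5 ≈ ω · (ι 0ℤ · t ⊕ ι (+ 7) · t ^ 2)
  V₅ = V-initial 5 2 ≡.refl 0ℤ (+ 7) ≡.refl
  V₆ : V 6 ≈ ω · (ι 0ℤ · t ⊕ ι (+ 1) · t ^ 2)
  V₆ = V-initial 6 1 ≡.refl 0ℤ (+ 1) ≡.refl
  V₇ : V 7 ≈ ω · (ι 0ℤ · t ⊕ ι (+ 1) · t ^ 2)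
  V₇ = V-initial 7 0 ≡.refl 0ℤ (+ 1) ≡.refl

  x : Series
  x = ι (+ 7) · t

  open Eval 0ˢ x using (ev₁; ev₁-+; ev₁-scale)

  7ˢ : Series
  7ˢ = ι (+ 7)

  -- 7^a F lies in 7 ω x^e ℤ[x], where x = 7 t.
  record C (a e : ℕ) (F : Series) : Set where
    constructor mkC
    field
      coeffs : List ℤ
      eq     : 7ˢ ^ a · F ≈ 7ˢ · (ω · (x ^ e · ev₁ coeffs))

  private
    variable
      a e : ℕ
      F G : Series

  C-≈ : F ≈ G → C a e F → C a e G
  C-≈ p (mkC u q) = mkC u (≈trans (·-congˡ _ (≈sym p)) q)

  C-⊕ : C a e F → C a e G → C a e (F ⊕ G)
  C-⊕ {e = e} (mkC u p) (mkC v q) = mkC (u +₁ v) (≈trans (SR.distribˡ _ _ _) (≈trans (⊕-cong p q)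
    (≈trans (solve≈ 5 (λ s o x u v → s :* (o :* (x :* u)) :+ s :* (o :* (x :* v)) := s :* (o :* (x :* (u :+ v)))) ≈-refl 7ˢ ω (x ^ e) (ev₁ u) (ev₁ v))
      (·-congˡ _ (·-congˡ _ (·-congˡ _ (≈sym (ev₁-+ u v))))))))

  C-scale : ∀ k → C a e F → C a e (ι k · F)
  C-scale {a} {e} {F} k (mkC u p) = mkC (map (k ℤ.*_) u) (≈trans (solve≈ 3 (λ s k f → s :* (k :* f) := k :* (s :* f)) ≈-refl (7ˢ ^ a) (ι k) F)
    (≈trans (·-congˡ _ p) (≈trans (solve≈ 5 (λ s o x u k → k :* (s :* (o :* (x :* u))) := s :* (o :* (x :* (k :* u)))) ≈-refl 7ˢ ω (x ^ e) (ev₁ u) (ι k))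
      (·-congˡ _ (·-congˡ _ (·-congˡ _ (≈sym (ev₁-scale k u))))))))

  C-suc : C a e F → C (suc a) e F
  C-suc {a} {e} {F} p = mkC (C.coeffs scaled⁷) (≈trans (solve≈ 3 (λ s k f → s :* k :* f := k :* (s :* f)) ≈-refl 7ˢ (7ˢ ^ a) F) (C.eq scaled⁷))
    where
    scaled⁷ : C a e (7ˢ · F)
    scaled⁷ = C-scale (+ 7) p

  C-raise : ∀ l → C a e F → C (l ℕ.+ a) e F
  C-raise zero    p = p
  C-raise (suc l) p = C-suc (C-raise l p)

  C-lower : ∀ i → C a (i ℕ.+ e) F → C a e F
  C-lower zero    p = p
  C-lower {a} {e} {F} (suc i) (mkC u p) = C-lower i (mkC (0ℤ ∷ u) (≈trans p
    (solve≈ 5 (λ s o x y u → s :* (o :* (x :* y :* u)) := s :* (o :* (y :* (con 0ℤ :+ x :* u)))) ≈-refl 7ˢ ω x (x ^ (i ℕ.+ e)) (ev₁ u))))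

  -- Since t = x / 7, a power of x is gained at the price of a power of 7.
  C-t : C a e F → C (suc a) (suc e) (t · F)
  C-t {a} {e} {F} (mkC u p) = mkC u (≈trans (solve≈ 4 (λ s k t f → s :* k :* (t :* f) := s :* t :* (k :* f)) ≈-refl 7ˢ (7ˢ ^ a) t F)
    (≈trans (·-congˡ _ p) (solve≈ 5 (λ s o x y u → x :* (s :* (o :* (y :* u))) := s :* (o :* (x :* y :* u))) ≈-refl 7ˢ ω x (x ^ e) (ev₁ u))))

  C-7 : ∀ k → C (k ℕ.+ a) e F → C a e (7ˢ ^ k · F)
  C-7 {a} {e} {F} k (mkC u p) = mkC u (≈trans (≈trans (≈sym (SR.*-assoc _ _ F)) (·-congʳ F (≈trans (SR.*-comm _ _) (≈sym (^-homo-* 7ˢ k a))))) p)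

  ι-7^ : ∀ k → ι ((+ 7) ℤ.^ k) ≈ 7ˢ ^ k
  ι-7^ zero    = ≈-refl
  ι-7^ (suc k) = ≈trans (ι-* (+ 7) ((+ 7) ℤ.^ k)) (·-congˡ 7ˢ (ι-7^ k))

  -- Bookkeeping for one term of the recurrence: k powers of 7 are taken from its coefficient, while
  -- l powers of 7 and i powers of x are given away.
  fit : ∀ k l i c → C a (i ℕ.+ e) F → ∀ {b} → l ℕ.+ a ≡ k ℕ.+ b → C b e (ι (c ℤ.* (+ 7) ℤ.^ k) · F)
  fit {e = e} {F = F} k l i c p eq = C-≈ (≈trans (≈sym (SR.*-assoc _ _ F)) (·-congʳ F (≈sym (≈trans (ι-* c _) (·-congˡ _ (ι-7^ k))))))
    (C-scale c (C-7 k (subst (λ a → C a e F) eq (C-raise l (C-lower i p)))))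

  V-from : ∀ m {A E} → C A E (ι (+ 7) · (t · V (4 ℕ.+ m))) → C A E (ι (+ 35) · (t · V (5 ℕ.+ m))) → C A E (ι (+ 49) · (t · V (6 ℕ.+ m))) →
    C A E (ι (+ 1) · (t · (t · V m))) → C A E (ι (+ 7) · (t · (t · V (1 ℕ.+ m)))) → C A E (ι (+ 21) · (t · (t · V (2 ℕ.+ m)))) →
    C A E (ι (+ 49) · (t · (t · V (3 ℕ.+ m)))) → C A E (ι (+ 147) · (t · (t · V (4 ℕ.+ m)))) → C A E (ι (+ 343) · (t · (t · V (5 ℕ.+ m)))) →
    C A E (ι (+ 343) · (t · (t · V (6 ℕ.+ m)))) → C A E (V (7 ℕ.+ m))
  V-from m a b c d e f g h i j = C-≈ (≈sym (V-recurrence m)) (C-⊕ (C-⊕ (C-⊕ (C-⊕ (C-⊕ (C-⊕ (C-⊕ (C-⊕ (C-⊕ a b) c) d) e) f) g) h) i) j)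

  -- The part of the estimates Strong j that the recurrence needs two steps later; unlike Strong, it holds for j = 0.
  record Weak (j : ℕ) : Set where
    constructor weak
    field
      w₁ : C (2 ℕ.+ j ℕ.* 2) (1 ℕ.+ j) (V (1 ℕ.+ j ℕ.* 4))
      w₂ : C (2 ℕ.+ j ℕ.* 2) (1 ℕ.+ j) (V (2 ℕ.+ j ℕ.* 4))
      w₃ : C (3 ℕ.+ j ℕ.* 2) (1 ℕ.+ j) (V (3 ℕ.+ j ℕ.* 4))

  -- The fields `s₀` and `s₁` are exactly what U and F ↦ U (ζ F) need on ω x^j, because x^j U (ω ζ^i
  -- x^j) = 7^(2j) V (i + 4 j). The others, weaker by one 7, carry the recurrence.
  record Strong (j : ℕ) : Set where
    constructor strong
    field
      s₀ : C (j ℕ.* 2)       (1 ℕ.+ j) (V (j ℕ.* 4))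
      s₁ : C (j ℕ.* 2)       (1 ℕ.+ j) (V (1 ℕ.+ j ℕ.* 4))
      s₂ : C (1 ℕ.+ j ℕ.* 2) (1 ℕ.+ j) (V (2 ℕ.+ j ℕ.* 4))
      s₃ : C (1 ℕ.+ j ℕ.* 2) (1 ℕ.+ j) (V (3 ℕ.+ j ℕ.* 4))

  strong⇒weak : ∀ {j} → Strong j → Weak j
  strong⇒weak (strong _ s₁ s₂ s₃) = weak (C-raise 2 s₁) (C-raise 1 s₂) (C-raise 2 s₃)

  step : ∀ {j} → Weak j → Strong (suc j) → Strong (suc (suc j))
  step {j} (weak v₁ v₂ v₃) (strong v₄ v₅ v₆ v₇) = strong v₈ v₉ v₁₀ v₁₁
    where
    m : ℕ
    m = j ℕ.* 4
    infix 9 _′ _″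
    _′ : ∀ {a e F} → C a e F → C (suc a) (suc e) (t · F)
    _′ = C-t
    _″ : ∀ {a e F} → C a e F → C (suc (suc a)) (suc (suc e)) (t · (t · F))
    p ″ = C-t (C-t p)
    v₈ : C (4 ℕ.+ j ℕ.* 2) (3 ℕ.+ j) (V (8 ℕ.+ m))
    -- Coefficients are split as c times 7^k only as far as needed: here 21 = 3 · 7 and 343 = 49 ·
    -- 7, further on 343 = 7 · 7².
    v₈ = V-from (1 ℕ.+ m) (fit 0 1 0 (+ 7) (v₅ ′) ≡.refl) (fit 0 0 0 (+ 35) (v₆ ′) ≡.refl) (fit 0 0 0 (+ 49) (v₇ ′) ≡.refl)
      (fit 0 0 0 (+ 1) (v₁ ″) ≡.refl) (fit 0 0 0 (+ 7) (v₂ ″) ≡.refl) (fit 1 0 0 (+ 3) (v₃ ″) ≡.refl) (fit 0 0 1 (+ 49) (v₄ ″) ≡.refl)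
      (fit 0 0 1 (+ 147) (v₅ ″) ≡.refl) (fit 1 0 1 (+ 49) (v₆ ″) ≡.refl) (fit 1 0 1 (+ 49) (v₇ ″) ≡.refl)
    v₉ : C (4 ℕ.+ j ℕ.* 2) (3 ℕ.+ j) (V (9 ℕ.+ m))
    v₉ = V-from (2 ℕ.+ m) (fit 0 0 0 (+ 7) (v₆ ′) ≡.refl) (fit 0 0 0 (+ 35) (v₇ ′) ≡.refl) (fit 1 0 1 (+ 7) (v₈ ′) ≡.refl)
      (fit 0 0 0 (+ 1) (v₂ ″) ≡.refl) (fit 1 0 0 (+ 1) (v₃ ″) ≡.refl) (fit 0 0 1 (+ 21) (v₄ ″) ≡.refl) (fit 0 0 1 (+ 49) (v₅ ″) ≡.refl)
      (fit 1 0 1 (+ 21) (v₆ ″) ≡.refl) (fit 1 0 1 (+ 49) (v₇ ″) ≡.refl) (fit 2 0 2 (+ 7) (v₈ ″) ≡.refl)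
    v₁₀ : C (5 ℕ.+ j ℕ.* 2) (3 ℕ.+ j) (V (10 ℕ.+ m))
    v₁₀ = V-from (3 ℕ.+ m) (fit 0 1 0 (+ 7) (v₇ ′) ≡.refl) (fit 0 0 1 (+ 35) (v₈ ′) ≡.refl) (fit 0 0 1 (+ 49) (v₉ ′) ≡.refl)
      (fit 0 0 0 (+ 1) (v₃ ″) ≡.refl) (fit 0 1 1 (+ 7) (v₄ ″) ≡.refl) (fit 0 1 1 (+ 21) (v₅ ″) ≡.refl) (fit 0 0 1 (+ 49) (v₆ ″) ≡.refl)
      (fit 0 0 1 (+ 147) (v₇ ″) ≡.refl) (fit 1 0 2 (+ 49) (v₈ ″) ≡.refl) (fit 1 0 2 (+ 49) (v₉ ″) ≡.refl)
    v₁₁ : C (5 ℕ.+ j ℕ.* 2) (3 ℕ.+ j) (V (11 ℕ.+ m))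
    v₁₁ = V-from (4 ℕ.+ m) (fit 0 0 1 (+ 7) (v₈ ′) ≡.refl) (fit 0 0 1 (+ 35) (v₉ ′) ≡.refl) (fit 1 0 1 (+ 7) (v₁₀ ′) ≡.refl)
      (fit 0 1 1 (+ 1) (v₄ ″) ≡.refl) (fit 0 1 1 (+ 7) (v₅ ″) ≡.refl) (fit 0 0 1 (+ 21) (v₆ ″) ≡.refl) (fit 0 0 1 (+ 49) (v₇ ″) ≡.refl)
      (fit 1 0 2 (+ 21) (v₈ ″) ≡.refl) (fit 1 0 2 (+ 49) (v₉ ″) ≡.refl) (fit 2 0 2 (+ 7) (v₁₀ ″) ≡.refl)

  weak₀ : Weak 0
  weak₀ = weak
    (mkC (-[1+ 55 ] ∷ -[1+ 48 ] ∷ []) (≈trans (·-congˡ _ V₁) (≈trans (solve≈ 2 (λ o t → let k : Solver.Polynomial 2 ; k = con (+ 7) ; x : Solver.Polynomial 2 ; x = k :* t in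
      k :^ 2 :* (o :* (con -[1+ 55 ] :* t :+ con -[1+ 342 ] :* t :^ 2)) := k :* (o :* (x :^ 1 :* (con -[1+ 55 ] :+ x :* (con -[1+ 48 ] :+ x :* con 0ℤ))))) ≈-refl ω t) zero-tail₂)))
    (mkC (0ℤ ∷ (+ 7) ∷ []) (≈trans (·-congˡ _ V₂) (≈trans (solve≈ 2 (λ o t → let k : Solver.Polynomial 2 ; k = con (+ 7) ; x : Solver.Polynomial 2 ; x = k :* t in
      k :^ 2 :* (o :* (con 0ℤ :* t :+ con (+ 49) :* t :^ 2)) := k :* (o :* (x :^ 1 :* (con 0ℤ :+ x :* (con (+ 7) :+ x :* con 0ℤ))))) ≈-refl ω t) zero-tail₂)))
    (mkC (-[1+ 13 ] ∷ -[1+ 48 ] ∷ []) (≈trans (·-congˡ _ V₃) (≈trans (solve≈ 2 (λ o t → let k : Solver.Polynomial 2 ; k = con (+ 7) ; x : Solver.Polynomial 2 ; x = k :* t in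
      k :^ 3 :* (o :* (con -[1+ 1 ] :* t :+ con -[1+ 48 ] :* t :^ 2)) := k :* (o :* (x :^ 1 :* (con -[1+ 13 ] :+ x :* (con -[1+ 48 ] :+ x :* con 0ℤ))))) ≈-refl ω t) zero-tail₂)))
    where
    zero-tail₂ : ∀ {a b} → 7ˢ · (ω · (x ^ 1 · (ι a ⊕ x · (ι b ⊕ x · ι 0ℤ)))) ≈ 7ˢ · (ω · (x ^ 1 · (ι a ⊕ x · (ι b ⊕ x · 0ˢ))))
    zero-tail₂ = ·-congˡ _ (·-congˡ _ (·-congˡ _ (⊕-cong ≈-refl (·-congˡ _ (⊕-cong ≈-refl (·-congˡ _ ι-0))))))

  strong₁ : Strong 1
  strong₁ = strong
    (mkC (-1ℤ ∷ []) (≈trans (·-congˡ _ V₄) (≈trans (solve≈ 2 (λ o t → let k : Solver.Polynomial 2 ; k = con (+ 7) ; x : Solver.Polynomial 2 ; x = k :* t in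
      k :^ 2 :* (o :* (con 0ℤ :* t :+ con -[1+ 6 ] :* t :^ 2)) := k :* (o :* (x :^ 2 :* (con -1ℤ :+ x :* con 0ℤ)))) ≈-refl ω t) zero-tail₁)))
    (mkC (1ℤ ∷ []) (≈trans (·-congˡ _ V₅) (≈trans (solve≈ 2 (λ o t → let k : Solver.Polynomial 2 ; k = con (+ 7) ; x : Solver.Polynomial 2 ; x = k :* t in
      k :^ 2 :* (o :* (con 0ℤ :* t :+ con (+ 7) :* t :^ 2)) := k :* (o :* (x :^ 2 :* (con 1ℤ :+ x :* con 0ℤ)))) ≈-refl ω t) zero-tail₁)))
    (mkC (1ℤ ∷ []) (≈trans (·-congˡ _ V₆) (cubed)))
    (mkC (1ℤ ∷ []) (≈trans (·-congˡ _ V₇) (cubed)))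
    where
    zero-tail₁ : ∀ {a} → 7ˢ · (ω · (x ^ 2 · (ι a ⊕ x · ι 0ℤ))) ≈ 7ˢ · (ω · (x ^ 2 · (ι a ⊕ x · 0ˢ)))
    zero-tail₁ = ·-congˡ _ (·-congˡ _ (·-congˡ _ (⊕-cong ≈-refl (·-congˡ _ ι-0))))
    cubed : 7ˢ ^ 3 · (ω · (ι 0ℤ · t ⊕ ι (+ 1) · t ^ 2)) ≈ 7ˢ · (ω · (x ^ 2 · (ι 1ℤ ⊕ x · 0ˢ)))
    cubed = ≈trans (solve≈ 2 (λ o t → let k : Solver.Polynomial 2 ; k = con (+ 7) ; x : Solver.Polynomial 2 ; x = k :* t in
      k :^ 3 :* (o :* (con 0ℤ :* t :+ con (+ 1) :* t :^ 2)) := k :* (o :* (x :^ 2 :* (con 1ℤ :+ x :* con 0ℤ)))) ≈-refl ω t) zero-tail₁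

  estimates : ∀ j → Weak j × Strong (suc j)
  estimates zero    = weak₀ , strong₁
  estimates (suc j) = strong⇒weak (proj₂ (estimates j)) , step (proj₁ (estimates j)) (proj₂ (estimates j))

  InLattice : Series → Set
  InLattice F = ∃[ u ] F ≈ ω · (x · ev₁ u)

  lattice-⊕ : InLattice F → InLattice G → InLattice (F ⊕ G)
  lattice-⊕ (u , p) (v , q) = u +₁ v , ≈trans (⊕-cong p q) (≈trans
    (solve≈ 4 (λ o x u v → o :* (x :* u) :+ o :* (x :* v) := o :* (x :* (u :+ v))) ≈-refl ω x (ev₁ u) (ev₁ v))
    (·-congˡ _ (·-congˡ _ (≈sym (ev₁-+ u v)))))

  lattice-ι : ∀ k → InLattice F → InLattice (ι k · F)
  lattice-ι k (u , p) = map (k ℤ.*_) u , ≈trans (·-congˡ _ p) (≈trans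
    (solve≈ 4 (λ o x u k → k :* (o :* (x :* u)) := o :* (x :* (k :* u))) ≈-refl ω x (ev₁ u) (ι k))
    (·-congˡ _ (·-congˡ _ (≈sym (ev₁-scale k u)))))

  lattice-≈ : F ≈ G → InLattice F → InLattice G
  lattice-≈ p (u , q) = u , ≈trans (≈sym p) q

  lattice-0 : InLattice 0ˢ
  lattice-0 = [] , ≈sym (≈trans (·-congˡ _ (SR.zeroʳ x)) (SR.zeroʳ ω))

  record Divisible (F : Series) : Set where
    constructor divisible
    field
      {quotient} : Series
      inLattice  : InLattice quotient
      eq         : F ≈ 7ˢ · quotient

  divisible-⊕ : Divisible F → Divisible G → Divisible (F ⊕ G)
  divisible-⊕ (divisible l p) (divisible m q) = divisible (lattice-⊕ l m) (≈trans (⊕-cong p q) (≈sym (SR.distribˡ _ _ _)))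

  divisible-ι : ∀ k → Divisible F → Divisible (ι k · F)
  divisible-ι k (divisible {G} l p) = divisible (lattice-ι k l) (≈trans (·-congˡ _ p)
    (solve≈ 3 (λ k s g → k :* (s :* g) := s :* (k :* g)) ≈-refl (ι k) 7ˢ G))

  divisible-≈ : F ≈ G → Divisible F → Divisible G
  divisible-≈ p (divisible l q) = divisible l (≈trans (≈sym p) q)

  divisible⇒lattice : Divisible F → InLattice F
  divisible⇒lattice (divisible l p) = lattice-≈ (≈sym p) (lattice-ι (+ 7) l)

  t-regular : Regular t
  t-regular = ·-regular (·-regular q-regular (unit-regular _ (^-unit (φ E) 4 (φ-unit E E-unit)))) (unit-regular _ (^-unit iE 4 iE-unit))

  x-regular : Regular x
  x-regular = ·-regular (ι-regular 6) t-regular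

  -- A further factor t^j enters U as φ(t)^j and completes t^j to ζ^(4j). So the product with x^j is
  -- 7^(2j) V (i + 4 j), and x^j is cancelled at the end.
  U-monomial : ∀ i j → C (j ℕ.* 2) (1 ℕ.+ j) (V (i ℕ.+ j ℕ.* 4)) → Divisible (U (ζ ^ i · (ω · x ^ j)))
  U-monomial i j (mkC u p) = divisible (u , ≈-refl) (^-regular j x-regular (begin
    x ^ j · U (ζ ^ i · (ω · x ^ j))
      ≈⟨ ≈trans (·-cong (^-distrib-* 7ˢ t j) (≈trans (U-cong (≈trans (·-congˡ _ (·-congˡ ω (^-distrib-* 7ˢ t j)))
           (≈trans (solve≈ 4 (λ z o k y → z :* (o :* (k :* y)) := k :* (z :* (o :* y))) ≈-refl (ζ ^ i) ω (7ˢ ^ j) (t ^ j)) (·-congʳ _ (≈sym (ι-7^ j))))))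
           (≈trans (U-ι· _ _) (·-congʳ _ (ι-7^ j))))) (solve≈ 3 (λ k t u → k :* t :* (k :* u) := k :* k :* (t :* u)) ≈-refl (7ˢ ^ j) (t ^ j) _) ⟩
    7ˢ ^ j · 7ˢ ^ j · (t ^ j · U (ζ ^ i · (ω · t ^ j)))
      ≈⟨ ·-cong (≈trans (≈sym (^-homo-* 7ˢ j j)) (double j)) (≈trans (≈sym (U-φ· (t ^ j) _)) (U-cong collect)) ⟩
    7ˢ ^ (j ℕ.* 2) · V (i ℕ.+ j ℕ.* 4)
      ≈⟨ p ⟩
    7ˢ · (ω · (x ^ (1 ℕ.+ j) · ev₁ u))
      ≈⟨ solve≈ 5 (λ k o x y u → k :* (o :* (x :* y :* u)) := y :* (k :* (o :* (x :* u)))) ≈-refl 7ˢ ω x (x ^ j) (ev₁ u) ⟩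
    x ^ j · (7ˢ · (ω · (x · ev₁ u))) ∎))
    where
    double : ∀ j → 7ˢ ^ (j ℕ.+ j) ≈ 7ˢ ^ (j ℕ.* 2)
    double j = subst (λ k → 7ˢ ^ (j ℕ.+ j) ≈ 7ˢ ^ k) (≡.trans (cong (j ℕ.+_) (≡.sym (ℕP.+-identityʳ j))) (ℕP.*-comm 2 j)) ≈-refl
    ζ^4j : ζ ^ (j ℕ.* 4) ≈ t ^ j · s ^ j
    ζ^4j = go j
      where
      go : ∀ j → ζ ^ (j ℕ.* 4) ≈ t ^ j · s ^ j
      go zero    = ≈sym (SR.*-identityˡ 1ˢ)
      go (suc j) = ≈trans (^-homo-* ζ 4 (j ℕ.* 4)) (≈trans (·-cong (≈sym t·s) (go j))
        (solve≈ 4 (λ t s a b → t :* s :* (a :* b) := t :* a :* (s :* b)) ≈-refl t s (t ^ j) (s ^ j)))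
    collect : φ (t ^ j) · (ζ ^ i · (ω · t ^ j)) ≈ ω · ζ ^ (i ℕ.+ j ℕ.* 4)
    collect = ≈trans (·-congʳ _ (φ-^ t j)) (≈trans (solve≈ 4 (λ s z o t → s :* (z :* (o :* t)) := o :* (z :* (t :* s))) ≈-refl (s ^ j) (ζ ^ i) ω (t ^ j))
      (·-congˡ ω (≈trans (·-congˡ _ (≈sym ζ^4j)) (≈sym (^-homo-* ζ i (j ℕ.* 4))))))

  U-polynomial : ∀ i → (∀ j → C (suc j ℕ.* 2) (2 ℕ.+ j) (V (i ℕ.+ suc j ℕ.* 4))) → ∀ j u → Divisible (U (ζ ^ i · (ω · (x ^ suc j · ev₁ u))))
  U-polynomial i h j []      = divisible lattice-0 (≈trans (U-cong (≈trans (·-congˡ _ (≈trans (·-congˡ _ (SR.zeroʳ _)) (SR.zeroʳ _))) (SR.zeroʳ _)))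
    (≈trans U-0 (≈sym (SR.zeroʳ 7ˢ))))
  U-polynomial i h j (k ∷ u) = divisible-≈ (≈sym (≈trans
      (U-cong (solve≈ 6 (λ z o y k x u → z :* (o :* (y :* (k :+ x :* u))) := k :* (z :* (o :* y)) :+ z :* (o :* (x :* y :* u))) ≈-refl
        (ζ ^ i) ω (x ^ suc j) (ι k) x (ev₁ u)))
      (≈trans (U-⊕ _ _) (⊕-cong (U-ι· k _) ≈-refl))))
    (divisible-⊕ (divisible-ι k (U-monomial i (suc j) (h j))) (U-polynomial i h (suc j) u))

  U-lattice : InLattice F → Divisible (U F)
  U-lattice (u , p) = divisible-≈
    (≈sym (U-cong (≈trans p (solve≈ 3 (λ o x u → o :* (x :* u) := con 1ℤ :* (o :* (x :^ 1 :* u))) ≈-refl ω x (ev₁ u)))))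
    (U-polynomial 0 (λ j → Strong.s₀ (proj₂ (estimates j))) 0 u)

  U-ζ-lattice : InLattice F → Divisible (U (ζ · F))
  U-ζ-lattice (u , p) = divisible-≈
    (≈sym (U-cong (≈trans (·-congˡ ζ p) (solve≈ 4 (λ z o x u → z :* (o :* (x :* u)) := z :^ 1 :* (o :* (x :^ 1 :* u))) ≈-refl ζ ω x (ev₁ u)))))
    (U-polynomial 1 (λ j → Strong.s₁ (proj₂ (estimates j))) 0 u)

  -- In terms of x, E₄ = ω + ω x (35 + 49 x). The second part lies in the lattice already; the first
  -- gives V 1 = ω x (-8 - 7 x), in the lattice but not in 7 times it.
  U-ζE₄ : InLattice (U (ζ · E₄))
  U-ζE₄ = lattice-≈ (≈sym split) (lattice-⊕ first-part (divisible⇒lattice (U-ζ-lattice {H} ((+ 35) ∷ (+ 49) ∷ [] , ≈-refl))))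
    where
    H : Series
    H = ω · (x · ev₁ ((+ 35) ∷ (+ 49) ∷ []))
    first-part : InLattice (V 1)
    first-part = -[1+ 7 ] ∷ -[1+ 6 ] ∷ [] , ≈trans V₁ (≈trans (solve≈ 2 (λ o t → let x : Solver.Polynomial 2 ; x = con (+ 7) :* t in
        o :* (con -[1+ 55 ] :* t :+ con -[1+ 342 ] :* t :^ 2) := o :* (x :* (con -[1+ 7 ] :+ x :* (con -[1+ 6 ] :+ x :* con 0ℤ)))) ≈-refl ω t)
      (·-congˡ _ (·-congˡ _ (⊕-cong ≈-refl (·-congˡ _ (⊕-cong ≈-refl (·-congˡ _ ι-0)))))))
    split : U (ζ · E₄) ≈ V 1 ⊕ U (ζ · H)
    split = ≈trans (U-cong (≈trans (·-congˡ ζ E₄-ω) (≈trans (solve≈ 3 (λ z o t → let x : Solver.Polynomial 3 ; x = con (+ 7) :* t in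
        z :* (o :* (con 1ℤ :+ con (+ 245) :* t :+ con (+ 2401) :* t :^ 2)) := o :* z :^ 1 :+ z :* (o :* (x :* (con (+ 35) :+ x :* (con (+ 49) :+ x :* con 0ℤ))))) ≈-refl ζ ω t)
      (⊕-cong ≈-refl (·-congˡ ζ (·-congˡ _ (·-congˡ _ (⊕-cong ≈-refl (·-congˡ _ (⊕-cong ≈-refl (·-congˡ _ ι-0)))))))))))
      (U-⊕ _ _)

-- Generating functions along the progressions, and the residues.

module Progressions where
  open SeriesRing
  open Operators
  open Evaluation
  open Pentagonal
  open EulerDissection
  open Generators
  open DivisorSums using (U-ι·)
  open WeightTwo
  open WeightFour
  open Contraction
  open import Data.Nat as ℕ using (ℕ; zero; suc; _≤_; _<_; _≥_; _∸_; z≤n; s≤s)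
  import Data.Nat.Properties as ℕP
  import Data.Nat.Divisibility as ℕD
  open import Data.Nat.Solver using (module +-*-Solver)
  open import Data.Integer as ℤ using (ℤ; +_; 1ℤ)
  import Data.Integer.Properties as ℤP
  open import Data.Integer.Divisibility using (_∣_)
  open import Data.Product using (_,_; _×_; ∃-syntax)
  open import Data.Sum using (_⊎_; inj₁; inj₂; [_,_]′)
  open import Data.Empty using (⊥-elim)
  open import Relation.Binary.PropositionalEquality as ≡ using (_≡_; cong; subst)

  open Solver using (_:+_; _:*_; _:=_; con) renaming (solve to solve≈)
  open ≈-Reasoning
  private module N = +-*-Solver

  -- M is φ E or E according to the parity of k. The lattice lies in 7 ℤ[[q]], so this gives divisibility of H by 7^(k+1).
  Progression : Series → ℕ → Series → Set
  Progression M k H = ∃[ F ] InLattice F × M · H ≈ 7ˢ ^ k · F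

  odd-start : Progression (φ E) 0 (U (q ^ 2 · e₄))
  odd-start = U (ζ · E₄) , U-ζE₄ , ≈trans (≈sym (U-φ· (φ E) _)) (≈trans (U-cong (begin
    φ (φ E) · (q ^ 2 · e₄)
      ≈⟨ solve≈ 3 (λ e q h → e :* (q :* h) := q :* e :* h) ≈-refl (φ (φ E)) (q ^ 2) e₄ ⟩
    q ^ 2 · φ (φ E) · e₄
      ≈⟨ ·-congˡ _ (≈trans (⊛-· E₄ iE) (SR.*-comm E₄ iE)) ⟩
    q ^ 2 · φ (φ E) · (iE · E₄)
      ≈⟨ ≈sym (SR.*-assoc _ iE E₄) ⟩
    ζ · E₄ ∎)) (≈sym (SR.*-identityˡ _)))

  odd-to-even : ∀ {k H} → Progression (φ E) k H → Progression E (suc k) (U H)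
  odd-to-even {k} {H} (F , l , p) = quotient , inLattice , (begin
    E · U H                ≈⟨ ≈sym (U-φ· E H) ⟩
    U (φ E · H)            ≈⟨ U-cong (≈trans p (·-congʳ F (≈sym (ι-7^ k)))) ⟩
    U (ι ((+ 7) ℤ.^ k) · F) ≈⟨ ≈trans (U-ι· _ F) (·-cong (ι-7^ k) eq) ⟩
    7ˢ ^ k · (7ˢ · quotient) ≈⟨ solve≈ 3 (λ a s g → a :* (s :* g) := s :* a :* g) ≈-refl (7ˢ ^ k) 7ˢ quotient ⟩
    7ˢ ^ suc k · quotient  ∎)
    where open Divisible (U-lattice l)

  even-to-odd : ∀ {k H} → Progression E k H → Progression (φ E) (suc k) (U (q ^ 2 · H))
  even-to-odd {k} {H} (F , l , p) = quotient , inLattice , (begin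
    φ E · U (q ^ 2 · H)
      ≈⟨ ≈sym (U-φ· (φ E) _) ⟩
    U (φ (φ E) · (q ^ 2 · H))
      ≈⟨ U-cong (begin
        φ (φ E) · (q ^ 2 · H)   ≈⟨ solve≈ 3 (λ e q h → e :* (q :* h) := q :* e :* h) ≈-refl (φ (φ E)) (q ^ 2) H ⟩
        q ^ 2 · φ (φ E) · H     ≈⟨ ·-congʳ H (≈sym ζ·E) ⟩
        ζ · E · H               ≈⟨ SR.*-assoc ζ E H ⟩
        ζ · (E · H)             ≈⟨ ·-congˡ ζ (≈trans p (·-congʳ F (≈sym (ι-7^ k)))) ⟩
        ζ · (ι ((+ 7) ℤ.^ k) · F) ≈⟨ solve≈ 3 (λ z a f → z :* (a :* f) := a :* (z :* f)) ≈-refl ζ (ι ((+ 7) ℤ.^ k)) F ⟩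
        ι ((+ 7) ℤ.^ k) · (ζ · F) ∎) ⟩
    U (ι ((+ 7) ℤ.^ k) · (ζ · F))
      ≈⟨ ≈trans (U-ι· _ _) (·-cong (ι-7^ k) eq) ⟩
    7ˢ ^ k · (7ˢ · quotient)
      ≈⟨ solve≈ 3 (λ a s g → a :* (s :* g) := s :* a :* g) ≈-refl (7ˢ ^ k) 7ˢ quotient ⟩
    7ˢ ^ suc k · quotient ∎)
    where open Divisible (U-ζ-lattice l)

  progression-divisible : ∀ {M k H} → Unit M → Progression M k H → ∃[ G ] H ≈ ι ((+ 7) ℤ.^ suc k) · G
  progression-divisible {M} {k} {H} unit (F , (u , l) , p) = inv M · (ω · (t · X₁)) , unit-regular M unit (begin
    M · H
      ≈⟨ ≈trans p (·-congˡ _ l) ⟩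
    7ˢ ^ k · (ω · (7ˢ · t · X₁))
      ≈⟨ solve≈ 5 (λ a o s t x → a :* (o :* (s :* t :* x)) := con 1ℤ :* (s :* a :* (o :* (t :* x)))) ≈-refl (7ˢ ^ k) ω 7ˢ t X₁ ⟩
    1ˢ · (7ˢ ^ suc k · (ω · (t · X₁)))
      ≈⟨ ·-cong (≈sym (inv-right M unit)) (·-congʳ _ (≈sym (ι-7^ (suc k)))) ⟩
    M · inv M · (ι ((+ 7) ℤ.^ suc k) · (ω · (t · X₁)))
      ≈⟨ solve≈ 4 (λ m i a x → m :* i :* (a :* x) := m :* (a :* (i :* x))) ≈-refl M (inv M) (ι ((+ 7) ℤ.^ suc k)) (ω · (t · X₁)) ⟩
    M · (ι ((+ 7) ℤ.^ suc k) · (inv M · (ω · (t · X₁)))) ∎)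
    where
    X₁ : Series
    X₁ = Eval.ev₁ 0ˢ x u

  -- The offset by one comes from q²: it places the exponent 7 n + 5 at 7 (n + 1). Neither kind of
  -- step removes it, and it makes the residues grow by 4 or 6 times 7^k.
  Coefficients : Series → ℕ → ℕ → Series → Set
  Coefficients h k d H = ∀ n → H (suc n) ≡ h (7 ℕ.^ k ℕ.* n ℕ.+ d)

  opaque
    unfolding _·_ φ

    U-at : ∀ H n → U H n ≡ H (n ℕ.* 7)
    U-at H n = ≡.refl

    seven-divides : ∀ k {H} → (∃[ G ] H ≈ ι ((+ 7) ℤ.^ k) · G) → ∀ n → + (7 ℕ.^ k) ∣ H n
    seven-divides k {H} (G , p) n = ℕD.divides ℤ.∣ G n ∣ (≡.trans
      (cong ℤ.∣_∣ (≡.trans (at p n) (≡.trans (ι-scale-at ((+ 7) ℤ.^ k) G n) (cong (ℤ._* G n) (pos-^ k)))))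
      (≡.trans (ℤP.abs-* (+ (7 ℕ.^ k)) (G n)) (ℕP.*-comm (7 ℕ.^ k) ℤ.∣ G n ∣)))
      where
      pos-^ : ∀ k → (+ 7) ℤ.^ k ≡ + (7 ℕ.^ k)
      pos-^ zero    = ≡.refl
      pos-^ (suc k) = ≡.trans (cong (+ 7 ℤ.*_) (pos-^ k)) (≡.sym (ℤP.pos-* 7 (7 ℕ.^ k)))

  start-coefficients : ∀ h → Coefficients h 1 5 (U (q ^ 2 · h))
  start-coefficients h n = ≡.trans (U-at _ (suc n)) (≡.trans (q^·-shift 2 h (5 ℕ.+ n ℕ.* 7))
    (cong h (N.solve 1 (λ n → N.con 5 N.:+ n N.:* N.con 7 N.:= N.con 7 N.:* n N.:+ N.con 5) ≡.refl n)))

  odd-coefficients : ∀ h {k d H} → Coefficients h k d H → Coefficients h (suc k) (4 ℕ.* 7 ℕ.^ k ℕ.+ d) (U (q ^ 2 · H))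
  odd-coefficients h {k} {d} {H} c n = ≡.trans (U-at _ (suc n)) (≡.trans (q^·-shift 2 H (5 ℕ.+ n ℕ.* 7)) (≡.trans (c (4 ℕ.+ n ℕ.* 7))
    (cong h (N.solve 3 (λ a n d → a N.:* (N.con 4 N.:+ n N.:* N.con 7) N.:+ d N.:= N.con 7 N.:* a N.:* n N.:+ (N.con 4 N.:* a N.:+ d)) ≡.refl (7 ℕ.^ k) n d))))

  even-coefficients : ∀ h {k d H} → Coefficients h k d H → Coefficients h (suc k) (6 ℕ.* 7 ℕ.^ k ℕ.+ d) (U H)
  even-coefficients h {k} {d} {H} c n = ≡.trans (U-at _ (suc n)) (≡.trans (c (6 ℕ.+ n ℕ.* 7))
    (cong h (N.solve 3 (λ a n d → a N.:* (N.con 6 N.:+ n N.:* N.con 7) N.:+ d N.:= N.con 7 N.:* a N.:* n N.:+ (N.con 6 N.:* a N.:+ d)) ≡.refl (7 ℕ.^ k) n d)))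

  -- In 24 δ = c 7^(k+1) + 1 the value c alternates between 17 and 23: 24 · 5 = 17 · 7 + 1, then 24
  -- · 6 + 17 = 23 · 7 and 24 · 4 + 23 = 17 · 7.
  record Stage (M : Series) (c k : ℕ) : Set where
    constructor stage
    field
      {series}     : Series
      {residue}    : ℕ
      progression  : Progression M k series
      coefficients : Coefficients e₄ (suc k) residue series
      congruence   : 24 ℕ.* residue ≡ c ℕ.* 7 ℕ.^ suc k ℕ.+ 1

  next-even : ∀ {k} → Stage (φ E) 17 k → Stage E 23 (suc k)
  next-even {k} (stage {H} {d} p c e) = stage (odd-to-even {k} {H} p) (even-coefficients e₄ {suc k} {d} {H} c)
    (≡.trans (N.solve 2 (λ a d → N.con 24 N.:* (N.con 6 N.:* a N.:+ d) N.:= N.con 144 N.:* a N.:+ N.con 24 N.:* d) ≡.refl (7 ℕ.^ suc k) d)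
    (≡.trans (cong (144 ℕ.* 7 ℕ.^ suc k ℕ.+_) e)
      (N.solve 1 (λ a → N.con 144 N.:* a N.:+ (N.con 17 N.:* a N.:+ N.con 1) N.:= N.con 23 N.:* (N.con 7 N.:* a) N.:+ N.con 1) ≡.refl (7 ℕ.^ suc k))))

  next-odd : ∀ {k} → Stage E 23 k → Stage (φ E) 17 (suc k)
  next-odd {k} (stage {H} {d} p c e) = stage (even-to-odd {k} {H} p) (odd-coefficients e₄ {suc k} {d} {H} c)
    (≡.trans (N.solve 2 (λ a d → N.con 24 N.:* (N.con 4 N.:* a N.:+ d) N.:= N.con 96 N.:* a N.:+ N.con 24 N.:* d) ≡.refl (7 ℕ.^ suc k) d)
    (≡.trans (cong (96 ℕ.* 7 ℕ.^ suc k ℕ.+_) e)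
      (N.solve 1 (λ a → N.con 96 N.:* a N.:+ (N.con 23 N.:* a N.:+ N.con 1) N.:= N.con 17 N.:* (N.con 7 N.:* a) N.:+ N.con 1) ≡.refl (7 ℕ.^ suc k))))

  stages : ∀ k → Stage (φ E) 17 k ⊎ Stage E 23 k
  stages zero    = inj₁ (stage odd-start (start-coefficients e₄) ≡.refl)
  stages (suc k) = [ (λ s → inj₂ (next-even s)) , (λ s → inj₁ (next-odd s)) ]′ (stages k)

  stage-congruence : ∀ {M k} c → Unit M → c < 24 → Stage M c k →
    ∃[ d ] ∃[ c ] c < 24 × 24 ℕ.* d ≡ c ℕ.* 7 ℕ.^ suc k ℕ.+ 1 × (∀ n → + (7 ℕ.^ suc k) ∣ e₄ (7 ℕ.^ suc k ℕ.* n ℕ.+ d))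
  stage-congruence {M} {k} c unit c<24 (stage {H} {d} p cs e) = d , c , c<24 , e ,
    λ n → subst (+ (7 ℕ.^ suc k) ∣_) (cs n) (seven-divides (suc k) (progression-divisible {M} {k} {H} unit p) (suc n))

  congruence-at-residue : ∀ k →
    ∃[ d ] ∃[ c ] c < 24 × 24 ℕ.* d ≡ c ℕ.* 7 ℕ.^ suc k ℕ.+ 1 × (∀ n → + (7 ℕ.^ suc k) ∣ e₄ (7 ℕ.^ suc k ℕ.* n ℕ.+ d))
  congruence-at-residue k =
    [ stage-congruence 17 (φ-unit E E-unit) (ℕP.m≤m+n 18 6) , stage-congruence 23 E-unit ℕP.≤-refl ]′ (stages k)

  -- d is an inverse of 24 modulo m, so multiplication by d shows that m divides e itself.
  small-multiple : ∀ {m e} → m ℕD.∣ 24 ℕ.* e → ∀ {c d} → 24 ℕ.* d ≡ c ℕ.* m ℕ.+ 1 → e < m → e ≡ 0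
  small-multiple {m} {zero}  p eq l = ≡.refl
  small-multiple {m} {suc e} p {c} {d} eq l = ⊥-elim (ℕD.>⇒∤ l (ℕD.∣m+n∣m⇒∣n {m = c ℕ.* suc e ℕ.* m}
    (subst (m ℕD.∣_) (≡.trans (N.solve 2 (λ d e → d N.:* (N.con 24 N.:* e) N.:= N.con 24 N.:* d N.:* e) ≡.refl d (suc e))
      (≡.trans (cong (ℕ._* suc e) eq) (N.solve 3 (λ c m e → (c N.:* m N.:+ N.con 1) N.:* e N.:= c N.:* e N.:* m N.:+ e) ≡.refl c m (suc e))))
      (ℕD.∣n⇒∣m*n d p)) (ℕD.n∣m*n (c ℕ.* suc e))))

  residue-unique : ∀ {m c d c′ d′} → 24 ℕ.* d ≡ c ℕ.* m ℕ.+ 1 → 24 ℕ.* d′ ≡ c′ ℕ.* m ℕ.+ 1 → d ≤ d′ → d′ < m → d′ ≡ d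
  residue-unique {m} {c} {d} {c′} {d′} e e′ l b = ≡.trans (≡.sym (ℕP.m+[n∸m]≡n l)) (≡.trans (cong (d ℕ.+_)
      (small-multiple (ℕD.∣m+n∣m⇒∣n {m = c ℕ.* m} (subst (m ℕD.∣_) split (ℕD.n∣m*n c′)) (ℕD.n∣m*n c)) {c} {d} e (ℕP.≤-<-trans (ℕP.m∸n≤m d′ d) b)))
    (ℕP.+-identityʳ d))
    where
    k : ℕ
    k = d′ ∸ d
    split : c′ ℕ.* m ≡ c ℕ.* m ℕ.+ 24 ℕ.* k
    split = ℕP.+-cancelʳ-≡ 1 (c′ ℕ.* m) (c ℕ.* m ℕ.+ 24 ℕ.* k) (≡.trans (≡.sym e′) (≡.trans (cong (24 ℕ.*_) (≡.sym (ℕP.m+[n∸m]≡n l)))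
      (≡.trans (ℕP.*-distribˡ-+ 24 d k) (≡.trans (cong (ℕ._+ 24 ℕ.* k) e)
        (N.solve 2 (λ a b → a N.:+ N.con 1 N.:+ b N.:= a N.:+ b N.:+ N.con 1) ≡.refl (c ℕ.* m) (24 ℕ.* k))))))

  -- From 24 d ≤ 23 m + 1 < 24 m.
  residue-bound : ∀ {m c d} → 1 < m → c < 24 → 24 ℕ.* d ≡ c ℕ.* m ℕ.+ 1 → d < m
  residue-bound {m} {c} {d} 1<m (s≤s c≤23) e = ℕP.*-cancelˡ-< 24 d m (ℕP.≤-<-trans (ℕP.≤-reflexive e)
    (ℕP.<-≤-trans (ℕP.+-mono-≤-< (ℕP.*-monoˡ-≤ m c≤23) 1<m) (ℕP.≤-reflexive (ℕP.+-comm (23 ℕ.* m) m))))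

-- The congruence at the given residue δ.

open import Data.Nat using (ℕ; _+_; _*_; _∸_; _^_; _<_; _≥_)
import Data.Nat.Divisibility as ℕD
open import Data.Integer using (+_)
open import Data.Integer.Divisibility using (_∣_)
open import Data.Nat using (suc; _≤_; s≤s; z≤n)
import Data.Nat.Properties as ℕP
open import Data.Product using (_,_)
open import Data.Sum using (inj₁; inj₂)
open import Relation.Binary.PropositionalEquality using (_≡_; sym; trans; cong; subst)
open Progressions

theorem5p5 : (k n δ : ℕ) → k ≥ 1 → 0 < δ → δ < 7 ^ k → (7 ^ k) ℕD.∣ (24 * δ ∸ 1) →
    (+ (7 ^ k)) ∣ e₄ (7 ^ k * n + δ)
theorem5p5 (suc k) n δ@(suc _) _ _ δ<m (ℕD.divides c′ e′) with congruence-at-residue k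
... | d , c , c<24 , e , divides-at = subst (λ d → + (7 ^ suc k) ∣ e₄ (7 ^ suc k * n + d)) d≡δ (divides-at n)
  where
  m : ℕ
  m = 7 ^ suc k
  1<m : 1 < m
  1<m = ℕP.≤-trans (s≤s (s≤s z≤n)) (ℕP.m≤m*n 7 (7 ^ k) {{ℕP.m^n≢0 7 k}})
  -- Positivity of δ makes the truncated difference in the hypothesis a true one.
  δ-eq : 24 * δ ≡ c′ * m + 1
  δ-eq = trans (sym (ℕP.m∸n+n≡m {24 * δ} {1} (s≤s z≤n))) (cong (_+ 1) e′)
  -- Both numbers invert 24 modulo m. `residue-unique` wants the larger one below m: for δ this is
  -- assumed, for the constructed d it follows from c < 24.
  d≡δ : d ≡ δ
  d≡δ with ℕP.≤-total d δ
  ... | inj₁ l = sym (residue-unique {m} {c} {d} {c′} {δ} e δ-eq l δ<m)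
  ... | inj₂ l = residue-unique {m} {c′} {δ} {c} {d} δ-eq e l (residue-bound {m} {c} {d} 1<m c<24 e)
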